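{- For every integer $n\ge 0$ and each of the following six cases, the number of partitions of $n$ satisfying the stated restrictions equals the number of partitions of $n$ all of whose parts are congruent modulo $12$ to one of the listed residues. (Case $I_{5a}$) Restrictions: satisfies Condition (2) and avoids $1+2+2$. Residues: $1,2,5,6,8,9,11$. (Case $I_{6a}$) Restrictions: satisfies Condition (1) and avoids $2$ (no part equals $2$). Residues: $1,4,5,6,7,9,10$. (Case 7) Restrictions: avoids $1+1$, $2+2+2$, $P_2$, $P_3$, $P_4$, $P_5$, $P_9$. Residues: $1,3,4,6,8,9,11$. (Case 7a) Restrictions: each part is $\ge 3$, and avoids $P_2$, $P_3$, $P_4$, $P_5$, $P_9$. Residues: $3,4,5,6,7,8,9$. (Case 8) Restrictions: avoids $1$ (no part equals $1$), $P_1$, $P_2$, $P_7$, $P_8$, $P_{11}$. Residues: $2,3,4,5,8,9,11$. (Case 8a) Restrictions: avoids $1+1$, $1+2+3$, $2+2+3$, $P_1$, $P_3$, $P_6$, $P_8$, $P_{10}$. Residues: $1,3,4,7,8,9,10$.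
   Context: A partition of $n$ is a finite weakly increasing sequence of positive integers $1\le\lambda_1\le\lambda_2\le\cdots\le\lambda_s$ (its parts) with $\sum_{j=1}^s\lambda_j=n$, written $\lambda_1+\lambda_2+\cdots+\lambda_s$ (the empty partition is the unique partition of $0$). For $r\in\{0,1,2\}$, a partition $\lambda_1+\cdots+\lambda_s$ satisfies Condition $(r)$ if $\lambda_{t+3}-\lambda_t\ge 3$ for all $t$ for which these parts exist, and $\lambda_t+\lambda_{t+1}+\lambda_{t+2}\equiv r\pmod 3$ whenever $\lambda_{t+2}-\lambda_t\le 1$. A subpartition is a contiguous block $\lambda_t+\lambda_{t+1}+\cdots+\lambda_{t+m}$ of parts of the partition (in weakly increasing order). A partition avoids a given pattern such as $1+2+2$ if no contiguous block of its parts equals that pattern; it avoids a family $P_m$ if it avoids every pattern in the family. The families are, with $r$ ranging over all positive integers: $P_1: r+r+r$; $P_2: r+r+(r+1)$; $P_3: r+(r+1)+(r+1)$; $P_4: r+r+r+r$; $P_5: r+r+r+(r+2)$; $P_6: r+r+(r+1)+(r+2)$; $P_7: r+(r+1)+(r+2)+(r+2)$; $P_8: r+(r+1)+(r+2)+(r+3)$; $P_9: r+(r+2)+(r+2)+(r+2)$; $P_{10}: r+r+(r+2)+(r+2)+(r+3)$; $P_{11}: r+(r+1)+(r+1)+(r+3)+(r+3)$. -}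

module Defs where

open import Data.List.Base using (List; []; _∷_; length)
open import Data.List.Membership.Propositional using (_∈_)
open import Data.List.Relation.Binary.Infix.Heterogeneous using (Infix)
open import Data.List.Relation.Unary.All using (All)
open import Data.List.Relation.Unary.Any using (Any)
open import Data.List.Relation.Unary.Linked using (Linked)
open import Data.List.Relation.Unary.Unique.Propositional using (Unique)
open import Data.Nat.Base using (ℕ; _+_; _≤_; _%_; NonZero)
open import Data.Nat.ListAction using (sum)
open import Data.Product.Base using (∃; _×_)
open import Function.Bundles using (_⇔_)
open import Relation.Binary.PropositionalEquality.Core using (_≡_)
open import Relation.Nullary.Negation.Core using (¬_)
open import Relation.Unary using (Pred; _∩_)
open import Level using (0ℓ)

infix 4 _≡_[mod_] _SubpartitionOf_

_≡_[mod_] : ℕ → ℕ → (m : ℕ) → .{{NonZero m}} → Set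
a ≡ b [mod m ] = a % m ≡ b % m

record IsPartition (n : ℕ) (λs : List ℕ) : Set where
  field
    positive   : All (1 ≤_) λs
    increasing : Linked _≤_ λs
    total      : sum λs ≡ n

_SubpartitionOf_ : List ℕ → List ℕ → Set
_SubpartitionOf_ = Infix _≡_

Avoids : List ℕ → Pred (List ℕ) 0ℓ
Avoids p λs = ¬ (p SubpartitionOf λs)

-- A family assigns to each r a pattern; only r ≥ 1 belongs to the family.
AvoidsFamily : (ℕ → List ℕ) → Pred (List ℕ) 0ℓ
AvoidsFamily P λs = ∀ r → 1 ≤ r → Avoids (P r) λs

P₁ P₂ P₃ P₄ P₅ P₆ P₇ P₈ P₉ P₁₀ P₁₁ : ℕ → List ℕ
P₁  r = r ∷ r ∷ r ∷ []
P₂  r = r ∷ r ∷ r + 1 ∷ []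
P₃  r = r ∷ r + 1 ∷ r + 1 ∷ []
P₄  r = r ∷ r ∷ r ∷ r ∷ []
P₅  r = r ∷ r ∷ r ∷ r + 2 ∷ []
P₆  r = r ∷ r ∷ r + 1 ∷ r + 2 ∷ []
P₇  r = r ∷ r + 1 ∷ r + 2 ∷ r + 2 ∷ []
P₈  r = r ∷ r + 1 ∷ r + 2 ∷ r + 3 ∷ []
P₉  r = r ∷ r + 2 ∷ r + 2 ∷ r + 2 ∷ []
P₁₀ r = r ∷ r ∷ r + 2 ∷ r + 2 ∷ r + 3 ∷ []
P₁₁ r = r ∷ r + 1 ∷ r + 1 ∷ r + 3 ∷ r + 3 ∷ []

-- Consecutive parts are the entries of a contiguous block.  The bounds
-- d - a ≥ 3 and c - a ≤ 1 are written without subtraction, since _∸_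
-- truncates.
record Condition (r : ℕ) (λs : List ℕ) : Set where
  field
    distance-three : ∀ a b c d → (a ∷ b ∷ c ∷ d ∷ []) SubpartitionOf λs →
                     a + 3 ≤ d
    distance-two   : ∀ a b c → (a ∷ b ∷ c ∷ []) SubpartitionOf λs →
                     c ≤ a + 1 → a + b + c ≡ r [mod 3 ]

PartsCongruentMod12To : List ℕ → Pred (List ℕ) 0ℓ
PartsCongruentMod12To residues =
  All (λ part → Any (λ r → part ≡ r [mod 12 ]) residues)

-- Exactly k lists satisfy A: some repetition-free enumeration of them has
-- length k.
HasCount : Pred (List ℕ) 0ℓ → ℕ → Set
HasCount A k =
  ∃ λ xs → Unique xs × (∀ x → x ∈ xs ⇔ A x) × length xs ≡ k

-- The number of partitions of n satisfying A equals the number of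
-- partitions of n satisfying B (both numbers exist and are the same k).
SameNumberOfPartitions : ℕ → (A B : Pred (List ℕ) 0ℓ) → Set
SameNumberOfPartitions n A B =
  ∃ λ k → HasCount (IsPartition n ∩ A) k × HasCount (IsPartition n ∩ B) k

-- Sorting by the smallest part, the partitions avoiding the patterns are described by finitely many generating
-- functions F_i(N) (parts ≥ N, state i) with linear recurrences in N, which determine them because they tend to 1.
-- Let Λ be the linear functional on series in s with Λ(sᵐ) = q^(m(m+1)/2), so that Λ(s h(s)) = q Λ(h(q s)).
-- Each F_i(N) is Λ of an infinite product in s.  Adding s h(s) - q h(q s), with Λ-image 0, for suitable h
-- gives recurrences in a parameter w of such products, and these are solved by sending w to 0:
-- * in cases 8 and 8a, Λ(w) = (1 + w q³) Λ(w q⁶) reduces both to the same constant;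
-- * in cases 5a and 6a, a two-term recurrence w → w q⁶ has a Heine-type solution, summed by the q-binomial theorem;
-- * in cases 7 and 7a, the recurrence w → w q² factors over ℤ[√3] into the steps 1 + √3 qᵏ + q²ᵏ.  By Jacobi's
--   triple product their product is a theta series u + √3 v, and u + 2 v and v are quintuple products, while
--   u + v is an Euler product.  The last one gives the constant of cases 8 and 8a.
module Submission where

open import Algebra.Bundles using (CommutativeRing)
open import Data.Integer.Base as ℤ using (ℤ; +_; -[1+_])
import Data.Integer.Properties as ℤ
import Data.Integer.Tactic.RingSolver as ℤR
open import Data.Nat.Base as ℕ using (ℕ; zero; suc; _≤_; _<_; z≤n; s≤s; _∸_)
import Data.Nat.Properties as ℕ
import Data.Nat.Tactic.RingSolver as ℕR
open import Data.Product.Base using (_×_; _,_; proj₁; proj₂; Σ; ∃)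
open import Data.Sum.Base using (_⊎_; inj₁; inj₂)
open import Function.Bundles using (_⇔_; mk⇔; Equivalence)
open import Level using (0ℓ)
open import Relation.Binary.PropositionalEquality as ≡ using (_≡_)

module Solver where
  open import Data.Bool.Base using (Bool; true; false; if_then_else_; T; _∧_)
  open import Data.Nat.Base using (_≡ᵇ_; _<ᵇ_)
  open import Data.List.Base using (List; []; _∷_)
  open import Data.Vec.Base as Vec using (Vec; []; _∷_; lookup; zipWith; replicate)
  open import Data.Fin.Base using (Fin; zero; suc)

  infixl 6 _⊕_ _⊖_
  infixl 7 _⊗_
  infixr 8 _⊛_
  infix 9 ⊝_

  data Expr (n : ℕ) : Set where
    var : Fin n → Expr n
    con : ℤ → Expr n
    _⊕_ _⊗_ _⊖_ : Expr n → Expr n → Expr n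
    ⊝_ : Expr n → Expr n
    _⊛_ : Expr n → ℕ → Expr n

  pattern v0 = var zero
  pattern v1 = var (suc zero)
  pattern v2 = var (suc (suc zero))
  pattern v3 = var (suc (suc (suc zero)))
  pattern v4 = var (suc (suc (suc (suc zero))))
  pattern v5 = var (suc (suc (suc (suc (suc zero)))))
  pattern v6 = var (suc (suc (suc (suc (suc (suc zero))))))
  pattern v7 = var (suc (suc (suc (suc (suc (suc (suc zero)))))))
  pattern v8 = var (suc (suc (suc (suc (suc (suc (suc (suc zero))))))))
  pattern v9 = var (suc (suc (suc (suc (suc (suc (suc (suc (suc zero)))))))))
  pattern v10 = var (suc (suc (suc (suc (suc (suc (suc (suc (suc (suc zero))))))))))
  pattern v11 = var (suc (suc (suc (suc (suc (suc (suc (suc (suc (suc (suc zero)))))))))))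
  pattern v12 = var (suc (suc (suc (suc (suc (suc (suc (suc (suc (suc (suc (suc zero))))))))))))
  pattern v13 = var (suc (suc (suc (suc (suc (suc (suc (suc (suc (suc (suc (suc (suc zero)))))))))))))
  pattern v14 = var (suc (suc (suc (suc (suc (suc (suc (suc (suc (suc (suc (suc (suc (suc zero))))))))))))))
  pattern v15 = var (suc (suc (suc (suc (suc (suc (suc (suc (suc (suc (suc (suc (suc (suc (suc zero)))))))))))))))
  pattern v16 = var (suc (suc (suc (suc (suc (suc (suc (suc (suc (suc (suc (suc (suc (suc (suc (suc zero))))))))))))))))
  pattern v17 = var (suc (suc (suc (suc (suc (suc (suc (suc (suc (suc (suc (suc (suc (suc (suc (suc (suc zero)))))))))))))))))
  pattern v18 = var (suc (suc (suc (suc (suc (suc (suc (suc (suc (suc (suc (suc (suc (suc (suc (suc (suc (suc zero))))))))))))))))))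
  pattern v19 = var (suc (suc (suc (suc (suc (suc (suc (suc (suc (suc (suc (suc (suc (suc (suc (suc (suc (suc (suc zero)))))))))))))))))))
  pattern v20 = var (suc (suc (suc (suc (suc (suc (suc (suc (suc (suc (suc (suc (suc (suc (suc (suc (suc (suc (suc (suc zero))))))))))))))))))))
  pattern v21 = var (suc (suc (suc (suc (suc (suc (suc (suc (suc (suc (suc (suc (suc (suc (suc (suc (suc (suc (suc (suc (suc zero)))))))))))))))))))))
  pattern v22 = var (suc (suc (suc (suc (suc (suc (suc (suc (suc (suc (suc (suc (suc (suc (suc (suc (suc (suc (suc (suc (suc (suc zero))))))))))))))))))))))
  pattern v23 = var (suc (suc (suc (suc (suc (suc (suc (suc (suc (suc (suc (suc (suc (suc (suc (suc (suc (suc (suc (suc (suc (suc (suc zero)))))))))))))))))))))))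
  pattern ø = con (+ 0)
  pattern I = con (+ 1)

  Mono : ℕ → Set
  Mono = Vec ℕ

  Poly : ℕ → Set
  Poly n = List (ℤ × Mono n)

  eqᵐ ltᵐ : ∀ {n} → Mono n → Mono n → Bool
  eqᵐ [] [] = true
  eqᵐ (a ∷ as) (b ∷ bs) = (a ≡ᵇ b) ∧ eqᵐ as bs
  ltᵐ [] [] = false
  ltᵐ (a ∷ as) (b ∷ bs) = if a <ᵇ b then true else (if a ≡ᵇ b then ltᵐ as bs else false)

  consᵖ : ∀ {n} → ℤ → Mono n → Poly n → Poly n
  consᵖ (+ zero) m p = p
  consᵖ c        m p = (c , m) ∷ p

  add : ∀ {n} → Poly n → Poly n → Poly n
  add [] q = q
  add (t ∷ p) [] = t ∷ p
  add ((c , m) ∷ p) ((d , l) ∷ q) =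
    if eqᵐ m l then consᵖ (c ℤ.+ d) m (add p q)
    else if ltᵐ m l then (c , m) ∷ add p ((d , l) ∷ q)
    else (d , l) ∷ add ((c , m) ∷ p) q

  scale : ∀ {n} → ℤ → Mono n → Poly n → Poly n
  scale c m [] = []
  scale c m ((d , l) ∷ p) = (c ℤ.* d , zipWith ℕ._+_ m l) ∷ scale c m p

  mul : ∀ {n} → Poly n → Poly n → Poly n
  mul [] q = []
  mul ((c , m) ∷ p) q = add (scale c m q) (mul p q)

  one : ∀ {n} → Poly n
  one {n} = (ℤ.1ℤ , replicate n 0) ∷ []

  pow : ∀ {n} → Poly n → ℕ → Poly n
  pow p zero = one
  pow p (suc k) = mul p (pow p k)

  unit : ∀ {n} → Fin n → Mono n
  unit {suc n} zero = 1 ∷ replicate n 0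
  unit (suc i) = 0 ∷ unit i

  norm : ∀ {n} → Expr n → Poly n
  norm (var i) = (ℤ.1ℤ , unit i) ∷ []
  norm (con c) = consᵖ c (replicate _ 0) []
  norm (a ⊕ b) = add (norm a) (norm b)
  norm (a ⊖ b) = add (norm a) (scale (ℤ.-1ℤ) (replicate _ 0) (norm b))
  norm (⊝ a) = scale (ℤ.-1ℤ) (replicate _ 0) (norm a)
  norm (a ⊗ b) = mul (norm a) (norm b)
  norm (a ⊛ k) = pow (norm a) k

  module Prove (R : CommutativeRing 0ℓ 0ℓ) where
    open CommutativeRing R
    open import Relation.Binary.Reasoning.Setoid setoid
    open import Algebra.Properties.Semiring.Exp semiring using (_^_; ^-homo-*; ^-congˡ)
    open import Algebra.Properties.Semiring.Mult semiring using (×1-homo-*; ×-homo-+) renaming (_×_ to _·_)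
    open import Algebra.Properties.Ring ring using (-‿distribˡ-*; -‿distribʳ-*; -‿involutive; -0#≈0#; -‿+-comm)
    open import Algebra.Properties.CommutativeSemigroup +-commutativeSemigroup using (interchange; x∙yz≈y∙xz)
    import Algebra.Properties.CommutativeSemigroup *-commutativeSemigroup as M

    ι : ℤ → Carrier
    ι (+ n) = n · 1#
    ι -[1+ n ] = - (suc n · 1#)

    ι-⊖ : ∀ m n → ι (m ℤ.⊖ n) ≈ m · 1# - n · 1#
    ι-⊖ zero zero = sym (trans (+-congˡ -0#≈0#) (+-identityʳ _))
    ι-⊖ zero (suc n) = sym (+-identityˡ _)
    ι-⊖ (suc m) zero = sym (trans (+-congˡ -0#≈0#) (+-identityʳ _))
    ι-⊖ (suc m) (suc n) = begin
      ι (suc m ℤ.⊖ suc n) ≡⟨ ≡.cong ι (ℤ.[1+m]⊖[1+n]≡m⊖n m n) ⟩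
      ι (m ℤ.⊖ n) ≈⟨ ι-⊖ m n ⟩
      m · 1# - n · 1# ≈⟨ +-identityˡ _ ⟨
      0# + (m · 1# - n · 1#) ≈⟨ +-congʳ (-‿inverseʳ 1#) ⟨
      (1# - 1#) + (m · 1# - n · 1#) ≈⟨ interchange _ _ _ _ ⟩
      (1# + m · 1#) + (- 1# - n · 1#) ≈⟨ +-congˡ (-‿+-comm _ _) ⟩
      suc m · 1# - suc n · 1# ∎

    ι-+ : ∀ a b → ι (a ℤ.+ b) ≈ ι a + ι b
    ι-+ (+ m) (+ n) = ×-homo-+ 1# m n
    ι-+ (+ m) -[1+ n ] = ι-⊖ m (suc n)
    ι-+ -[1+ m ] (+ n) = trans (ι-⊖ n (suc m)) (+-comm _ _)
    ι-+ -[1+ m ] -[1+ n ] = begin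
      - (suc (suc (m ℕ.+ n)) · 1#) ≡⟨ ≡.cong (λ k → - (suc k · 1#)) (ℕ.+-suc m n) ⟨
      - (suc (m ℕ.+ suc n) · 1#) ≈⟨ -‿cong (×-homo-+ 1# (suc m) (suc n)) ⟩
      - (suc m · 1# + suc n · 1#) ≈⟨ -‿+-comm _ _ ⟨
      - (suc m · 1#) - suc n · 1# ∎

    ι-neg : ∀ a → ι (ℤ.- a) ≈ - ι a
    ι-neg (+ zero) = sym -0#≈0#
    ι-neg (+ suc n) = refl
    ι-neg -[1+ n ] = sym (-‿involutive _)

    ι-+* : ∀ m b → ι (+ m ℤ.* b) ≈ m · 1# * ι b
    ι-+* m (+ n) = trans (reflexive (≡.cong ι (≡.sym (ℤ.pos-* m n)))) (×1-homo-* m n)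
    ι-+* m -[1+ n ] = begin
      ι (+ m ℤ.* -[1+ n ]) ≡⟨ ≡.cong ι (ℤ.neg-distribʳ-* (+ m) (+ suc n)) ⟨
      ι (ℤ.- (+ m ℤ.* + suc n)) ≈⟨ ι-neg (+ m ℤ.* + suc n) ⟩
      - ι (+ m ℤ.* + suc n) ≈⟨ -‿cong (ι-+* m (+ suc n)) ⟩
      - (m · 1# * ι (+ suc n)) ≈⟨ -‿distribʳ-* _ _ ⟩
      m · 1# * ι -[1+ n ] ∎

    ι-* : ∀ a b → ι (a ℤ.* b) ≈ ι a * ι b
    ι-* (+ m) b = ι-+* m b
    ι-* -[1+ m ] b = begin
      ι (-[1+ m ] ℤ.* b) ≡⟨ ≡.cong ι (ℤ.neg-distribˡ-* (+ suc m) b) ⟨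
      ι (ℤ.- (+ suc m ℤ.* b)) ≈⟨ ι-neg (+ suc m ℤ.* b) ⟩
      - ι (+ suc m ℤ.* b) ≈⟨ -‿cong (ι-+* (suc m) b) ⟩
      - (suc m · 1# * ι b) ≈⟨ -‿distribˡ-* _ _ ⟩
      ι -[1+ m ] * ι b ∎

    ⟦_⟧ᵐ : ∀ {n} → Mono n → Vec Carrier n → Carrier
    ⟦ [] ⟧ᵐ [] = 1#
    ⟦ k ∷ m ⟧ᵐ (x ∷ ρ) = x ^ k * ⟦ m ⟧ᵐ ρ

    ⟦_⟧ᵖ : ∀ {n} → Poly n → Vec Carrier n → Carrier
    ⟦ [] ⟧ᵖ ρ = 0#
    ⟦ (c , m) ∷ p ⟧ᵖ ρ = ι c * ⟦ m ⟧ᵐ ρ + ⟦ p ⟧ᵖ ρ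

    const : ℤ → Carrier
    const (+ 0) = 0#
    const (+ 1) = 1#
    const c = ι c

    ⟦_⟧ : ∀ {n} → Expr n → Vec Carrier n → Carrier
    ⟦ var i ⟧ ρ = lookup ρ i
    ⟦ con c ⟧ ρ = const c
    ⟦ a ⊕ b ⟧ ρ = ⟦ a ⟧ ρ + ⟦ b ⟧ ρ
    ⟦ a ⊖ b ⟧ ρ = ⟦ a ⟧ ρ - ⟦ b ⟧ ρ
    ⟦ ⊝ a ⟧ ρ = - ⟦ a ⟧ ρ
    ⟦ a ⊗ b ⟧ ρ = ⟦ a ⟧ ρ * ⟦ b ⟧ ρ
    ⟦ a ⊛ k ⟧ ρ = ⟦ a ⟧ ρ ^ k

    const-ι : ∀ c → ι c ≈ const c
    const-ι (+ 0) = refl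
    const-ι (+ 1) = +-identityʳ 1#
    const-ι (+ suc (suc n)) = refl
    const-ι -[1+ n ] = refl

    eqᵐ-sound : ∀ {n} (m l : Mono n) ρ → T (eqᵐ m l) → ⟦ m ⟧ᵐ ρ ≈ ⟦ l ⟧ᵐ ρ
    eqᵐ-sound [] [] [] _ = refl
    eqᵐ-sound (a ∷ m) (b ∷ l) (x ∷ ρ) t with a ≡ᵇ b in eq
    ... | true = *-cong (reflexive (≡.cong (x ^_) (ℕ.≡ᵇ⇒≡ a b (≡.subst T (≡.sym eq) _)))) (eqᵐ-sound m l ρ t)

    consᵖ-sound : ∀ {n} c (m : Mono n) p ρ → ⟦ consᵖ c m p ⟧ᵖ ρ ≈ ι c * ⟦ m ⟧ᵐ ρ + ⟦ p ⟧ᵖ ρ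
    consᵖ-sound (+ zero) m p ρ = sym (trans (+-congʳ (zeroˡ _)) (+-identityˡ _))
    consᵖ-sound (+ suc n) m p ρ = refl
    consᵖ-sound -[1+ n ] m p ρ = refl

    add-step : ∀ {n} c (m : Mono n) p d l q ρ b b′ → (T b → ⟦ m ⟧ᵐ ρ ≈ ⟦ l ⟧ᵐ ρ) →
      ⟦ add p q ⟧ᵖ ρ ≈ ⟦ p ⟧ᵖ ρ + ⟦ q ⟧ᵖ ρ →
      ⟦ add p ((d , l) ∷ q) ⟧ᵖ ρ ≈ ⟦ p ⟧ᵖ ρ + ⟦ (d , l) ∷ q ⟧ᵖ ρ →
      ⟦ add ((c , m) ∷ p) q ⟧ᵖ ρ ≈ ⟦ (c , m) ∷ p ⟧ᵖ ρ + ⟦ q ⟧ᵖ ρ →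
      ⟦ if b then consᵖ (c ℤ.+ d) m (add p q) else if b′ then (c , m) ∷ add p ((d , l) ∷ q)
        else (d , l) ∷ add ((c , m) ∷ p) q ⟧ᵖ ρ ≈ ⟦ (c , m) ∷ p ⟧ᵖ ρ + ⟦ (d , l) ∷ q ⟧ᵖ ρ
    add-step c m p d l q ρ true _ m≈l h₁ h₂ h₃ = begin
      ⟦ consᵖ (c ℤ.+ d) m (add p q) ⟧ᵖ ρ ≈⟨ consᵖ-sound (c ℤ.+ d) m (add p q) ρ ⟩
      ι (c ℤ.+ d) * ⟦ m ⟧ᵐ ρ + ⟦ add p q ⟧ᵖ ρ ≈⟨ +-cong (trans (*-congʳ (ι-+ c d)) (distribʳ _ _ _)) h₁ ⟩
      (ι c * ⟦ m ⟧ᵐ ρ + ι d * ⟦ m ⟧ᵐ ρ) + (⟦ p ⟧ᵖ ρ + ⟦ q ⟧ᵖ ρ) ≈⟨ +-congʳ (+-congˡ (*-congˡ (m≈l _))) ⟩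
      (ι c * ⟦ m ⟧ᵐ ρ + ι d * ⟦ l ⟧ᵐ ρ) + (⟦ p ⟧ᵖ ρ + ⟦ q ⟧ᵖ ρ) ≈⟨ interchange _ _ _ _ ⟩
      _ ∎
    add-step c m p d l q ρ false true m≈l h₁ h₂ h₃ = trans (+-congˡ h₂) (sym (+-assoc _ _ _))
    add-step c m p d l q ρ false false m≈l h₁ h₂ h₃ = trans (+-congˡ h₃) (x∙yz≈y∙xz _ _ _)

    add-sound : ∀ {n} (p q : Poly n) ρ → ⟦ add p q ⟧ᵖ ρ ≈ ⟦ p ⟧ᵖ ρ + ⟦ q ⟧ᵖ ρ
    add-sound [] q ρ = sym (+-identityˡ _)
    add-sound (t ∷ p) [] ρ = sym (+-identityʳ _)
    add-sound ((c , m) ∷ p) ((d , l) ∷ q) ρ = add-step c m p d l q ρ (eqᵐ m l) (ltᵐ m l) (eqᵐ-sound m l ρ)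
      (add-sound p q ρ) (add-sound p ((d , l) ∷ q) ρ) (add-sound ((c , m) ∷ p) q ρ)

    zip-sound : ∀ {n} (m l : Mono n) ρ → ⟦ zipWith ℕ._+_ m l ⟧ᵐ ρ ≈ ⟦ m ⟧ᵐ ρ * ⟦ l ⟧ᵐ ρ
    zip-sound [] [] [] = sym (*-identityˡ _)
    zip-sound (a ∷ m) (b ∷ l) (x ∷ ρ) =
      trans (*-cong (^-homo-* x a b) (zip-sound m l ρ)) (M.interchange _ _ _ _)

    scale-sound : ∀ {n} c (m : Mono n) p ρ → ⟦ scale c m p ⟧ᵖ ρ ≈ ι c * ⟦ m ⟧ᵐ ρ * ⟦ p ⟧ᵖ ρ
    scale-sound c m [] ρ = sym (zeroʳ _)
    scale-sound c m ((d , l) ∷ p) ρ =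
      trans (+-cong (trans (*-cong (ι-* c d) (zip-sound m l ρ)) (M.interchange _ _ _ _)) (scale-sound c m p ρ)) (sym (distribˡ _ _ _))

    mul-sound : ∀ {n} (p q : Poly n) ρ → ⟦ mul p q ⟧ᵖ ρ ≈ ⟦ p ⟧ᵖ ρ * ⟦ q ⟧ᵖ ρ
    mul-sound [] q ρ = sym (zeroˡ _)
    mul-sound ((c , m) ∷ p) q ρ =
      trans (add-sound (scale c m q) (mul p q) ρ) (trans (+-cong (scale-sound c m q ρ) (mul-sound p q ρ)) (sym (distribʳ _ _ _)))

    rep-sound : ∀ {n} (ρ : Vec Carrier n) → ⟦ replicate n 0 ⟧ᵐ ρ ≈ 1#
    rep-sound [] = refl
    rep-sound (x ∷ ρ) = trans (*-identityˡ _) (rep-sound ρ)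

    one-sound : ∀ {n} c (ρ : Vec Carrier n) → ι c * ⟦ replicate n 0 ⟧ᵐ ρ + 0# ≈ ι c
    one-sound c ρ = trans (+-identityʳ _) (trans (*-congˡ (rep-sound ρ)) (*-identityʳ _))

    pow-sound : ∀ {n} (p : Poly n) k ρ → ⟦ pow p k ⟧ᵖ ρ ≈ ⟦ p ⟧ᵖ ρ ^ k
    pow-sound p zero ρ = trans (one-sound ℤ.1ℤ ρ) (+-identityʳ 1#)
    pow-sound p (suc k) ρ = trans (mul-sound p (pow p k) ρ) (*-congˡ (pow-sound p k ρ))

    unit-sound : ∀ {n} (i : Fin n) ρ → ⟦ unit i ⟧ᵐ ρ ≈ lookup ρ i
    unit-sound zero (x ∷ ρ) = trans (*-cong (*-identityʳ x) (rep-sound ρ)) (*-identityʳ x)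
    unit-sound (suc i) (x ∷ ρ) = trans (*-identityˡ _) (unit-sound i ρ)

    neg-sound : ∀ {n} (p : Poly n) ρ → ⟦ scale ℤ.-1ℤ (replicate n 0) p ⟧ᵖ ρ ≈ - ⟦ p ⟧ᵖ ρ
    neg-sound {n} p ρ = begin
      ⟦ scale ℤ.-1ℤ (replicate n 0) p ⟧ᵖ ρ ≈⟨ scale-sound ℤ.-1ℤ (replicate n 0) p ρ ⟩
      - (1# + 0#) * ⟦ replicate n 0 ⟧ᵐ ρ * ⟦ p ⟧ᵖ ρ ≈⟨ *-congʳ (trans (*-cong (-‿cong (+-identityʳ 1#)) (rep-sound ρ)) (*-identityʳ _)) ⟩
      - 1# * ⟦ p ⟧ᵖ ρ ≈⟨ -‿distribˡ-* _ _ ⟨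
      - (1# * ⟦ p ⟧ᵖ ρ) ≈⟨ -‿cong (*-identityˡ _) ⟩
      - ⟦ p ⟧ᵖ ρ ∎

    norm-sound : ∀ {n} (e : Expr n) ρ → ⟦ norm e ⟧ᵖ ρ ≈ ⟦ e ⟧ ρ
    norm-sound (var i) ρ = trans (+-identityʳ _) (trans (*-cong (+-identityʳ 1#) (unit-sound i ρ)) (*-identityˡ _))
    norm-sound (con c) ρ = trans (consᵖ-sound c (replicate _ 0) [] ρ) (trans (one-sound c ρ) (const-ι c))
    norm-sound (a ⊕ b) ρ = trans (add-sound (norm a) (norm b) ρ) (+-cong (norm-sound a ρ) (norm-sound b ρ))
    norm-sound (a ⊖ b) ρ = trans (add-sound (norm a) _ ρ) (+-cong (norm-sound a ρ) (trans (neg-sound (norm b) ρ) (-‿cong (norm-sound b ρ))))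
    norm-sound (⊝ a) ρ = trans (neg-sound (norm a) ρ) (-‿cong (norm-sound a ρ))
    norm-sound (a ⊗ b) ρ = trans (mul-sound (norm a) (norm b) ρ) (*-cong (norm-sound a ρ) (norm-sound b ρ))
    norm-sound (a ⊛ k) ρ = trans (pow-sound (norm a) k ρ) (^-congˡ k (norm-sound a ρ))

    prove : ∀ {n} (ρ : Vec Carrier n) (a b : Expr n) → norm (a ⊖ b) ≡ [] → ⟦ a ⟧ ρ ≈ ⟦ b ⟧ ρ
    prove ρ a b eq = begin
      ⟦ a ⟧ ρ ≈⟨ +-identityʳ _ ⟨
      ⟦ a ⟧ ρ + 0# ≈⟨ +-congˡ (-‿inverseˡ _) ⟨
      ⟦ a ⟧ ρ + (- ⟦ b ⟧ ρ + ⟦ b ⟧ ρ) ≈⟨ +-assoc _ _ _ ⟨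
      ⟦ a ⊖ b ⟧ ρ + ⟦ b ⟧ ρ ≈⟨ +-congʳ (norm-sound (a ⊖ b) ρ) ⟨
      ⟦ norm (a ⊖ b) ⟧ᵖ ρ + ⟦ b ⟧ ρ ≡⟨ ≡.cong (λ p → ⟦ p ⟧ᵖ ρ + ⟦ b ⟧ ρ) eq ⟩
      0# + ⟦ b ⟧ ρ ≈⟨ +-identityˡ _ ⟩
      ⟦ b ⟧ ρ ∎

-- Complete rings and formal power series

module PS where
  open import Function.Base using (_∘_)

  record CompleteRing : Set₁ where
    field
      ring : CommutativeRing 0ℓ 0ℓ
    open CommutativeRing ring public using (Carrier; _≈_; _+_; _*_; -_; _-_; 0#; 1#)
    field
      Ord : ℕ → Carrier → Set
      ord-cong : ∀ {n x y} → x ≈ y → Ord n x → Ord n y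
      ord-0 : ∀ {n} → Ord n 0#
      ord-+ : ∀ {n x y} → Ord n x → Ord n y → Ord n (x + y)
      ord-* : ∀ {m n x y} → Ord m x → Ord n y → Ord (m ℕ.+ n) (x * y)
      ord-all : ∀ {x} → Ord 0 x
      ord-mono : ∀ {m n x} → m ≤ n → Ord n x → Ord m x
      ord-sep : ∀ {x} → (∀ n → Ord n x) → x ≈ 0#
      lim : (ℕ → Carrier) → Carrier
      lim-approx : ∀ {f} → (∀ n → Ord n (f (suc n) - f n)) → ∀ n → Ord n (lim f - f n)
      q : Carrier
      ord-q : Ord 1 q

  module PowerSeries (C : CommutativeRing 0ℓ 0ℓ) where
    open CommutativeRing C
    open import Relation.Binary.Reasoning.Setoid setoid
    open import Algebra.Properties.CommutativeSemigroup +-commutativeSemigroup using (interchange)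

    Series : Set
    Series = ℕ → Carrier

    infix 4 _≋_
    _≋_ : Series → Series → Set
    f ≋ g = ∀ n → f n ≈ g n

    tail : Series → Series
    tail f n = f (suc n)

    conv : Series → Series → Series
    conv f g zero = f 0 * g 0
    conv f g (suc n) = f 0 * g (suc n) + conv (tail f) g n

    ⟨_⟩ : Carrier → Series
    ⟨ c ⟩ zero = c
    ⟨ c ⟩ (suc n) = 0#

    X : Series
    X zero = 0#
    X (suc n) = ⟨ 1# ⟩ n

    conv-cong : ∀ {f f′ g g′} → f ≋ f′ → g ≋ g′ → conv f g ≋ conv f′ g′
    conv-cong p r zero = *-cong (p 0) (r 0)
    conv-cong p r (suc n) = +-cong (*-cong (p 0) (r (suc n))) (conv-cong (p ∘ suc) r n)

    conv-sucʳ : ∀ f g n → conv f g (suc n) ≈ conv f (tail g) n + f (suc n) * g 0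
    conv-sucʳ f g zero = refl
    conv-sucʳ f g (suc n) = trans (+-congˡ (conv-sucʳ (tail f) g n)) (sym (+-assoc _ _ _))

    conv-comm : ∀ f g → conv f g ≋ conv g f
    conv-comm f g zero = *-comm _ _
    conv-comm f g (suc n) = begin
      f 0 * g (suc n) + conv (tail f) g n ≈⟨ +-cong (*-comm _ _) (conv-comm (tail f) g n) ⟩
      g (suc n) * f 0 + conv g (tail f) n ≈⟨ +-comm _ _ ⟩
      conv g (tail f) n + g (suc n) * f 0 ≈⟨ conv-sucʳ g f n ⟨
      conv g f (suc n) ∎

    conv-distribʳ : ∀ h f g → conv (λ n → f n + g n) h ≋ (λ n → conv f h n + conv g h n)
    conv-distribʳ h f g zero = distribʳ _ _ _
    conv-distribʳ h f g (suc n) = trans (+-cong (distribʳ _ _ _) (conv-distribʳ h (tail f) (tail g) n)) (interchange _ _ _ _)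

    conv-scale : ∀ c f g → conv (λ n → c * f n) g ≋ (λ n → c * conv f g n)
    conv-scale c f g zero = *-assoc _ _ _
    conv-scale c f g (suc n) = trans (+-cong (*-assoc _ _ _) (conv-scale c (tail f) g n)) (sym (distribˡ _ _ _))

    conv-assoc : ∀ f g h → conv (conv f g) h ≋ conv f (conv g h)
    conv-assoc f g h zero = *-assoc _ _ _
    conv-assoc f g h (suc n) = begin
      f 0 * g 0 * h (suc n) + conv (λ k → f 0 * g (suc k) + conv (tail f) g k) h n
        ≈⟨ +-cong (*-assoc _ _ _) (trans (conv-distribʳ h _ _ n) (+-cong (conv-scale (f 0) (tail g) h n) (conv-assoc (tail f) g h n))) ⟩
      f 0 * (g 0 * h (suc n)) + (f 0 * conv (tail g) h n + conv (tail f) (conv g h) n) ≈⟨ +-assoc _ _ _ ⟨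
      f 0 * (g 0 * h (suc n)) + f 0 * conv (tail g) h n + conv (tail f) (conv g h) n ≈⟨ +-congʳ (distribˡ _ _ _) ⟨
      conv f (conv g h) (suc n) ∎

    conv-zeroˡ : ∀ g → conv (λ _ → 0#) g ≋ (λ _ → 0#)
    conv-zeroˡ g zero = zeroˡ _
    conv-zeroˡ g (suc n) = trans (+-cong (zeroˡ _) (conv-zeroˡ g n)) (+-identityˡ _)

    conv-⟨⟩ : ∀ c g → conv ⟨ c ⟩ g ≋ (λ n → c * g n)
    conv-⟨⟩ c g zero = refl
    conv-⟨⟩ c g (suc n) = trans (+-congˡ (conv-zeroˡ g n)) (+-identityʳ _)

    conv-X-suc : ∀ g n → conv X g (suc n) ≈ g n
    conv-X-suc g n = trans (+-cong (zeroˡ _) (trans (conv-⟨⟩ 1# g n) (*-identityˡ _))) (+-identityˡ _)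

    series : CommutativeRing 0ℓ 0ℓ
    series = record
      { Carrier = Series ; _≈_ = _≋_ ; _+_ = λ f g n → f n + g n ; _*_ = conv ; -_ = λ f n → - f n ; 0# = λ _ → 0# ; 1# = ⟨ 1# ⟩
      ; isCommutativeRing = record
        { *-comm = conv-comm
        ; isRing = record
          { *-cong = conv-cong
          ; *-assoc = conv-assoc
          ; *-identity = (λ f n → trans (conv-⟨⟩ 1# f n) (*-identityˡ _)) , (λ f n → trans (conv-comm f _ n) (trans (conv-⟨⟩ 1# f n) (*-identityˡ _)))
          ; distrib = (λ f g h n → trans (conv-comm f _ n) (trans (conv-distribʳ f g h n) (+-cong (conv-comm g f n) (conv-comm h f n)))) , conv-distribʳ
          ; +-isAbelianGroup = record
            { comm = λ f g n → +-comm _ _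
            ; isGroup = record
              { ⁻¹-cong = λ p n → -‿cong (p n)
              ; inverse = (λ f n → -‿inverseˡ _) , (λ f n → -‿inverseʳ _)
              ; isMonoid = record
                { identity = (λ f n → +-identityˡ _) , (λ f n → +-identityʳ _)
                ; isSemigroup = record
                  { assoc = λ f g h n → +-assoc _ _ _
                  ; isMagma = record
                    { ∙-cong = λ p r n → +-cong (p n) (r n)
                    ; isEquivalence = record { refl = λ n → refl ; sym = λ p n → sym (p n) ; trans = λ p r n → trans (p n) (r n) } } } } } } } } }

    Order : ℕ → Series → Set
    Order k f = ∀ i → i < k → f i ≈ 0#

    order-* : ∀ m n f g → Order m f → Order n g → Order (m ℕ.+ n) (conv f g)
    order-* zero n f g p r zero (s≤s _) = trans (*-congˡ (r 0 (s≤s z≤n))) (zeroʳ _)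
    order-* zero n f g p r (suc i) i<n = trans
      (+-cong (trans (*-congˡ (r _ i<n)) (zeroʳ _)) (order-* 0 n (tail f) g (λ _ ()) r i (ℕ.<⇒≤ i<n))) (+-identityˡ _)
    order-* (suc m) n f g p r zero _ = trans (*-congʳ (p 0 (s≤s z≤n))) (zeroˡ _)
    order-* (suc m) n f g p r (suc i) (s≤s i<n) = trans
      (+-cong (trans (*-congʳ (p 0 (s≤s z≤n))) (zeroˡ _)) (order-* m n (tail f) g (λ j j<m → p (suc j) (s≤s j<m)) r i i<n)) (+-identityˡ _)

    limit : (ℕ → Series) → Series
    limit f n = f (suc n) n

    limit-approx : ∀ {f} → (∀ n → Order n (λ i → f (suc n) i - f n i)) → ∀ n → Order n (λ i → limit f i - f n i)
    limit-approx {f} h n i i<n = begin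
      f (suc i) i - f n i ≈⟨ +-congʳ (stable n i<n) ⟨
      f n i - f n i ≈⟨ -‿inverseʳ _ ⟩
      0# ∎
      where
      open import Algebra.Properties.Ring ring using (x∙y⁻¹≈ε⇒x≈y)
      stable : ∀ n → i < n → f n i ≈ f (suc i) i
      stable (suc n) (s≤s i≤n) with ℕ.m≤n⇒m<n∨m≡n i≤n
      ... | inj₁ i<n = trans (x∙y⁻¹≈ε⇒x≈y _ _ (h n i i<n)) (stable n i<n)
      ... | inj₂ ≡.refl = refl

    complete : CompleteRing
    complete = record
      { ring = series ; Ord = Order
      ; ord-cong = λ p o i i<n → trans (sym (p i)) (o i i<n)
      ; ord-0 = λ i _ → refl
      ; ord-+ = λ o o′ i i<n → trans (+-cong (o i i<n) (o′ i i<n)) (+-identityˡ _)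
      ; ord-* = λ {m} {n} {f} {g} → order-* m n f g
      ; ord-all = λ i ()
      ; ord-mono = λ m≤n o i i<m → o i (ℕ.<-≤-trans i<m m≤n)
      ; ord-sep = λ h n → h (suc n) n ℕ.≤-refl
      ; lim = limit
      ; lim-approx = limit-approx
      ; q = X
      ; ord-q = λ { zero _ → refl ; (suc _) (s≤s ()) } }

open PS using (CompleteRing)
module Analysis (K : CompleteRing) where
  open import Data.Vec.Base using ([]; _∷_)
  open Solver
  open CompleteRing K public using (Ord; ord-cong; ord-0; ord-+; ord-*; ord-all; ord-mono; ord-sep; lim; lim-approx; q; ord-q)
  open CommutativeRing (CompleteRing.ring K) public hiding (zero)
  open Prove (CompleteRing.ring K) public
  open import Algebra.Properties.Semiring.Exp semiring public using (_^_; ^-homo-*; ^-assocʳ; ^-congˡ; ^-congʳ)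
  open import Relation.Binary.Reasoning.Setoid setoid public

  ord-*ˡ : ∀ {n y} x → Ord n y → Ord n (x * y)
  ord-*ˡ x o = ord-* ord-all o

  ord-*ʳ : ∀ {n y} x → Ord n y → Ord n (y * x)
  ord-*ʳ x o = ord-cong (*-comm _ _) (ord-*ˡ x o)

  ord-neg : ∀ {n x} → Ord n x → Ord n (- x)
  ord-neg {x = x} o = ord-cong (prove (x ∷ []) (⊝ I ⊗ v0) (⊝ v0) ≡.refl) (ord-*ˡ (- 1#) o)

  ord-- : ∀ {n x y} → Ord n x → Ord n y → Ord n (x - y)
  ord-- o o′ = ord-+ o (ord-neg o′)

  ord-^ : ∀ {k x} → Ord k x → ∀ n → Ord (n ℕ.* k) (x ^ n)
  ord-^ o zero = ord-all
  ord-^ o (suc n) = ord-* o (ord-^ o n)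

  ord-q^ : ∀ n → Ord n (q ^ n)
  ord-q^ n = ≡.subst (λ k → Ord k (q ^ n)) (ℕ.*-identityʳ n) (ord-^ ord-q n)

  ord-≥ : ∀ {m n} → m ≤ n → Ord m (q ^ n)
  ord-≥ {n = n} m≤n = ord-mono m≤n (ord-q^ n)

  infix 4 _⟶_
  _⟶_ : (ℕ → Carrier) → Carrier → Set
  f ⟶ x = ∀ n → Ord n (x - f n)

  separated : ∀ {x y} → (∀ n → Ord n (x - y)) → x ≈ y
  separated {x} {y} h = begin
    x ≈⟨ prove (x ∷ y ∷ []) v0 (v0 ⊖ v1 ⊕ v1) ≡.refl ⟩
    x - y + y ≈⟨ +-congʳ (ord-sep h) ⟩
    0# + y ≈⟨ +-identityˡ y ⟩
    y ∎

  from-zero : ∀ {x y} → x - y ≈ 0# → x ≈ y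
  from-zero {x} {y} h = trans (prove (x ∷ y ∷ []) v0 (v0 ⊖ v1 ⊕ v1) ≡.refl) (trans (+-congʳ h) (+-identityˡ y))

  ⟶-unique : ∀ {f x y} → f ⟶ x → f ⟶ y → x ≈ y
  ⟶-unique {f} {x} {y} p r = separated λ n → ord-cong
    (prove (f n ∷ x ∷ y ∷ []) ((v1 ⊖ v0) ⊖ (v2 ⊖ v0)) (v1 ⊖ v2) ≡.refl) (ord-- (p n) (r n))

  ⟶-cong : ∀ {f g x} → (∀ n → f n ≈ g n) → f ⟶ x → g ⟶ x
  ⟶-cong e p n = ord-cong (+-congˡ (-‿cong (e n))) (p n)

  ⟶-≈ : ∀ {f x y} → x ≈ y → f ⟶ x → f ⟶ y
  ⟶-≈ e p n = ord-cong (+-congʳ e) (p n)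

  ⟶-const : ∀ {x} → (λ _ → x) ⟶ x
  ⟶-const n = ord-cong (sym (-‿inverseʳ _)) ord-0

  ⟶-suc : ∀ {f x} → f ⟶ x → (λ n → f (suc n)) ⟶ x
  ⟶-suc p n = ord-mono (ℕ.n≤1+n n) (p (suc n))

  ⟶-+ : ∀ {f g x y} → f ⟶ x → g ⟶ y → (λ n → f n + g n) ⟶ x + y
  ⟶-+ {f} {g} {x} {y} p r n = ord-cong
    (prove (x ∷ y ∷ f n ∷ g n ∷ []) ((v0 ⊖ v2) ⊕ (v1 ⊖ v3)) ((v0 ⊕ v1) ⊖ (v2 ⊕ v3)) ≡.refl) (ord-+ (p n) (r n))

  ⟶-* : ∀ {f g x y} → f ⟶ x → g ⟶ y → (λ n → f n * g n) ⟶ x * y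
  ⟶-* {f} {g} {x} {y} p r n = ord-cong
    (prove (x ∷ y ∷ f n ∷ g n ∷ []) ((v0 ⊖ v2) ⊗ v1 ⊕ v2 ⊗ (v1 ⊖ v3)) (v0 ⊗ v1 ⊖ v2 ⊗ v3) ≡.refl)
    (ord-+ (ord-*ʳ y (p n)) (ord-*ˡ (f n) (r n)))

  lim-⟶ : ∀ {f} → (∀ n → Ord n (f (suc n) - f n)) → f ⟶ lim f
  lim-⟶ = lim-approx

  recurrence-zero : ∀ (a b δ : ℕ → Carrier) → (∀ k → δ k ≈ a k * δ (suc k) + b k * δ (suc (suc k))) →
    (∀ k → Ord k (δ k)) → ∀ k → δ k ≈ 0#
  recurrence-zero a b δ rec o k = ord-sep λ n → lem n k
    where
    lem : ∀ n k → Ord n (δ k)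
    lem n k = go n k (ℕ.m≤m+n n k)
      where
      go : ∀ j k → n ≤ j ℕ.+ k → Ord n (δ k)
      go zero k n≤k = ord-mono n≤k (o k)
      go (suc j) k le = ord-cong (sym (rec k)) (ord-+
        (ord-*ˡ (a k) (go j (suc k) (ℕ.≤-trans le (ℕ.≤-reflexive (≡.sym (ℕ.+-suc j k))))))
        (ord-*ˡ (b k) (go j (suc (suc k)) (ℕ.≤-trans le (ℕ.≤-trans (ℕ.n≤1+n _) (ℕ.≤-reflexive (≡.sym (≡.trans (ℕ.+-suc j (suc k)) (≡.cong suc (ℕ.+-suc j k))))))))))

  recurrence-unique : ∀ (a b x y : ℕ → Carrier) {l} →
    (∀ k → x k ≈ a k * x (suc k) + b k * x (suc (suc k))) → (∀ k → y k ≈ a k * y (suc k) + b k * y (suc (suc k))) →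
    x ⟶ l → y ⟶ l → ∀ k → x k ≈ y k
  recurrence-unique a b x y {l} rx ry px py k = begin
    x k ≈⟨ prove (x k ∷ y k ∷ []) v0 (v0 ⊖ v1 ⊕ v1) ≡.refl ⟩
    x k - y k + y k ≈⟨ +-congʳ (recurrence-zero a b (λ k → x k - y k) rec ord k) ⟩
    0# + y k ≈⟨ +-identityˡ _ ⟩
    y k ∎
    where
    rec : ∀ k → x k - y k ≈ a k * (x (suc k) - y (suc k)) + b k * (x (suc (suc k)) - y (suc (suc k)))
    rec k = trans (+-cong (rx k) (-‿cong (ry k)))
      (prove (a k ∷ b k ∷ x (suc k) ∷ y (suc k) ∷ x (suc (suc k)) ∷ y (suc (suc k)) ∷ [])
        (v0 ⊗ v2 ⊕ v1 ⊗ v4 ⊖ (v0 ⊗ v3 ⊕ v1 ⊗ v5)) (v0 ⊗ (v2 ⊖ v3) ⊕ v1 ⊗ (v4 ⊖ v5)) ≡.refl)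
    ord : ∀ k → Ord k (x k - y k)
    ord k = ord-cong (prove (l ∷ x k ∷ y k ∷ []) ((v0 ⊖ v2) ⊖ (v0 ⊖ v1)) (v1 ⊖ v2) ≡.refl) (ord-- (py k) (px k))

  first-order-unique : ∀ (a x y : ℕ → Carrier) {l} → (∀ k → x k ≈ a k * x (suc k)) → (∀ k → y k ≈ a k * y (suc k)) →
    x ⟶ l → y ⟶ l → ∀ k → x k ≈ y k
  first-order-unique a x y rx ry = recurrence-unique a (λ _ → 0#) x y
    (λ k → trans (rx k) (sym (trans (+-congˡ (zeroˡ _)) (+-identityʳ _)))) (λ k → trans (ry k) (sym (trans (+-congˡ (zeroˡ _)) (+-identityʳ _))))

  Σ< : (ℕ → Carrier) → ℕ → Carrier
  Σ< f zero = 0#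
  Σ< f (suc n) = Σ< f n + f n

  Summable : (ℕ → Carrier) → Set
  Summable f = ∀ n → Ord n (f n)

  ∑ : (ℕ → Carrier) → Carrier
  ∑ f = lim (Σ< f)

  ∑-⟶ : ∀ {f} → Summable f → Σ< f ⟶ ∑ f
  ∑-⟶ {f} s = lim-⟶ λ n → ord-cong (prove (Σ< f n ∷ f n ∷ []) v1 (v0 ⊕ v1 ⊖ v0) ≡.refl) (s n)

  Σ<-cong : ∀ {f g} → (∀ n → f n ≈ g n) → ∀ n → Σ< f n ≈ Σ< g n
  Σ<-cong e zero = refl
  Σ<-cong e (suc n) = +-cong (Σ<-cong e n) (e n)

  Σ<-+ : ∀ f g n → Σ< f n + Σ< g n ≈ Σ< (λ n → f n + g n) n
  Σ<-+ f g zero = +-identityˡ _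
  Σ<-+ f g (suc n) = trans
    (prove (Σ< f n ∷ Σ< g n ∷ f n ∷ g n ∷ []) ((v0 ⊕ v2) ⊕ (v1 ⊕ v3)) ((v0 ⊕ v1) ⊕ (v2 ⊕ v3)) ≡.refl) (+-congʳ (Σ<-+ f g n))

  Σ<-*ˡ : ∀ c f n → c * Σ< f n ≈ Σ< (λ n → c * f n) n
  Σ<-*ˡ c f zero = zeroʳ _
  Σ<-*ˡ c f (suc n) = trans (distribˡ _ _ _) (+-congʳ (Σ<-*ˡ c f n))

  Σ<-suc : ∀ f n → Σ< f (suc n) ≈ f 0 + Σ< (λ k → f (suc k)) n
  Σ<-suc f zero = +-comm _ _
  Σ<-suc f (suc n) = trans (+-congʳ (Σ<-suc f n)) (+-assoc _ _ _)

  ∑-cong : ∀ {f g} → (∀ n → f n ≈ g n) → Summable f → ∑ f ≈ ∑ g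
  ∑-cong {f} {g} e s = ⟶-unique {f = Σ< g} (⟶-cong (Σ<-cong e) (∑-⟶ s)) (∑-⟶ λ n → ord-cong (e n) (s n))

  ∑-+ : ∀ {f g} → Summable f → Summable g → ∑ f + ∑ g ≈ ∑ (λ n → f n + g n)
  ∑-+ {f} {g} s t = ⟶-unique (⟶-cong (Σ<-+ f g) (⟶-+ (∑-⟶ s) (∑-⟶ t))) (∑-⟶ λ n → ord-+ (s n) (t n))

  ∑-*ˡ : ∀ c {f} → Summable f → c * ∑ f ≈ ∑ (λ n → c * f n)
  ∑-*ˡ c {f} s = ⟶-unique (⟶-cong (Σ<-*ˡ c f) (⟶-* ⟶-const (∑-⟶ s))) (∑-⟶ λ n → ord-*ˡ c (s n))

  ∑-suc : ∀ {f} → Summable f → ∑ f ≈ f 0 + ∑ (λ n → f (suc n))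
  ∑-suc {f} s = ⟶-unique (⟶-cong (Σ<-suc f) (⟶-suc (∑-⟶ s)))
    (⟶-+ ⟶-const (∑-⟶ λ n → ord-mono (ℕ.n≤1+n n) (s (suc n))))

  ∑-telescope : ∀ {f} u → Summable u → (∀ n → f n ≈ u (suc n) - u n) → u 0 ≈ 0# → ∑ f ≈ 0#
  ∑-telescope {f} u s e u0 = ⟶-unique
    (∑-⟶ λ n → ord-cong (sym (e n)) (ord-- (ord-mono (ℕ.n≤1+n n) (s (suc n))) (s n)))
    λ n → ord-cong (sym (trans (+-congˡ (-‿cong (part n))) (+-identityˡ _))) (ord-neg (s n))
    where
    part : ∀ n → Σ< f n ≈ u n
    part zero = sym u0
    part (suc n) = trans (+-cong (part n) (e n)) (prove (u n ∷ u (suc n) ∷ []) (v0 ⊕ (v1 ⊖ v0)) v1 ≡.refl)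

  ord-∑ : ∀ {f n} → Summable f → (∀ m → Ord n (f m)) → Ord n (∑ f)
  ord-∑ {f} {n} s o = ord-cong (prove (∑ f ∷ Σ< f n ∷ []) (v0 ⊖ v1 ⊕ v1) v0 ≡.refl) (ord-+ (∑-⟶ s n) (part n))
    where
    part : ∀ k → Ord n (Σ< f k)
    part zero = ord-0
    part (suc k) = ord-+ (part k) (o k)

  ∑-- : ∀ {f g} → Summable f → Summable g → ∑ f - ∑ g ≈ ∑ (λ n → f n - g n)
  ∑-- {f} {g} s t = trans (+-congˡ (trans (neg (∑ g)) (∑-*ˡ (- 1#) t))) (trans (∑-+ s (λ n → ord-*ˡ _ (t n)))
    (∑-cong (λ n → +-congˡ (sym (neg (g n)))) (λ n → ord-+ (s n) (ord-*ˡ _ (t n)))))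
    where
    neg : ∀ x → - x ≈ - 1# * x
    neg x = prove (x ∷ []) (⊝ v0) ((⊝ I) ⊗ v0) ≡.refl

  pair-zero : ∀ (a b c d δ ε : ℕ → Carrier) → (∀ k → δ k ≈ a k * ε k + b k * δ (suc k)) → (∀ k → ε k ≈ c k * δ (suc k) + d k * ε (suc k)) →
    (∀ k → Ord k (δ k)) → (∀ k → Ord k (ε k)) → ∀ k → δ k ≈ 0# × ε k ≈ 0#
  pair-zero a b c d δ ε rδ rε oδ oε k = ord-sep (λ n → proj₁ (go n n k (ℕ.m≤m+n n k))) , ord-sep (λ n → proj₂ (go n n k (ℕ.m≤m+n n k)))
    where
    go : ∀ n j k → n ≤ j ℕ.+ k → Ord n (δ k) × Ord n (ε k)
    go n zero k n≤k = ord-mono n≤k (oδ k) , ord-mono n≤k (oε k)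
    go n (suc j) k n≤ = ord-cong (sym (rδ k)) (ord-+ (ord-*ˡ (a k) oε′) (ord-*ˡ (b k) (proj₁ ih))) , oε′
      where
      ih = go n j (suc k) (ℕ.≤-trans n≤ (ℕ.≤-reflexive (≡.sym (ℕ.+-suc j k))))
      oε′ = ord-cong (sym (rε k)) (ord-+ (ord-*ˡ (c k) (proj₁ ih)) (ord-*ˡ (d k) (proj₂ ih)))

  Π< : (ℕ → Carrier) → ℕ → Carrier
  Π< f zero = 1#
  Π< f (suc n) = Π< f n * f n

  Factors : (ℕ → Carrier) → Set
  Factors f = ∀ n → Ord n (f n - 1#)

  ∏ : (ℕ → Carrier) → Carrier
  ∏ f = lim (Π< f)

  ∏-⟶ : ∀ {f} → Factors f → Π< f ⟶ ∏ f
  ∏-⟶ {f} s = lim-⟶ λ n → ord-cong (prove (Π< f n ∷ f n ∷ []) (v0 ⊗ (v1 ⊖ I)) (v0 ⊗ v1 ⊖ v0) ≡.refl) (ord-*ˡ (Π< f n) (s n))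

  Π<-cong : ∀ {f g} → (∀ n → f n ≈ g n) → ∀ n → Π< f n ≈ Π< g n
  Π<-cong e zero = refl
  Π<-cong e (suc n) = *-cong (Π<-cong e n) (e n)

  Π<-* : ∀ f g n → Π< f n * Π< g n ≈ Π< (λ n → f n * g n) n
  Π<-* f g zero = *-identityˡ _
  Π<-* f g (suc n) = trans
    (prove (Π< f n ∷ Π< g n ∷ f n ∷ g n ∷ []) ((v0 ⊗ v2) ⊗ (v1 ⊗ v3)) ((v0 ⊗ v1) ⊗ (v2 ⊗ v3)) ≡.refl) (*-congʳ (Π<-* f g n))

  Π<-suc : ∀ f n → Π< f (suc n) ≈ f 0 * Π< (λ k → f (suc k)) n
  Π<-suc f zero = *-comm _ _
  Π<-suc f (suc n) = trans (*-congʳ (Π<-suc f n)) (*-assoc _ _ _)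

  factors-* : ∀ {f g} → Factors f → Factors g → Factors (λ n → f n * g n)
  factors-* {f} {g} s t n = ord-cong (prove (f n ∷ g n ∷ []) ((v0 ⊖ I) ⊗ v1 ⊕ (v1 ⊖ I)) (v0 ⊗ v1 ⊖ I) ≡.refl)
    (ord-+ (ord-*ʳ (g n) (s n)) (t n))

  factors-suc : ∀ {f} → Factors f → Factors (λ n → f (suc n))
  factors-suc s n = ord-mono (ℕ.n≤1+n n) (s (suc n))

  ∏-cong : ∀ {f g} → (∀ n → f n ≈ g n) → Factors f → ∏ f ≈ ∏ g
  ∏-cong {f} {g} e s = ⟶-unique {f = Π< g} (⟶-cong (Π<-cong e) (∏-⟶ s)) (∏-⟶ λ n → ord-cong (+-congʳ (e n)) (s n))

  ∏-* : ∀ {f g} → Factors f → Factors g → ∏ f * ∏ g ≈ ∏ (λ n → f n * g n)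
  ∏-* {f} {g} s t = ⟶-unique (⟶-cong (Π<-* f g) (⟶-* (∏-⟶ s) (∏-⟶ t))) (∏-⟶ (factors-* s t))

  ∏-suc : ∀ {f} → Factors f → ∏ f ≈ f 0 * ∏ (λ n → f (suc n))
  ∏-suc {f} s = ⟶-unique (⟶-cong (Π<-suc f) (⟶-suc (∏-⟶ s))) (⟶-* ⟶-const (∏-⟶ (factors-suc s)))

  geo : Carrier → Carrier
  geo x = ∑ (x ^_)

  geo-inverse : ∀ {x} → Ord 1 x → (1# - x) * geo x ≈ 1#
  geo-inverse {x} o = begin
    (1# - x) * geo x ≈⟨ prove (x ∷ geo x ∷ []) ((I ⊖ v0) ⊗ v1) (v1 ⊖ v0 ⊗ v1) ≡.refl ⟩
    geo x - x * geo x ≈⟨ +-cong (∑-suc s) (-‿cong (∑-*ˡ x s)) ⟩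
    1# + ∑ (λ n → x ^ suc n) - ∑ (λ n → x ^ suc n) ≈⟨ prove (∑ (λ n → x ^ suc n) ∷ []) (I ⊕ v0 ⊖ v0) I ≡.refl ⟩
    1# ∎
    where
    s : Summable (x ^_)
    s n = ≡.subst (λ k → Ord k (x ^ n)) (ℕ.*-identityʳ n) (ord-^ o n)

  Unital : Carrier → Set
  Unital u = Ord 1 (u - 1#)

  recip : Carrier → Carrier
  recip u = geo (1# - u)

  recip-inverse : ∀ {u} → Unital u → u * recip u ≈ 1#
  recip-inverse {u} o = trans (*-congʳ (prove (u ∷ []) v0 (I ⊖ (I ⊖ v0)) ≡.refl))
    (geo-inverse (ord-cong (prove (u ∷ []) (⊝ (v0 ⊖ I)) (I ⊖ v0) ≡.refl) (ord-neg o)))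

  unital-* : ∀ {u v} → Unital u → Unital v → Unital (u * v)
  unital-* {u} {v} o p = ord-cong (prove (u ∷ v ∷ []) ((v0 ⊖ I) ⊗ v1 ⊕ (v1 ⊖ I)) (v0 ⊗ v1 ⊖ I) ≡.refl) (ord-+ (ord-*ʳ v o) p)

  unital-1- : ∀ {x} → Ord 1 x → Unital (1# - x)
  unital-1- {x} o = ord-cong (prove (x ∷ []) (⊝ v0) (I ⊖ v0 ⊖ I) ≡.refl) (ord-neg o)

  cancel : ∀ u {x y} → Unital u → u * x ≈ u * y → x ≈ y
  cancel u {x} {y} o e = begin
    x ≈⟨ *-identityˡ x ⟨
    1# * x ≈⟨ *-congʳ (recip-inverse o) ⟨
    u * recip u * x ≈⟨ prove (u ∷ recip u ∷ x ∷ []) (v0 ⊗ v1 ⊗ v2) (v1 ⊗ (v0 ⊗ v2)) ≡.refl ⟩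
    recip u * (u * x) ≈⟨ *-congˡ e ⟩
    recip u * (u * y) ≈⟨ prove (u ∷ recip u ∷ y ∷ []) (v1 ⊗ (v0 ⊗ v2)) (v0 ⊗ v1 ⊗ v2) ≡.refl ⟩
    u * recip u * y ≈⟨ *-congʳ (recip-inverse o) ⟩
    1# * y ≈⟨ *-identityˡ y ⟩
    y ∎

-- The triple product

module JacobiTriple (K : CompleteRing) where
  open import Data.Nat.Tactic.RingSolver using (solve-∀)
  open import Data.Vec.Base using ([]; _∷_)
  open Solver
  open Analysis K

  -- Jacobi's triple product for the product of the (1 + X pʲ)(1 + Y pʲ)(1 - pʲ⁺¹) with X Y = p² and σ = X + Y.
  module Triple (p σ : Carrier) (ord-p : Ord 1 p) (ord-σ : Ord 1 σ) where
    e : ℕ → Carrier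
    e zero = 1#
    e (suc zero) = σ - p
    e (suc (suc n)) = σ * p ^ suc n * e (suc n) - p ^ (3 ℕ.+ (n ℕ.+ n)) * e n

    ord-p^ : ∀ n → Ord n (p ^ n)
    ord-p^ n = ≡.subst (λ k → Ord k (p ^ n)) (ℕ.*-identityʳ n) (ord-^ ord-p n)

    ord-p≥ : ∀ {m n} → m ≤ n → Ord m (p ^ n)
    ord-p≥ {n = n} m≤n = ord-mono m≤n (ord-p^ n)

    e-summable : Summable e
    e-summable n = proj₁ (both n)
      where
      both : ∀ n → Ord n (e n) × Ord (suc n) (e (suc n))
      both zero = ord-all , ord-- ord-σ ord-p
      both (suc n) = proj₂ (both n) , ord-- (ord-* {m = suc n} (ord-*ˡ σ (ord-p^ (suc n))) (ord-mono (s≤s z≤n) (proj₂ (both n))) ▹)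
        (ord-*ʳ (e n) (ord-p≥ (s≤s (s≤s (ℕ.≤-trans (ℕ.m≤m+n n n) (ℕ.n≤1+n _))))))
        where
        _▹ : ∀ {x} → Ord (suc n ℕ.+ 1) x → Ord (suc (suc n)) x
        _▹ {x} o = ≡.subst (λ k → Ord k x) (ℕ.+-comm (suc n) 1) o

    β : ℕ → ℕ → Carrier
    β zero zero = 1#
    β zero (suc n) = 0#
    β (suc N) zero = (1# + p ^ (2 ℕ.+ (N ℕ.+ N))) * β N zero + p ^ suc N * β N zero + p ^ (2 ℕ.+ N) * β N 1
    β (suc N) (suc n) = (1# + p ^ (2 ℕ.+ (N ℕ.+ N))) * β N (suc n) + p ^ (N ∸ n) * β N n + p ^ (3 ℕ.+ (N ℕ.+ n)) * β N (suc (suc n))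

    β-zero : ∀ N n → N < n → β N n ≈ 0#
    β-zero zero (suc n) _ = refl
    β-zero (suc N) (suc n) (s≤s N<n) = begin
      (1# + p ^ (2 ℕ.+ (N ℕ.+ N))) * β N (suc n) + p ^ (N ∸ n) * β N n + p ^ (3 ℕ.+ (N ℕ.+ n)) * β N (suc (suc n))
        ≈⟨ +-cong (+-cong (*-congˡ (β-zero N (suc n) (ℕ.m<n⇒m<1+n N<n))) (*-congˡ (β-zero N n N<n))) (*-congˡ (β-zero N (suc (suc n)) (ℕ.m<n⇒m<1+n (ℕ.m<n⇒m<1+n N<n)))) ⟩
      (1# + p ^ (2 ℕ.+ (N ℕ.+ N))) * 0# + p ^ (N ∸ n) * 0# + p ^ (3 ℕ.+ (N ℕ.+ n)) * 0#
        ≈⟨ prove ((1# + p ^ (2 ℕ.+ (N ℕ.+ N))) ∷ p ^ (N ∸ n) ∷ p ^ (3 ℕ.+ (N ℕ.+ n)) ∷ []) (v0 ⊗ ø ⊕ v1 ⊗ ø ⊕ v2 ⊗ ø) ø ≡.refl ⟩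
      0# ∎

    factor : ℕ → Carrier
    factor j = 1# + σ * p ^ j + p ^ (2 ℕ.+ (j ℕ.+ j))

    Σe : ℕ → ℕ → Carrier
    Σe N = Σ< (λ n → e n * β N n)

    private
      p^-+ : ∀ m n → p ^ (m ℕ.+ n) ≈ p ^ m * p ^ n
      p^-+ = ^-homo-* p

      p^-≡ : ∀ {m n} → m ≡ n → p ^ m ≈ p ^ n
      p^-≡ eq = reflexive (≡.cong (p ^_) eq)

      -- Multiplying by factor N shifts e up and down by one; x and y are the two boundary terms.
      module Step (N : ℕ) where
        x y : ℕ → Carrier
        x zero = p ^ suc N * β N 0
        x (suc n) = p ^ (N ∸ n) * β N n * e (suc n)
        y zero = p ^ suc N * β N 0
        y (suc n) = p ^ (2 ℕ.+ (N ℕ.+ n)) * β N (suc n) * e n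

        P : Carrier
        P = p ^ (2 ℕ.+ (N ℕ.+ N))

        recurrence : ∀ n → e n * β (suc N) n ≈ (1# + P) * (e n * β N n) + x n + y (suc n)
        recurrence zero = trans (*-congˡ (+-congˡ (*-congʳ (p^-≡ (≡.cong (2 ℕ.+_) (≡.sym (ℕ.+-identityʳ N)))))))
          (prove (P ∷ β N 0 ∷ p ^ suc N ∷ p ^ (2 ℕ.+ (N ℕ.+ 0)) ∷ β N 1 ∷ []) (I ⊗ ((I ⊕ v0) ⊗ v1 ⊕ v2 ⊗ v1 ⊕ v3 ⊗ v4)) ((I ⊕ v0) ⊗ (I ⊗ v1) ⊕ v2 ⊗ v1 ⊕ v3 ⊗ v4 ⊗ I) ≡.refl)
        recurrence (suc n) = trans (*-congˡ (+-congˡ (*-congʳ (p^-≡ (≡.cong (2 ℕ.+_) (≡.sym (ℕ.+-suc N n)))))))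
          (prove (P ∷ β N (suc n) ∷ p ^ (N ∸ n) ∷ β N n ∷ p ^ (2 ℕ.+ (N ℕ.+ suc n)) ∷ β N (suc (suc n)) ∷ e (suc n) ∷ [])
            (v6 ⊗ ((I ⊕ v0) ⊗ v1 ⊕ v2 ⊗ v3 ⊕ v4 ⊗ v5)) ((I ⊕ v0) ⊗ (v6 ⊗ v1) ⊕ v2 ⊗ v3 ⊗ v6 ⊕ v4 ⊗ v5 ⊗ v6) ≡.refl)

        expand : ∀ n → σ * p ^ N * (e n * β N n) ≈ x (suc n) + y n
        expand zero = prove (σ ∷ p ^ N ∷ β N 0 ∷ p ∷ []) (v0 ⊗ v1 ⊗ (I ⊗ v2)) (v1 ⊗ v2 ⊗ (v0 ⊖ v3) ⊕ v3 ⊗ v1 ⊗ v2) ≡.refl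
        expand (suc n) with ℕ.≤-<-connex (suc n) N
        ... | inj₂ N<n = trans (*-congˡ (*-congˡ z)) (trans (prove (σ * p ^ N ∷ e (suc n) ∷ p ^ (N ∸ suc n) ∷ e (suc (suc n)) ∷ p ^ (2 ℕ.+ (N ℕ.+ n)) ∷ e n ∷ [])
                (v0 ⊗ (v1 ⊗ ø)) (v2 ⊗ ø ⊗ v3 ⊕ v4 ⊗ ø ⊗ v5) ≡.refl) (+-cong (*-congʳ (*-congˡ (sym z))) (*-congʳ (*-congˡ (sym z)))))
          where z = β-zero N (suc n) N<n
        ... | inj₁ n<N = begin
          σ * p ^ N * (e (suc n) * b) ≈⟨ *-congʳ (*-congˡ (trans (p^-≡ (≡.sym (ℕ.m∸n+n≡m n<N))) (p^-+ (N ∸ suc n) (suc n)))) ⟩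
          σ * (d * p ^ suc n) * (e (suc n) * b)
            ≈⟨ prove (σ ∷ d ∷ p ^ suc n ∷ e (suc n) ∷ b ∷ p ^ (3 ℕ.+ (n ℕ.+ n)) ∷ e n ∷ []) (v0 ⊗ (v1 ⊗ v2) ⊗ (v3 ⊗ v4)) (v1 ⊗ v4 ⊗ (v0 ⊗ v2 ⊗ v3 ⊖ v5 ⊗ v6) ⊕ v1 ⊗ v5 ⊗ v4 ⊗ v6) ≡.refl ⟩
          d * b * e (suc (suc n)) + d * p ^ (3 ℕ.+ (n ℕ.+ n)) * b * e n ≈⟨ +-congˡ (*-congʳ (*-congʳ (trans (sym (p^-+ (N ∸ suc n) (3 ℕ.+ (n ℕ.+ n)))) (p^-≡ exponent)))) ⟩
          x (suc (suc n)) + y (suc n) ∎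
          where
          d = p ^ (N ∸ suc n)
          b = β N (suc n)
          lemma : ∀ d n → d ℕ.+ (3 ℕ.+ (n ℕ.+ n)) ≡ 2 ℕ.+ (d ℕ.+ suc n ℕ.+ n)
          lemma = solve-∀
          exponent : N ∸ suc n ℕ.+ (3 ℕ.+ (n ℕ.+ n)) ≡ 2 ℕ.+ (N ℕ.+ n)
          exponent = ≡.trans (lemma (N ∸ suc n) n) (≡.cong (λ k → 2 ℕ.+ (k ℕ.+ n)) (ℕ.m∸n+n≡m n<N))

        partial : ∀ M → Σe (suc N) M + x M ≈ factor N * Σe N M + y M
        partial zero = +-congʳ (sym (zeroʳ _))
        partial (suc M) = begin
          Σe (suc N) M + e M * β (suc N) M + x (suc M) ≈⟨ +-congʳ (+-congˡ (recurrence M)) ⟩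
          Σe (suc N) M + ((1# + P) * eb + x M + y (suc M)) + x (suc M)
            ≈⟨ prove (Σe (suc N) M ∷ P ∷ eb ∷ x M ∷ y (suc M) ∷ x (suc M) ∷ y M ∷ []) (v0 ⊕ ((I ⊕ v1) ⊗ v2 ⊕ v3 ⊕ v4) ⊕ v5) ((v0 ⊕ v3) ⊖ v6 ⊕ ((I ⊕ v1) ⊗ v2 ⊕ (v5 ⊕ v6) ⊕ v4)) ≡.refl ⟩
          (Σe (suc N) M + x M) - y M + ((1# + P) * eb + (x (suc M) + y M) + y (suc M)) ≈⟨ +-cong (+-congʳ (partial M)) (+-congʳ (+-congˡ (sym (expand M)))) ⟩
          (factor N * Σe N M + y M) - y M + ((1# + P) * eb + σ * p ^ N * eb + y (suc M))
            ≈⟨ prove (σ * p ^ N ∷ P ∷ Σe N M ∷ y M ∷ eb ∷ y (suc M) ∷ []) (((I ⊕ v0 ⊕ v1) ⊗ v2 ⊕ v3) ⊖ v3 ⊕ ((I ⊕ v1) ⊗ v4 ⊕ v0 ⊗ v4 ⊕ v5)) ((I ⊕ v0 ⊕ v1) ⊗ (v2 ⊕ v4) ⊕ v5) ≡.refl ⟩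
          factor N * Σe N (suc M) + y (suc M) ∎
          where eb = e M * β N M

        exact : ∀ M → N < M → Σe (suc N) (suc M) ≈ factor N * Σe N (suc M)
        exact M N<M = begin
          Σe (suc N) (suc M) ≈⟨ +-identityʳ _ ⟨
          Σe (suc N) (suc M) + 0# ≈⟨ +-congˡ (trans (*-congʳ (trans (*-congˡ (β-zero N M N<M)) (zeroʳ _))) (zeroˡ _)) ⟨
          Σe (suc N) (suc M) + x (suc M) ≈⟨ partial (suc M) ⟩
          factor N * Σe N (suc M) + y (suc M) ≈⟨ +-congˡ (trans (*-congʳ (trans (*-congˡ (β-zero N (suc M) (ℕ.m<n⇒m<1+n N<M))) (zeroʳ _))) (zeroˡ _)) ⟩
          factor N * Σe N (suc M) + 0# ≈⟨ +-identityʳ _ ⟩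
          factor N * Σe N (suc M) ∎

    finite : ∀ N M → N ≤ M → Π< factor N ≈ Σe N (suc M)
    finite zero zero _ = prove [] I (ø ⊕ I ⊗ I) ≡.refl
    finite zero (suc M) _ = trans (finite zero M z≤n) (sym (trans (+-congˡ (zeroʳ _)) (+-identityʳ _)))
    finite (suc N) M N<M = trans (*-congʳ (finite N M (ℕ.<⇒≤ N<M))) (trans (*-comm _ _) (sym (Step.exact N M N<M)))

    pp : ℕ → Carrier
    pp = Π< (λ i → 1# - p ^ suc i)

    closed : ∀ N n m → N ≡ n ℕ.+ m → β N n * (pp m * pp (suc (n ℕ.+ n ℕ.+ m))) ≈ pp (suc (N ℕ.+ N))
    closed₁ : ∀ N n m → N ≡ n ℕ.+ m → β N (suc n) * (pp m * pp (suc (suc (n ℕ.+ n ℕ.+ m)))) ≈ (1# - p ^ m) * pp (suc (N ℕ.+ N))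
    closed₁ N n zero eq = trans (*-congʳ (β-zero N (suc n) (s≤s (ℕ.≤-reflexive (≡.trans eq (ℕ.+-identityʳ n))))))
      (prove (pp 0 * pp (suc (suc (n ℕ.+ n ℕ.+ 0))) ∷ pp (suc (N ℕ.+ N)) ∷ []) (ø ⊗ v0) ((I ⊖ I) ⊗ v1) ≡.refl)
    closed₁ N n (suc m) eq = begin
      β N (suc n) * (pp m * (1# - p ^ suc m) * pp (suc (suc (n ℕ.+ n ℕ.+ suc m)))) ≡⟨ ≡.cong (λ i → β N (suc n) * (pp m * (1# - p ^ suc m) * pp (suc i))) (lemma n m) ⟩
      β N (suc n) * (pp m * (1# - p ^ suc m) * Q) ≈⟨ prove (β N (suc n) ∷ pp m ∷ p ^ suc m ∷ Q ∷ []) (v0 ⊗ (v1 ⊗ (I ⊖ v2) ⊗ v3)) ((I ⊖ v2) ⊗ (v0 ⊗ (v1 ⊗ v3))) ≡.refl ⟩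
      (1# - p ^ suc m) * (β N (suc n) * (pp m * Q)) ≈⟨ *-congˡ (closed N (suc n) m (≡.trans eq (ℕ.+-suc n m))) ⟩
      (1# - p ^ suc m) * pp (suc (N ℕ.+ N)) ∎
      where
      Q = pp (suc (suc n ℕ.+ suc n ℕ.+ m))
      lemma : ∀ n m → suc (n ℕ.+ n ℕ.+ suc m) ≡ suc n ℕ.+ suc n ℕ.+ m
      lemma = solve-∀
    closed zero zero zero eq = prove (p ∷ []) (I ⊗ (I ⊗ (I ⊗ (I ⊖ v0 ⊛ 1)))) (I ⊗ (I ⊖ v0 ⊛ 1)) ≡.refl
    closed (suc N) zero (suc m) ≡.refl = begin
      ((1# + p ^ (2 ℕ.+ (m ℕ.+ m))) * b₀ + p ^ suc m * b₀ + p ^ (2 ℕ.+ m) * b₁) * (pp m * (1# - p ^ suc m) * (pp (suc m) * (1# - p ^ suc (suc m))))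
        ≈⟨ *-congʳ (+-congʳ (+-congʳ (*-congʳ (+-congˡ (*-congˡ (*-congˡ (p^-+ m m))))))) ⟩
      ((1# + p * (p * (a * a))) * b₀ + p * a * b₀ + p * (p * a) * b₁) * (pp m * (1# - p * a) * (pp (suc m) * (1# - p * (p * a))))
        ≈⟨ prove (p ∷ a ∷ b₀ ∷ b₁ ∷ pp m ∷ pp (suc m) ∷ [])
          (((I ⊕ v0 ⊗ (v0 ⊗ (v1 ⊗ v1))) ⊗ v2 ⊕ v0 ⊗ v1 ⊗ v2 ⊕ v0 ⊗ (v0 ⊗ v1) ⊗ v3) ⊗ (v4 ⊗ (I ⊖ v0 ⊗ v1) ⊗ (v5 ⊗ (I ⊖ v0 ⊗ (v0 ⊗ v1)))))
          ((I ⊕ v0 ⊛ 2 ⊗ v1 ⊗ v1 ⊕ v0 ⊗ v1) ⊗ (I ⊖ v0 ⊗ v1) ⊗ (I ⊖ v0 ⊛ 2 ⊗ v1) ⊗ (v2 ⊗ (v4 ⊗ v5)) ⊕ v0 ⊛ 2 ⊗ v1 ⊗ (I ⊖ v0 ⊗ v1) ⊗ (v3 ⊗ (v4 ⊗ (v5 ⊗ (I ⊖ v0 ⊗ (v0 ⊗ v1)))))) ≡.refl ⟩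
      (1# + p ^ 2 * a * a + p * a) * (1# - p * a) * (1# - p ^ 2 * a) * (b₀ * (pp m * pp (suc m))) + p ^ 2 * a * (1# - p * a) * (b₁ * (pp m * pp (suc (suc m))))
        ≈⟨ +-cong (*-congˡ (closed m zero m ≡.refl)) (*-congˡ (closed₁ m zero m ≡.refl)) ⟩
      (1# + p ^ 2 * a * a + p * a) * (1# - p * a) * (1# - p ^ 2 * a) * P + p ^ 2 * a * (1# - p * a) * ((1# - a) * P)
        ≈⟨ prove (p ∷ a ∷ P ∷ []) ((I ⊕ v0 ⊛ 2 ⊗ v1 ⊗ v1 ⊕ v0 ⊗ v1) ⊗ (I ⊖ v0 ⊗ v1) ⊗ (I ⊖ v0 ⊛ 2 ⊗ v1) ⊗ v2 ⊕ v0 ⊛ 2 ⊗ v1 ⊗ (I ⊖ v0 ⊗ v1) ⊗ ((I ⊖ v1) ⊗ v2))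
          (v2 ⊗ (I ⊖ v0 ⊗ (v0 ⊗ (v1 ⊗ v1))) ⊗ (I ⊖ v0 ⊗ (v0 ⊗ (v0 ⊗ (v1 ⊗ v1))))) ≡.refl ⟩
      P * (1# - p * (p * (a * a))) * (1# - p * (p * (p * (a * a))))
        ≈⟨ *-cong (*-congˡ (+-congˡ (-‿cong (*-congˡ (*-congˡ (p^-+ m m)))))) (+-congˡ (-‿cong (*-congˡ (*-congˡ (*-congˡ (p^-+ m m)))))) ⟨
      pp (suc (suc (suc (m ℕ.+ m)))) ≡⟨ ≡.cong (λ i → pp (suc (suc i))) (≡.sym (ℕ.+-suc m m)) ⟩
      pp (suc (suc m ℕ.+ suc m)) ∎
      where
      a = p ^ m
      b₀ = β m 0
      b₁ = β m 1
      P = pp (suc (m ℕ.+ m))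
    closed (suc N) (suc n) m eq = begin
      (c * b₁ + p ^ (N ∸ n) * b₀ + p ^ (3 ℕ.+ (N ℕ.+ n)) * b₂) * (pp m * pp (suc (suc n ℕ.+ suc n ℕ.+ m)))
        ≡⟨ ≡.cong (λ i → (c * b₁ + p ^ (N ∸ n) * b₀ + p ^ (3 ℕ.+ (N ℕ.+ n)) * b₂) * (pp m * pp i)) (lemma n m) ⟩
      (c * b₁ + p ^ (N ∸ n) * b₀ + p ^ (3 ℕ.+ (N ℕ.+ n)) * b₂) * (pp m * (Q * (1# - p * (p * b)) * (1# - p * (p * (p * b)))))
        ≈⟨ *-congʳ (+-cong (+-congˡ (*-congʳ (p^-≡ N∸n))) (*-congʳ (p^-≡ (≡.trans (≡.cong (λ i → 3 ℕ.+ (i ℕ.+ n)) N≡) (lemma₃ n m))))) ⟩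
      (c * b₁ + a * b₀ + p * (p * (p * b)) * b₂) * (pp m * (Q * (1# - p * (p * b)) * (1# - p * (p * (p * b)))))
        ≈⟨ prove (p ∷ a ∷ b ∷ b₁ ∷ b₀ ∷ b₂ ∷ pp m ∷ Q ∷ c ∷ [])
          ((v8 ⊗ v3 ⊕ v1 ⊗ v4 ⊕ v0 ⊗ (v0 ⊗ (v0 ⊗ v2)) ⊗ v5) ⊗ (v6 ⊗ (v7 ⊗ (I ⊖ v0 ⊗ (v0 ⊗ v2)) ⊗ (I ⊖ v0 ⊗ (v0 ⊗ (v0 ⊗ v2))))))
          (v8 ⊗ (I ⊖ v0 ⊛ 3 ⊗ v2) ⊗ (v3 ⊗ (v6 ⊗ (v7 ⊗ (I ⊖ v0 ⊗ (v0 ⊗ v2))))) ⊕ v1 ⊗ (I ⊖ v0 ⊛ 2 ⊗ v2) ⊗ (I ⊖ v0 ⊛ 3 ⊗ v2) ⊗ (v4 ⊗ (v6 ⊗ v7))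
            ⊕ v0 ⊛ 3 ⊗ v2 ⊗ (v5 ⊗ (v6 ⊗ (v7 ⊗ (I ⊖ v0 ⊗ (v0 ⊗ v2)) ⊗ (I ⊖ v0 ⊗ (v0 ⊗ (v0 ⊗ v2))))))) ≡.refl ⟩
      c * (1# - p ^ 3 * b) * (b₁ * (pp m * pp (suc (suc (n ℕ.+ n ℕ.+ m))))) + a * (1# - p ^ 2 * b) * (1# - p ^ 3 * b) * (b₀ * (pp m * Q))
        + p ^ 3 * b * (b₂ * (pp m * pp (suc (suc (suc (n ℕ.+ n ℕ.+ m))))))
        ≈⟨ +-cong (+-cong (*-cong (*-congʳ (+-congˡ (trans (p^-≡ (≡.trans (≡.cong (λ i → 2 ℕ.+ (i ℕ.+ i)) N≡) (lemma₂ n m))) (*-congˡ (*-congˡ (p^-+ m (n ℕ.+ n ℕ.+ m))))))) (closed₁ N n m N≡)) (*-congˡ (closed N n m N≡))) (third m N≡) ⟩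
      (1# + p * (p * (a * b))) * (1# - p ^ 3 * b) * ((1# - a) * P) + a * (1# - p ^ 2 * b) * (1# - p ^ 3 * b) * P + (1# - a) * (p ^ 3 * b - p ^ 2 * (a * b)) * P
        ≈⟨ prove (p ∷ a ∷ b ∷ P ∷ []) ((I ⊕ v0 ⊗ (v0 ⊗ (v1 ⊗ v2))) ⊗ (I ⊖ v0 ⊛ 3 ⊗ v2) ⊗ ((I ⊖ v1) ⊗ v3) ⊕ v1 ⊗ (I ⊖ v0 ⊛ 2 ⊗ v2) ⊗ (I ⊖ v0 ⊛ 3 ⊗ v2) ⊗ v3 ⊕ (I ⊖ v1) ⊗ (v0 ⊛ 3 ⊗ v2 ⊖ v0 ⊛ 2 ⊗ (v1 ⊗ v2)) ⊗ v3)
          (v3 ⊗ (I ⊖ v0 ⊗ (v0 ⊗ (v1 ⊗ v2))) ⊗ (I ⊖ v0 ⊗ (v0 ⊗ (v0 ⊗ (v1 ⊗ v2))))) ≡.refl ⟩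
      P * (1# - p * (p * (a * b))) * (1# - p * (p * (p * (a * b))))
        ≈⟨ *-cong (*-congˡ (+-congˡ (-‿cong (*-congˡ (*-congˡ ab))))) (+-congˡ (-‿cong (*-congˡ (*-congˡ (*-congˡ ab))))) ⟨
      pp (suc (suc (suc (N ℕ.+ N)))) ≡⟨ ≡.cong (λ i → pp (suc (suc i))) (≡.sym (ℕ.+-suc N N)) ⟩
      pp (suc (suc N ℕ.+ suc N)) ∎
      where
      N≡ : N ≡ n ℕ.+ m
      N≡ = ℕ.suc-injective eq
      N∸n : N ∸ n ≡ m
      N∸n = ≡.trans (≡.cong (_∸ n) N≡) (ℕ.m+n∸m≡n n m)
      a = p ^ m
      b = p ^ (n ℕ.+ n ℕ.+ m)
      b₀ = β N n
      b₁ = β N (suc n)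
      b₂ = β N (suc (suc n))
      c = 1# + p ^ (2 ℕ.+ (N ℕ.+ N))
      Q = pp (suc (n ℕ.+ n ℕ.+ m))
      P = pp (suc (N ℕ.+ N))
      lemma : ∀ n m → suc (suc n ℕ.+ suc n ℕ.+ m) ≡ suc (suc (suc (n ℕ.+ n ℕ.+ m)))
      lemma = solve-∀
      lemma₂ : ∀ n m → 2 ℕ.+ (n ℕ.+ m ℕ.+ (n ℕ.+ m)) ≡ 2 ℕ.+ (m ℕ.+ (n ℕ.+ n ℕ.+ m))
      lemma₂ = solve-∀
      lemma₃ : ∀ n m → 3 ℕ.+ (n ℕ.+ m ℕ.+ n) ≡ 3 ℕ.+ (n ℕ.+ n ℕ.+ m)
      lemma₃ = solve-∀
      ab : p ^ (N ℕ.+ N) ≈ a * b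
      ab = trans (p^-≡ (≡.trans (≡.cong (λ i → i ℕ.+ i) N≡) (lemma₄ n m))) (p^-+ m _)
        where
        lemma₄ : ∀ n m → n ℕ.+ m ℕ.+ (n ℕ.+ m) ≡ m ℕ.+ (n ℕ.+ n ℕ.+ m)
        lemma₄ = solve-∀
      third : ∀ m → N ≡ n ℕ.+ m → p ^ 3 * p ^ (n ℕ.+ n ℕ.+ m) * (b₂ * (pp m * pp (suc (suc (suc (n ℕ.+ n ℕ.+ m)))))) ≈ (1# - p ^ m) * (p ^ 3 * p ^ (n ℕ.+ n ℕ.+ m) - p ^ 2 * (p ^ m * p ^ (n ℕ.+ n ℕ.+ m))) * P
      third zero e0 = trans (*-congˡ (*-congʳ (β-zero N (suc (suc n)) (s≤s (ℕ.≤-trans (ℕ.≤-reflexive (≡.trans e0 (ℕ.+-identityʳ n))) (ℕ.n≤1+n n))))))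
        (prove (p ^ 3 ∷ p ^ (n ℕ.+ n ℕ.+ 0) ∷ pp 0 * pp (suc (suc (suc (n ℕ.+ n ℕ.+ 0)))) ∷ p ^ 2 ∷ P ∷ []) (v0 ⊗ v1 ⊗ (ø ⊗ v2)) ((I ⊖ I) ⊗ (v0 ⊗ v1 ⊖ v3 ⊗ (I ⊗ v1)) ⊗ v4) ≡.refl)
      third (suc m) e1 = begin
        p ^ 3 * B * (b₂ * (pp m * (1# - p * p ^ m) * pp (suc (suc (suc (n ℕ.+ n ℕ.+ suc m)))))) ≡⟨ ≡.cong (λ i → p ^ 3 * B * (b₂ * (pp m * (1# - p * p ^ m) * pp (suc (suc i))))) (lemma₅ n m) ⟩
        p ^ 3 * B * (b₂ * (pp m * (1# - p * p ^ m) * R)) ≈⟨ prove (p ^ 3 * B ∷ b₂ ∷ pp m ∷ p * p ^ m ∷ R ∷ []) (v0 ⊗ (v1 ⊗ (v2 ⊗ (I ⊖ v3) ⊗ v4))) ((I ⊖ v3) ⊗ v0 ⊗ (v1 ⊗ (v2 ⊗ v4))) ≡.refl ⟩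
        (1# - p * p ^ m) * (p ^ 3 * B) * (b₂ * (pp m * R)) ≈⟨ *-congˡ (closed₁ N (suc n) m (≡.trans e1 (ℕ.+-suc n m))) ⟩
        (1# - p * p ^ m) * (p ^ 3 * B) * ((1# - p ^ m) * P) ≈⟨ prove (p ∷ p ^ m ∷ B ∷ P ∷ []) ((I ⊖ v0 ⊗ v1) ⊗ (v0 ⊛ 3 ⊗ v2) ⊗ ((I ⊖ v1) ⊗ v3)) ((I ⊖ v0 ⊗ v1) ⊗ (v0 ⊛ 3 ⊗ v2 ⊖ v0 ⊛ 2 ⊗ ((v0 ⊗ v1) ⊗ v2)) ⊗ v3) ≡.refl ⟩
        (1# - p * p ^ m) * (p ^ 3 * B - p ^ 2 * (p * p ^ m * B)) * P ∎
        where
        B = p ^ (n ℕ.+ n ℕ.+ suc m)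
        R = pp (suc (suc (suc n ℕ.+ suc n ℕ.+ m)))
        lemma₅ : ∀ n m → suc (n ℕ.+ n ℕ.+ suc m) ≡ suc n ℕ.+ suc n ℕ.+ m
        lemma₅ = solve-∀

    pp-factors : ∀ m → Factors (λ i → 1# - p ^ (suc m ℕ.+ i))
    pp-factors m n = ord-cong (prove (p ^ (suc m ℕ.+ n) ∷ []) (⊝ v0) (I ⊖ v0 ⊖ I) ≡.refl) (ord-neg (ord-p≥ (ℕ.m≤n+m n (suc m))))

    pp∞ : Carrier
    pp∞ = ∏ (λ i → 1# - p ^ suc i)

    factor-factors : Factors factor
    factor-factors n = ord-cong (prove (σ * p ^ n ∷ p ^ (2 ℕ.+ (n ℕ.+ n)) ∷ []) (v0 ⊕ v1) (I ⊕ v0 ⊕ v1 ⊖ I) ≡.refl)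
      (ord-+ (ord-*ˡ σ (ord-p^ n)) (ord-p≥ (ℕ.≤-trans (ℕ.m≤n+m n n) (ℕ.m≤n+m _ 2))))

    private
      near-* : ∀ {m x y} → Ord m (x - 1#) → Ord m (y - 1#) → Ord m (x * y - 1#)
      near-* {x = x} {y} o o′ = ord-cong (prove (x ∷ y ∷ []) ((v0 ⊖ I) ⊗ v1 ⊕ (v1 ⊖ I)) (v0 ⊗ v1 ⊖ I) ≡.refl) (ord-+ (ord-*ʳ y o) o′)

      near-1 : ∀ {k m} → k ≤ m → Ord k (1# - p ^ m - 1#)
      near-1 {k} {m} k≤m = ord-cong (prove (p ^ m ∷ []) (⊝ v0) (I ⊖ v0 ⊖ I) ≡.refl) (ord-neg (ord-p≥ k≤m))

      tail-∏ : ℕ → Carrier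
      tail-∏ m = ∏ (λ i → 1# - p ^ (suc m ℕ.+ i))

      pp-split : ∀ m → pp∞ ≈ pp m * tail-∏ m
      pp-split zero = sym (*-identityˡ _)
      pp-split (suc m) = trans (pp-split m) (trans (*-congˡ (trans (∏-suc (pp-factors m)) (*-cong (+-congˡ (-‿cong (p^-≡ (ℕ.+-identityʳ (suc m)))))
        (∏-cong (λ i → +-congˡ (-‿cong (p^-≡ (ℕ.+-suc (suc m) i)))) (factors-suc {λ i → 1# - p ^ (suc m ℕ.+ i)} (pp-factors m)))))) (sym (*-assoc _ _ _)))

      tail-near : ∀ m → Ord (suc m) (tail-∏ m - 1#)
      tail-near m = ord-cong (prove (tail-∏ m ∷ Π< g (suc m) ∷ []) ((v0 ⊖ v1) ⊕ (v1 ⊖ I)) (v0 ⊖ I) ≡.refl) (ord-+ (∏-⟶ (pp-factors m) (suc m)) (part (suc m)))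
        where
        g = λ i → 1# - p ^ (suc m ℕ.+ i)
        part : ∀ n → Ord (suc m) (Π< g n - 1#)
        part zero = ord-cong (sym (-‿inverseʳ 1#)) ord-0
        part (suc n) = near-* (part n) (near-1 (ℕ.m≤m+n (suc m) n))

      pp-unital : ∀ m → Unital (pp m)
      pp-unital zero = ord-cong (sym (-‿inverseʳ 1#)) ord-0
      pp-unital (suc m) = near-* (pp-unital m) (near-1 {m = suc m} (s≤s z≤n))

      rest : ℕ → ℕ → Carrier
      rest a = Π< (λ i → 1# - p ^ suc (a ℕ.+ i))

      pp-+ : ∀ a m → pp (a ℕ.+ m) ≈ pp a * rest a m
      pp-+ a zero = trans (reflexive (≡.cong pp (ℕ.+-identityʳ a))) (sym (*-identityʳ _))
      pp-+ a (suc m) = trans (reflexive (≡.cong pp (ℕ.+-suc a m))) (trans (*-congʳ (pp-+ a m)) (*-assoc _ _ _))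

      rest-near : ∀ k a m → k ≤ suc a → Ord k (rest a m - 1#)
      rest-near k a zero _ = ord-cong (sym (-‿inverseʳ 1#)) ord-0
      rest-near k a (suc m) k≤a = near-* (rest-near k a m k≤a) (near-1 (ℕ.≤-trans k≤a (ℕ.m≤m+n (suc a) m)))

      β-near : ∀ n m → Ord (suc m) (β (n ℕ.+ m) n * pp∞ - 1#)
      β-near n m = ord-cong (+-congʳ (sym (begin
        β (n ℕ.+ m) n * pp∞ ≈⟨ *-congˡ (pp-split m) ⟩
        β (n ℕ.+ m) n * (pp m * tail-∏ m) ≈⟨ *-assoc _ _ _ ⟨
        β (n ℕ.+ m) n * pp m * tail-∏ m ≈⟨ *-congʳ (cancel Q (pp-unital A) (begin
          Q * (β (n ℕ.+ m) n * pp m) ≈⟨ prove (Q ∷ β (n ℕ.+ m) n ∷ pp m ∷ []) (v0 ⊗ (v1 ⊗ v2)) (v1 ⊗ (v2 ⊗ v0)) ≡.refl ⟩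
          β (n ℕ.+ m) n * (pp m * Q) ≈⟨ closed (n ℕ.+ m) n m ≡.refl ⟩
          pp (suc (n ℕ.+ m ℕ.+ (n ℕ.+ m))) ≡⟨ ≡.cong (λ i → pp (suc i)) (lemma n m) ⟩
          pp (A ℕ.+ m) ≈⟨ pp-+ A m ⟩
          Q * rest A m ∎)) ⟩
        rest A m * tail-∏ m ∎)))
        (near-* (rest-near (suc m) A m (s≤s (ℕ.≤-trans (ℕ.m≤n+m m (n ℕ.+ n)) (ℕ.n≤1+n _)))) (tail-near m))
        where
        A = suc (n ℕ.+ n ℕ.+ m)
        Q = pp A
        lemma : ∀ n m → n ℕ.+ m ℕ.+ (n ℕ.+ m) ≡ n ℕ.+ n ℕ.+ m ℕ.+ m
        lemma = solve-∀

    triple-product : ∏ factor * pp∞ ≈ ∑ e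
    triple-product = ⟶-unique (⟶-* (∏-⟶ factor-factors) ⟶-const)
      λ N → ord-cong (prove (∑ e ∷ Σ< e N ∷ Π< factor N * pp∞ ∷ []) ((v0 ⊖ v1) ⊖ (v2 ⊖ v1)) (v0 ⊖ v2) ≡.refl)
        (ord-- (∑-⟶ e-summable N) (ord-cong (+-congʳ (*-congʳ (sym (finite N N ℕ.≤-refl)))) (main N)))
      where
      term : ∀ N n → n ≤ N → Ord N (e n * β N n * pp∞ - e n)
      term N n n≤N = ord-cong (prove (e n ∷ β N n ∷ pp∞ ∷ []) (v0 ⊗ (v1 ⊗ v2 ⊖ I)) (v0 ⊗ v1 ⊗ v2 ⊖ v0) ≡.refl)
        (≡.subst (λ k → Ord k (e n * (β N n * pp∞ - 1#))) (ℕ.m+[n∸m]≡n n≤N) (ord-* (e-summable n)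
          (ord-mono (ℕ.n≤1+n _) (≡.subst (λ k → Ord (suc (N ∸ n)) (β k n * pp∞ - 1#)) (ℕ.m+[n∸m]≡n n≤N) (β-near n (N ∸ n))))))
      sums : ∀ N M → M ≤ suc N → Ord N (Σe N M * pp∞ - Σ< e M)
      sums N zero _ = ord-cong (prove (pp∞ ∷ []) ø (ø ⊗ v0 ⊖ ø) ≡.refl) ord-0
      sums N (suc M) (s≤s M≤N) = ord-cong (prove (Σe N M ∷ e M * β N M ∷ pp∞ ∷ Σ< e M ∷ e M ∷ []) ((v0 ⊗ v2 ⊖ v3) ⊕ (v1 ⊗ v2 ⊖ v4)) ((v0 ⊕ v1) ⊗ v2 ⊖ (v3 ⊕ v4)) ≡.refl)
        (ord-+ (sums N M (ℕ.≤-trans M≤N (ℕ.n≤1+n N))) (term N M M≤N))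
      main : ∀ N → Ord N (Σe N (suc N) * pp∞ - Σ< e N)
      main N = ord-cong (prove (Σe N (suc N) * pp∞ ∷ Σ< e N ∷ e N ∷ []) ((v0 ⊖ (v1 ⊕ v2)) ⊕ v2) (v0 ⊖ v1) ≡.refl) (ord-+ (sums N (suc N) ℕ.≤-refl) (e-summable N))

-- The functional Λ

module Lam where
  open import Data.Nat.GeneralisedArithmetic using (fold)
  open import Data.Vec.Base using ([]; _∷_)
  import Algebra.Properties.Semiring.Exp as Exp
  open Solver
  open PS using (CompleteRing; module PowerSeries)

  triangle : ℕ → ℕ
  triangle zero = 0
  triangle (suc m) = suc m ℕ.+ triangle m

  m≤triangle : ∀ m → m ≤ triangle m
  m≤triangle zero = z≤n
  m≤triangle (suc m) = ℕ.m≤m+n (suc m) (triangle m)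

  record Functional (K : CompleteRing) : Set₁ where
    open Analysis K
    field
      S : CommutativeRing 0ℓ 0ℓ
    module S = CommutativeRing S
    open Exp S.semiring using () renaming (_^_ to _^ˢ_)
    field
      ⟨_⟩ : Carrier → S.Carrier
      ⟨⟩-cong : ∀ {a b} → a ≈ b → ⟨ a ⟩ S.≈ ⟨ b ⟩
      ⟨⟩-* : ∀ a b → ⟨ a * b ⟩ S.≈ ⟨ a ⟩ S.* ⟨ b ⟩
      ⟨⟩-+ : ∀ a b → ⟨ a + b ⟩ S.≈ ⟨ a ⟩ S.+ ⟨ b ⟩
      ⟨⟩-1 : ⟨ 1# ⟩ S.≈ S.1#
      s : S.Carrier
      σ : S.Carrier → S.Carrier
      σ-cong : ∀ {f g} → f S.≈ g → σ f S.≈ σ g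
      σ-+ : ∀ f g → σ (f S.+ g) S.≈ σ f S.+ σ g
      σ-* : ∀ f g → σ (f S.* g) S.≈ σ f S.* σ g
      σ-1 : σ S.1# S.≈ S.1#
      σ-⟨⟩ : ∀ c → σ ⟨ c ⟩ S.≈ ⟨ c ⟩
      σ-s : σ s S.≈ ⟨ q ⟩ S.* s
      Λ : S.Carrier → Carrier
      Λ-cong : ∀ {f g} → f S.≈ g → Λ f ≈ Λ g
      Λ-+ : ∀ f g → Λ (f S.+ g) ≈ Λ f + Λ g
      Λ-⟨⟩ : ∀ c f → Λ (⟨ c ⟩ S.* f) ≈ c * Λ f
      Λ-s : ∀ f → Λ (s S.* f) ≈ q * Λ (σ f)
      Λ-1 : Λ S.1# ≈ 1#
      Ordˢ : ℕ → S.Carrier → Set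
      ordˢ-cong : ∀ {n f g} → f S.≈ g → Ordˢ n f → Ordˢ n g
      ordˢ-+ : ∀ {n f g} → Ordˢ n f → Ordˢ n g → Ordˢ n (f S.+ g)
      ordˢ-* : ∀ {n f} g → Ordˢ n f → Ordˢ n (g S.* f)
      ordˢ-⟨⟩ : ∀ {n c} → Ord n c → Ordˢ n ⟨ c ⟩
      ordˢ-Λ : ∀ {n f} → Ordˢ n f → Ord n (Λ f)
      ct : S.Carrier → Carrier
      ct-cong : ∀ {f g} → f S.≈ g → ct f ≈ ct g
      ct-+ : ∀ f g → ct (f S.+ g) ≈ ct f + ct g
      ct-* : ∀ f g → ct (f S.* g) ≈ ct f * ct g
      ct-⟨⟩ : ∀ c → ct ⟨ c ⟩ ≈ c
      ct-s : ct s ≈ 0#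
      σ-limit : ∀ n f → Ord n (Λ (fold f σ n) - ct f)
      -- num e c is the product (c sᵉ; qᵉ)_∞ and den e c its inverse.
      num den : ℕ → Carrier → S.Carrier
      num-cong : ∀ {e c d} → c ≈ d → num (suc e) c S.≈ num (suc e) d
      den-cong : ∀ {e c d} → c ≈ d → den (suc e) c S.≈ den (suc e) d
      num-rec : ∀ e c → num (suc e) c S.≈ (S.1# S.- ⟨ c ⟩ S.* s ^ˢ suc e) S.* num (suc e) (c * q ^ suc e)
      den-rec : ∀ e c → (S.1# S.- ⟨ c ⟩ S.* s ^ˢ suc e) S.* den (suc e) c S.≈ den (suc e) (c * q ^ suc e)
      σ-num : ∀ e c → σ (num (suc e) c) S.≈ num (suc e) (c * q ^ suc e)
      σ-den : ∀ e c → σ (den (suc e) c) S.≈ den (suc e) (c * q ^ suc e)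
      num-den : ∀ e c → num (suc e) c S.* den (suc e) c S.≈ S.1#
      num-ord : ∀ {n e c} → Ord n c → Ordˢ n (num (suc e) c S.- S.1#)
      den-ord : ∀ {n e c} → Ord n c → Ordˢ n (den (suc e) c S.- S.1#)
      num-square : ∀ e c → num (suc e) c S.* num (suc e) (- c) S.≈ num (2 ℕ.* suc e) (c * c)
      ct-num : ∀ e c → ct (num e c) ≈ 1#
      ct-den : ∀ e c → ct (den e c) ≈ 1#

  module Construction (K : CompleteRing) where
    open Analysis K
    module P = PowerSeries (CompleteRing.ring K)
    open P using (conv; tail; X)
    S : CommutativeRing 0ℓ 0ℓ
    S = P.series
    module S = CommutativeRing S
    module SP = Prove S
    open Exp S.semiring using () renaming (_^_ to _^ˢ_)
    import Relation.Binary.Reasoning.Setoid S.setoid as SR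

    ⟨_⟩ : Carrier → S.Carrier
    ⟨ c ⟩ = P.⟨ c ⟩

    ⟨⟩-cong : ∀ {a b} → a ≈ b → ⟨ a ⟩ S.≈ ⟨ b ⟩
    ⟨⟩-cong e zero = e
    ⟨⟩-cong e (suc n) = refl

    ⟨⟩-* : ∀ a b → ⟨ a * b ⟩ S.≈ ⟨ a ⟩ S.* ⟨ b ⟩
    ⟨⟩-* a b zero = refl
    ⟨⟩-* a b (suc n) = sym (trans (P.conv-⟨⟩ a ⟨ b ⟩ (suc n)) (zeroʳ a))

    ⟨⟩-+ : ∀ a b → ⟨ a + b ⟩ S.≈ ⟨ a ⟩ S.+ ⟨ b ⟩
    ⟨⟩-+ a b zero = refl
    ⟨⟩-+ a b (suc n) = sym (+-identityˡ _)

    σ : S.Carrier → S.Carrier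
    σ f n = q ^ n * f n

    σ-* : ∀ f g → σ (f S.* g) S.≈ σ f S.* σ g
    σ-* f g n = go f g n 0
      where
      -- σ restricted to the tail of f picks up extra powers of q, so the induction shifts the exponent by j.
      go : ∀ f g n j → q ^ (j ℕ.+ n) * conv f g n ≈ conv (λ i → q ^ (j ℕ.+ i) * f i) (σ g) n
      go f g zero j = prove (q ^ (j ℕ.+ 0) ∷ f 0 ∷ g 0 ∷ []) (v0 ⊗ (v1 ⊗ v2)) ((v0 ⊗ v1) ⊗ (I ⊗ v2)) ≡.refl
      go f g (suc n) j = begin
        q ^ (j ℕ.+ suc n) * (f 0 * g (suc n) + conv (tail f) g n) ≈⟨ distribˡ _ _ _ ⟩
        q ^ (j ℕ.+ suc n) * (f 0 * g (suc n)) + q ^ (j ℕ.+ suc n) * conv (tail f) g n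
          ≈⟨ +-cong (trans (*-congʳ (^-homo-* q j (suc n))) (prove (q ^ j ∷ q ^ suc n ∷ f 0 ∷ g (suc n) ∷ []) ((v0 ⊗ v1) ⊗ (v2 ⊗ v3)) ((v0 ⊗ v2) ⊗ (v1 ⊗ v3)) ≡.refl))
               (trans (*-congʳ (^-congʳ q (ℕ.+-suc j n))) (go (tail f) g n (suc j))) ⟩
        q ^ j * f 0 * σ g (suc n) + conv (λ i → q ^ (suc j ℕ.+ i) * f (suc i)) (σ g) n
          ≈⟨ +-cong (*-congʳ (*-congʳ (^-congʳ q (≡.sym (ℕ.+-identityʳ j)))))
               (P.conv-cong {g = σ g} (λ i → *-congʳ (^-congʳ q (≡.sym (ℕ.+-suc j i)))) (λ _ → refl) n) ⟩
        conv (λ i → q ^ (j ℕ.+ i) * f i) (σ g) (suc n) ∎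

    σ-⟨⟩ : ∀ c → σ ⟨ c ⟩ S.≈ ⟨ c ⟩
    σ-⟨⟩ c zero = *-identityˡ c
    σ-⟨⟩ c (suc n) = zeroʳ _

    σ-X : σ X S.≈ ⟨ q ⟩ S.* X
    σ-X zero = trans (zeroʳ _) (sym (zeroʳ _))
    σ-X (suc zero) = trans (*-congʳ (*-identityʳ q)) (sym (P.conv-⟨⟩ q X 1))
    σ-X (suc (suc n)) = trans (zeroʳ _) (sym (trans (P.conv-⟨⟩ q X (suc (suc n))) (zeroʳ q)))

    σ-1 : σ S.1# S.≈ S.1#
    σ-1 = σ-⟨⟩ 1#

    σ-cong : ∀ {f g} → f S.≈ g → σ f S.≈ σ g
    σ-cong e n = *-congˡ (e n)

    σ-^ : ∀ f n → σ (f ^ˢ n) S.≈ σ f ^ˢ n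
    σ-^ f zero = σ-1
    σ-^ f (suc n) = S.trans (σ-* f (f ^ˢ n)) (S.*-congˡ {x = σ f} (σ-^ f n))

    terms : S.Carrier → ℕ → Carrier
    terms f m = q ^ triangle m * f m

    terms-summable : ∀ f → Summable (terms f)
    terms-summable f m = ord-*ʳ (f m) (ord-≥ (m≤triangle m))

    Λ : S.Carrier → Carrier
    Λ f = ∑ (terms f)

    Λ-cong : ∀ {f g} → f S.≈ g → Λ f ≈ Λ g
    Λ-cong {f} e = ∑-cong (λ m → *-congˡ (e m)) (terms-summable f)

    Λ-+ : ∀ f g → Λ (f S.+ g) ≈ Λ f + Λ g
    Λ-+ f g = trans (∑-cong (λ m → distribˡ _ _ _) (terms-summable (f S.+ g))) (sym (∑-+ (terms-summable f) (terms-summable g)))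

    Λ-⟨⟩ : ∀ c f → Λ (⟨ c ⟩ S.* f) ≈ c * Λ f
    Λ-⟨⟩ c f = trans (∑-cong (λ m → trans (*-congˡ (P.conv-⟨⟩ c f m)) (prove (q ^ triangle m ∷ c ∷ f m ∷ []) (v0 ⊗ (v1 ⊗ v2)) (v1 ⊗ (v0 ⊗ v2)) ≡.refl)) (terms-summable (⟨ c ⟩ S.* f)))
      (sym (∑-*ˡ c (terms-summable f)))

    Λ-X : ∀ f → Λ (X S.* f) ≈ q * Λ (σ f)
    Λ-X f = begin
      Λ (X S.* f) ≈⟨ ∑-suc (terms-summable (X S.* f)) ⟩
      1# * conv X f 0 + ∑ (λ m → terms (X S.* f) (suc m)) ≈⟨ trans (+-congʳ (trans (*-congˡ (zeroˡ _)) (zeroʳ _))) (+-identityˡ _) ⟩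
      ∑ (λ m → terms (X S.* f) (suc m)) ≈⟨ ∑-cong step (λ m → ord-mono (ℕ.n≤1+n m) (terms-summable (X S.* f) (suc m))) ⟩
      ∑ (λ m → q * terms (σ f) m) ≈⟨ ∑-*ˡ q (terms-summable (σ f)) ⟨
      q * Λ (σ f) ∎
      where
      step : ∀ m → terms (X S.* f) (suc m) ≈ q * terms (σ f) m
      step m = trans (*-cong (*-congˡ (^-homo-* q m (triangle m))) (P.conv-X-suc f m))
        (prove (q ∷ q ^ m ∷ q ^ triangle m ∷ f m ∷ []) ((v0 ⊗ (v1 ⊗ v2)) ⊗ v3) (v0 ⊗ (v2 ⊗ (v1 ⊗ v3))) ≡.refl)

    Ordˢ : ℕ → S.Carrier → Set
    Ordˢ n f = ∀ m → Ord n (f m)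

    ordˢ-* : ∀ {n f} g → Ordˢ n f → Ordˢ n (g S.* f)
    ordˢ-* g o zero = ord-*ˡ (g 0) (o 0)
    ordˢ-* g o (suc m) = ord-+ (ord-*ˡ (g 0) (o (suc m))) (ordˢ-* (tail g) o m)

    ordˢ-⟨⟩ : ∀ {n c} → Ord n c → Ordˢ n ⟨ c ⟩
    ordˢ-⟨⟩ o zero = o
    ordˢ-⟨⟩ o (suc m) = ord-0

    ordˢ-Λ : ∀ {n f} → Ordˢ n f → Ord n (Λ f)
    ordˢ-Λ {f = f} o = ord-∑ (terms-summable f) (λ m → ord-*ˡ _ (o m))

    Λ-1 : Λ S.1# ≈ 1#
    Λ-1 = trans (∑-suc (terms-summable S.1#)) (trans (+-cong (*-identityˡ 1#)
      (∑-telescope (λ _ → 0#) (λ _ → ord-0) (λ m → trans (zeroʳ _) (sym (-‿inverseʳ 0#))) refl)) (+-identityʳ 1#))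

    -- The equation A * C ≈ B * σ C has exactly one solution with constant term 1, because its
    -- coefficient at sᵐ determines (1 - qᵐ) * C m.
    module _ (A B : S.Carrier) where
      step : S.Carrier → S.Carrier
      step C zero = 1#
      step C (suc m) = geo (q ^ suc m) * (conv (tail B) (σ C) m - conv (tail A) C m)

      iter : ℕ → S.Carrier
      iter zero = S.1#
      iter (suc k) = step (iter k)

      core : S.Carrier
      core m = iter (suc m) m

    conv-local : ∀ f {g g′} m → (∀ i → i ≤ m → g i ≈ g′ i) → conv f g m ≈ conv f g′ m
    conv-local f zero e = *-congˡ (e 0 z≤n)
    conv-local f (suc m) e = +-cong (*-congˡ (e (suc m) ℕ.≤-refl)) (conv-local (tail f) m (λ i i≤m → e i (ℕ.≤-trans i≤m (ℕ.n≤1+n m))))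

    step-local : ∀ A B {C D} m → (∀ i → i < m → C i ≈ D i) → step A B C m ≈ step A B D m
    step-local A B zero e = refl
    step-local A B (suc m) e = *-congˡ (+-cong (conv-local (tail B) m (λ i i≤m → *-congˡ (e i (s≤s i≤m))))
      (-‿cong (conv-local (tail A) m (λ i i≤m → e i (s≤s i≤m)))))

    iter-stable : ∀ A B k m → m < k → iter A B (suc k) m ≈ iter A B k m
    iter-stable A B (suc k) m (s≤s m≤k) = step-local A B m (λ i i<m → iter-stable A B k i (ℕ.<-≤-trans i<m m≤k))

    core-iter : ∀ A B k m → m < k → core A B m ≈ iter A B k m
    core-iter A B (suc k) m (s≤s m≤k) with ℕ.m≤n⇒m<n∨m≡n m≤k
    ... | inj₁ m<k = trans (core-iter A B k m m<k) (sym (iter-stable A B k m m<k))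
    ... | inj₂ ≡.refl = refl

    core-step : ∀ A B m → core A B m ≈ step A B (core A B) m
    core-step A B m = step-local A B m (λ i i<m → sym (core-iter A B m i i<m))

    core-eq : ∀ A B → A 0 ≈ 1# → B 0 ≈ 1# → A S.* core A B S.≈ B S.* σ (core A B)
    core-eq A B a b zero = trans (*-congʳ a) (sym (trans (*-congʳ b) (*-congˡ (*-identityˡ _))))
    core-eq A B a b (suc m) = begin
      A 0 * C (suc m) + y ≈⟨ +-congʳ (trans (*-congʳ a) (*-identityˡ _)) ⟩
      C (suc m) + y ≈⟨ +-congʳ (trans (core-step A B (suc m)) refl) ⟩
      geo p * (x - y) + y ≈⟨ prove (geo p ∷ x ∷ y ∷ p ∷ []) (v0 ⊗ (v1 ⊖ v2) ⊕ v2) (v3 ⊗ (v0 ⊗ (v1 ⊖ v2)) ⊕ (((I ⊖ v3) ⊗ v0) ⊗ (v1 ⊖ v2) ⊕ v2)) ≡.refl ⟩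
      p * (geo p * (x - y)) + ((1# - p) * geo p * (x - y) + y) ≈⟨ +-cong (*-congˡ (sym (core-step A B (suc m))))
        (trans (+-congʳ (*-congʳ (geo-inverse (ord-≥ {n = suc m} (s≤s z≤n))))) (prove (x ∷ y ∷ []) (I ⊗ (v0 ⊖ v1) ⊕ v1) v0 ≡.refl)) ⟩
      p * C (suc m) + x ≈⟨ +-congʳ (trans (*-congʳ b) (*-identityˡ _)) ⟨
      B 0 * σ C (suc m) + x ∎
      where
      C = core A B
      p = q ^ suc m
      x = conv (tail B) (σ C) m
      y = conv (tail A) C m

    core-unique : ∀ A B {C D} → A 0 ≈ 1# → B 0 ≈ 1# → A S.* C S.≈ B S.* σ C → A S.* D S.≈ B S.* σ D → C 0 ≈ D 0 → C S.≈ D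
    core-unique A B {C} {D} a b eC eD e0 n = go n n ℕ.≤-refl
      where
      solved : ∀ {C} m → A S.* C S.≈ B S.* σ C → (1# - q ^ suc m) * C (suc m) ≈ conv (tail B) (σ C) m - conv (tail A) C m
      solved {C} m e = begin
        (1# - p) * C (suc m) ≈⟨ prove (C (suc m) ∷ p ∷ x ∷ y ∷ []) ((I ⊖ v1) ⊗ v0) ((v0 ⊕ v3) ⊖ v3 ⊖ v1 ⊗ v0) ≡.refl ⟩
        C (suc m) + y - y - p * C (suc m) ≈⟨ +-congʳ (+-congʳ (+-congʳ (trans (*-congʳ a) (*-identityˡ _)))) ⟨
        A 0 * C (suc m) + y - y - p * C (suc m) ≈⟨ +-congʳ (+-congʳ (e (suc m))) ⟩
        B 0 * (p * C (suc m)) + x - y - p * C (suc m) ≈⟨ +-congʳ (+-congʳ (+-congʳ (trans (*-congʳ b) (*-identityˡ _)))) ⟩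
        p * C (suc m) + x - y - p * C (suc m) ≈⟨ prove (p * C (suc m) ∷ x ∷ y ∷ []) (v0 ⊕ v1 ⊖ v2 ⊖ v0) (v1 ⊖ v2) ≡.refl ⟩
        x - y ∎
        where
        p = q ^ suc m
        x = conv (tail B) (σ C) m
        y = conv (tail A) C m
      go : ∀ n m → m ≤ n → C m ≈ D m
      go n zero _ = e0
      go (suc n) (suc m) (s≤s m≤n) = cancel (1# - q ^ suc m) (unital-1- (ord-≥ {n = suc m} (s≤s z≤n)))
        (trans (solved m eC) (trans (+-cong (conv-local (tail B) m (λ i i≤m → *-congˡ (go n i (ℕ.≤-trans i≤m m≤n))))
          (-‿cong (conv-local (tail A) m (λ i i≤m → go n i (ℕ.≤-trans i≤m m≤n))))) (sym (solved m eD))))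

    factor : ℕ → Carrier → S.Carrier
    factor e c = S.1# S.- ⟨ c ⟩ S.* X ^ˢ e

    X^-0 : ∀ e → (X ^ˢ suc e) 0 ≈ 0#
    X^-0 e = zeroˡ _

    factor-0 : ∀ e c → factor (suc e) c 0 ≈ 1#
    factor-0 e c = trans (+-congˡ (-‿cong (trans (*-congˡ (X^-0 e)) (zeroʳ c)))) (trans (+-congˡ -0#≈0#) (+-identityʳ 1#))
      where
      open import Algebra.Properties.Ring ring using (-0#≈0#)

    σ-factor : ∀ e c → σ (factor e c) S.≈ factor e (c * q ^ e)
    σ-factor e c n = begin
      q ^ n * (S.1# n - (⟨ c ⟩ S.* X ^ˢ e) n) ≈⟨ prove (q ^ n ∷ S.1# n ∷ (⟨ c ⟩ S.* X ^ˢ e) n ∷ []) (v0 ⊗ (v1 ⊖ v2)) (v0 ⊗ v1 ⊖ v0 ⊗ v2) ≡.refl ⟩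
      σ S.1# n - σ (⟨ c ⟩ S.* X ^ˢ e) n ≈⟨ +-cong (σ-1 n) (-‿cong (body n)) ⟩
      factor e (c * q ^ e) n ∎
      where
      ⟨⟩-^ : ∀ e → ⟨ q ⟩ ^ˢ e S.≈ ⟨ q ^ e ⟩
      ⟨⟩-^ zero = S.refl {S.1#}
      ⟨⟩-^ (suc e) = S.trans (S.*-congˡ {x = ⟨ q ⟩} (⟨⟩-^ e)) (S.sym (⟨⟩-* q (q ^ e)))
      ^-dist : ∀ e → (⟨ q ⟩ S.* X) ^ˢ e S.≈ ⟨ q ⟩ ^ˢ e S.* X ^ˢ e
      ^-dist zero = S.sym (S.*-identityˡ S.1#)
      ^-dist (suc e) = S.trans (S.*-congˡ {x = ⟨ q ⟩ S.* X} (^-dist e))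
        (SP.prove (⟨ q ⟩ ∷ X ∷ ⟨ q ⟩ ^ˢ e ∷ X ^ˢ e ∷ []) ((v0 ⊗ v1) ⊗ (v2 ⊗ v3)) ((v0 ⊗ v2) ⊗ (v1 ⊗ v3)) ≡.refl)
      body : σ (⟨ c ⟩ S.* X ^ˢ e) S.≈ ⟨ c * q ^ e ⟩ S.* X ^ˢ e
      body = SR.begin
        σ (⟨ c ⟩ S.* X ^ˢ e) SR.≈⟨ σ-* ⟨ c ⟩ (X ^ˢ e) ⟩
        σ ⟨ c ⟩ S.* σ (X ^ˢ e) SR.≈⟨ S.*-cong {y = ⟨ c ⟩} {v = ⟨ q ⟩ ^ˢ e S.* X ^ˢ e} (σ-⟨⟩ c) (S.trans (σ-^ X e) (S.trans (^-cong′ e σ-X) (^-dist e))) ⟩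
        ⟨ c ⟩ S.* (⟨ q ⟩ ^ˢ e S.* X ^ˢ e) SR.≈⟨ S.*-congˡ {x = ⟨ c ⟩} (S.*-congʳ {x = X ^ˢ e} (⟨⟩-^ e)) ⟩
        ⟨ c ⟩ S.* (⟨ q ^ e ⟩ S.* X ^ˢ e) SR.≈⟨ S.*-assoc ⟨ c ⟩ ⟨ q ^ e ⟩ (X ^ˢ e) ⟨
        ⟨ c ⟩ S.* ⟨ q ^ e ⟩ S.* X ^ˢ e SR.≈⟨ S.*-congʳ {x = X ^ˢ e} (⟨⟩-* c (q ^ e)) ⟨
        ⟨ c * q ^ e ⟩ S.* X ^ˢ e SR.∎
        where
        ^-cong′ : ∀ {f g} e → f S.≈ g → f ^ˢ e S.≈ g ^ˢ e
        ^-cong′ zero p = S.refl {S.1#}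
        ^-cong′ {f} {g} (suc e) p = S.*-cong {f} {g} p (^-cong′ e p)

    factor-cong : ∀ e {c d} → c ≈ d → factor e c S.≈ factor e d
    factor-cong e {c} {d} p n = +-congˡ (-‿cong (S.*-congʳ {x = X ^ˢ e} (⟨⟩-cong p) n))

    num den : ℕ → Carrier → S.Carrier
    num e c = core S.1# (factor e c)
    den e c = core (factor e c) S.1#

    num-eq : ∀ e c → num (suc e) c S.≈ factor (suc e) c S.* σ (num (suc e) c)
    num-eq e c = S.trans (S.sym (S.*-identityˡ (num (suc e) c))) (core-eq S.1# (factor (suc e) c) refl (factor-0 e c))

    den-eq : ∀ e c → factor (suc e) c S.* den (suc e) c S.≈ σ (den (suc e) c)
    den-eq e c = S.trans (core-eq (factor (suc e) c) S.1# (factor-0 e c) refl) (S.*-identityˡ (σ (den (suc e) c)))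

    num-unique : ∀ e c {f} → f S.≈ factor (suc e) c S.* σ f → f 0 ≈ 1# → f S.≈ num (suc e) c
    num-unique e c {f} p f0 = core-unique S.1# (factor (suc e) c) refl (factor-0 e c)
      (S.trans (S.*-identityˡ f) p) (core-eq S.1# (factor (suc e) c) refl (factor-0 e c)) f0

    den-unique : ∀ e c {f} → factor (suc e) c S.* f S.≈ σ f → f 0 ≈ 1# → f S.≈ den (suc e) c
    den-unique e c {f} p f0 = core-unique (factor (suc e) c) S.1# (factor-0 e c) refl
      (S.trans p (S.sym (S.*-identityˡ (σ f)))) (core-eq (factor (suc e) c) S.1# (factor-0 e c) refl) f0

    σ-num : ∀ e c → σ (num (suc e) c) S.≈ num (suc e) (c * q ^ suc e)
    σ-num e c = num-unique e (c * q ^ suc e)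
      (S.trans (σ-cong (num-eq e c)) (S.trans (σ-* _ _) (S.*-congʳ {x = σ (σ (num (suc e) c))} (σ-factor (suc e) c)))) (*-identityˡ 1#)

    σ-den : ∀ e c → σ (den (suc e) c) S.≈ den (suc e) (c * q ^ suc e)
    σ-den e c = den-unique e (c * q ^ suc e)
      (S.trans (S.sym (S.trans (σ-* _ _) (S.*-congʳ {x = σ (den (suc e) c)} (σ-factor (suc e) c)))) (σ-cong (den-eq e c))) (*-identityˡ 1#)

    num-cong : ∀ {e c d} → c ≈ d → num (suc e) c S.≈ num (suc e) d
    num-cong {e} {c} {d} p = num-unique e d (S.trans (num-eq e c) (S.*-congʳ {x = σ (num (suc e) c)} (factor-cong (suc e) p))) refl

    den-cong : ∀ {e c d} → c ≈ d → den (suc e) c S.≈ den (suc e) d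
    den-cong {e} {c} {d} p = den-unique e d (S.trans (S.*-congʳ {x = den (suc e) c} (S.sym (factor-cong (suc e) p))) (den-eq e c)) refl

    unit-unique : ∀ {f} → f S.≈ σ f → f 0 ≈ 1# → f S.≈ S.1#
    unit-unique {f} p f0 = core-unique S.1# S.1# refl refl (S.*-congˡ {x = S.1#} p)
      (S.*-congˡ {x = S.1#} (S.sym σ-1)) f0

    num-den : ∀ e c → num (suc e) c S.* den (suc e) c S.≈ S.1#
    num-den e c = unit-unique (SR.begin
      n S.* d SR.≈⟨ S.*-congʳ {x = d} (num-eq e c) ⟩
      factor (suc e) c S.* σ n S.* d SR.≈⟨ SP.prove (factor (suc e) c ∷ σ n ∷ d ∷ []) (v0 ⊗ v1 ⊗ v2) (v1 ⊗ (v0 ⊗ v2)) ≡.refl ⟩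
      σ n S.* (factor (suc e) c S.* d) SR.≈⟨ S.*-congˡ {x = σ n} (den-eq e c) ⟩
      σ n S.* σ d SR.≈⟨ σ-* n d ⟨
      σ (n S.* d) SR.∎) (*-identityˡ 1#)
      where
      n = num (suc e) c
      d = den (suc e) c

    num-square : ∀ e c → num (suc e) c S.* num (suc e) (- c) S.≈ num (2 ℕ.* suc e) (c * c)
    num-square e c = num-unique (e ℕ.+ suc (e ℕ.+ 0)) (c * c) (SR.begin
      n S.* m SR.≈⟨ S.*-cong {n} {factor (suc e) c S.* σ n} (num-eq e c) (num-eq e (- c)) ⟩
      (factor (suc e) c S.* σ n) S.* (factor (suc e) (- c) S.* σ m)
        SR.≈⟨ SP.prove (factor (suc e) c ∷ σ n ∷ factor (suc e) (- c) ∷ σ m ∷ []) ((v0 ⊗ v1) ⊗ (v2 ⊗ v3)) ((v0 ⊗ v2) ⊗ (v1 ⊗ v3)) ≡.refl ⟩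
      (factor (suc e) c S.* factor (suc e) (- c)) S.* (σ n S.* σ m)
        SR.≈⟨ S.*-cong {factor (suc e) c S.* factor (suc e) (- c)} {factor (2 ℕ.* suc e) (c * c)} ff (S.sym (σ-* n m)) ⟩
      factor (2 ℕ.* suc e) (c * c) S.* σ (n S.* m) SR.∎) (*-identityˡ 1#)
      where
      n = num (suc e) c
      m = num (suc e) (- c)
      ⟨⟩-neg : ⟨ - c ⟩ S.≈ S.- ⟨ c ⟩
      ⟨⟩-neg zero = refl
      ⟨⟩-neg (suc n) = sym -0#≈0#
        where
        open import Algebra.Properties.Ring ring using (-0#≈0#)
      module E = Exp S.semiring
      ff : factor (suc e) c S.* factor (suc e) (- c) S.≈ factor (2 ℕ.* suc e) (c * c)
      ff = SR.begin
        factor (suc e) c S.* (S.1# S.- ⟨ - c ⟩ S.* X ^ˢ suc e)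
          SR.≈⟨ S.*-congˡ {x = factor (suc e) c} (S.+-congˡ {x = S.1#} (S.-‿cong (S.*-congʳ {x = X ^ˢ suc e} ⟨⟩-neg))) ⟩
        factor (suc e) c S.* (S.1# S.- (S.- ⟨ c ⟩) S.* X ^ˢ suc e)
          SR.≈⟨ SP.prove (⟨ c ⟩ ∷ X ^ˢ suc e ∷ []) ((I ⊖ v0 ⊗ v1) ⊗ (I ⊖ (⊝ v0) ⊗ v1)) (I ⊖ (v0 ⊗ v0) ⊗ (v1 ⊗ v1)) ≡.refl ⟩
        S.1# S.- (⟨ c ⟩ S.* ⟨ c ⟩) S.* (X ^ˢ suc e S.* X ^ˢ suc e)
          SR.≈⟨ S.+-congˡ {x = S.1#} (S.-‿cong (S.*-cong {⟨ c ⟩ S.* ⟨ c ⟩} {⟨ c * c ⟩} (S.sym (⟨⟩-* c c)) (S.sym (S.trans (S.reflexive (≡.cong (X ^ˢ_) (≡.cong (suc e ℕ.+_) (ℕ.+-identityʳ (suc e))))) (E.^-homo-* X (suc e) (suc e)))))) ⟩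
        factor (2 ℕ.* suc e) (c * c) SR.∎

    core-ord : ∀ {n} A B → Ordˢ n (tail A) → Ordˢ n (tail B) → Ordˢ n (core A B S.- S.1#)
    core-ord A B oA oB zero = ord-cong (sym (-‿inverseʳ 1#)) ord-0
    core-ord A B oA oB (suc m) = ord-cong (trans (sym (core-step A B (suc m))) (sym (trans (+-congˡ -0#≈0#) (+-identityʳ _))))
      (ord-*ˡ _ (ord-- (ordʳ (tail B) (σ (core A B)) oB m) (ordʳ (tail A) (core A B) oA m)))
      where
      open import Algebra.Properties.Ring ring using (-0#≈0#)
      ordʳ : ∀ {n} f g → Ordˢ n f → Ordˢ n (f S.* g)
      ordʳ f g o m = ord-cong (P.conv-comm g f m) (ordˢ-* g o m)

    tail-factor : ∀ {n} e {c} → Ord n c → Ordˢ n (tail (factor e c))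
    tail-factor e {c} o m = ord-+ ord-0 (ord-neg (ord-cong (sym (P.conv-⟨⟩ c (X ^ˢ e) (suc m))) (ord-*ʳ _ o)))

    σ^-ord : ∀ n f → Ordˢ n (fold f σ n S.- ⟨ f 0 ⟩)
    σ^-ord n f zero = ord-cong (sym (trans (+-congʳ (at-0 n)) (-‿inverseʳ (f 0)))) ord-0
      where
      at-0 : ∀ n → fold f σ n 0 ≈ f 0
      at-0 zero = refl
      at-0 (suc n) = trans (*-identityˡ _) (at-0 n)
    σ^-ord n f (suc m) = ord-- (ord-σ n) ord-0
      where
      ord-σ : ∀ n → Ord n (fold f σ n (suc m))
      ord-σ zero = ord-all
      ord-σ (suc n) = ord-* (ord-≥ {n = suc m} (s≤s z≤n)) (ord-σ n)

    Λ-limit : ∀ n f → Ord n (Λ (fold f σ n) - f 0)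
    Λ-limit n f = ord-cong (begin
      Λ (x S.- ⟨ f 0 ⟩) ≈⟨ prove (Λ (x S.- ⟨ f 0 ⟩) ∷ f 0 ∷ []) v0 (v0 ⊕ v1 ⊖ v1) ≡.refl ⟩
      Λ (x S.- ⟨ f 0 ⟩) + f 0 - f 0 ≈⟨ +-congʳ (+-congˡ (trans (Λ-cong (S.sym (S.*-identityʳ ⟨ f 0 ⟩))) (trans (Λ-⟨⟩ (f 0) S.1#) (trans (*-congˡ Λ-1) (*-identityʳ _))))) ⟨
      Λ (x S.- ⟨ f 0 ⟩) + Λ ⟨ f 0 ⟩ - f 0 ≈⟨ +-congʳ (trans (sym (Λ-+ (x S.- ⟨ f 0 ⟩) ⟨ f 0 ⟩)) (Λ-cong (SP.prove (x ∷ ⟨ f 0 ⟩ ∷ []) (v0 ⊖ v1 ⊕ v1) v0 ≡.refl))) ⟩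
      Λ x - f 0 ∎) (ordˢ-Λ (σ^-ord n f))
      where x = fold f σ n

    functional : Functional K
    functional = record
      { S = S ; ⟨_⟩ = ⟨_⟩ ; ⟨⟩-cong = ⟨⟩-cong ; ⟨⟩-* = ⟨⟩-* ; ⟨⟩-+ = ⟨⟩-+ ; ⟨⟩-1 = S.refl {S.1#} ; s = X
      ; σ = σ ; σ-cong = σ-cong ; σ-+ = λ f g n → distribˡ _ _ _ ; σ-* = σ-* ; σ-1 = σ-1 ; σ-⟨⟩ = σ-⟨⟩ ; σ-s = σ-X
      ; Λ = Λ ; Λ-cong = Λ-cong ; Λ-+ = Λ-+ ; Λ-⟨⟩ = Λ-⟨⟩ ; Λ-s = Λ-X ; Λ-1 = Λ-1
      ; Ordˢ = Ordˢ ; ordˢ-cong = λ e o m → ord-cong (e m) (o m) ; ordˢ-+ = λ o p m → ord-+ (o m) (p m) ; ordˢ-* = ordˢ-* ; ordˢ-⟨⟩ = ordˢ-⟨⟩ ; ordˢ-Λ = ordˢ-Λ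
      ; num = num ; den = den ; num-cong = λ {e} → num-cong {e} ; den-cong = λ {e} → den-cong {e} ; num-rec = num-rec′ ; den-rec = den-rec′
      ; σ-num = σ-num ; σ-den = σ-den ; num-den = num-den
      ; num-ord = λ {n} {e} o → core-ord S.1# (factor (suc e) _) (λ m → ord-0) (tail-factor (suc e) o)
      ; den-ord = λ {n} {e} o → core-ord (factor (suc e) _) S.1# (tail-factor (suc e) o) (λ m → ord-0)
      ; num-square = num-square
      ; ct = λ f → f 0 ; ct-cong = λ e → e 0 ; ct-+ = λ f g → refl ; ct-* = λ f g → refl ; ct-⟨⟩ = λ c → refl ; ct-s = refl
      ; ct-num = λ e c → refl ; ct-den = λ e c → refl ; σ-limit = Λ-limit }
      where
      num-rec′ : ∀ e c → num (suc e) c S.≈ factor (suc e) c S.* num (suc e) (c * q ^ suc e)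
      num-rec′ e c = S.trans (num-eq e c) (S.*-congˡ {x = factor (suc e) c} (σ-num e c))
      den-rec′ : ∀ e c → factor (suc e) c S.* den (suc e) c S.≈ den (suc e) (c * q ^ suc e)
      den-rec′ e c = S.trans (den-eq e c) (σ-den e c)

-- Partitions avoiding patterns

module Count where
  open import Data.Empty using (⊥; ⊥-elim)
  open import Data.List.Base using (List; []; _∷_; _++_; map)
  open import Data.List.Membership.Propositional using (_∈_)
  open import Data.List.Membership.Propositional.Properties using (∈-++⁺ˡ; ∈-++⁺ʳ; ∈-++⁻; ∈-map⁺; ∈-map⁻)
  open import Data.List.Membership.Propositional.Properties.WithK using (unique∧set⇒bag)
  open import Data.List.Properties using (length-++; length-map; ∷-injectiveʳ)
  open import Data.List.Relation.Binary.BagAndSetEquality using (∼bag⇒↭)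
  open import Data.List.Relation.Binary.Permutation.Propositional.Properties using (↭-length)
  open import Data.List.Relation.Unary.All as All using (All; []; _∷_)
  open import Data.List.Relation.Unary.All.Properties using (++⁺; ++⁻ˡ; ++⁻ʳ)
  open import Data.List.Relation.Unary.Any using (here)
  open import Data.List.Relation.Unary.AllPairs using ([]; _∷_)
  open import Data.List.Relation.Unary.Unique.Propositional using (Unique)
  import Data.List.Relation.Unary.Unique.Propositional.Properties as Unique
  open import Data.Nat.ListAction using (sum)
  open import Data.Unit.Base using (⊤; tt)
  open ≡ using (refl)
  open import Relation.Nullary using (¬_; Dec; yes; no)
  open import Relation.Nullary.Decidable using (¬?)
  open import Relation.Unary using (Pred)
  open import Defs using (HasCount)
  open PS using (CompleteRing; module PowerSeries)

  open Equivalence using (to; from)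

  count-⇔ : ∀ {A B : Pred (List ℕ) 0ℓ} {k} → (∀ x → A x ⇔ B x) → HasCount A k → HasCount B k
  count-⇔ e (xs , u , m , l) = xs , u , (λ x → mk⇔ (λ i → to (e x) (to (m x) i)) (λ b → from (m x) (from (e x) b))) , l

  count-⊎ : ∀ {A B : Pred (List ℕ) 0ℓ} {k l} → (∀ {x} → A x → ¬ B x) → HasCount A k → HasCount B l → HasCount (λ x → A x ⊎ B x) (k ℕ.+ l)
  count-⊎ {A} {B} disjoint (xs , u , m , refl) (ys , u′ , m′ , refl) = xs ++ ys , Unique.++⁺ u u′ (λ { (i , j) → disjoint (to (m _) i) (to (m′ _) j) }) ,
    (λ x → mk⇔ (λ i → join x (∈-++⁻ xs i)) λ { (inj₁ a) → ∈-++⁺ˡ (from (m x) a) ; (inj₂ b) → ∈-++⁺ʳ xs (from (m′ x) b) }) , length-++ xs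
    where
    join : ∀ x → x ∈ xs ⊎ x ∈ ys → A x ⊎ B x
    join x (inj₁ i) = inj₁ (to (m x) i)
    join x (inj₂ j) = inj₂ (to (m′ x) j)

  count-∷ : ∀ {A : Pred (List ℕ) 0ℓ} {k} N → HasCount A k → HasCount (λ x → ∃ λ y → x ≡ N ∷ y × A y) k
  count-∷ N (xs , u , m , refl) = map (N ∷_) xs , Unique.map⁺ ∷-injectiveʳ u ,
    (λ x → mk⇔ (λ i → let (y , j , e) = ∈-map⁻ (N ∷_) i in y , e , to (m y) j) λ { (y , refl , a) → ∈-map⁺ (N ∷_) (from (m y) a) }) , length-map (N ∷_) xs

  count-∅ : ∀ {A : Pred (List ℕ) 0ℓ} → (∀ x → ¬ A x) → HasCount A 0
  count-∅ no-A = [] , [] , (λ x → mk⇔ (λ ()) (λ a → ⊥-elim (no-A x a))) , refl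

  count-singleton : ∀ {A : Pred (List ℕ) 0ℓ} x → A x → (∀ y → A y → y ≡ x) → HasCount A 1
  count-singleton x a only = x ∷ [] , [] ∷ [] , (λ y → mk⇔ (λ { (here refl) → a }) (λ b → here (only y b))) , refl

  count-unique : ∀ {A : Pred (List ℕ) 0ℓ} {k l} → HasCount A k → HasCount A l → k ≡ l
  count-unique (xs , u , m , refl) (ys , u′ , m′ , refl) = ↭-length (∼bag⇒↭ (unique∧set⇒bag u u′ (λ {x} → mk⇔ (λ i → from (m′ x) (to (m x) i)) (λ j → from (m x) (to (m′ x) j)))))

  -- A pattern lists the differences between consecutive parts: after a part y, the pattern
  -- d₁ ∷ d₂ ∷ … stands for the parts y + d₁, y + d₁ + d₂, ….
  Pattern : Set
  Pattern = List ℕ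

  Pre : ℕ → Pattern → List ℕ → Set
  Pre y [] xs = ⊤
  Pre y (d ∷ ds) [] = ⊥
  Pre y (d ∷ ds) (x ∷ xs) = x ≡ y ℕ.+ d × Pre x ds xs

  Table : Set
  Table = ℕ → List Pattern

  Above : ℕ → List ℕ → Set
  Above N [] = ⊤
  Above N (x ∷ xs) = N ≤ x × Above x xs

  OK : Table → List ℕ → Set
  OK P [] = ⊤
  OK P (x ∷ xs) = All (λ t → ¬ Pre x t xs) (P x) × OK P xs

  -- P x lists the patterns forbidden after a part x, and π those forbidden at the start, relative to N.
  record Language (P : Table) (N : ℕ) (π : List Pattern) (xs : List ℕ) : Set where
    constructor language
    field
      above : Above N xs
      ok : OK P xs
      avoids : All (λ p → ¬ Pre N p xs) π
  open Language public

  up take : List Pattern → List Pattern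
  up [] = []
  up ([] ∷ π) = [] ∷ up π
  up ((zero ∷ ds) ∷ π) = up π
  up ((suc d ∷ ds) ∷ π) = (d ∷ ds) ∷ up π
  take [] = []
  take ([] ∷ π) = [] ∷ take π
  take ((zero ∷ ds) ∷ π) = ds ∷ take π
  take ((suc d ∷ ds) ∷ π) = take π

  above-suc : ∀ {N xs} → Above (suc N) xs → Above N xs
  above-suc {xs = []} _ = tt
  above-suc {xs = x ∷ xs} (le , a) = ℕ.<⇒≤ le , a

  up⁺ : ∀ {N} π xs → All (λ p → ¬ Pre N p xs) π → All (λ p → ¬ Pre (suc N) p xs) (up π)
  up⁺ [] xs [] = []
  up⁺ ([] ∷ π) xs (a ∷ as) = (λ p → a tt) ∷ up⁺ π xs as
  up⁺ ((zero ∷ ds) ∷ π) xs (a ∷ as) = up⁺ π xs as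
  up⁺ ((suc d ∷ ds) ∷ π) [] (a ∷ as) = (λ ()) ∷ up⁺ π [] as
  up⁺ {N} ((suc d ∷ ds) ∷ π) (x ∷ xs) (a ∷ as) = (λ { (e , p) → a (≡.trans e (≡.sym (ℕ.+-suc N d)) , p) }) ∷ up⁺ π (x ∷ xs) as

  up⁻ : ∀ {N} π xs → Above (suc N) xs → All (λ p → ¬ Pre (suc N) p xs) (up π) → All (λ p → ¬ Pre N p xs) π
  up⁻ [] xs ab [] = []
  up⁻ ([] ∷ π) xs ab (a ∷ as) = (λ p → a tt) ∷ up⁻ π xs ab as
  up⁻ ((zero ∷ ds) ∷ π) [] ab as = (λ ()) ∷ up⁻ π [] ab as
  up⁻ {N} ((zero ∷ ds) ∷ π) (x ∷ xs) ab as = (λ { (e , _) → ℕ.<-irrefl (≡.sym (≡.trans e (ℕ.+-identityʳ N))) (proj₁ ab) }) ∷ up⁻ π (x ∷ xs) ab as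
  up⁻ ((suc d ∷ ds) ∷ π) [] ab (a ∷ as) = (λ ()) ∷ up⁻ π [] ab as
  up⁻ {N} ((suc d ∷ ds) ∷ π) (x ∷ xs) ab (a ∷ as) = (λ { (e , p) → a (≡.trans e (ℕ.+-suc N d) , p) }) ∷ up⁻ π (x ∷ xs) ab as

  take⁺ : ∀ {N} π xs → All (λ p → ¬ Pre N p (N ∷ xs)) π → All (λ p → ¬ Pre N p xs) (take π)
  take⁺ [] xs [] = []
  take⁺ ([] ∷ π) xs (a ∷ as) = a ∷ take⁺ π xs as
  take⁺ {N} ((zero ∷ ds) ∷ π) xs (a ∷ as) = (λ p → a (≡.sym (ℕ.+-identityʳ N) , p)) ∷ take⁺ π xs as
  take⁺ ((suc d ∷ ds) ∷ π) xs (a ∷ as) = take⁺ π xs as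

  take⁻ : ∀ {N} π xs → All (λ p → ¬ Pre N p xs) (take π) → All (λ p → ¬ Pre N p (N ∷ xs)) π
  take⁻ [] xs [] = []
  take⁻ ([] ∷ π) xs (a ∷ as) = a ∷ take⁻ π xs as
  take⁻ ((zero ∷ ds) ∷ π) xs (a ∷ as) = (λ { (_ , p) → a p }) ∷ take⁻ π xs as
  take⁻ {N} ((suc d ∷ ds) ∷ π) xs as = (λ { (e , _) → ℕ.m≢1+m+n N (≡.trans e (ℕ.+-suc N d)) }) ∷ take⁻ π xs as

  Split : Table → ℕ → List Pattern → Pred (List ℕ) 0ℓ
  Split P N π xs = Language P (suc N) (up π) xs ⊎ (∃ λ ys → xs ≡ N ∷ ys × Language P N (take π ++ P N) ys)

  split : ∀ P N π xs → Language P N π xs ⇔ Split P N π xs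
  split P N π xs = mk⇔ (forward xs) (backward xs)
    where
    forward : ∀ xs → Language P N π xs → Split P N π xs
    forward [] (language a o s) = inj₁ (language tt tt (up⁺ π [] s))
    forward (x ∷ xs) (language (le , a) (o , os) s) with ℕ.m≤n⇒m<n∨m≡n le
    ... | inj₁ lt = inj₁ (language (lt , a) (o , os) (up⁺ π (x ∷ xs) s))
    ... | inj₂ refl = inj₂ (xs , refl , language a os (++⁺ (take⁺ π xs s) o))
    backward : ∀ xs → Split P N π xs → Language P N π xs
    backward xs (inj₁ (language a o s)) = language (above-suc a) o (up⁻ π xs a s)
    backward .(N ∷ ys) (inj₂ (ys , refl , language a o s)) = language (ℕ.≤-refl , a) (++⁻ʳ (take π) s , o) (take⁻ π ys (++⁻ˡ (take π) s))

  Total : Table → ℕ → List Pattern → ℕ → Pred (List ℕ) 0ℓ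
  Total P N π n xs = sum xs ≡ n × Language P N π xs

  total-< : ∀ P N π n {k} → n < N → HasCount (Total P (suc N) (up π) n) k → HasCount (Total P N π n) k
  total-< P N π n n<N = count-⇔ λ xs → mk⇔ (λ { (e , l) → e , from (split P N π xs) (inj₁ l) }) (λ { (e , l) → e , first xs e (to (split P N π xs) l) })
    where
    first : ∀ xs → sum xs ≡ n → Split P N π xs → Language P (suc N) (up π) xs
    first xs e (inj₁ l) = l
    first .(N ∷ ys) e (inj₂ (ys , refl , l)) = ⊥-elim (ℕ.<-irrefl refl (ℕ.<-≤-trans n<N (ℕ.≤-trans (ℕ.m≤m+n N (sum ys)) (ℕ.≤-reflexive e))))

  total-≥ : ∀ P N π m {k l} → HasCount (Total P (suc N) (up π) (N ℕ.+ m)) k → HasCount (Total P N (take π ++ P N) m) l → HasCount (Total P N π (N ℕ.+ m)) (k ℕ.+ l)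
  total-≥ P N π m c d = count-⇔ (λ xs → mk⇔ (λ
      { (inj₁ (e , l)) → e , from (split P N π xs) (inj₁ l)
      ; (inj₂ (ys , refl , e , l)) → ≡.cong (N ℕ.+_) e , from (split P N π xs) (inj₂ (ys , refl , l)) })
      (λ { (e , l) → forward xs e (to (split P N π xs) l) }))
    (count-⊎ (λ {x} → disjoint x) c (count-∷ N d))
    where
    disjoint : ∀ x → Total P (suc N) (up π) (N ℕ.+ m) x → ¬ ∃ λ ys → x ≡ N ∷ ys × Total P N (take π ++ P N) m ys
    disjoint .(N ∷ ys) (e , language (le , _) _ _) (ys , refl , _) = ℕ.<-irrefl refl le
    forward : ∀ xs → sum xs ≡ N ℕ.+ m → Split P N π xs →
      Total P (suc N) (up π) (N ℕ.+ m) xs ⊎ (∃ λ ys → xs ≡ N ∷ ys × Total P N (take π ++ P N) m ys)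
    forward xs e (inj₁ l) = inj₁ (e , l)
    forward .(N ∷ ys) e (inj₂ (ys , refl , l)) = inj₂ (ys , refl , ℕ.+-cancelˡ-≡ N _ _ e , l)

  only-[] : ∀ P N π n → n < N → ∀ xs → Total P N π n xs → n ≡ 0 × xs ≡ []
  only-[] P N π n n<N [] (e , _) = ≡.sym e , refl
  only-[] P N π n n<N (x ∷ xs) (e , language (le , _) _ _) = ⊥-elim (ℕ.<-irrefl refl (ℕ.<-≤-trans n<N (ℕ.≤-trans le (ℕ.≤-trans (ℕ.m≤m+n x (sum xs)) (ℕ.≤-reflexive e)))))

  pre[]? : ∀ N p → Dec (Pre N p [])
  pre[]? N [] = yes tt
  pre[]? N (d ∷ ds) = no λ ()

  tally : ∀ P fuel N π n → n ℕ.+ n < fuel ℕ.+ suc N → ∃ (HasCount (Total P (suc N) π n))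
  tally-< : ∀ P N π n → n < suc N → ∃ (HasCount (Total P (suc N) π n))
  tally-< P N π (suc n) n<N = 0 , count-∅ λ xs t → ℕ.1+n≢0 (proj₁ (only-[] P (suc N) π (suc n) n<N xs t))
  tally-< P N π zero n<N with All.all? (λ p → ¬? (pre[]? (suc N) p)) π
  ... | yes a = 1 , count-singleton [] (refl , language tt tt a) (λ xs t → proj₂ (only-[] P (suc N) π 0 n<N xs t))
  ... | no ¬a = 0 , count-∅ λ xs t → none xs (proj₂ (only-[] P (suc N) π 0 n<N xs t)) t
    where
    none : ∀ xs → xs ≡ [] → ¬ Total P (suc N) π 0 xs
    none .[] refl (_ , l) = ¬a (avoids l)
  tally P zero N π n lt = tally-< P N π n (ℕ.≤-<-trans (ℕ.m≤m+n n n) lt)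
  tally P (suc fuel) N π n lt with n ℕ.<? suc N
  ... | yes n<N = tally-< P N π n n<N
  ... | no n≮N = let (k , c) = tally P fuel (suc N) (up π) n (ℕ.<-≤-trans lt (ℕ.≤-reflexive (≡.sym (ℕ.+-suc fuel (suc N)))))
                     (l , d) = tally P fuel N (take π ++ P (suc N)) (n ∸ suc N) smaller
                 in k ℕ.+ l , ≡.subst (λ n → HasCount (Total P (suc N) π n) (k ℕ.+ l)) n≡ (total-≥ P (suc N) π (n ∸ suc N) (≡.subst (λ n → HasCount (Total P (suc (suc N)) (up π) n) k) (≡.sym n≡) c) d)
    where
    n≡ : suc N ℕ.+ (n ∸ suc N) ≡ n
    n≡ = ℕ.m+[n∸m]≡n (ℕ.≮⇒≥ n≮N)
    smaller : n ∸ suc N ℕ.+ (n ∸ suc N) < fuel ℕ.+ suc N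
    smaller = ℕ.≤-<-trans (ℕ.+-monoʳ-≤ (n ∸ suc N) (ℕ.m∸n≤m n (suc N))) (ℕ.<-≤-trans (ℕ.+-cancelˡ-< (suc N) _ _ (ℕ.<-≤-trans (ℕ.≤-<-trans (ℕ.≤-reflexive (≡.trans (≡.sym (ℕ.+-assoc (suc N) (n ∸ suc N) n)) (≡.cong (ℕ._+ n) n≡))) lt) (ℕ.≤-reflexive (ℕ.+-comm (suc fuel) (suc N))))) (ℕ.≤-trans (ℕ.≤-reflexive (ℕ.+-comm 1 fuel)) (ℕ.+-monoʳ-≤ fuel (s≤s z≤n))))

  -- Shifted to level N + 1, since there are infinitely many lists at level 0.
  abstract
    count : Table → ℕ → List Pattern → ℕ → ℕ
    count P N π n = proj₁ (tally P (suc (n ℕ.+ n)) N π n (ℕ.m≤m+n _ _))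

    count-correct : ∀ P N π n → HasCount (Total P (suc N) π n) (count P N π n)
    count-correct P N π n = proj₂ (tally P (suc (n ℕ.+ n)) N π n (ℕ.m≤m+n _ _))

  record Generating (K : CompleteRing) : Set₁ where
    open Analysis K
    field
      gf : Table → ℕ → List Pattern → Carrier
      gf-step : ∀ P N π → gf P N π ≈ gf P (suc N) (up π) + q ^ suc N * gf P N (take π ++ P (suc N))
      gf-same : ∀ {P P′ N π π′} → (∀ xs → Language P (suc N) π xs ⇔ Language P′ (suc N) π′ xs) → gf P N π ≈ gf P′ N π′
      gf-dead : ∀ {P N π} → [] ∈ π → gf P N π ≈ 0#
      gf-near : ∀ {P N π} → All (λ p → ¬ p ≡ []) π → Ord (suc N) (gf P N π - 1#)

  module Integers where
    K : CompleteRing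
    K = PowerSeries.complete ℤ.+-*-commutativeRing

    open Analysis K hiding (refl)

    gf : Table → ℕ → List Pattern → Carrier
    gf P N π n = + count P N π n

    shift-zero : ∀ m f n → n < m → (q ^ m * f) n ≡ ℤ.0ℤ
    shift-zero m f n n<m = ord-* {m} {0} {q ^ m} {f} (ord-q^ m) (λ _ ()) n (ℕ.<-≤-trans n<m (ℕ.≤-reflexive (≡.sym (ℕ.+-identityʳ m))))

    shift-+ : ∀ m f n → (q ^ m * f) (m ℕ.+ n) ≡ f n
    shift-+ zero f n = *-identityˡ f n
    shift-+ (suc m) f n = ≡.trans (*-assoc q (q ^ m) f (suc m ℕ.+ n)) (≡.trans (PowerSeries.conv-X-suc ℤ.+-*-commutativeRing (q ^ m * f) (m ℕ.+ n)) (shift-+ m f n))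

    gf-step : ∀ P N π → gf P N π ≈ gf P (suc N) (up π) + q ^ suc N * gf P N (take π ++ P (suc N))
    gf-step P N π n with n ℕ.<? suc N
    ... | yes n<N = ≡.trans (≡.cong +_ (count-unique (count-correct P N π n) (total-< P (suc N) π n n<N (count-correct P (suc N) (up π) n))))
      (≡.trans (≡.sym (ℤ.+-identityʳ _)) (≡.cong (λ z → gf P (suc N) (up π) n ℤ.+ z) (≡.sym (shift-zero (suc N) (gf P N (take π ++ P (suc N))) n n<N))))
    ... | no n≮N = ≡.subst (λ n → gf P N π n ≡ gf P (suc N) (up π) n ℤ.+ (q ^ suc N * gf P N (take π ++ P (suc N))) n) (ℕ.m+[n∸m]≡n (ℕ.≮⇒≥ n≮N)) (step (n ∸ suc N))
      where
      step : ∀ m → gf P N π (suc N ℕ.+ m) ≡ gf P (suc N) (up π) (suc N ℕ.+ m) ℤ.+ (q ^ suc N * gf P N (take π ++ P (suc N))) (suc N ℕ.+ m)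
      step m = ≡.trans (≡.cong +_ (count-unique (count-correct P N π (suc N ℕ.+ m)) (total-≥ P (suc N) π m (count-correct P (suc N) (up π) (suc N ℕ.+ m)) (count-correct P N (take π ++ P (suc N)) m))))
        (≡.cong (λ z → gf P (suc N) (up π) (suc N ℕ.+ m) ℤ.+ z) (≡.sym (shift-+ (suc N) (gf P N (take π ++ P (suc N))) m)))

    gf-same : ∀ {P P′ N π π′} → (∀ xs → Language P (suc N) π xs ⇔ Language P′ (suc N) π′ xs) → gf P N π ≈ gf P′ N π′
    gf-same {P} {P′} {N} {π} {π′} e n = ≡.cong +_ (count-unique (count-correct P N π n) (count-⇔ (λ xs → mk⇔ (λ { (s , l) → s , from (e xs) l }) (λ { (s , l) → s , to (e xs) l })) (count-correct P′ N π′ n)))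

    gf-dead : ∀ {P N π} → [] ∈ π → gf P N π ≈ 0#
    gf-dead {P} {N} {π} i n = ≡.cong +_ (count-unique (count-correct P N π n) (count-∅ λ { xs (_ , l) → All.lookup (avoids l) i tt }))

    gf-near : ∀ {P N π} → All (λ p → ¬ p ≡ []) π → Ord (suc N) (gf P N π - 1#)
    gf-near {P} {N} {π} alive zero i<N = ≡.cong (λ k → + k ℤ.- ℤ.1ℤ) (count-unique (count-correct P N π 0)
      (count-singleton [] (refl , language tt tt (All.map (λ { {[]} e → ⊥-elim (e refl) ; {d ∷ ds} e () }) alive)) (λ xs t → proj₂ (only-[] P (suc N) π 0 i<N xs t))))
    gf-near {P} {N} {π} alive (suc i) i<N = ≡.cong (λ k → + k ℤ.+ ℤ.0ℤ) (count-unique (count-correct P N π (suc i))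
      (count-∅ λ xs t → ℕ.1+n≢0 (proj₁ (only-[] P (suc N) π (suc i) i<N xs t))))

    generating : Generating K
    generating = record { gf = gf ; gf-step = gf-step ; gf-same = λ {P} {P′} {N} {π} {π′} → gf-same {P} {P′} {N} {π} {π′} ; gf-dead = λ {P} {N} {π} → gf-dead {P} {N} {π} ; gf-near = λ {P} {N} {π} → gf-near {P} {N} {π} }

module Patterns where
  open import Data.Bool.Base using (Bool; if_then_else_)
  open import Data.List.Base using (List; []; _∷_; _++_)
  open Count using (Pattern; Table)

  p₁ p₂ p₃ p₄ p₅ p₆ p₇ p₈ p₉ p₁₀ p₁₁ : Pattern
  p₁ = 0 ∷ 0 ∷ []
  p₂ = 0 ∷ 1 ∷ []
  p₃ = 1 ∷ 0 ∷ []
  p₄ = 0 ∷ 0 ∷ 0 ∷ []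
  p₅ = 0 ∷ 0 ∷ 2 ∷ []
  p₆ = 0 ∷ 1 ∷ 1 ∷ []
  p₇ = 1 ∷ 1 ∷ 0 ∷ []
  p₈ = 1 ∷ 1 ∷ 1 ∷ []
  p₉ = 2 ∷ 0 ∷ 0 ∷ []
  p₁₀ = 0 ∷ 2 ∷ 0 ∷ 1 ∷ []
  p₁₁ = 1 ∷ 0 ∷ 2 ∷ 0 ∷ []

  close : List Pattern
  close = (0 ∷ 0 ∷ 0 ∷ []) ∷ (0 ∷ 0 ∷ 1 ∷ []) ∷ (0 ∷ 0 ∷ 2 ∷ []) ∷ (0 ∷ 1 ∷ 0 ∷ []) ∷ (0 ∷ 1 ∷ 1 ∷ []) ∷ (0 ∷ 2 ∷ 0 ∷ []) ∷
    (1 ∷ 0 ∷ 0 ∷ []) ∷ (1 ∷ 0 ∷ 1 ∷ []) ∷ (1 ∷ 1 ∷ 0 ∷ []) ∷ (2 ∷ 0 ∷ 0 ∷ []) ∷ []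

  families₅ families₆ families₇ families₈ families₈ₐ : List Pattern
  families₅ = p₁ ∷ p₂ ∷ close
  families₆ = p₁ ∷ p₃ ∷ close
  families₇ = p₂ ∷ p₃ ∷ p₄ ∷ p₅ ∷ p₉ ∷ []
  families₈ = p₁ ∷ p₂ ∷ p₇ ∷ p₈ ∷ p₁₁ ∷ []
  families₈ₐ = p₁ ∷ p₃ ∷ p₆ ∷ p₈ ∷ p₁₀ ∷ []

  table : (families extra₁ extra₂ : List Pattern) → Table
  table fam e₁ e₂ 0 = []
  table fam e₁ e₂ 1 = e₁ ++ fam
  table fam e₁ e₂ 2 = e₂ ++ fam
  table fam e₁ e₂ (suc (suc (suc y))) = fam

  -- The pattern [] forbids the part itself.
  admitting : (ℕ → Bool) → Table
  admitting χ y = if χ y then [] else [] ∷ []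

module Predicates where
  open import Data.Bool.Base using (Bool; true; false; T; if_then_else_)
  open import Data.Bool.ListAction using (any)
  open import Data.Empty using (⊥-elim)
  open import Data.List.Base using (List; []; _∷_; _++_)
  open import Data.List.Membership.Propositional using (_∈_)
  open import Data.List.Membership.Propositional.Properties using (∈-++⁺ˡ; ∈-++⁺ʳ)
  open import Data.List.Relation.Binary.Infix.Heterogeneous using (here; there)
  open import Data.List.Relation.Binary.Prefix.Heterogeneous using (Prefix; []; _∷_)
  open import Data.List.Relation.Unary.All as All using (All; []; _∷_)
  open import Data.List.Relation.Unary.All.Properties using (++⁺)
  open import Data.List.Relation.Unary.Any as Any using (Any; here; there)
  open import Data.List.Relation.Unary.Any.Properties using (any⁺; any⁻)
  open import Data.List.Relation.Unary.Linked using (Linked; []; [-]; _∷_)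
  open import Data.Nat.Base using (_+_; _*_; _%_; _≡ᵇ_)
  open import Data.Nat.DivMod using ([m+kn]%n≡m%n; [m+n]%n≡m%n)
  open import Data.Unit.Base using (tt)
  open ≡ using (refl)
  open import Relation.Nullary using (¬_; yes; no)
  open import Relation.Unary using (Pred; _∩_)
  open import Defs
  open Count
  open Patterns

  open Equivalence using (to; from)

  chain : ℕ → Pattern → List ℕ
  chain y [] = []
  chain y (d ∷ ds) = y + d ∷ chain (y + d) ds

  pre⇒prefix : ∀ y ds xs → Pre y ds xs → Prefix _≡_ (chain y ds) xs
  pre⇒prefix y [] xs _ = []
  pre⇒prefix y (d ∷ ds) (.(y + d) ∷ xs) (refl , p) = refl ∷ pre⇒prefix (y + d) ds xs p

  prefix⇒pre : ∀ y ds xs → Prefix _≡_ (chain y ds) xs → Pre y ds xs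
  prefix⇒pre y [] xs _ = tt
  prefix⇒pre y (d ∷ ds) (x ∷ xs) (refl ∷ p) = refl , prefix⇒pre (y + d) ds xs p

  After : Pattern → ℕ → List ℕ
  After t y = y ∷ chain y t

  ok⇒avoids : ∀ P {t y} xs → OK P xs → t ∈ P y → Avoids (After t y) xs
  ok⇒avoids P {t} {y} (x ∷ xs) (o , os) i (here (refl ∷ p)) = All.lookup o i (prefix⇒pre y t xs p)
  ok⇒avoids P (x ∷ xs) (o , os) i (there p) = ok⇒avoids P xs os i p
  ok⇒avoids P [] o i (here ())

  above-mono : ∀ {M N} xs → M ≤ N → Above N xs → Above M xs
  above-mono [] _ _ = tt
  above-mono (x ∷ xs) le (le′ , a) = ℕ.≤-trans le le′ , a

  infix-above : ∀ {N p} xs → p SubpartitionOf xs → Above N xs → Above N p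
  infix-above xs (here pre) a = prefix-above xs pre a
    where
    prefix-above : ∀ {N p} xs → Prefix _≡_ p xs → Above N xs → Above N p
    prefix-above xs [] a = tt
    prefix-above (x ∷ xs) (refl ∷ pre) (le , a) = le , prefix-above xs pre a
  infix-above (x ∷ xs) (there i) (le , a) = infix-above xs i (above-mono xs le a)

  increasing⇒above : ∀ {N} xs → All (N ≤_) xs → Linked _≤_ xs → Above N xs
  increasing⇒above [] _ _ = tt
  increasing⇒above (x ∷ xs) (le ∷ _) l = le , rest x xs l
    where
    rest : ∀ x xs → Linked _≤_ (x ∷ xs) → Above x xs
    rest x [] _ = tt
    rest x (y ∷ ys) (x≤y ∷ l) = x≤y , rest y ys l

  above⇒all : ∀ {N} xs → Above N xs → All (N ≤_) xs
  above⇒all [] _ = []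
  above⇒all (x ∷ xs) (le , a) = le ∷ above⇒all xs (above-mono xs le a)

  above⇒increasing : ∀ {N} xs → Above N xs → Linked _≤_ xs
  above⇒increasing [] _ = []
  above⇒increasing (x ∷ []) _ = [-]
  above⇒increasing (x ∷ y ∷ xs) (_ , x≤y , a) = x≤y ∷ above⇒increasing (y ∷ xs) (ℕ.≤-refl , a)

  total⇔partition : ∀ P (A : Pred (List ℕ) 0ℓ) → (∀ xs → Above 1 xs → OK P xs ⇔ A xs) → ∀ n xs → Total P 1 [] n xs ⇔ (IsPartition n ∩ A) xs
  total⇔partition P A e n xs = mk⇔
    (λ { (s , language a o _) → record { positive = above⇒all xs a ; increasing = above⇒increasing xs a ; total = s } , to (e xs a) o })
    (λ { (p , x) → let a = increasing⇒above xs (IsPartition.positive p) (IsPartition.increasing p) in IsPartition.total p , language a (from (e xs a) x) [] })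

  record Restricted (extra₁ extra₂ fam : List Pattern) (xs : List ℕ) : Set where
    constructor restricted
    field
      at-1 : All (λ t → Avoids (After t 1) xs) extra₁
      at-2 : All (λ t → Avoids (After t 2) xs) extra₂
      families : All (λ t → AvoidsFamily (After t) xs) fam

  restricted⇔ok : ∀ fam e₁ e₂ xs → OK (table fam e₁ e₂) xs ⇔ Restricted e₁ e₂ fam xs
  restricted⇔ok fam e₁ e₂ xs = mk⇔ forward (backward xs)
    where
    P : Table
    P = table fam e₁ e₂
    everywhere : ∀ {t} r → 1 ≤ r → t ∈ fam → t ∈ P r
    everywhere (suc zero) _ i = ∈-++⁺ʳ e₁ i
    everywhere (suc (suc zero)) _ i = ∈-++⁺ʳ e₂ i
    everywhere (suc (suc (suc r))) _ i = i
    forward : OK P xs → Restricted e₁ e₂ fam xs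
    forward o = restricted (All.tabulate (λ i → ok⇒avoids P {y = 1} xs o (∈-++⁺ˡ i))) (All.tabulate (λ i → ok⇒avoids P {y = 2} xs o (∈-++⁺ˡ i)))
      (All.tabulate (λ i r 1≤r → ok⇒avoids P xs o (everywhere r 1≤r i)))
    backward : ∀ xs → Restricted e₁ e₂ fam xs → OK P xs
    backward [] _ = tt
    backward (x ∷ xs) r@(restricted a b c) = row x r , backward xs (restricted (All.map (λ h i → h (there i)) a) (All.map (λ h i → h (there i)) b) (All.map (λ h r 1≤r i → h r 1≤r (there i)) c))
      where
      begins : ∀ x {t} → Avoids (After t x) (x ∷ xs) → ¬ Pre x t xs
      begins x {t} h p = h (here (refl ∷ pre⇒prefix x t xs p))
      row : ∀ x → Restricted e₁ e₂ fam (x ∷ xs) → All (λ t → ¬ Pre x t xs) (P x)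
      row 0 _ = []
      row 1 (restricted a b c) = ++⁺ (All.map (begins 1) a) (All.map (λ h → begins 1 (h 1 (s≤s z≤n))) c)
      row 2 (restricted a b c) = ++⁺ (All.map (begins 2) b) (All.map (λ h → begins 2 (h 2 (s≤s z≤n))) c)
      row (suc (suc (suc y))) (restricted a b c) = All.map (λ h → begins (3 + y) (h (3 + y) (s≤s z≤n))) c

  family⇔ : ∀ {t P xs} → (∀ r → After t r ≡ P r) → AvoidsFamily (After t) xs ⇔ AvoidsFamily P xs
  family⇔ {xs = xs} e = mk⇔ (λ h r 1≤r → ≡.subst (λ p → Avoids p xs) (e r) (h r 1≤r)) (λ h r 1≤r → ≡.subst (λ p → Avoids p xs) (≡.sym (e r)) (h r 1≤r))

  after₁ : ∀ r → After p₁ r ≡ P₁ r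
  after₁ r rewrite ℕ.+-identityʳ r | ℕ.+-identityʳ r = refl
  after₂ : ∀ r → After p₂ r ≡ P₂ r
  after₂ r rewrite ℕ.+-identityʳ r = refl
  after₃ : ∀ r → After p₃ r ≡ P₃ r
  after₃ r rewrite ℕ.+-identityʳ (r + 1) = refl
  after₄ : ∀ r → After p₄ r ≡ P₄ r
  after₄ r rewrite ℕ.+-identityʳ r | ℕ.+-identityʳ r | ℕ.+-identityʳ r = refl
  after₅ : ∀ r → After p₅ r ≡ P₅ r
  after₅ r rewrite ℕ.+-identityʳ r | ℕ.+-identityʳ r = refl
  after₆ : ∀ r → After p₆ r ≡ P₆ r
  after₆ r rewrite ℕ.+-identityʳ r | ℕ.+-assoc r 1 1 = refl
  after₇ : ∀ r → After p₇ r ≡ P₇ r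
  after₇ r rewrite ℕ.+-identityʳ (r + 1 + 1) | ℕ.+-assoc r 1 1 = refl
  after₈ : ∀ r → After p₈ r ≡ P₈ r
  after₈ r rewrite ℕ.+-assoc r 1 1 | ℕ.+-assoc r 2 1 = refl
  after₉ : ∀ r → After p₉ r ≡ P₉ r
  after₉ r rewrite ℕ.+-identityʳ (r + 2) | ℕ.+-identityʳ (r + 2) = refl
  after₁₀ : ∀ r → After p₁₀ r ≡ P₁₀ r
  after₁₀ r rewrite ℕ.+-identityʳ r | ℕ.+-identityʳ (r + 2) | ℕ.+-assoc r 2 1 = refl
  after₁₁ : ∀ r → After p₁₁ r ≡ P₁₁ r
  after₁₁ r rewrite ℕ.+-identityʳ (r + 1) | ℕ.+-assoc r 1 2 | ℕ.+-identityʳ (r + 3) = refl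

  data Narrow : Pattern → Set where
    narrow : ∀ {i j k} → i + (j + k) ≤ 2 → Narrow (i ∷ j ∷ k ∷ [])

  close-narrow : All Narrow close
  close-narrow = narrow (z≤n) ∷ narrow (s≤s z≤n) ∷ narrow (s≤s (s≤s z≤n)) ∷ narrow (s≤s z≤n) ∷ narrow (s≤s (s≤s z≤n)) ∷ narrow (s≤s (s≤s z≤n)) ∷ narrow (s≤s z≤n) ∷ narrow (s≤s (s≤s z≤n)) ∷ narrow (s≤s (s≤s z≤n)) ∷ narrow (s≤s (s≤s z≤n)) ∷ []

  close-complete : ∀ i j k → i + (j + (k + 0)) ≤ 2 → (i ∷ j ∷ k ∷ []) ∈ close
  close-complete 0 0 0 _ = here refl
  close-complete 0 0 1 _ = there (here refl)
  close-complete 0 0 2 _ = there (there (here refl))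
  close-complete 0 1 0 _ = there (there (there (here refl)))
  close-complete 0 1 1 _ = there (there (there (there (here refl))))
  close-complete 0 2 0 _ = there (there (there (there (there (here refl)))))
  close-complete 1 0 0 _ = there (there (there (there (there (there (here refl))))))
  close-complete 1 0 1 _ = there (there (there (there (there (there (there (here refl)))))))
  close-complete 1 1 0 _ = there (there (there (there (there (there (there (there (here refl))))))))
  close-complete 2 0 0 _ = there (there (there (there (there (there (there (there (there (here refl)))))))))
  close-complete 0 0 (suc (suc (suc k))) (s≤s (s≤s ()))
  close-complete 0 1 (suc (suc k)) (s≤s (s≤s ()))
  close-complete 0 2 (suc k) (s≤s (s≤s ()))
  close-complete 0 (suc (suc (suc j))) k (s≤s (s≤s ()))
  close-complete 1 0 (suc (suc k)) (s≤s (s≤s ()))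
  close-complete 1 1 (suc k) (s≤s (s≤s ()))
  close-complete 1 (suc (suc j)) k (s≤s (s≤s ()))
  close-complete 2 0 (suc k) (s≤s (s≤s ()))
  close-complete 2 (suc j) k (s≤s (s≤s ()))
  close-complete (suc (suc (suc i))) j k (s≤s (s≤s ()))

  sum-of-three : ∀ a i j → (a + (a + i) + (a + i + j)) % 3 ≡ (i + i + j) % 3
  sum-of-three a i j = ≡.trans (≡.cong (_% 3) (regroup a i j)) ([m+kn]%n≡m%n (i + i + j) a 3)
    where
    regroup : ∀ a i j → a + (a + i) + (a + i + j) ≡ i + i + j + a * 3
    regroup = ℕR.solve-∀

  -- If a ≤ b ≤ c ≤ a + 1, the gaps are (0, 0), (0, 1) or (1, 0); bad lists the forbidden ones.
  condition⇔ : ∀ r (bad : List Pattern) →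
    (∀ {t} → t ∈ bad → (t ≡ 0 ∷ 0 ∷ [] × ¬ 0 ≡ r % 3) ⊎ (t ≡ 0 ∷ 1 ∷ [] × ¬ 1 ≡ r % 3) ⊎ (t ≡ 1 ∷ 0 ∷ [] × ¬ 2 ≡ r % 3)) →
    ((0 ∷ 0 ∷ []) ∈ bad ⊎ 0 ≡ r % 3) → ((0 ∷ 1 ∷ []) ∈ bad ⊎ 1 ≡ r % 3) → ((1 ∷ 0 ∷ []) ∈ bad ⊎ 2 ≡ r % 3) →
    ∀ xs → Above 1 xs → All (λ t → AvoidsFamily (After t) xs) (bad ++ close) ⇔ Condition r xs
  condition⇔ r bad bad⇒ c₀₀ c₀₁ c₁₀ xs ab = mk⇔ (λ as → record { distance-three = three as ; distance-two = two as }) back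
    where
    Families : Set
    Families = All (λ t → AvoidsFamily (After t) xs) (bad ++ close)
    gap : ∀ {a b} → a ≤ b → b ≡ a + (b ∸ a)
    gap a≤b = ≡.sym (ℕ.m+[n∸m]≡n a≤b)
    near : ∀ a i j k → (a ∷ a + i ∷ a + i + j ∷ a + i + j + k ∷ []) SubpartitionOf xs → 1 ≤ a → Families → a + 3 ≤ a + i + j + k
    near a i j k sub 1≤a as with a + 3 ℕ.≤? a + i + j + k
    ... | yes le = le
    ... | no ≰ = ⊥-elim (All.lookup as (∈-++⁺ʳ bad (close-complete i j k (ℕ.≤-pred (ℕ.+-cancelˡ-< a _ _ (ℕ.≤-<-trans (ℕ.≤-reflexive (regroup a i j k)) (ℕ.≰⇒> ≰)))))) a 1≤a sub)
      where
      regroup : ∀ a i j k → a + (i + (j + (k + 0))) ≡ a + i + j + k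
      regroup = ℕR.solve-∀
    three : Families → ∀ a b c d → (a ∷ b ∷ c ∷ d ∷ []) SubpartitionOf xs → a + 3 ≤ d
    three as a b c d sub with infix-above xs sub ab
    ... | 1≤a , a≤b , b≤c , c≤d , _ = shifted (gap a≤b) (gap b≤c) (gap c≤d) sub
      where
      shifted : ∀ {b c d i j k} → b ≡ a + i → c ≡ b + j → d ≡ c + k → (a ∷ b ∷ c ∷ d ∷ []) SubpartitionOf xs → a + 3 ≤ d
      shifted {i = i} {j} {k} refl refl refl sub = near a i j k sub 1≤a as
    decide : ∀ a i j → (a ∷ a + i ∷ a + i + j ∷ []) SubpartitionOf xs → 1 ≤ a → Families → ((i ∷ j ∷ []) ∈ bad ⊎ (i + i + j) % 3 ≡ r % 3) → a + (a + i) + (a + i + j) ≡ r [mod 3 ]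
    decide a i j sub 1≤a as (inj₁ m) = ⊥-elim (All.lookup as (∈-++⁺ˡ m) a 1≤a sub)
    decide a i j sub 1≤a as (inj₂ e) = ≡.trans (sum-of-three a i j) e
    allowed : ∀ a i j → (a ∷ a + i ∷ a + i + j ∷ []) SubpartitionOf xs → 1 ≤ a → Families → i + j ≤ 1 → a + (a + i) + (a + i + j) ≡ r [mod 3 ]
    allowed a 0 0 sub 1≤a as _ = decide a 0 0 sub 1≤a as c₀₀
    allowed a 0 1 sub 1≤a as _ = decide a 0 1 sub 1≤a as c₀₁
    allowed a 1 0 sub 1≤a as _ = decide a 1 0 sub 1≤a as c₁₀
    allowed a 0 (suc (suc j)) sub 1≤a as (s≤s ())
    allowed a 1 (suc j) sub 1≤a as (s≤s ())
    allowed a (suc (suc i)) j sub 1≤a as (s≤s ())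
    two : Families → ∀ a b c → (a ∷ b ∷ c ∷ []) SubpartitionOf xs → c ≤ a + 1 → a + b + c ≡ r [mod 3 ]
    two as a b c sub with infix-above xs sub ab
    ... | 1≤a , a≤b , b≤c , _ = shifted (gap a≤b) (gap b≤c) sub
      where
      shifted : ∀ {b c i j} → b ≡ a + i → c ≡ b + j → (a ∷ b ∷ c ∷ []) SubpartitionOf xs → c ≤ a + 1 → a + b + c ≡ r [mod 3 ]
      shifted {i = i} {j} refl refl sub le = allowed a i j sub 1≤a as (ℕ.+-cancelˡ-≤ a _ _ (ℕ.≤-trans (ℕ.≤-reflexive (≡.sym (ℕ.+-assoc a i j))) le))
    back : Condition r xs → Families
    back cond = ++⁺ (All.tabulate λ i → avoid (bad⇒ i)) (All.tabulate λ i → far (All.lookup close-narrow i))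
      where
      open Condition cond
      tied : ∀ i j → i + j ≤ 1 → ¬ (i + i + j) % 3 ≡ r % 3 → AvoidsFamily (After (i ∷ j ∷ [])) xs
      tied i j le ≢r a 1≤a sub = ≢r (≡.trans (≡.sym (sum-of-three a i j)) (distance-two a (a + i) (a + i + j) sub (ℕ.≤-trans (ℕ.≤-reflexive (ℕ.+-assoc a i j)) (ℕ.+-monoʳ-≤ a le))))
      avoid : ∀ {t} → (t ≡ 0 ∷ 0 ∷ [] × ¬ 0 ≡ r % 3) ⊎ (t ≡ 0 ∷ 1 ∷ [] × ¬ 1 ≡ r % 3) ⊎ (t ≡ 1 ∷ 0 ∷ [] × ¬ 2 ≡ r % 3) → AvoidsFamily (After t) xs
      avoid (inj₁ (refl , ≢r)) = tied 0 0 z≤n ≢r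
      avoid (inj₂ (inj₁ (refl , ≢r))) = tied 0 1 ℕ.≤-refl ≢r
      avoid (inj₂ (inj₂ (refl , ≢r))) = tied 1 0 ℕ.≤-refl ≢r
      far : ∀ {t} → Narrow t → AvoidsFamily (After t) xs
      far (narrow {i} {j} {k} le) a 1≤a sub = ℕ.<⇒≱ (s≤s le) (ℕ.+-cancelˡ-≤ a _ _ (ℕ.≤-trans (distance-three a (a + i) (a + i + j) (a + i + j + k) sub) (ℕ.≤-reflexive (regroup a i j k))))
        where
        regroup : ∀ a i j k → a + i + j + k ≡ a + (i + (j + k))
        regroup = ℕR.solve-∀

  three-up⇔ : ∀ xs → Above 1 xs → (Avoids (1 ∷ []) xs × Avoids (2 ∷ []) xs) ⇔ All (3 ≤_) xs
  three-up⇔ xs ab = mk⇔ (λ { (h₁ , h₂) → forward xs (above⇒all xs ab) h₁ h₂ }) (λ as → small 1 (s≤s (s≤s z≤n)) as , small 2 (s≤s (s≤s (s≤s z≤n))) as)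
    where
    forward : ∀ xs → All (1 ≤_) xs → Avoids (1 ∷ []) xs → Avoids (2 ∷ []) xs → All (3 ≤_) xs
    forward [] _ _ _ = []
    forward (0 ∷ xs) (() ∷ _) h₁ h₂
    forward (1 ∷ xs) _ h₁ h₂ = ⊥-elim (h₁ (here (refl ∷ [])))
    forward (2 ∷ xs) _ h₁ h₂ = ⊥-elim (h₂ (here (refl ∷ [])))
    forward (suc (suc (suc x)) ∷ xs) (_ ∷ as) h₁ h₂ = s≤s (s≤s (s≤s z≤n)) ∷ forward xs as (λ i → h₁ (there i)) (λ i → h₂ (there i))
    small : ∀ y {xs} → y < 3 → All (3 ≤_) xs → Avoids (y ∷ []) xs
    small y lt (le ∷ _) (here (refl ∷ _)) = ℕ.<⇒≱ lt le
    small y lt (_ ∷ as) (there i) = small y lt as i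

  congruent : List ℕ → ℕ → Bool
  congruent residues y = any (λ r → y % 12 ≡ᵇ r % 12) residues

  residues⇔ : ∀ residues xs → OK (admitting (congruent residues)) xs ⇔ PartsCongruentMod12To residues xs
  residues⇔ residues xs = mk⇔ (forward xs) (backward xs)
    where
    forward : ∀ xs → OK (admitting (congruent residues)) xs → PartsCongruentMod12To residues xs
    forward [] _ = []
    forward (x ∷ xs) (o , os) = here-part (congruent residues x) refl o ∷ forward xs os
      where
      here-part : ∀ b → congruent residues x ≡ b → All (λ t → ¬ Pre x t xs) (if b then [] else [] ∷ []) → Any (λ r → x ≡ r [mod 12 ]) residues
      here-part true e _ = Any.map (λ {r} → ℕ.≡ᵇ⇒≡ (x % 12) (r % 12)) (any⁻ _ residues (≡.subst T (≡.sym e) tt))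
      here-part false e (a ∷ _) = ⊥-elim (a tt)
    backward : ∀ xs → PartsCongruentMod12To residues xs → OK (admitting (congruent residues)) xs
    backward [] _ = tt
    backward (x ∷ xs) (a ∷ as) = here-part (congruent residues x) refl , backward xs as
      where
      here-part : ∀ b → congruent residues x ≡ b → All (λ t → ¬ Pre x t xs) (if congruent residues x then [] else [] ∷ [])
      here-part true e = ≡.subst (λ b → All (λ t → ¬ Pre x t xs) (if b then [] else [] ∷ [])) (≡.sym e) []
      here-part false e = ⊥-elim (≡.subst T e (any⁺ _ (Any.map (λ {r} → ℕ.≡⇒≡ᵇ (x % 12) (r % 12)) a)))

  congruent-periodic : ∀ residues y → congruent residues (12 + y) ≡ congruent residues y
  congruent-periodic residues y = ≡.cong (λ z → any (λ r → z ≡ᵇ r % 12) residues) (≡.trans (≡.cong (_% 12) (ℕ.+-comm 12 y)) ([m+n]%n≡m%n y 12))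

  residues₅ₐ : List ℕ
  residues₅ₐ = 1 ∷ 2 ∷ 5 ∷ 6 ∷ 8 ∷ 9 ∷ 11 ∷ []
  residues₆ₐ : List ℕ
  residues₆ₐ = 1 ∷ 4 ∷ 5 ∷ 6 ∷ 7 ∷ 9 ∷ 10 ∷ []
  residues₇ : List ℕ
  residues₇ = 1 ∷ 3 ∷ 4 ∷ 6 ∷ 8 ∷ 9 ∷ 11 ∷ []
  residues₇ₐ : List ℕ
  residues₇ₐ = 3 ∷ 4 ∷ 5 ∷ 6 ∷ 7 ∷ 8 ∷ 9 ∷ []
  residues₈ : List ℕ
  residues₈ = 2 ∷ 3 ∷ 4 ∷ 5 ∷ 8 ∷ 9 ∷ 11 ∷ []
  residues₈ₐ : List ℕ
  residues₈ₐ = 1 ∷ 3 ∷ 4 ∷ 7 ∷ 8 ∷ 9 ∷ 10 ∷ []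

open Lam using (Functional)
open Count using (Table; Pattern; Generating)

-- Abstract, because the evaluations do not depend on the choice of the ring and of the functional.
abstract
  K : CompleteRing
  K = Count.Integers.K

  Φ : Functional K
  Φ = Lam.Construction.functional K

  generating : Generating K
  generating = Count.Integers.generating

module AK = Analysis K
module FK = Functional Φ
module JT = JacobiTriple K

abstract
  cancel-q : ∀ {x y} → AK.q AK.* x AK.≈ AK.q AK.* y → x AK.≈ y
  cancel-q {x} {y} e n = ≡.trans (≡.sym (PS.PowerSeries.conv-X-suc ℤ.+-*-commutativeRing x n)) (≡.trans (e (suc n)) (PS.PowerSeries.conv-X-suc ℤ.+-*-commutativeRing y n))

  counts-equal : ∀ P P′ π → Generating.gf generating P 0 π AK.≈ Generating.gf generating P′ 0 π → ∀ n → Count.count P 0 π n ≡ Count.count P′ 0 π n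
  counts-equal P P′ π e n = ℤ.+-injective (e n)

module Root3 where
  open import Data.Vec.Base using ([]; _∷_)
  open Solver
  open AK

  three : Carrier
  three = 1# + 1# + 1#

  -- K [√3], with (a , b) standing for a + b √3.
  complete : CompleteRing
  complete = record
    { ring = record
      { Carrier = Carrier × Carrier
      ; _≈_ = λ x y → proj₁ x ≈ proj₁ y × proj₂ x ≈ proj₂ y
      ; _+_ = λ x y → proj₁ x + proj₁ y , proj₂ x + proj₂ y
      ; _*_ = λ x y → proj₁ x * proj₁ y + three * (proj₂ x * proj₂ y) , proj₁ x * proj₂ y + proj₂ x * proj₁ y
      ; -_ = λ x → - proj₁ x , - proj₂ x
      ; 0# = 0# , 0#
      ; 1# = 1# , 0#
      ; isCommutativeRing = record
        { *-comm = λ (a , b) (c , d) → prove (a ∷ b ∷ c ∷ d ∷ three ∷ []) (v0 ⊗ v2 ⊕ v4 ⊗ (v1 ⊗ v3)) (v2 ⊗ v0 ⊕ v4 ⊗ (v3 ⊗ v1)) ≡.refl ,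
            prove (a ∷ b ∷ c ∷ d ∷ []) (v0 ⊗ v3 ⊕ v1 ⊗ v2) (v2 ⊗ v1 ⊕ v3 ⊗ v0) ≡.refl
        ; isRing = record
          { *-cong = λ (p , r) (p′ , r′) → +-cong (*-cong p p′) (*-congˡ (*-cong r r′)) , +-cong (*-cong p r′) (*-cong r p′)
          ; *-assoc = λ (a , b) (c , d) (e , f) →
              prove (a ∷ b ∷ c ∷ d ∷ e ∷ f ∷ three ∷ []) ((v0 ⊗ v2 ⊕ v6 ⊗ (v1 ⊗ v3)) ⊗ v4 ⊕ v6 ⊗ ((v0 ⊗ v3 ⊕ v1 ⊗ v2) ⊗ v5)) (v0 ⊗ (v2 ⊗ v4 ⊕ v6 ⊗ (v3 ⊗ v5)) ⊕ v6 ⊗ (v1 ⊗ (v2 ⊗ v5 ⊕ v3 ⊗ v4))) ≡.refl ,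
              prove (a ∷ b ∷ c ∷ d ∷ e ∷ f ∷ three ∷ []) ((v0 ⊗ v2 ⊕ v6 ⊗ (v1 ⊗ v3)) ⊗ v5 ⊕ (v0 ⊗ v3 ⊕ v1 ⊗ v2) ⊗ v4) (v0 ⊗ (v2 ⊗ v5 ⊕ v3 ⊗ v4) ⊕ v1 ⊗ (v2 ⊗ v4 ⊕ v6 ⊗ (v3 ⊗ v5))) ≡.refl
          ; *-identity = (λ (a , b) → prove (a ∷ b ∷ three ∷ []) (I ⊗ v0 ⊕ v2 ⊗ (ø ⊗ v1)) v0 ≡.refl , prove (a ∷ b ∷ []) (I ⊗ v1 ⊕ ø ⊗ v0) v1 ≡.refl) ,
              (λ (a , b) → prove (a ∷ b ∷ three ∷ []) (v0 ⊗ I ⊕ v2 ⊗ (v1 ⊗ ø)) v0 ≡.refl , prove (a ∷ b ∷ []) (v0 ⊗ ø ⊕ v1 ⊗ I) v1 ≡.refl)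
          ; distrib = (λ (a , b) (c , d) (e , f) →
              prove (a ∷ b ∷ c ∷ d ∷ e ∷ f ∷ three ∷ []) (v0 ⊗ (v2 ⊕ v4) ⊕ v6 ⊗ (v1 ⊗ (v3 ⊕ v5))) ((v0 ⊗ v2 ⊕ v6 ⊗ (v1 ⊗ v3)) ⊕ (v0 ⊗ v4 ⊕ v6 ⊗ (v1 ⊗ v5))) ≡.refl ,
              prove (a ∷ b ∷ c ∷ d ∷ e ∷ f ∷ []) (v0 ⊗ (v3 ⊕ v5) ⊕ v1 ⊗ (v2 ⊕ v4)) ((v0 ⊗ v3 ⊕ v1 ⊗ v2) ⊕ (v0 ⊗ v5 ⊕ v1 ⊗ v4)) ≡.refl) ,
              (λ (a , b) (c , d) (e , f) →
              prove (a ∷ b ∷ c ∷ d ∷ e ∷ f ∷ three ∷ []) ((v2 ⊕ v4) ⊗ v0 ⊕ v6 ⊗ ((v3 ⊕ v5) ⊗ v1)) ((v2 ⊗ v0 ⊕ v6 ⊗ (v3 ⊗ v1)) ⊕ (v4 ⊗ v0 ⊕ v6 ⊗ (v5 ⊗ v1))) ≡.refl ,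
              prove (a ∷ b ∷ c ∷ d ∷ e ∷ f ∷ []) ((v2 ⊕ v4) ⊗ v1 ⊕ (v3 ⊕ v5) ⊗ v0) ((v2 ⊗ v1 ⊕ v3 ⊗ v0) ⊕ (v4 ⊗ v1 ⊕ v5 ⊗ v0)) ≡.refl)
          ; +-isAbelianGroup = record
            { comm = λ _ _ → +-comm _ _ , +-comm _ _
            ; isGroup = record
              { ⁻¹-cong = λ (p , r) → -‿cong p , -‿cong r
              ; inverse = (λ _ → -‿inverseˡ _ , -‿inverseˡ _) , (λ _ → -‿inverseʳ _ , -‿inverseʳ _)
              ; isMonoid = record
                { identity = (λ _ → +-identityˡ _ , +-identityˡ _) , (λ _ → +-identityʳ _ , +-identityʳ _)
                ; isSemigroup = record
                  { assoc = λ _ _ _ → +-assoc _ _ _ , +-assoc _ _ _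
                  ; isMagma = record
                    { ∙-cong = λ (p , r) (p′ , r′) → +-cong p p′ , +-cong r r′
                    ; isEquivalence = record { refl = refl , refl ; sym = λ (p , r) → sym p , sym r ; trans = λ (p , r) (p′ , r′) → trans p p′ , trans r r′ } } } } } } } } }
    ; Ord = λ n x → Ord n (proj₁ x) × Ord n (proj₂ x)
    ; ord-cong = λ (p , r) (o , o′) → ord-cong p o , ord-cong r o′
    ; ord-0 = ord-0 , ord-0
    ; ord-+ = λ (o , o′) (r , r′) → ord-+ o r , ord-+ o′ r′
    ; ord-* = λ (o , o′) (r , r′) → ord-+ (ord-* o r) (ord-*ˡ three (ord-* o′ r′)) , ord-+ (ord-* o r′) (ord-* o′ r)
    ; ord-all = ord-all , ord-all
    ; ord-mono = λ le (o , o′) → ord-mono le o , ord-mono le o′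
    ; ord-sep = λ h → ord-sep (λ n → proj₁ (h n)) , ord-sep (λ n → proj₂ (h n))
    ; lim = λ f → lim (λ n → proj₁ (f n)) , lim (λ n → proj₂ (f n))
    ; lim-approx = λ h n → lim-approx (λ n → proj₁ (h n)) n , lim-approx (λ n → proj₂ (h n)) n
    ; q = q , 0#
    ; ord-q = ord-q , ord-0 }

  module L = Analysis complete

  ⟶-pair : ∀ {f g x y} → f ⟶ x → g ⟶ y → (λ n → f n , g n) L.⟶ (x , y)
  ⟶-pair p r n = p n , r n

  embed : Carrier → L.Carrier
  embed a = a , 0#

  embed-* : ∀ a b → embed (a * b) L.≈ embed a L.* embed b
  embed-* a b = prove (a ∷ b ∷ three ∷ []) (v0 ⊗ v1) (v0 ⊗ v1 ⊕ v2 ⊗ (ø ⊗ ø)) ≡.refl , prove (a ∷ b ∷ []) ø (v0 ⊗ ø ⊕ ø ⊗ v1) ≡.refl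

  embed-^ : ∀ n → embed (q ^ n) L.≈ L.q L.^ n
  embed-^ zero = L.refl
  embed-^ (suc n) = L.trans (embed-* q (q ^ n)) (L.*-congˡ (embed-^ n))

  embed-1-q^ : ∀ n → embed (1# - q ^ n) L.≈ L.1# L.- L.q L.^ n
  embed-1-q^ n = L.trans (refl , prove [] ø (ø ⊖ ø) ≡.refl) (L.+-congˡ (L.-‿cong (embed-^ n)))

  embed-∏ : ∀ {f} → Factors f → (∀ n → L.Ord n (embed (f n) L.- L.1#)) → embed (∏ f) L.≈ L.∏ (λ n → embed (f n))
  embed-∏ {f} s s′ = L.⟶-unique {f = λ n → embed (Π< f n)} (⟶-pair (∏-⟶ s) ⟶-const) (L.⟶-cong (λ n → L.sym (part n)) (L.∏-⟶ s′))
    where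
    part : ∀ n → embed (Π< f n) L.≈ L.Π< (λ n → embed (f n)) n
    part zero = L.refl
    part (suc n) = L.trans (embed-* (Π< f n) (f n)) (L.*-congʳ (part n))

  ∑-pair : ∀ {u v} → Summable u → Summable v → L.∑ (λ n → u n , v n) L.≈ (∑ u , ∑ v)
  ∑-pair {u} {v} s t = L.⟶-unique (L.∑-⟶ λ n → s n , t n) (L.⟶-cong (λ n → L.sym (part n)) (⟶-pair (∑-⟶ s) (∑-⟶ t)))
    where
    part : ∀ n → L.Σ< (λ n → u n , v n) n L.≈ (Σ< u n , Σ< v n)
    part zero = L.refl
    part (suc n) = L.+-congʳ (part n)

-- Recurrences from certificates

module Cert where
  open import Data.Fin.Base using (zero; suc)
  open import Data.List.Base using ([]; _∷_)
  open import Data.Vec.Base using (Vec; []; _∷_; lookup)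
  import Algebra.Properties.Semiring.Exp as Exp
  import Algebra.Properties.Semiring.Mult as Mult
  import Algebra.Properties.Ring as RingProperties
  import Relation.Binary.Reasoning.Setoid as SetoidReasoning
  open Solver
  open PS using (CompleteRing)

  subst : ∀ {m n} → Vec (Expr m) n → Expr n → Expr m
  subst τ (var i) = lookup τ i
  subst τ (con c) = con c
  subst τ (a ⊕ b) = subst τ a ⊕ subst τ b
  subst τ (a ⊗ b) = subst τ a ⊗ subst τ b
  subst τ (a ⊖ b) = subst τ a ⊖ subst τ b
  subst τ (⊝ a) = ⊝ subst τ a
  subst τ (a ⊛ k) = subst τ a ⊛ k

  module Hom (A B : CommutativeRing 0ℓ 0ℓ) (φ : CommutativeRing.Carrier A → CommutativeRing.Carrier B)
    (φ-cong : ∀ {x y} → CommutativeRing._≈_ A x y → CommutativeRing._≈_ B (φ x) (φ y))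
    (φ-+ : ∀ x y → CommutativeRing._≈_ B (φ (CommutativeRing._+_ A x y)) (CommutativeRing._+_ B (φ x) (φ y)))
    (φ-* : ∀ x y → CommutativeRing._≈_ B (φ (CommutativeRing._*_ A x y)) (CommutativeRing._*_ B (φ x) (φ y)))
    (φ-1 : CommutativeRing._≈_ B (φ (CommutativeRing.1# A)) (CommutativeRing.1# B)) where
    private
      module A = CommutativeRing A
      module B = CommutativeRing B
      module PA = Prove A
      module PB = Prove B
      open SetoidReasoning B.setoid
      open Exp A.semiring using () renaming (_^_ to _^ᴬ_)
      open Exp B.semiring using () renaming (_^_ to _^ᴮ_)
      open Mult A.semiring using () renaming (_×_ to _·ᴬ_)
      open Mult B.semiring using () renaming (_×_ to _·ᴮ_)

    φ-0 : φ A.0# B.≈ B.0#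
    φ-0 = begin
      φ A.0# ≈⟨ PB.prove (φ A.0# ∷ []) v0 (v0 ⊕ v0 ⊖ v0) ≡.refl ⟩
      φ A.0# B.+ φ A.0# B.- φ A.0# ≈⟨ B.+-congʳ (φ-+ A.0# A.0#) ⟨
      φ (A.0# A.+ A.0#) B.- φ A.0# ≈⟨ B.+-congʳ (φ-cong (A.+-identityˡ A.0#)) ⟩
      φ A.0# B.- φ A.0# ≈⟨ B.-‿inverseʳ _ ⟩
      B.0# ∎

    φ-neg : ∀ x → φ (A.- x) B.≈ B.- φ x
    φ-neg x = begin
      φ (A.- x) ≈⟨ PB.prove (φ (A.- x) ∷ φ x ∷ []) v0 ((v0 ⊕ v1) ⊖ v1) ≡.refl ⟩
      φ (A.- x) B.+ φ x B.- φ x ≈⟨ B.+-congʳ (B.trans (B.sym (φ-+ _ _)) (B.trans (φ-cong (A.-‿inverseˡ x)) φ-0)) ⟩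
      B.0# B.- φ x ≈⟨ B.+-identityˡ _ ⟩
      B.- φ x ∎

    φ-^ : ∀ x k → φ (x ^ᴬ k) B.≈ φ x ^ᴮ k
    φ-^ x zero = φ-1
    φ-^ x (suc k) = B.trans (φ-* _ _) (B.*-congˡ (φ-^ x k))

    φ-· : ∀ n → φ (n ·ᴬ A.1#) B.≈ n ·ᴮ B.1#
    φ-· zero = φ-0
    φ-· (suc n) = B.trans (φ-+ _ _) (B.+-cong φ-1 (φ-· n))

    φ-const : ∀ c → φ (PA.const c) B.≈ PB.const c
    φ-const (+ 0) = φ-0
    φ-const (+ 1) = φ-1
    φ-const (+ suc (suc n)) = φ-· (suc (suc n))
    φ-const -[1+ n ] = B.trans (φ-neg _) (B.-‿cong (φ-· (suc n)))

    eval : ∀ {m n} (τ : Vec (Expr m) n) ρ ρ′ → (∀ i → φ (lookup ρ i) B.≈ PB.⟦ lookup τ i ⟧ ρ′) → ∀ e → φ (PA.⟦ e ⟧ ρ) B.≈ PB.⟦ subst τ e ⟧ ρ′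
    eval τ ρ ρ′ h (var i) = h i
    eval τ ρ ρ′ h (con c) = φ-const c
    eval τ ρ ρ′ h (a ⊕ b) = B.trans (φ-+ _ _) (B.+-cong (eval τ ρ ρ′ h a) (eval τ ρ ρ′ h b))
    eval τ ρ ρ′ h (a ⊗ b) = B.trans (φ-* _ _) (B.*-cong (eval τ ρ ρ′ h a) (eval τ ρ ρ′ h b))
    eval τ ρ ρ′ h (a ⊖ b) = B.trans (φ-+ _ _) (B.+-cong (eval τ ρ ρ′ h a) (B.trans (φ-neg _) (B.-‿cong (eval τ ρ ρ′ h b))))
    eval τ ρ ρ′ h (⊝ a) = B.trans (φ-neg _) (B.-‿cong (eval τ ρ ρ′ h a))
    eval τ ρ ρ′ h (a ⊛ k) = B.trans (φ-^ _ k) (PB′.^-congˡ k (eval τ ρ ρ′ h a))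
      where module PB′ = Exp B.semiring

  module Certificates where
    open AK public
    open FK public
    module SP = Prove S
    module SE = Exp S.semiring
    module SR = SetoidReasoning S.setoid

    wk : Expr 2 → Expr 3
    wk = subst (v1 ∷ v2 ∷ [])

    shift : Expr 3 → Expr 3
    shift = subst (v1 ⊗ v0 ∷ v1 ∷ v2 ∷ [])

    -- In Expr 3 the variables are s, q, w; in Expr 2 they are q, w.
    module At (w : Carrier) where
      infix 9 _↓ _↓ˢ
      _↓ : Expr 2 → Carrier
      c ↓ = ⟦ c ⟧ (q ∷ w ∷ [])

      _↓ˢ : Expr 3 → S.Carrier
      p ↓ˢ = SP.⟦ p ⟧ (s ∷ ⟨ q ⟩ ∷ ⟨ w ⟩ ∷ [])

      embed : ∀ c → ⟨ c ↓ ⟩ S.≈ wk c ↓ˢ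
      embed = Hom.eval (CompleteRing.ring K) S ⟨_⟩ ⟨⟩-cong ⟨⟩-+ ⟨⟩-* ⟨⟩-1 _ _ _ λ { zero → S.refl ; (suc zero) → S.refl }

      σ-↓ : ∀ p → σ (p ↓ˢ) S.≈ shift p ↓ˢ
      σ-↓ = Hom.eval S S σ σ-cong σ-+ σ-* σ-1 _ _ _ λ { zero → σ-s ; (suc zero) → σ-⟨⟩ q ; (suc (suc zero)) → σ-⟨⟩ w }

      facs : ℕ → Expr 2 → ℕ → Expr 3
      facs e c zero = I
      facs e c (suc k) = facs e c k ⊗ (I ⊖ (wk c ⊗ v1 ⊛ (k ℕ.* suc e)) ⊗ v0 ⊛ suc e)

      step : ∀ e c k → ⟨ c ↓ * q ^ (k ℕ.* suc e) ⟩ S.≈ (wk c ⊗ v1 ⊛ (k ℕ.* suc e)) ↓ˢ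
      step e c k = embed (c ⊗ v0 ⊛ (k ℕ.* suc e))

      next : ∀ e c k → c ↓ * q ^ (k ℕ.* suc e) * q ^ suc e ≈ c ↓ * q ^ (suc k ℕ.* suc e)
      next e c k = trans (*-assoc _ _ _) (*-congˡ (trans (*-comm _ _) (sym (^-homo-* q (suc e) (k ℕ.* suc e)))))

      num-steps : ∀ e c k → num (suc e) (c ↓) S.≈ facs e c k ↓ˢ S.* num (suc e) (c ↓ * q ^ (k ℕ.* suc e))
      num-steps e c zero = S.trans (num-cong (sym (*-identityʳ _))) (S.sym (S.*-identityˡ _))
      num-steps e c (suc k) = S.trans (num-steps e c k) (S.trans (S.*-congˡ (S.trans (num-rec e _)
        (S.*-cong (S.+-congˡ (S.-‿cong (S.*-congʳ (step e c k)))) (num-cong (next e c k))))) (S.sym (S.*-assoc _ _ _)))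

      den-steps : ∀ e c k → facs e c k ↓ˢ S.* den (suc e) (c ↓) S.≈ den (suc e) (c ↓ * q ^ (k ℕ.* suc e))
      den-steps e c zero = S.trans (S.*-identityˡ _) (den-cong (sym (*-identityʳ _)))
      den-steps e c (suc k) = S.trans (SP.prove (facs e c k ↓ˢ ∷ x ∷ den (suc e) (c ↓) ∷ []) ((v0 ⊗ v1) ⊗ v2) (v1 ⊗ (v0 ⊗ v2)) ≡.refl)
        (S.trans (S.*-cong (S.+-congˡ (S.-‿cong (S.*-congʳ (S.sym (step e c k))))) (den-steps e c k)) (S.trans (den-rec e _) (den-cong (next e c k))))
        where x = (I ⊖ (wk c ⊗ v1 ⊛ (k ℕ.* suc e)) ⊗ v0 ⊛ suc e) ↓ˢ

      -- A record, so that the polynomial p can be inferred from a proof.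
      infix 4 _∼_∙_
      record _∼_∙_ (x : S.Carrier) (p : Expr 3) (u : S.Carrier) : Set where
        constructor rel
        field holds : x S.≈ p ↓ˢ S.* u
      open _∼_∙_ public

      infixl 6 _⊠_
      _⊠_ : ∀ {x y p p′ u v} → x ∼ p ∙ u → y ∼ p′ ∙ v → x S.* y ∼ p ⊗ p′ ∙ u S.* v
      _⊠_ {p = p} {p′} {u} {v} (rel e) (rel e′) = rel (S.trans (S.*-cong e e′)
        (SP.prove (p ↓ˢ ∷ u ∷ p′ ↓ˢ ∷ v ∷ []) ((v0 ⊗ v1) ⊗ (v2 ⊗ v3)) ((v0 ⊗ v2) ⊗ (v1 ⊗ v3)) ≡.refl))

      same : ∀ {x} → x ∼ I ∙ x
      same = rel (S.sym (S.*-identityˡ _))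

      -- num (e+1) c as a polynomial times num (e+1) d, where d = c q^(k(e+1)).
      numᵏ : ∀ e k c d → norm (c ⊗ v0 ⊛ (k ℕ.* suc e) ⊖ d) ≡ [] → num (suc e) (c ↓) ∼ facs e c k ∙ num (suc e) (d ↓)
      numᵏ e k c d eq = rel (S.trans (num-steps e c k) (S.*-congˡ (num-cong (prove (q ∷ w ∷ []) (c ⊗ v0 ⊛ (k ℕ.* suc e)) d eq))))

      denᵏ : ∀ e k c d → norm (c ⊗ v0 ⊛ (k ℕ.* suc e) ⊖ d) ≡ [] → den (suc e) (d ↓) ∼ facs e c k ∙ den (suc e) (c ↓)
      denᵏ e k c d eq = rel (S.sym (S.trans (den-steps e c k) (den-cong (prove (q ∷ w ∷ []) (c ⊗ v0 ⊛ (k ℕ.* suc e)) d eq))))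

      σ-numᵏ : ∀ e c d → norm (c ⊗ v0 ⊛ suc e ⊖ d) ≡ [] → σ (num (suc e) (c ↓)) ∼ I ∙ num (suc e) (d ↓)
      σ-numᵏ e c d eq = rel (S.trans (σ-num e _) (S.trans (num-cong (prove (q ∷ w ∷ []) (c ⊗ v0 ⊛ suc e) d eq)) (S.sym (S.*-identityˡ _))))

      σ-denᵏ : ∀ e c → σ (den (suc e) (c ↓)) ∼ facs e c 1 ∙ den (suc e) (c ↓)
      σ-denᵏ e c = rel (S.trans (σ-den e _) (S.trans (den-cong (*-congˡ (^-congʳ q (≡.sym (ℕ.+-identityʳ (suc e)))))) (S.sym (den-steps e c 1))))

      σ-numʳ : ∀ e k c d → norm (c ⊗ v0 ⊛ suc e ⊗ v0 ⊛ (k ℕ.* suc e) ⊖ d) ≡ [] → σ (num (suc e) (c ↓)) ∼ facs e (c ⊗ v0 ⊛ suc e) k ∙ num (suc e) (d ↓)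
      σ-numʳ e k c d eq = rel (S.trans (σ-num e _) (holds (numᵏ e k (c ⊗ v0 ⊛ suc e) d eq)))

      σ-denʳ : ∀ e k c d → norm (c ⊗ v0 ⊛ (k ℕ.* suc e) ⊖ d ⊗ v0 ⊛ suc e) ≡ [] → σ (den (suc e) (d ↓)) ∼ facs e c k ∙ den (suc e) (c ↓)
      σ-denʳ e k c d eq = rel (S.trans (σ-den e _) (holds (denᵏ e k c (d ⊗ v0 ⊛ suc e) eq)))

      infixl 6 _σ⊠_
      _σ⊠_ : ∀ {x y p p′ u v} → σ x ∼ p ∙ u → σ y ∼ p′ ∙ v → σ (x S.* y) ∼ p ⊗ p′ ∙ u S.* v
      e σ⊠ e′ = rel (S.trans (σ-* _ _) (holds (e ⊠ e′)))

      poly : ∀ p {x p′ u} → x ∼ p′ ∙ u → p ↓ˢ S.* x ∼ p ⊗ p′ ∙ u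
      poly p (rel e) = rel (S.trans (S.*-congˡ e) (S.sym (S.*-assoc _ _ _)))

      infixr 5 _,_⊞_
      data Terms (u : S.Carrier) : Set where
        ⟪_,_⟫ : ∀ (c : Expr 2) {x p} → x ∼ p ∙ u → Terms u
        _,_⊞_ : ∀ (c : Expr 2) {x p} → x ∼ p ∙ u → Terms u → Terms u

      total : ∀ {u} → Terms u → Expr 3
      total (⟪_,_⟫ c {p = p} _) = wk c ⊗ p
      total (_,_⊞_ c {p = p} _ ts) = wk c ⊗ p ⊕ total ts

      value : ∀ {u} → Terms u → Carrier
      value (⟪_,_⟫ c {x} _) = c ↓ * Λ x
      value (_,_⊞_ c {x} _ ts) = c ↓ * Λ x + value ts

      Λ-term : ∀ {u} c {x p} → x ∼ p ∙ u → Λ ((wk c ⊗ p) ↓ˢ S.* u) ≈ c ↓ * Λ x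
      Λ-term {u} c {x} {p} (rel e) = trans (Λ-cong (S.trans (S.*-assoc _ _ _) (S.*-cong (S.sym (embed c)) (S.sym e)))) (Λ-⟨⟩ (c ↓) x)

      Λ-total : ∀ {u} (ts : Terms u) → Λ (total ts ↓ˢ S.* u) ≈ value ts
      Λ-total (⟪ c , e ⟫) = Λ-term c e
      Λ-total {u} (c , e ⊞ ts) = trans (Λ-cong (S.distribʳ u _ _)) (trans (Λ-+ _ _) (+-cong (Λ-term c e) (Λ-total ts)))

      certificate : ∀ {u C A B} (g : Expr 3) → C ∼ B ∙ u → σ C ∼ A ∙ u → ∀ {x p} → x ∼ p ∙ u → (ts : Terms u) →
        norm (p ⊕ v0 ⊗ g ⊗ B ⊖ (total ts ⊕ v1 ⊗ shift g ⊗ A)) ≡ [] → Λ x ≈ value ts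
      certificate {u} {C} {A} {B} g (rel eB) (rel eA) {x} {p} (rel e) ts eq = begin
        Λ x ≈⟨ prove (Λ x ∷ Λ (s S.* h) ∷ []) v0 (v0 ⊕ v1 ⊖ v1) ≡.refl ⟩
        Λ x + Λ (s S.* h) - Λ (s S.* h) ≈⟨ +-cong (sym (Λ-+ _ _)) (-‿cong (Λ-s h)) ⟩
        Λ (x S.+ s S.* h) - q * Λ (σ h) ≈⟨ +-congʳ (Λ-cong both) ⟩
        Λ (total ts ↓ˢ S.* u S.+ ⟨ q ⟩ S.* σ h) - q * Λ (σ h) ≈⟨ +-congʳ (trans (Λ-+ _ _) (+-cong (Λ-total ts) (Λ-⟨⟩ q (σ h)))) ⟩
        value ts + q * Λ (σ h) - q * Λ (σ h) ≈⟨ prove (value ts ∷ q * Λ (σ h) ∷ []) (v0 ⊕ v1 ⊖ v1) v0 ≡.refl ⟩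
        value ts ∎
        where
        h = g ↓ˢ S.* C
        both : x S.+ s S.* h S.≈ total ts ↓ˢ S.* u S.+ ⟨ q ⟩ S.* σ h
        both = SR.begin
          x S.+ s S.* h SR.≈⟨ S.+-cong e (S.*-congˡ (S.*-congˡ eB)) ⟩
          p ↓ˢ S.* u S.+ s S.* (g ↓ˢ S.* (B ↓ˢ S.* u))
            SR.≈⟨ SP.prove (p ↓ˢ ∷ s ∷ g ↓ˢ ∷ B ↓ˢ ∷ u ∷ []) (v0 ⊗ v4 ⊕ v1 ⊗ (v2 ⊗ (v3 ⊗ v4))) ((v0 ⊕ v1 ⊗ v2 ⊗ v3) ⊗ v4) ≡.refl ⟩
          (p ⊕ v0 ⊗ g ⊗ B) ↓ˢ S.* u SR.≈⟨ S.*-congʳ (SP.prove _ (p ⊕ v0 ⊗ g ⊗ B) (total ts ⊕ v1 ⊗ shift g ⊗ A) eq) ⟩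
          (total ts ⊕ v1 ⊗ shift g ⊗ A) ↓ˢ S.* u
            SR.≈⟨ SP.prove (total ts ↓ˢ ∷ ⟨ q ⟩ ∷ shift g ↓ˢ ∷ A ↓ˢ ∷ u ∷ []) ((v0 ⊕ v1 ⊗ v2 ⊗ v3) ⊗ v4) (v0 ⊗ v4 ⊕ v1 ⊗ (v2 ⊗ (v3 ⊗ v4))) ≡.refl ⟩
          total ts ↓ˢ S.* u S.+ ⟨ q ⟩ S.* (shift g ↓ˢ S.* (A ↓ˢ S.* u))
            SR.≈⟨ S.+-congˡ (S.*-congˡ (S.trans (σ-* (g ↓ˢ) C) (S.*-cong (σ-↓ g) eA))) ⟨
          total ts ↓ˢ S.* u S.+ ⟨ q ⟩ S.* σ h SR.∎

module Recurrences where
  open ≡ using (refl)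
  open Solver
  open Cert using (module Certificates)
  open Certificates public hiding (refl)
  open S using () renaming (_*_ to _✶_)

  AΦ : Carrier → S.Carrier
  AΦ w = num 1 (- q) ✶ num 2 (- w) ✶ den 2 q ✶ den 3 w

  A-rec : ∀ w → Λ (AΦ w) ≈ (1# + w * q ^ 3) * Λ (AΦ (w * q ^ 6))
  A-rec w = certificate (⊝ (v2 ⊗ (v1 ⊛ 2 ⊕ v0)))
    (numᵏ 0 1 (⊝ I) (⊝ v0) refl ⊠ numᵏ 1 1 (⊝ (v1 ⊗ v0 ⊛ 4)) (⊝ (v1 ⊗ v0 ⊛ 6)) refl ⊠ denᵏ 1 0 v0 v0 refl ⊠ denᵏ 2 0 v1 v1 refl)
    (σ-numᵏ 0 (⊝ I) (⊝ v0) refl σ⊠ σ-numᵏ 1 (⊝ (v1 ⊗ v0 ⊛ 4)) (⊝ (v1 ⊗ v0 ⊛ 6)) refl σ⊠ σ-denᵏ 1 v0 σ⊠ σ-denᵏ 2 v1)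
    (numᵏ 0 0 (⊝ v0) (⊝ v0) refl ⊠ numᵏ 1 3 (⊝ v1) (⊝ (v1 ⊗ v0 ⊛ 6)) refl ⊠ denᵏ 1 0 v0 v0 refl ⊠ denᵏ 2 0 v1 v1 refl)
    ⟪ I ⊕ v1 ⊗ v0 ⊛ 3 , numᵏ 0 0 (⊝ v0) (⊝ v0) refl ⊠ numᵏ 1 0 (⊝ (v1 ⊗ v0 ⊛ 6)) (⊝ (v1 ⊗ v0 ⊛ 6)) refl ⊠ denᵏ 1 0 v0 v0 refl ⊠ denᵏ 2 2 v1 (v1 ⊗ v0 ⊛ 6) refl ⟫
    refl
    where
    open At w

  -- (c s; q) inverse over (w s³; q³), times (-v s²; q²).
  B : Carrier → Carrier → Carrier → S.Carrier
  B c v w = den 1 c ✶ num 2 (- v) ✶ den 3 w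

  P₁-rec : ∀ w → Λ (B q (w * q) w) ≈ (1# - q) * Λ (B q (w * q ^ 3) (w * q ^ 3)) + q * (1# + w * q ^ 3) * Λ (B q (w * q ^ 6 * q) (w * q ^ 6))
  P₁-rec w = certificate (⊝ (v2 ⊗ v1 ⊛ 3) ⊖ (v1 ⊕ v1 ⊛ 3) ⊗ v2 ⊗ v0 ⊖ v2 ⊗ v0 ⊛ 2 ⊕ (v1 ⊛ 3 ⊖ v1 ⊛ 4) ⊗ v2 ⊛ 2 ⊗ v0 ⊛ 3)
    (denᵏ 0 0 v0 v0 refl ⊠ numᵏ 1 1 (⊝ (v1 ⊗ v0 ⊛ 5)) (⊝ (v1 ⊗ v0 ⊛ 7)) refl ⊠ denᵏ 2 0 v1 v1 refl)
    (σ-denᵏ 0 v0 σ⊠ σ-numᵏ 1 (⊝ (v1 ⊗ v0 ⊛ 5)) (⊝ (v1 ⊗ v0 ⊛ 7)) refl σ⊠ σ-denᵏ 2 v1)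
    (denᵏ 0 0 v0 v0 refl ⊠ numᵏ 1 3 (⊝ (v1 ⊗ v0)) (⊝ (v1 ⊗ v0 ⊛ 7)) refl ⊠ denᵏ 2 0 v1 v1 refl)
    (I ⊖ v0 , denᵏ 0 0 v0 v0 refl ⊠ numᵏ 1 2 (⊝ (v1 ⊗ v0 ⊛ 3)) (⊝ (v1 ⊗ v0 ⊛ 7)) refl ⊠ denᵏ 2 1 v1 (v1 ⊗ v0 ⊛ 3) refl
      ⊞ ⟪ v0 ⊗ (I ⊕ v1 ⊗ v0 ⊛ 3) , denᵏ 0 0 v0 v0 refl ⊠ numᵏ 1 0 (⊝ (v1 ⊗ v0 ⊛ 6 ⊗ v0)) (⊝ (v1 ⊗ v0 ⊛ 7)) refl ⊠ denᵏ 2 2 v1 (v1 ⊗ v0 ⊛ 6) refl ⟫)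
    refl
    where
    open At w

  Q₁-rec : ∀ w → Λ (B q w w) ≈ (1# - q) * Λ (B q (w * q ^ 3 * q) (w * q ^ 3)) + q * (1# + w * q ^ 2) * Λ (B q (w * q ^ 6) (w * q ^ 6))
  Q₁-rec w = certificate (⊝ (v2 ⊗ v1 ⊛ 2) ⊖ (I ⊕ v1 ⊛ 2) ⊗ v2 ⊗ v0 ⊖ v2 ⊗ v0 ⊛ 2)
    (denᵏ 0 0 v0 v0 refl ⊠ numᵏ 1 1 (⊝ (v1 ⊗ v0 ⊛ 4)) (⊝ (v1 ⊗ v0 ⊛ 6)) refl ⊠ denᵏ 2 0 v1 v1 refl)
    (σ-denᵏ 0 v0 σ⊠ σ-numᵏ 1 (⊝ (v1 ⊗ v0 ⊛ 4)) (⊝ (v1 ⊗ v0 ⊛ 6)) refl σ⊠ σ-denᵏ 2 v1)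
    (denᵏ 0 0 v0 v0 refl ⊠ numᵏ 1 3 (⊝ v1) (⊝ (v1 ⊗ v0 ⊛ 6)) refl ⊠ denᵏ 2 0 v1 v1 refl)
    (I ⊖ v0 , denᵏ 0 0 v0 v0 refl ⊠ numᵏ 1 1 (⊝ (v1 ⊗ v0 ⊛ 3 ⊗ v0)) (⊝ (v1 ⊗ v0 ⊛ 6)) refl ⊠ denᵏ 2 1 v1 (v1 ⊗ v0 ⊛ 3) refl
      ⊞ ⟪ v0 ⊗ (I ⊕ v1 ⊗ v0 ⊛ 2) , denᵏ 0 0 v0 v0 refl ⊠ numᵏ 1 0 (⊝ (v1 ⊗ v0 ⊛ 6)) (⊝ (v1 ⊗ v0 ⊛ 6)) refl ⊠ denᵏ 2 2 v1 (v1 ⊗ v0 ⊛ 6) refl ⟫)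
    refl
    where
    open At w

  R : Carrier → S.Carrier
  R w = (S.1# S.+ s) ✶ B q (w * q ^ 2) w

  R-rec : ∀ w → Λ (R w) ≈ (1# - q ^ 3) * Λ (B (q ^ 2) (w * q ^ 6) (w * q ^ 6)) + q * (1# + w * q ^ 4) * Λ (R (w * q ^ 6))
  R-rec w = certificate
    (⊝ (I ⊖ v1 ⊛ 2 ⊕ v1 ⊛ 4 ⊗ v2) ⊖ (v1 ⊛ 2 ⊕ v1 ⊛ 3 ⊕ v1 ⊛ 4) ⊗ v2 ⊗ v0 ⊖ (I ⊕ v1 ⊛ 2 ⊕ v1 ⊛ 3 ⊕ v1 ⊛ 4 ⊖ v1 ⊛ 6) ⊗ v2 ⊗ v0 ⊛ 2
      ⊕ (v1 ⊛ 4 ⊗ v2 ⊛ 2 ⊖ v1 ⊛ 6 ⊗ v2 ⊛ 2 ⊖ v1 ⊛ 2 ⊗ v2) ⊗ v0 ⊛ 3 ⊕ (v1 ⊛ 3 ⊖ v1 ⊛ 6) ⊗ v2 ⊛ 2 ⊗ (v0 ⊛ 4 ⊕ v0 ⊛ 5))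
    (denᵏ 0 0 v0 v0 refl ⊠ numᵏ 1 1 (⊝ (v1 ⊗ v0 ⊛ 6)) (⊝ (v1 ⊗ v0 ⊛ 8)) refl ⊠ denᵏ 2 0 v1 v1 refl)
    (σ-denᵏ 0 v0 σ⊠ σ-numᵏ 1 (⊝ (v1 ⊗ v0 ⊛ 6)) (⊝ (v1 ⊗ v0 ⊛ 8)) refl σ⊠ σ-denᵏ 2 v1)
    (poly (I ⊕ v0) (denᵏ 0 0 v0 v0 refl ⊠ numᵏ 1 3 (⊝ (v1 ⊗ v0 ⊛ 2)) (⊝ (v1 ⊗ v0 ⊛ 8)) refl ⊠ denᵏ 2 0 v1 v1 refl))
    (I ⊖ v0 ⊛ 3 , denᵏ 0 1 v0 (v0 ⊛ 2) refl ⊠ numᵏ 1 1 (⊝ (v1 ⊗ v0 ⊛ 6)) (⊝ (v1 ⊗ v0 ⊛ 8)) refl ⊠ denᵏ 2 2 v1 (v1 ⊗ v0 ⊛ 6) refl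
      ⊞ ⟪ v0 ⊗ (I ⊕ v1 ⊗ v0 ⊛ 4) , poly (I ⊕ v0) (denᵏ 0 0 v0 v0 refl ⊠ numᵏ 1 0 (⊝ (v1 ⊗ v0 ⊛ 6 ⊗ v0 ⊛ 2)) (⊝ (v1 ⊗ v0 ⊛ 8)) refl ⊠ denᵏ 2 2 v1 (v1 ⊗ v0 ⊛ 6) refl) ⟫)
    refl
    where
    open At w

  V-rec : ∀ w → Λ (B (q ^ 2) w w) ≈ (1# - q) * Λ (R w) + q ^ 3 * (1# + w) * Λ (B (q ^ 2) (w * q ^ 6) (w * q ^ 6))
  V-rec w = certificate (I ⊖ v1 ⊛ 2 ⊖ v1 ⊛ 2 ⊗ v2 ⊖ v2 ⊗ v0 ⊕ v1 ⊛ 2 ⊗ v2 ⊗ (v0 ⊛ 2 ⊕ v0 ⊛ 3))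
    (denᵏ 0 0 v0 v0 refl ⊠ numᵏ 1 1 (⊝ (v1 ⊗ v0 ⊛ 4)) (⊝ (v1 ⊗ v0 ⊛ 6)) refl ⊠ denᵏ 2 0 v1 v1 refl)
    (σ-denᵏ 0 v0 σ⊠ σ-numᵏ 1 (⊝ (v1 ⊗ v0 ⊛ 4)) (⊝ (v1 ⊗ v0 ⊛ 6)) refl σ⊠ σ-denᵏ 2 v1)
    (denᵏ 0 1 v0 (v0 ⊛ 2) refl ⊠ numᵏ 1 3 (⊝ v1) (⊝ (v1 ⊗ v0 ⊛ 6)) refl ⊠ denᵏ 2 0 v1 v1 refl)
    (I ⊖ v0 , poly (I ⊕ v0) (denᵏ 0 0 v0 v0 refl ⊠ numᵏ 1 2 (⊝ (v1 ⊗ v0 ⊛ 2)) (⊝ (v1 ⊗ v0 ⊛ 6)) refl ⊠ denᵏ 2 0 v1 v1 refl)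
      ⊞ ⟪ v0 ⊛ 3 ⊗ (I ⊕ v1) , denᵏ 0 1 v0 (v0 ⊛ 2) refl ⊠ numᵏ 1 0 (⊝ (v1 ⊗ v0 ⊛ 6)) (⊝ (v1 ⊗ v0 ⊛ 6)) refl ⊠ denᵏ 2 2 v1 (v1 ⊗ v0 ⊛ 6) refl ⟫)
    refl
    where
    open At w

  D : Carrier → Carrier → S.Carrier
  D v w = num 2 v ✶ den 3 w

  W⁻-rec : ∀ w → Λ (D (w * q ^ 2) (w * q ^ 3)) ≈ 1# * Λ (D (w * q ^ 4) (w * q ^ 3)) + - (w * q ^ 5) * Λ (D (w * q ^ 6 * q ^ 2) (w * q ^ 6 * q ^ 3))
  W⁻-rec w = certificate (v1 ⊛ 4 ⊗ v2 ⊕ v1 ⊛ 2 ⊗ v2 ⊗ v0 ⊖ (v1 ⊛ 6 ⊕ v1 ⊛ 7) ⊗ v2 ⊛ 2 ⊗ v0 ⊛ 3)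
    (numᵏ 1 1 (v1 ⊗ v0 ⊛ 6) (v1 ⊗ v0 ⊛ 8) refl ⊠ denᵏ 2 0 (v1 ⊗ v0 ⊛ 3) (v1 ⊗ v0 ⊛ 3) refl)
    (σ-numᵏ 1 (v1 ⊗ v0 ⊛ 6) (v1 ⊗ v0 ⊛ 8) refl σ⊠ σ-denᵏ 2 (v1 ⊗ v0 ⊛ 3))
    (numᵏ 1 3 (v1 ⊗ v0 ⊛ 2) (v1 ⊗ v0 ⊛ 8) refl ⊠ denᵏ 2 0 (v1 ⊗ v0 ⊛ 3) (v1 ⊗ v0 ⊛ 3) refl)
    (I , numᵏ 1 2 (v1 ⊗ v0 ⊛ 4) (v1 ⊗ v0 ⊛ 8) refl ⊠ denᵏ 2 0 (v1 ⊗ v0 ⊛ 3) (v1 ⊗ v0 ⊛ 3) refl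
      ⊞ ⟪ ⊝ (v1 ⊗ v0 ⊛ 5) , numᵏ 1 0 (v1 ⊗ v0 ⊛ 6 ⊗ v0 ⊛ 2) (v1 ⊗ v0 ⊛ 8) refl ⊠ denᵏ 2 2 (v1 ⊗ v0 ⊛ 3) (v1 ⊗ v0 ⊛ 6 ⊗ v0 ⊛ 3) refl ⟫)
    refl
    where
    open At w

  W⁺-rec : ∀ w → Λ (D (w * q ^ 4) (w * q ^ 3)) ≈ (1# - q) * Λ (D (w * q ^ 6 * q ^ 2) (w * q ^ 6 * q ^ 3)) + q * (1# - w * q ^ 6) * Λ (D (w * q ^ 6 * q ^ 4) (w * q ^ 6 * q ^ 3))
  W⁺-rec w = certificate (v1 ⊛ 6 ⊗ v2 ⊕ v1 ⊛ 4 ⊗ v2 ⊗ v0 ⊖ (v1 ⊛ 3 ⊕ v1 ⊛ 6) ⊗ v2 ⊗ v0 ⊛ 2 ⊖ (v1 ⊛ 9 ⊕ v1 ⊛ 10) ⊗ v2 ⊛ 2 ⊗ v0 ⊛ 3 ⊕ v1 ⊛ 9 ⊗ v2 ⊛ 2 ⊗ (v0 ⊛ 4 ⊕ v0 ⊛ 5))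
    (numᵏ 1 1 (v1 ⊗ v0 ⊛ 8) (v1 ⊗ v0 ⊛ 10) refl ⊠ denᵏ 2 0 (v1 ⊗ v0 ⊛ 3) (v1 ⊗ v0 ⊛ 3) refl)
    (σ-numᵏ 1 (v1 ⊗ v0 ⊛ 8) (v1 ⊗ v0 ⊛ 10) refl σ⊠ σ-denᵏ 2 (v1 ⊗ v0 ⊛ 3))
    (numᵏ 1 3 (v1 ⊗ v0 ⊛ 4) (v1 ⊗ v0 ⊛ 10) refl ⊠ denᵏ 2 0 (v1 ⊗ v0 ⊛ 3) (v1 ⊗ v0 ⊛ 3) refl)
    (I ⊖ v0 , numᵏ 1 1 (v1 ⊗ v0 ⊛ 6 ⊗ v0 ⊛ 2) (v1 ⊗ v0 ⊛ 10) refl ⊠ denᵏ 2 2 (v1 ⊗ v0 ⊛ 3) (v1 ⊗ v0 ⊛ 6 ⊗ v0 ⊛ 3) refl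
      ⊞ ⟪ v0 ⊗ (I ⊖ v1 ⊗ v0 ⊛ 6) , numᵏ 1 0 (v1 ⊗ v0 ⊛ 6 ⊗ v0 ⊛ 4) (v1 ⊗ v0 ⊛ 10) refl ⊠ denᵏ 2 2 (v1 ⊗ v0 ⊛ 3) (v1 ⊗ v0 ⊛ 6 ⊗ v0 ⊛ 3) refl ⟫)
    refl
    where
    open At w

  E-rec : ∀ w → Λ (den 1 w) ≈ (1# + w * q) * Λ (den 1 (w * q))
  E-rec w = certificate (⊝ v2) (denᵏ 0 0 v1 v1 refl) (σ-denᵏ 0 v1) (denᵏ 0 0 v1 v1 refl) ⟪ I ⊕ v1 ⊗ v0 , denᵏ 0 1 v1 (v1 ⊗ v0) refl ⟫ refl
    where
    open At w

  G : Carrier → S.Carrier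
  G w = num 1 (- w) ✶ num 2 (- (w * q ^ 2)) ✶ num 2 (q ^ 2) ✶ den 2 w ✶ den 2 (w * q) ✶ den 3 (q ^ 3)

  G-rec : ∀ w → Λ (G w) ≈ (1# + q) * (1# + w * q) * Λ (G (w * q ^ 2)) + - (q * (1# - w * q ^ 2 + w ^ 2 * q ^ 4)) * Λ (G (w * q ^ 4))
  G-rec w = certificate
    (⊝ ((I ⊕ v1 ⊕ v1 ⊛ 2) ⊗ v2 ⊖ v1 ⊛ 4 ⊗ v2 ⊛ 2)
      ⊖ ((I ⊕ v1 ⊕ v1 ⊛ 2) ⊗ v2 ⊕ (v1 ⊕ v1 ⊛ 2 ⊕ v1 ⊛ 3) ⊗ v2 ⊛ 2) ⊗ v0
      ⊖ ((v1 ⊛ 2 ⊕ v1 ⊛ 3 ⊕ v1 ⊛ 4) ⊗ v2 ⊛ 2 ⊕ (v1 ⊛ 3 ⊕ v1 ⊛ 4 ⊕ v1 ⊛ 5) ⊗ v2 ⊛ 3) ⊗ v0 ⊛ 2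
      ⊕ (v1 ⊗ v2 ⊛ 2 ⊖ (v1 ⊛ 3 ⊕ v1 ⊛ 4 ⊕ v1 ⊛ 5) ⊗ v2 ⊛ 3) ⊗ v0 ⊛ 3)
    (numᵏ 0 1 (⊝ (v1 ⊗ v0 ⊛ 3)) (⊝ (v1 ⊗ v0 ⊛ 4)) refl ⊠ numᵏ 1 1 (⊝ (v1 ⊗ v0 ⊛ 4)) (⊝ (v1 ⊗ v0 ⊛ 6)) refl ⊠ numᵏ 1 1 (v0 ⊛ 2) (v0 ⊛ 4) refl
      ⊠ denᵏ 1 0 v1 v1 refl ⊠ denᵏ 1 0 (v1 ⊗ v0) (v1 ⊗ v0) refl ⊠ denᵏ 2 0 (v0 ⊛ 3) (v0 ⊛ 3) refl)
    (σ-numᵏ 0 (⊝ (v1 ⊗ v0 ⊛ 3)) (⊝ (v1 ⊗ v0 ⊛ 4)) refl σ⊠ σ-numᵏ 1 (⊝ (v1 ⊗ v0 ⊛ 4)) (⊝ (v1 ⊗ v0 ⊛ 6)) refl σ⊠ σ-numᵏ 1 (v0 ⊛ 2) (v0 ⊛ 4) refl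
      σ⊠ σ-denᵏ 1 v1 σ⊠ σ-denᵏ 1 (v1 ⊗ v0) σ⊠ σ-denᵏ 2 (v0 ⊛ 3))
    (numᵏ 0 4 (⊝ v1) (⊝ (v1 ⊗ v0 ⊛ 4)) refl ⊠ numᵏ 1 2 (⊝ (v1 ⊗ v0 ⊛ 2)) (⊝ (v1 ⊗ v0 ⊛ 6)) refl ⊠ numᵏ 1 1 (v0 ⊛ 2) (v0 ⊛ 4) refl
      ⊠ denᵏ 1 0 v1 v1 refl ⊠ denᵏ 1 0 (v1 ⊗ v0) (v1 ⊗ v0) refl ⊠ denᵏ 2 0 (v0 ⊛ 3) (v0 ⊛ 3) refl)
    ((I ⊕ v0) ⊗ (I ⊕ v1 ⊗ v0) ,
      numᵏ 0 2 (⊝ (v1 ⊗ v0 ⊛ 2)) (⊝ (v1 ⊗ v0 ⊛ 4)) refl ⊠ numᵏ 1 1 (⊝ (v1 ⊗ v0 ⊛ 2 ⊗ v0 ⊛ 2)) (⊝ (v1 ⊗ v0 ⊛ 6)) refl ⊠ numᵏ 1 1 (v0 ⊛ 2) (v0 ⊛ 4) refl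
      ⊠ denᵏ 1 1 v1 (v1 ⊗ v0 ⊛ 2) refl ⊠ denᵏ 1 1 (v1 ⊗ v0) (v1 ⊗ v0 ⊛ 2 ⊗ v0) refl ⊠ denᵏ 2 0 (v0 ⊛ 3) (v0 ⊛ 3) refl
      ⊞ ⟪ ⊝ (v0 ⊗ (I ⊖ v1 ⊗ v0 ⊛ 2 ⊕ v1 ⊛ 2 ⊗ v0 ⊛ 4)) ,
      numᵏ 0 0 (⊝ (v1 ⊗ v0 ⊛ 4)) (⊝ (v1 ⊗ v0 ⊛ 4)) refl ⊠ numᵏ 1 0 (⊝ (v1 ⊗ v0 ⊛ 4 ⊗ v0 ⊛ 2)) (⊝ (v1 ⊗ v0 ⊛ 6)) refl ⊠ numᵏ 1 1 (v0 ⊛ 2) (v0 ⊛ 4) refl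
      ⊠ denᵏ 1 2 v1 (v1 ⊗ v0 ⊛ 4) refl ⊠ denᵏ 1 2 (v1 ⊗ v0) (v1 ⊗ v0 ⊛ 4 ⊗ v0) refl ⊠ denᵏ 2 0 (v0 ⊛ 3) (v0 ⊛ 3) refl ⟫)
    refl
    where
    open At w

module Cases where
  open import Data.Nat.GeneralisedArithmetic using (fold)
  open import Data.Fin.Base using (Fin; zero; suc)
  open import Data.List.Base using (List; []; _∷_)
  open import Data.Vec.Base using ([]; _∷_)
  open ≡ using (refl)
  open Solver
  open PS using (CompleteRing)
  open Lam using (triangle)

  -- term a c d j stands for the summand qᶜ⁺ᵀ⁽ᵃ⁾⁺ᵃⁿ F j (n + a + d) of a recurrence for F i n,
  -- and for qᶜ sᵃ σᵈ (Ψ j) in the corresponding equation between elements of S.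
  data Term (k : ℕ) : Set where
    term : (a c d : ℕ) (j : Fin k) → Term k

  module Systems where
    open Recurrences public

    σ^ : ℕ → S.Carrier → S.Carrier
    σ^ n f = fold f σ n

    sumR : ∀ {k} → (Fin k → ℕ → Carrier) → ℕ → List (Term k) → Carrier
    sumR F n [] = 0#
    sumR F n (term a c d j ∷ ts) = q ^ (c ℕ.+ triangle a ℕ.+ n ℕ.* a) * F j (suc n ℕ.+ (a ℕ.+ d ℕ.∸ 1)) + sumR F n ts

    Positive : ∀ {k} → List (Term k) → Set
    Positive [] = 0 ≡ 0
    Positive (term a c d j ∷ ts) = suc (a ℕ.+ d ℕ.∸ 1) ≡ a ℕ.+ d × Positive ts

    σ^-cong : ∀ n {f g} → f S.≈ g → σ^ n f S.≈ σ^ n g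
    σ^-cong zero e = e
    σ^-cong (suc n) e = σ-cong (σ^-cong n e)

    σ^-* : ∀ n f g → σ^ n (f S.* g) S.≈ σ^ n f S.* σ^ n g
    σ^-* zero f g = S.refl
    σ^-* (suc n) f g = S.trans (σ-cong (σ^-* n f g)) (σ-* _ _)

    σ^-+ : ∀ n f g → σ^ n (f S.+ g) S.≈ σ^ n f S.+ σ^ n g
    σ^-+ zero f g = S.refl
    σ^-+ (suc n) f g = S.trans (σ-cong (σ^-+ n f g)) (σ-+ _ _)

    σ^-⟨⟩ : ∀ n c → σ^ n ⟨ c ⟩ S.≈ ⟨ c ⟩
    σ^-⟨⟩ zero c = S.refl
    σ^-⟨⟩ (suc n) c = S.trans (σ-cong (σ^-⟨⟩ n c)) (σ-⟨⟩ c)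

    σ^-s : ∀ n → σ^ n s S.≈ ⟨ q ^ n ⟩ S.* s
    σ^-s zero = S.sym (S.trans (S.*-congʳ ⟨⟩-1) (S.*-identityˡ s))
    σ^-s (suc n) = S.trans (σ-cong (σ^-s n)) (S.trans (σ-* _ _) (S.trans (S.*-cong (σ-⟨⟩ _) σ-s)
      (S.trans (SP.prove (⟨ q ^ n ⟩ ∷ ⟨ q ⟩ ∷ s ∷ []) (v0 ⊗ (v1 ⊗ v2)) (v1 ⊗ v0 ⊗ v2) ≡.refl) (S.*-congʳ (S.sym (⟨⟩-* q (q ^ n)))))))

    σ^-σ^ : ∀ m n f → σ^ m (σ^ n f) S.≈ σ^ (m ℕ.+ n) f
    σ^-σ^ zero n f = S.refl
    σ^-σ^ (suc m) n f = σ-cong (σ^-σ^ m n f)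

    Λ-s^ : ∀ n a f → Λ (σ^ n (s SE.^ a S.* f)) ≈ q ^ (triangle a ℕ.+ n ℕ.* a) * Λ (σ^ (n ℕ.+ a) f)
    Λ-s^ n zero f = begin
      Λ (σ^ n (S.1# S.* f)) ≈⟨ Λ-cong (σ^-cong n (S.*-identityˡ f)) ⟩
      Λ (σ^ n f) ≈⟨ *-identityˡ _ ⟨
      1# * Λ (σ^ n f) ≡⟨ ≡.cong₂ (λ i j → q ^ i * Λ (σ^ j f)) (≡.sym (ℕ.*-zeroʳ n)) (≡.sym (ℕ.+-identityʳ n)) ⟩
      q ^ (n ℕ.* 0) * Λ (σ^ (n ℕ.+ 0) f) ∎
    Λ-s^ n (suc a) f = begin
      Λ (σ^ n (s S.* s SE.^ a S.* f)) ≈⟨ Λ-cong (S.trans (σ^-cong n (S.*-assoc _ _ _)) (S.trans (σ^-* n s _) (S.trans (S.*-congʳ (σ^-s n)) (S.*-assoc _ _ _)))) ⟩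
      Λ (⟨ q ^ n ⟩ S.* (s S.* σ^ n (s SE.^ a S.* f))) ≈⟨ trans (Λ-⟨⟩ _ _) (*-congˡ (Λ-s _)) ⟩
      q ^ n * (q * Λ (σ^ (suc n) (s SE.^ a S.* f))) ≈⟨ *-congˡ (*-congˡ (Λ-s^ (suc n) a f)) ⟩
      q ^ n * (q * (q ^ (triangle a ℕ.+ suc n ℕ.* a) * Λ (σ^ (suc n ℕ.+ a) f)))
        ≈⟨ prove (q ∷ q ^ n ∷ q ^ (triangle a ℕ.+ suc n ℕ.* a) ∷ Λ (σ^ (suc n ℕ.+ a) f) ∷ []) (v1 ⊗ (v0 ⊗ (v2 ⊗ v3))) (v0 ⊗ (v1 ⊗ v2) ⊗ v3) ≡.refl ⟩
      q * (q ^ n * q ^ (triangle a ℕ.+ suc n ℕ.* a)) * Λ (σ^ (suc n ℕ.+ a) f)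
        ≈⟨ *-cong (trans (*-congˡ (sym (^-homo-* q n _))) (reflexive (≡.cong (q ^_) exponent))) (reflexive (≡.cong (λ i → Λ (σ^ i f)) (≡.sym (ℕ.+-suc n a)))) ⟩
      q ^ (triangle (suc a) ℕ.+ n ℕ.* suc a) * Λ (σ^ (n ℕ.+ suc a) f) ∎
      where
      open import Data.Nat.Tactic.RingSolver using (solve-∀)
      lemma : ∀ n a t → suc (n ℕ.+ (t ℕ.+ (a ℕ.+ n ℕ.* a))) ≡ suc (a ℕ.+ t) ℕ.+ n ℕ.* suc a
      lemma = solve-∀
      exponent : suc (n ℕ.+ (triangle a ℕ.+ suc n ℕ.* a)) ≡ triangle (suc a) ℕ.+ n ℕ.* suc a
      exponent = lemma n a (triangle a)

    module _ {k} (Ψ : Fin k → S.Carrier) where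
      open At 1#

      data Parts (u : S.Carrier) : Set where
        end : Parts u
        part : ∀ (a c d : ℕ) (j : Fin k) {p} → σ^ d (Ψ j) ∼ p ∙ u → Parts u → Parts u

      terms′ : ∀ {u} → Parts u → List (Term k)
      terms′ end = []
      terms′ (part a c d j e ts) = term a c d j ∷ terms′ ts

      polys : ∀ {u} → Parts u → Expr 3
      polys end = ø
      polys (part a c d j {p} e ts) = v1 ⊛ c ⊗ v0 ⊛ a ⊗ p ⊕ polys ts

      candidate : ℕ → Fin k → Carrier
      candidate n j = Λ (σ^ n (Ψ j))

      Λ-parts : ∀ {u} n (ts : Parts u) → Positive (terms′ ts) → Λ (σ^ n (polys ts ↓ˢ S.* u)) ≈ sumR (λ j n → candidate n j) n (terms′ ts)
      Λ-parts {u} n end _ = trans (Λ-cong (S.trans (σ^-cong n (S.trans (S.zeroˡ u) (S.sym (S.zeroˡ S.1#)))) (S.trans (σ^-* n S.0# S.1#) (S.trans (S.*-congʳ (zeros n)) (S.trans (S.zeroˡ _) ⟨⟩-0)))))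
        (trans (Λ-⟨⟩ 0# S.1#) (zeroˡ _))
        where
        zeros : ∀ n → σ^ n S.0# S.≈ S.0#
        zeros zero = S.refl
        zeros (suc n) = S.trans (σ-cong (zeros n)) (Hom.φ-0 S S σ σ-cong σ-+ σ-* σ-1)
          where
          open Cert using (module Hom)
        ⟨⟩-0 : S.0# S.≈ ⟨ 0# ⟩ S.* S.1#
        ⟨⟩-0 = S.sym (S.trans (S.*-congʳ (Hom.φ-0 (CompleteRing.ring K) S ⟨_⟩ ⟨⟩-cong ⟨⟩-+ ⟨⟩-* ⟨⟩-1)) (S.zeroˡ _))
          where
          open Cert using (module Hom)
      Λ-parts {u} n (part a c d j {p} (rel e) ts) (pos , ps) =
        trans (Λ-cong (S.trans (σ^-cong n (S.distribʳ u _ _)) (σ^-+ n _ _))) (trans (Λ-+ _ _) (+-cong head (Λ-parts n ts ps)))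
        where
        head : Λ (σ^ n ((v1 ⊛ c ⊗ v0 ⊛ a ⊗ p) ↓ˢ S.* u)) ≈ q ^ (c ℕ.+ triangle a ℕ.+ n ℕ.* a) * Λ (σ^ (suc n ℕ.+ (a ℕ.+ d ℕ.∸ 1)) (Ψ j))
        head = begin
          Λ (σ^ n ((v1 ⊛ c ⊗ v0 ⊛ a ⊗ p) ↓ˢ S.* u))
            ≈⟨ Λ-cong (σ^-cong n (S.trans (SP.prove (⟨ q ⟩ SE.^ c ∷ s SE.^ a ∷ p ↓ˢ ∷ u ∷ []) (v0 ⊗ v1 ⊗ v2 ⊗ v3) (v0 ⊗ (v1 ⊗ (v2 ⊗ v3))) ≡.refl) (S.*-cong (S.sym (embed (v0 ⊛ c))) (S.*-congˡ (S.sym e))))) ⟩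
          Λ (σ^ n (⟨ q ^ c ⟩ S.* (s SE.^ a S.* σ^ d (Ψ j)))) ≈⟨ trans (Λ-cong (S.trans (σ^-* n _ _) (S.*-congʳ (σ^-⟨⟩ n _)))) (Λ-⟨⟩ _ _) ⟩
          q ^ c * Λ (σ^ n (s SE.^ a S.* σ^ d (Ψ j))) ≈⟨ *-congˡ (trans (Λ-s^ n a _) (*-congˡ (Λ-cong (σ^-σ^ (n ℕ.+ a) d (Ψ j))))) ⟩
          q ^ c * (q ^ (triangle a ℕ.+ n ℕ.* a) * Λ (σ^ (n ℕ.+ a ℕ.+ d) (Ψ j))) ≈⟨ sym (*-assoc _ _ _) ⟩
          q ^ c * q ^ (triangle a ℕ.+ n ℕ.* a) * Λ (σ^ (n ℕ.+ a ℕ.+ d) (Ψ j)) ≈⟨ *-cong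
            (trans (sym (^-homo-* q c _)) (reflexive (≡.cong (q ^_) (≡.sym (ℕ.+-assoc c (triangle a) (n ℕ.* a))))))
            (reflexive (≡.cong (λ i → Λ (σ^ i (Ψ j))) (≡.trans (ℕ.+-assoc n a d) (≡.trans (≡.cong (n ℕ.+_) (≡.sym pos)) (ℕ.+-suc n _))))) ⟩
          q ^ (c ℕ.+ triangle a ℕ.+ n ℕ.* a) * Λ (σ^ (suc n ℕ.+ (a ℕ.+ d ℕ.∸ 1)) (Ψ j)) ∎

      record Equation (i : Fin k) : Set where
        constructor equation
        field
          {u} : S.Carrier
          {p} : Expr 3
          lhs : Ψ i ∼ p ∙ u
          parts : Parts u
          check : norm (p ⊖ polys parts) ≡ []
          positive : Positive (terms′ parts)

      system-solution : (eqs : ∀ i → Equation i) → (∀ i → ct (Ψ i) ≈ 1#) → (F : Fin k → ℕ → Carrier) →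
        (∀ i n → F i n ≈ sumR F n (terms′ (Equation.parts (eqs i)))) → (∀ i n → Ord n (F i n - 1#)) → ∀ i n → F i n ≈ Λ (σ^ n (Ψ i))
      system-solution eqs ct1 F rec lim i n = separated λ m → go m m i n (ℕ.m≤m+n m n)
        where
        H : Fin k → ℕ → Carrier
        H j n = candidate n j
        recH : ∀ i n → H i n ≈ sumR H n (terms′ (Equation.parts (eqs i)))
        recH i n = trans (Λ-cong (σ^-cong n (S.trans (holds lhs) (S.*-congʳ (SP.prove _ p (polys parts) check))))) (Λ-parts n parts positive)
          where
          open Equation (eqs i)
        base : ∀ i n → Ord n (F i n - H i n)
        base i n = ord-cong (prove (F i n ∷ H i n ∷ 1# ∷ []) ((v0 ⊖ v2) ⊖ (v1 ⊖ v2)) (v0 ⊖ v1) ≡.refl)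
          (ord-- (lim i n) (ord-cong (+-congˡ (-‿cong (ct1 i))) (σ-limit n (Ψ i))))
        go : ∀ m b i n → m ≤ b ℕ.+ n → Ord m (F i n - H i n)
        go m zero i n m≤n = ord-mono m≤n (base i n)
        go m (suc b) i n m≤ = ord-cong (sym (+-cong (rec i n) (-‿cong (recH i n)))) (sums (terms′ (Equation.parts (eqs i))))
          where
          sums : ∀ ts → Ord m (sumR F n ts - sumR H n ts)
          sums [] = ord-cong (sym (-‿inverseʳ 0#)) ord-0
          sums (term a c d j ∷ ts) = ord-cong
            (prove (q ^ (c ℕ.+ triangle a ℕ.+ n ℕ.* a) ∷ F j n′ ∷ H j n′ ∷ sumR F n ts ∷ sumR H n ts ∷ []) (v0 ⊗ (v1 ⊖ v2) ⊕ (v3 ⊖ v4)) ((v0 ⊗ v1 ⊕ v3) ⊖ (v0 ⊗ v2 ⊕ v4)) ≡.refl)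
            (ord-+ (ord-*ˡ _ (go m b j n′ (ℕ.≤-trans m≤ (ℕ.≤-trans (ℕ.≤-reflexive (≡.sym (ℕ.+-suc b n))) (ℕ.+-monoʳ-≤ b (s≤s (ℕ.m≤m+n n _))))))) (sums ts))
            where n′ = suc n ℕ.+ (a ℕ.+ d ℕ.∸ 1)

module Links where
  open import Data.Fin.Base using (Fin)
  open import Data.Fin.Patterns using (0F; 1F; 2F; 3F)
  open import Data.List.Base using (List; []; _∷_)
  open import Data.Vec.Base using ([]; _∷_)
  open ≡ using (refl)
  open Solver
  open PS using (CompleteRing)
  open Cert using (subst; module Hom)
  open Cases

  -- Here n = N - 2 for the lower bound N on the parts.
  system₇ : Fin 3 → List (Term 3)
  system₇ 0F = term 0 0 1 0F ∷ term 1 1 0 1F ∷ term 2 1 0 2F ∷ term 3 0 0 0F ∷ []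
  system₇ 1F = term 0 0 1 2F ∷ term 1 1 0 1F ∷ []
  system₇ 2F = term 0 0 1 0F ∷ term 1 1 0 1F ∷ term 2 1 0 2F ∷ []

  system₈ : Fin 4 → List (Term 4)
  system₈ 0F = term 0 0 1 0F ∷ term 1 1 0 1F ∷ term 2 1 0 0F ∷ []
  system₈ 1F = term 0 0 1 0F ∷ term 1 1 0 2F ∷ term 2 1 0 3F ∷ []
  system₈ 2F = term 0 0 1 0F ∷ term 1 1 1 0F ∷ []
  system₈ 3F = term 0 0 1 0F ∷ term 1 1 0 1F ∷ []

  system₈ₐ : Fin 4 → List (Term 4)
  system₈ₐ 0F = term 0 0 1 0F ∷ term 1 1 0 1F ∷ term 2 1 0 3F ∷ term 3 1 0 0F ∷ []
  system₈ₐ 1F = term 0 0 1 0F ∷ term 1 1 0 2F ∷ []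
  system₈ₐ 2F = term 0 0 1 0F ∷ term 1 1 1 0F ∷ []
  system₈ₐ 3F = term 0 0 1 0F ∷ term 1 1 0 1F ∷ term 2 1 0 3F ∷ []

  system₅ : Fin 4 → List (Term 4)
  system₅ 0F = term 0 0 1 0F ∷ term 1 1 0 1F ∷ term 2 1 0 3F ∷ []
  system₅ 1F = term 0 0 1 0F ∷ term 1 1 0 2F ∷ term 2 1 0 3F ∷ []
  system₅ 2F = term 0 0 1 0F ∷ term 1 1 0 2F ∷ []
  system₅ 3F = term 0 0 1 0F ∷ term 1 1 0 1F ∷ []

  system₆ : Fin 2 → List (Term 2)
  system₆ 0F = term 0 0 1 0F ∷ term 1 1 0 1F ∷ term 2 1 0 1F ∷ term 3 1 0 0F ∷ []
  system₆ 1F = term 0 0 1 0F ∷ term 1 1 0 1F ∷ []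

  module Identification where
    open Systems public
    open S using () renaming (_*_ to _✶_)

    open At 1#

    Solves : ∀ {k} → (Fin k → List (Term k)) → (Fin k → ℕ → Carrier) → Set
    Solves sys F = (∀ i n → F i n ≈ sumR F n (sys i)) × (∀ i n → Ord n (F i n - 1#))

    σ-poly : ∀ p {x A u} → σ x ∼ A ∙ u → σ (p ↓ˢ ✶ x) ∼ shift p ⊗ A ∙ u
    σ-poly p (rel e) = rel (S.trans (σ-* _ _) (S.trans (S.*-cong (σ-↓ p) e) (S.sym (S.*-assoc _ _ _))))

    bare : ∀ p {u} → p ↓ˢ ✶ u ∼ p ∙ u
    bare p = rel S.refl

    ct-✶ : ∀ {x y} → ct x ≈ 1# → ct y ≈ 1# → ct (x ✶ y) ≈ 1#
    ct-✶ e e′ = trans (ct-* _ _) (trans (*-cong e e′) (*-identityˡ 1#))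

    ct-poly : ∀ p → norm (subst (ø ∷ v0 ∷ v1 ∷ []) p ⊖ I) ≡ [] → ct (p ↓ˢ) ≈ 1#
    ct-poly p eq = trans (Hom.eval S (CompleteRing.ring K) ct ct-cong ct-+ ct-* (trans (ct-cong (S.sym ⟨⟩-1)) (ct-⟨⟩ 1#)) (ø ∷ v0 ∷ v1 ∷ []) _ (q ∷ 1# ∷ [])
      (λ { 0F → ct-s ; 1F → ct-⟨⟩ q ; 2F → ct-⟨⟩ 1# }) p)
      (prove (q ∷ 1# ∷ []) (subst (ø ∷ v0 ∷ v1 ∷ []) p) I eq)

    num-ratio : ∀ c → num 2 (c * c) ✶ den 1 c S.≈ num 1 (- c)
    num-ratio c = SR.begin
      num 2 (c * c) ✶ den 1 c SR.≈⟨ S.*-congʳ (num-square 0 c) ⟨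
      num 1 c ✶ num 1 (- c) ✶ den 1 c SR.≈⟨ SP.prove (num 1 c ∷ num 1 (- c) ∷ den 1 c ∷ []) (v0 ⊗ v1 ⊗ v2) ((v0 ⊗ v2) ⊗ v1) refl ⟩
      num 1 c ✶ den 1 c ✶ num 1 (- c) SR.≈⟨ S.*-congʳ (num-den 0 c) ⟩
      S.1# ✶ num 1 (- c) SR.≈⟨ S.*-identityˡ _ ⟩
      num 1 (- c) SR.∎

    module Case₇ where
      C u : S.Carrier
      C = num 4 (q ^ 4) ✶ den 1 q ✶ den 2 q ✶ den 3 1#
      u = num 4 (q ^ 8) ✶ den 1 q ✶ den 2 q ✶ den 3 1#
      C-u = numᵏ 3 1 (v0 ⊛ 4) (v0 ⊛ 8) refl ⊠ denᵏ 0 0 v0 v0 refl ⊠ denᵏ 1 0 v0 v0 refl ⊠ denᵏ 2 0 I I refl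
      σC-u = σ-numᵏ 3 (v0 ⊛ 4) (v0 ⊛ 8) refl σ⊠ σ-denᵏ 0 v0 σ⊠ σ-denᵏ 1 v0 σ⊠ σ-denᵏ 2 I
      p₂ p₄ : Expr 3
      p₂ = (I ⊖ v1 ⊛ 3 ⊗ v0 ⊛ 3) ⊗ (I ⊖ v1 ⊗ v0 ⊛ 2) ⊗ (I ⊖ v0 ⊛ 3)
      p₄ = I ⊖ v0 ⊛ 3
      Ψ : Fin 3 → S.Carrier
      Ψ 0F = C
      Ψ 1F = p₂ ↓ˢ ✶ u
      Ψ 2F = p₄ ↓ˢ ✶ C

      equations : ∀ i → Equation Ψ i
      equations 0F = equation C-u (part 0 0 1 0F σC-u (part 1 1 0 1F (bare p₂) (part 2 1 0 2F (poly p₄ C-u) (part 3 0 0 0F C-u end)))) refl (refl , refl , refl , refl , refl)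
      equations 1F = equation (bare p₂) (part 0 0 1 2F (σ-poly p₄ σC-u) (part 1 1 0 1F (bare p₂) end)) refl (refl , refl , refl)
      equations 2F = equation (poly p₄ C-u) (part 0 0 1 0F σC-u (part 1 1 0 1F (bare p₂) (part 2 1 0 2F (poly p₄ C-u) end))) refl (refl , refl , refl , refl)

      ct-C : ct C ≈ 1#
      ct-C = ct-✶ (ct-✶ (ct-✶ (ct-num 4 _) (ct-den 1 _)) (ct-den 2 _)) (ct-den 3 _)

      solution : ∀ F → Solves system₇ F → ∀ i n → F i n ≈ Λ (σ^ n (Ψ i))
      solution F (rec , lim) = system-solution Ψ equations
        (λ { 0F → ct-C ; 1F → ct-✶ (ct-poly p₂ refl) (ct-✶ (ct-✶ (ct-✶ (ct-num 4 _) (ct-den 1 _)) (ct-den 2 _)) (ct-den 3 _)) ; 2F → ct-✶ (ct-poly p₄ refl) ct-C })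
        F (λ { 0F → rec 0F ; 1F → rec 1F ; 2F → rec 2F }) lim

      σC : S.Carrier
      σC = num 4 (q ^ 8) ✶ den 1 (q ^ 2) ✶ den 2 (q ^ 3) ✶ den 3 (q ^ 3)

      first : ∀ F → Solves system₇ F → F 2F 0 + q * F 1F 0 ≈ Λ (G 1#)
      first F sol = begin
        F 2F 0 + q * F 1F 0 ≈⟨ +-cong (solution F sol 2F 0) (*-congˡ (solution F sol 1F 0)) ⟩
        Λ (Ψ 2F) + q * Λ (Ψ 1F) ≈⟨ +-congʳ (*-identityˡ _) ⟨
        1# * Λ (Ψ 2F) + q * Λ (Ψ 1F) ≈⟨ certificate (⊝ I)
          (numᵏ 3 1 (v0 ⊛ 4) (v0 ⊛ 8) refl ⊠ denᵏ 0 0 I I refl ⊠ denᵏ 1 0 v0 v0 refl ⊠ denᵏ 2 1 I (v0 ⊛ 3) refl)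
          (σ-numᵏ 3 (v0 ⊛ 4) (v0 ⊛ 8) refl σ⊠ σ-denᵏ 0 I σ⊠ σ-denᵏ 1 v0 σ⊠ σ-denʳ 2 2 I (v0 ⊛ 3) refl)
          (numᵏ 3 1 (v0 ⊛ 4) (v0 ⊛ 8) refl ⊠ denᵏ 0 0 I I refl ⊠ denᵏ 1 0 v0 v0 refl ⊠ denᵏ 2 1 I (v0 ⊛ 3) refl)
          (I , poly p₄ (numᵏ 3 1 (v0 ⊛ 4) (v0 ⊛ 8) refl ⊠ denᵏ 0 1 I v0 refl ⊠ denᵏ 1 0 v0 v0 refl ⊠ denᵏ 2 0 I I refl)
            ⊞ ⟪ v0 , poly p₂ (numᵏ 3 0 (v0 ⊛ 8) (v0 ⊛ 8) refl ⊠ denᵏ 0 1 I v0 refl ⊠ denᵏ 1 0 v0 v0 refl ⊠ denᵏ 2 0 I I refl) ⟫)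
          refl ⟨
        Λ (num 4 (q ^ 4) ✶ den 1 1# ✶ den 2 q ✶ den 3 (q ^ 3)) ≈⟨ Λ-cong (S.sym G₁) ⟩
        Λ (G 1#) ∎
        where
        G₁ : G 1# S.≈ num 4 (q ^ 4) ✶ den 1 1# ✶ den 2 q ✶ den 3 (q ^ 3)
        G₁ = SR.begin
          G 1# SR.≈⟨ S.*-congʳ (S.*-congʳ (S.*-congʳ (S.*-congʳ (S.*-cong (S.sym (num-ratio 1#)) (num-cong (-‿cong (*-identityˡ _))))))) ⟩
          num 2 (1# * 1#) ✶ den 1 1# ✶ num 2 (- q ^ 2) ✶ num 2 (q ^ 2) ✶ den 2 1# ✶ den 2 (1# * q) ✶ den 3 (q ^ 3)
            SR.≈⟨ SP.prove (num 2 (1# * 1#) ∷ den 1 1# ∷ num 2 (- q ^ 2) ∷ num 2 (q ^ 2) ∷ den 2 1# ∷ den 2 (1# * q) ∷ den 3 (q ^ 3) ∷ [])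
                  (v0 ⊗ v1 ⊗ v2 ⊗ v3 ⊗ v4 ⊗ v5 ⊗ v6) ((v0 ⊗ v4) ⊗ ((v3 ⊗ v2) ⊗ v1 ⊗ v5 ⊗ v6)) refl ⟩
          (num 2 (1# * 1#) ✶ den 2 1#) ✶ (num 2 (q ^ 2) ✶ num 2 (- q ^ 2) ✶ den 1 1# ✶ den 2 (1# * q) ✶ den 3 (q ^ 3))
            SR.≈⟨ S.*-cong (S.trans (S.*-congʳ (num-cong (*-identityˡ 1#))) (num-den 1 1#))
                  (S.*-congʳ (S.*-cong (S.*-congʳ (S.trans (num-square 1 (q ^ 2)) (num-cong (sym (^-homo-* q 2 2))))) (den-cong (*-identityˡ q)))) ⟩
          S.1# ✶ (num 4 (q ^ 4) ✶ den 1 1# ✶ den 2 q ✶ den 3 (q ^ 3)) SR.≈⟨ S.*-identityˡ _ ⟩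
          num 4 (q ^ 4) ✶ den 1 1# ✶ den 2 q ✶ den 3 (q ^ 3) SR.∎

      σC-form : σ C S.≈ σC
      σC-form = S.trans (σ-* _ _) (S.*-cong (S.trans (σ-* _ _) (S.*-cong (S.trans (σ-* _ _) (S.*-cong
        (S.trans (σ-num 3 _) (num-cong (sym (^-homo-* q 4 4)))) (σ-den 0 q)))
        (σ-den 1 q))) (S.trans (σ-den 2 _) (den-cong (*-identityˡ _))))

      second : ∀ F → Solves system₇ F → F 0F 1 ≈ Λ (G (1# * q ^ 2))
      second F sol = trans (solution F sol 0F 1) (Λ-cong (S.trans σC-form (S.sym G₂)))
        where
        c = 1# * q ^ 2
        G₂ : G c S.≈ σC
        G₂ = SR.begin
          G c SR.≈⟨ S.*-congʳ (S.*-congʳ (S.*-congʳ (S.*-congʳ (S.*-congʳ (S.sym (num-ratio c)))))) ⟩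
          num 2 (c * c) ✶ den 1 c ✶ num 2 (- (c * q ^ 2)) ✶ num 2 (q ^ 2) ✶ den 2 c ✶ den 2 (c * q) ✶ den 3 (q ^ 3)
            SR.≈⟨ SP.prove (num 2 (c * c) ∷ den 1 c ∷ num 2 (- (c * q ^ 2)) ∷ num 2 (q ^ 2) ∷ den 2 c ∷ den 2 (c * q) ∷ den 3 (q ^ 3) ∷ [])
                  (v0 ⊗ v1 ⊗ v2 ⊗ v3 ⊗ v4 ⊗ v5 ⊗ v6) ((v3 ⊗ v4) ⊗ ((v0 ⊗ v2) ⊗ v1 ⊗ v5 ⊗ v6)) refl ⟩
          (num 2 (q ^ 2) ✶ den 2 c) ✶ (num 2 (c * c) ✶ num 2 (- (c * q ^ 2)) ✶ den 1 c ✶ den 2 (c * q) ✶ den 3 (q ^ 3))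
            SR.≈⟨ S.*-cong (S.trans (S.*-congʳ (num-cong (sym (*-identityˡ _)))) (num-den 1 c))
                  (S.*-congʳ (S.*-cong (S.*-cong (S.trans (S.*-congˡ (num-cong (-‿cong (*-congˡ (sym (*-identityˡ _)))))) (S.trans (num-square 1 (c * c)) (num-cong c⁴)))
                    (den-cong (*-identityˡ _))) (den-cong (trans (*-congʳ (*-identityˡ _)) (prove (q ∷ []) (v0 ⊛ 2 ⊗ v0) (v0 ⊛ 3) refl))))) ⟩
          S.1# ✶ σC SR.≈⟨ S.*-identityˡ _ ⟩
          σC SR.∎
          where
          c⁴ : c * c * (c * c) ≈ q ^ 8
          c⁴ = prove (q ∷ []) ((I ⊗ v0 ⊛ 2) ⊗ (I ⊗ v0 ⊛ 2) ⊗ ((I ⊗ v0 ⊛ 2) ⊗ (I ⊗ v0 ⊛ 2))) (v0 ⊛ 8) refl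

      A-form : AΦ 1# S.≈ (I ⊕ v0 ⊛ 2) ↓ˢ ✶ C
      A-form = SR.begin
        num 1 (- q) ✶ num 2 (- 1#) ✶ den 2 q ✶ den 3 1#
          SR.≈⟨ S.*-congʳ (S.*-congʳ (S.*-cong (S.sym (num-ratio q)) (S.trans (holds (numᵏ 1 1 (⊝ I) (⊝ (v0 ⊛ 2)) refl)) (S.*-congʳ (SP.prove (s ∷ ⟨ q ⟩ ∷ ⟨ 1# ⟩ ∷ []) (facs 1 (⊝ I) 1) (I ⊕ v0 ⊛ 2) refl))))) ⟩
        num 2 (q * q) ✶ den 1 q ✶ ((I ⊕ v0 ⊛ 2) ↓ˢ ✶ num 2 (- q ^ 2)) ✶ den 2 q ✶ den 3 1#
          SR.≈⟨ SP.prove (num 2 (q * q) ∷ den 1 q ∷ (I ⊕ v0 ⊛ 2) ↓ˢ ∷ num 2 (- q ^ 2) ∷ den 2 q ∷ den 3 1# ∷ [])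
                (v0 ⊗ v1 ⊗ (v2 ⊗ v3) ⊗ v4 ⊗ v5) (v2 ⊗ ((v0 ⊗ v3) ⊗ v1 ⊗ v4 ⊗ v5)) refl ⟩
        (I ⊕ v0 ⊛ 2) ↓ˢ ✶ (num 2 (q * q) ✶ num 2 (- q ^ 2) ✶ den 1 q ✶ den 2 q ✶ den 3 1#)
          SR.≈⟨ S.*-congˡ (S.*-congʳ (S.*-congʳ (S.*-congʳ (S.trans (S.*-congˡ (num-cong (-‿cong q²))) (S.trans (num-square 1 (q * q)) (num-cong (prove (q ∷ []) (v0 ⊗ v0 ⊗ (v0 ⊗ v0)) (v0 ⊛ 4) refl))))))) ⟩
        (I ⊕ v0 ⊛ 2) ↓ˢ ✶ C SR.∎
        where
        q² : q ^ 2 ≈ q * q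
        q² = prove (q ∷ []) (v0 ⊛ 2) (v0 ⊗ v0) refl

      difference : ∀ F → Solves system₇ F → F 2F 0 + q * F 1F 0 ≈ Λ (AΦ 1#) + q * F 0F 1
      difference F sol = begin
        F 2F 0 + q * F 1F 0 ≈⟨ +-cong (solution F sol 2F 0) (*-congˡ (solution F sol 1F 0)) ⟩
        x + q * y ≈⟨ prove (x ∷ q ∷ y ∷ z ∷ []) (v0 ⊕ v1 ⊗ v2) ((I ⊗ v0 ⊕ (v1 ⊗ v2 ⊕ (⊝ v1) ⊗ v3)) ⊕ v1 ⊗ v3) refl ⟩
        1# * x + (q * y + - q * z) + q * z ≈⟨ +-cong (sym (trans (Λ-cong A-form) (certificate (⊝ (v0 ⊕ v0 ⊛ 2)) C-u σC-u (poly (I ⊕ v0 ⊛ 2) C-u)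
          (I , poly p₄ C-u ⊞ (v0 , bare p₂ ⊞ ⟪ ⊝ v0 , σC-u ⟫)) refl))) (*-congˡ (sym (solution F sol 0F 1))) ⟩
        Λ (AΦ 1#) + q * F 0F 1 ∎
        where
        x = Λ (Ψ 2F)
        y = Λ (Ψ 1F)
        z = Λ (σ C)

    module Case₈ where
      C u : S.Carrier
      C = AΦ (q ^ 2)
      u = num 1 (- q ^ 2) ✶ num 2 (- q ^ 4) ✶ den 2 q ✶ den 3 (q ^ 2)
      C-u = numᵏ 0 1 (⊝ v0) (⊝ (v0 ⊛ 2)) refl ⊠ numᵏ 1 1 (⊝ (v0 ⊛ 2)) (⊝ (v0 ⊛ 4)) refl ⊠ denᵏ 1 0 v0 v0 refl ⊠ denᵏ 2 0 (v0 ⊛ 2) (v0 ⊛ 2) refl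
      σC-u = σ-numᵏ 0 (⊝ v0) (⊝ (v0 ⊛ 2)) refl σ⊠ σ-numᵏ 1 (⊝ (v0 ⊛ 2)) (⊝ (v0 ⊛ 4)) refl σ⊠ σ-denᵏ 1 v0 σ⊠ σ-denᵏ 2 (v0 ⊛ 2)
      A p₂ p₆ p₉ : Expr 3
      A = (I ⊖ v1 ⊗ v0 ⊛ 2) ⊗ (I ⊖ v1 ⊛ 2 ⊗ v0 ⊛ 3)
      p₂ = (I ⊕ v1 ⊗ v0 ⊕ v1 ⊛ 2 ⊗ v0 ⊛ 2) ⊗ A ⊕ v1 ⊗ v0 ⊛ 2 ⊗ (I ⊖ v1 ⊗ v0 ⊛ 2) ⊗ (I ⊕ v1 ⊗ v0) ⊗ (I ⊕ v1 ⊛ 2 ⊗ v0 ⊛ 2)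
      p₆ = (I ⊕ v1 ⊗ v0) ⊗ A
      p₉ = I ⊖ v1 ⊗ v0 ⊛ 2
      Ψ : Fin 4 → S.Carrier
      Ψ 0F = C
      Ψ 1F = p₂ ↓ˢ ✶ u
      Ψ 2F = p₆ ↓ˢ ✶ u
      Ψ 3F = p₉ ↓ˢ ✶ C

      equations : ∀ i → Equation Ψ i
      equations 0F = equation C-u (part 0 0 1 0F σC-u (part 1 1 0 1F (bare p₂) (part 2 1 0 0F C-u end))) refl (refl , refl , refl , refl)
      equations 1F = equation (bare p₂) (part 0 0 1 0F σC-u (part 1 1 0 2F (bare p₆) (part 2 1 0 3F (poly p₉ C-u) end))) refl (refl , refl , refl , refl)
      equations 2F = equation (bare p₆) (part 0 0 1 0F σC-u (part 1 1 1 0F σC-u end)) refl (refl , refl , refl)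
      equations 3F = equation (poly p₉ C-u) (part 0 0 1 0F σC-u (part 1 1 0 1F (bare p₂) end)) refl (refl , refl , refl)

      ct-C : ct C ≈ 1#
      ct-C = ct-✶ (ct-✶ (ct-✶ (ct-num 1 _) (ct-num 2 _)) (ct-den 2 _)) (ct-den 3 _)
      ct-u : ct u ≈ 1#
      ct-u = ct-✶ (ct-✶ (ct-✶ (ct-num 1 _) (ct-num 2 _)) (ct-den 2 _)) (ct-den 3 _)

      solution : ∀ F → Solves system₈ F → F 0F 0 ≈ Λ (AΦ (q ^ 2))
      solution F (rec , lim) = system-solution Ψ equations
        (λ { 0F → ct-C ; 1F → ct-✶ (ct-poly p₂ refl) ct-u ; 2F → ct-✶ (ct-poly p₆ refl) ct-u ; 3F → ct-✶ (ct-poly p₉ refl) ct-C })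
        F (λ { 0F → rec 0F ; 1F → rec 1F ; 2F → rec 2F ; 3F → rec 3F }) lim 0F 0

    module Case₈ₐ where
      C u : S.Carrier
      C = num 1 (- q) ✶ num 2 (- q ^ 2) ✶ den 2 q ✶ den 3 q
      u = num 1 (- q ^ 2) ✶ num 2 (- q ^ 4) ✶ den 2 q ✶ den 3 q
      C-u = numᵏ 0 1 (⊝ v0) (⊝ (v0 ⊛ 2)) refl ⊠ numᵏ 1 1 (⊝ (v0 ⊛ 2)) (⊝ (v0 ⊛ 4)) refl ⊠ denᵏ 1 0 v0 v0 refl ⊠ denᵏ 2 0 v0 v0 refl
      σC-u = σ-numᵏ 0 (⊝ v0) (⊝ (v0 ⊛ 2)) refl σ⊠ σ-numᵏ 1 (⊝ (v0 ⊛ 2)) (⊝ (v0 ⊛ 4)) refl σ⊠ σ-denᵏ 1 v0 σ⊠ σ-denᵏ 2 v0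
      A p₂ p₆ p₇ : Expr 3
      A = (I ⊖ v1 ⊗ v0 ⊛ 2) ⊗ (I ⊖ v1 ⊗ v0 ⊛ 3)
      p₂ = (I ⊕ v1 ⊗ v0 ⊕ v1 ⊛ 2 ⊗ v0 ⊛ 2) ⊗ A
      p₆ = (I ⊕ v1 ⊗ v0) ⊗ A
      p₇ = I ⊖ v1 ⊗ v0 ⊛ 3
      Ψ : Fin 4 → S.Carrier
      Ψ 0F = C
      Ψ 1F = p₂ ↓ˢ ✶ u
      Ψ 2F = p₆ ↓ˢ ✶ u
      Ψ 3F = p₇ ↓ˢ ✶ C

      equations : ∀ i → Equation Ψ i
      equations 0F = equation C-u (part 0 0 1 0F σC-u (part 1 1 0 1F (bare p₂) (part 2 1 0 3F (poly p₇ C-u) (part 3 1 0 0F C-u end)))) refl (refl , refl , refl , refl , refl)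
      equations 1F = equation (bare p₂) (part 0 0 1 0F σC-u (part 1 1 0 2F (bare p₆) end)) refl (refl , refl , refl)
      equations 2F = equation (bare p₆) (part 0 0 1 0F σC-u (part 1 1 1 0F σC-u end)) refl (refl , refl , refl)
      equations 3F = equation (poly p₇ C-u) (part 0 0 1 0F σC-u (part 1 1 0 1F (bare p₂) (part 2 1 0 3F (poly p₇ C-u) end))) refl (refl , refl , refl , refl)

      ct-C : ct C ≈ 1#
      ct-C = ct-✶ (ct-✶ (ct-✶ (ct-num 1 _) (ct-num 2 _)) (ct-den 2 _)) (ct-den 3 _)
      ct-u : ct u ≈ 1#
      ct-u = ct-✶ (ct-✶ (ct-✶ (ct-num 1 _) (ct-num 2 _)) (ct-den 2 _)) (ct-den 3 _)

      solution : ∀ F → Solves system₈ₐ F → F 3F 0 + q * F 2F 0 ≈ (1# + q) * Λ (AΦ (q ^ 4))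
      solution F (rec , lim) = begin
        F 3F 0 + q * F 2F 0 ≈⟨ +-cong (sol 3F) (*-congˡ (sol 2F)) ⟩
        Λ (p₇ ↓ˢ ✶ C) + q * Λ (p₆ ↓ˢ ✶ u) ≈⟨ +-congʳ (certificate ø C-u σC-u (poly p₇ C-u)
          (I ⊕ v0 , numᵏ 0 1 (⊝ v0) (⊝ (v0 ⊛ 2)) refl ⊠ numᵏ 1 0 (⊝ (v0 ⊛ 4)) (⊝ (v0 ⊛ 4)) refl ⊠ denᵏ 1 0 v0 v0 refl ⊠ denᵏ 2 1 v0 (v0 ⊛ 4) refl ⊞ ⟪ ⊝ v0 , bare p₆ ⟫) refl) ⟩
        (1# + q) * Λ (AΦ (q ^ 4)) + - q * Λ (p₆ ↓ˢ ✶ u) + q * Λ (p₆ ↓ˢ ✶ u)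
          ≈⟨ prove ((1# + q) * Λ (AΦ (q ^ 4)) ∷ q ∷ Λ (p₆ ↓ˢ ✶ u) ∷ []) (v0 ⊕ (⊝ v1) ⊗ v2 ⊕ v1 ⊗ v2) v0 refl ⟩
        (1# + q) * Λ (AΦ (q ^ 4)) ∎
        where
        sol : ∀ i → F i 0 ≈ Λ (Ψ i)
        sol i = system-solution Ψ equations
          (λ { 0F → ct-C ; 1F → ct-✶ (ct-poly p₂ refl) ct-u ; 2F → ct-✶ (ct-poly p₆ refl) ct-u ; 3F → ct-✶ (ct-poly p₇ refl) ct-C })
          F (λ { 0F → rec 0F ; 1F → rec 1F ; 2F → rec 2F ; 3F → rec 3F }) lim i 0

    module Case₅ where
      C u : S.Carrier
      C = den 1 q ✶ num 2 (- q) ✶ den 3 (q ^ 2)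
      u = den 1 q ✶ num 2 (- q ^ 3) ✶ den 3 (q ^ 2)
      C-u = denᵏ 0 0 v0 v0 refl ⊠ numᵏ 1 1 (⊝ v0) (⊝ (v0 ⊛ 3)) refl ⊠ denᵏ 2 0 (v0 ⊛ 2) (v0 ⊛ 2) refl
      σC-u = σ-denᵏ 0 v0 σ⊠ σ-numᵏ 1 (⊝ v0) (⊝ (v0 ⊛ 3)) refl σ⊠ σ-denᵏ 2 (v0 ⊛ 2)
      p₂ p₇ : Expr 3
      p₂ = I ⊖ v1 ⊛ 2 ⊗ v0 ⊛ 3 ⊕ v1 ⊗ v0 ⊛ 2
      p₇ = I ⊖ v1 ⊛ 2 ⊗ v0 ⊛ 3
      Ψ : Fin 4 → S.Carrier
      Ψ 0F = C
      Ψ 1F = p₂ ↓ˢ ✶ u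
      Ψ 2F = p₇ ↓ˢ ✶ u
      Ψ 3F = u

      equations : ∀ i → Equation Ψ i
      equations 0F = equation C-u (part 0 0 1 0F σC-u (part 1 1 0 1F (bare p₂) (part 2 1 0 3F same end))) refl (refl , refl , refl , refl)
      equations 1F = equation (bare p₂) (part 0 0 1 0F σC-u (part 1 1 0 2F (bare p₇) (part 2 1 0 3F same end))) refl (refl , refl , refl , refl)
      equations 2F = equation (bare p₇) (part 0 0 1 0F σC-u (part 1 1 0 2F (bare p₇) end)) refl (refl , refl , refl)
      equations 3F = equation same (part 0 0 1 0F σC-u (part 1 1 0 1F (bare p₂) end)) refl (refl , refl , refl)

      ct-C : ct C ≈ 1#
      ct-C = ct-✶ (ct-✶ (ct-den 1 _) (ct-num 2 _)) (ct-den 3 _)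
      ct-u : ct u ≈ 1#
      ct-u = ct-✶ (ct-✶ (ct-den 1 _) (ct-num 2 _)) (ct-den 3 _)

      u₅ = den 1 q ✶ num 2 (- q ^ 5) ✶ den 3 (q ^ 2)

      solution : ∀ F → Solves system₅ F → F 0F 0 + q * F 2F 0 + q ^ 2 * F 3F 1
        ≈ Λ (B q (q ^ 2 * q) (q ^ 2)) + q * (1# + q) * Λ (B q (q ^ 5) (q ^ 5))
      solution F (rec , lim) = begin
        F 0F 0 + q * F 2F 0 + q ^ 2 * F 3F 1
          ≈⟨ +-cong (+-cong (trans (sol 0F 0) first) (*-congˡ (sol 2F 0))) (*-congˡ (sol 3F 1)) ⟩
        - q * y + (- q ^ 2 * z + (1# * a + (q * (1# + q)) * b)) + q * y + q ^ 2 * z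
          ≈⟨ prove (q ∷ y ∷ z ∷ a ∷ b ∷ []) ((⊝ v0) ⊗ v1 ⊕ ((⊝ (v0 ⊛ 2)) ⊗ v2 ⊕ (I ⊗ v3 ⊕ (v0 ⊗ (I ⊕ v0)) ⊗ v4)) ⊕ v0 ⊗ v1 ⊕ v0 ⊛ 2 ⊗ v2) (v3 ⊕ v0 ⊗ (I ⊕ v0) ⊗ v4) refl ⟩
        a + q * (1# + q) * b ∎
        where
        y = Λ (p₇ ↓ˢ ✶ u)
        z = Λ (σ u)
        a = Λ (B q (q ^ 2 * q) (q ^ 2))
        b = Λ (B q (q ^ 5) (q ^ 5))
        u-u₅ = denᵏ 0 0 v0 v0 refl ⊠ numᵏ 1 1 (⊝ (v0 ⊛ 3)) (⊝ (v0 ⊛ 5)) refl ⊠ denᵏ 2 0 (v0 ⊛ 2) (v0 ⊛ 2) refl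
        σu-u₅ = σ-denᵏ 0 v0 σ⊠ σ-numᵏ 1 (⊝ (v0 ⊛ 3)) (⊝ (v0 ⊛ 5)) refl σ⊠ σ-denᵏ 2 (v0 ⊛ 2)
        first : Λ C ≈ - q * y + (- q ^ 2 * z + (1# * a + (q * (1# + q)) * b))
        first = certificate (⊝ (v1 ⊗ v0)) u-u₅ σu-u₅
          (denᵏ 0 0 v0 v0 refl ⊠ numᵏ 1 2 (⊝ v0) (⊝ (v0 ⊛ 5)) refl ⊠ denᵏ 2 0 (v0 ⊛ 2) (v0 ⊛ 2) refl)
          (⊝ v0 , poly p₇ u-u₅ ⊞ (⊝ (v0 ⊛ 2) , σu-u₅
            ⊞ (I , denᵏ 0 0 v0 v0 refl ⊠ numᵏ 1 1 (⊝ (v0 ⊛ 2 ⊗ v0)) (⊝ (v0 ⊛ 5)) refl ⊠ denᵏ 2 0 (v0 ⊛ 2) (v0 ⊛ 2) refl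
            ⊞ ⟪ v0 ⊗ (I ⊕ v0) , denᵏ 0 0 v0 v0 refl ⊠ numᵏ 1 0 (⊝ (v0 ⊛ 5)) (⊝ (v0 ⊛ 5)) refl ⊠ denᵏ 2 1 (v0 ⊛ 2) (v0 ⊛ 5) refl ⟫)))
          refl
        sol : ∀ i n → F i n ≈ Λ (σ^ n (Ψ i))
        sol = system-solution Ψ equations
          (λ { 0F → ct-C ; 1F → ct-✶ (ct-poly p₂ refl) ct-u ; 2F → ct-✶ (ct-poly p₇ refl) ct-u ; 3F → ct-u })
          F (λ { 0F → rec 0F ; 1F → rec 1F ; 2F → rec 2F ; 3F → rec 3F }) lim

    module Case₆ where
      C u : S.Carrier
      C = den 1 q ✶ num 2 (- q) ✶ den 3 q
      u = den 1 q ✶ num 2 (- q ^ 3) ✶ den 3 q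
      C-u = denᵏ 0 0 v0 v0 refl ⊠ numᵏ 1 1 (⊝ v0) (⊝ (v0 ⊛ 3)) refl ⊠ denᵏ 2 0 v0 v0 refl
      σC-u = σ-denᵏ 0 v0 σ⊠ σ-numᵏ 1 (⊝ v0) (⊝ (v0 ⊛ 3)) refl σ⊠ σ-denᵏ 2 v0
      p₂ : Expr 3
      p₂ = I ⊖ v1 ⊗ v0 ⊛ 3
      Ψ : Fin 2 → S.Carrier
      Ψ 0F = C
      Ψ 1F = p₂ ↓ˢ ✶ u

      equations : ∀ i → Equation Ψ i
      equations 0F = equation C-u (part 0 0 1 0F σC-u (part 1 1 0 1F (bare p₂) (part 2 1 0 1F (bare p₂) (part 3 1 0 0F C-u end)))) refl (refl , refl , refl , refl , refl)
      equations 1F = equation (bare p₂) (part 0 0 1 0F σC-u (part 1 1 0 1F (bare p₂) end)) refl (refl , refl , refl)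

      ct-C : ct C ≈ 1#
      ct-C = ct-✶ (ct-✶ (ct-den 1 _) (ct-num 2 _)) (ct-den 3 _)
      ct-u : ct u ≈ 1#
      ct-u = ct-✶ (ct-✶ (ct-den 1 _) (ct-num 2 _)) (ct-den 3 _)

      solution : ∀ F → Solves system₆ F → (1# + q) * F 0F 1 + q ^ 2 * F 1F 1 ≈ Λ (R q)
      solution F (rec , lim) = begin
        (1# + q) * F 0F 1 + q ^ 2 * F 1F 1 ≈⟨ +-cong (*-congˡ (sol 0F 1)) (*-congˡ (sol 1F 1)) ⟩
        (1# + q) * Λ (σ C) + q ^ 2 * Λ (σ (p₂ ↓ˢ ✶ u)) ≈⟨ certificate (⊝ (I ⊕ v1) ⊖ v1 ⊗ v0 ⊛ 2 ⊕ v1 ⊛ 2 ⊗ v0 ⊛ 3)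
          (denᵏ 0 0 v0 v0 refl ⊠ numᵏ 1 1 (⊝ (v0 ⊛ 3)) (⊝ (v0 ⊛ 5)) refl ⊠ denᵏ 2 0 v0 v0 refl) σu-u₅
          (poly (I ⊕ v0) (denᵏ 0 0 v0 v0 refl ⊠ numᵏ 1 1 (⊝ (v0 ⊗ v0 ⊛ 2)) (⊝ (v0 ⊛ 5)) refl ⊠ denᵏ 2 0 v0 v0 refl))
          (I ⊕ v0 , σ-denᵏ 0 v0 σ⊠ σ-numʳ 1 1 (⊝ v0) (⊝ (v0 ⊛ 5)) refl σ⊠ σ-denᵏ 2 v0 ⊞ ⟪ v0 ⊛ 2 , σ-poly p₂ σu-u₅ ⟫)
          refl ⟨
        Λ (R q) ∎
        where
        σu-u₅ = σ-denᵏ 0 v0 σ⊠ σ-numᵏ 1 (⊝ (v0 ⊛ 3)) (⊝ (v0 ⊛ 5)) refl σ⊠ σ-denᵏ 2 v0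
        sol : ∀ i n → F i n ≈ Λ (σ^ n (Ψ i))
        sol = system-solution Ψ equations (λ { 0F → ct-C ; 1F → ct-✶ (ct-poly p₂ refl) ct-u }) F (λ { 0F → rec 0F ; 1F → rec 1F }) lim

module Products where
  open import Data.Nat.Tactic.RingSolver using (solve-∀)
  open import Data.Vec.Base using ([]; _∷_)
  open Solver
  open AK public

  q^-+ : ∀ m n → q ^ (m ℕ.+ n) ≈ q ^ m * q ^ n
  q^-+ = ^-homo-* q

  q^-≡ : ∀ {m n} → m ≡ n → q ^ m ≈ q ^ n
  q^-≡ e = reflexive (≡.cong (q ^_) e)

  n≤a+n*b : ∀ a b n → n ≤ a ℕ.+ n ℕ.* suc b
  n≤a+n*b a b n = ℕ.≤-trans (ℕ.m≤m*n n (suc b)) (ℕ.m≤n+m _ a)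

  -- (q^a; q^(b+1))_∞ and (-q^a; q^(b+1))_∞.
  poch⁻ poch⁺ : ℕ → ℕ → Carrier
  poch⁻ a b = ∏ λ n → 1# - q ^ (a ℕ.+ n ℕ.* suc b)
  poch⁺ a b = ∏ λ n → 1# + q ^ (a ℕ.+ n ℕ.* suc b)

  factors⁻ : ∀ a b → Factors (λ n → 1# - q ^ (a ℕ.+ n ℕ.* suc b))
  factors⁻ a b n = ord-cong (prove (q ^ (a ℕ.+ n ℕ.* suc b) ∷ []) (⊝ v0) (I ⊖ v0 ⊖ I) ≡.refl) (ord-neg (ord-≥ (n≤a+n*b a b n)))

  factors⁺ : ∀ a b → Factors (λ n → 1# + q ^ (a ℕ.+ n ℕ.* suc b))
  factors⁺ a b n = ord-cong (prove (q ^ (a ℕ.+ n ℕ.* suc b) ∷ []) v0 (I ⊕ v0 ⊖ I) ≡.refl) (ord-≥ (n≤a+n*b a b n))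

  shift-exponent : ∀ a b n → a ℕ.+ suc n ℕ.* suc b ≡ a ℕ.+ suc b ℕ.+ n ℕ.* suc b
  shift-exponent a b n = ≡.sym (ℕ.+-assoc a (suc b) (n ℕ.* suc b))

  poch⁻-suc : ∀ a b → poch⁻ a b ≈ (1# - q ^ a) * poch⁻ (a ℕ.+ suc b) b
  poch⁻-suc a b = trans (∏-suc (factors⁻ a b)) (*-cong (+-congˡ (-‿cong (q^-≡ (ℕ.+-identityʳ a))))
    (∏-cong (λ n → +-congˡ (-‿cong (q^-≡ (shift-exponent a b n)))) (factors-suc {λ n → 1# - q ^ (a ℕ.+ n ℕ.* suc b)} (factors⁻ a b))))

  poch⁺-suc : ∀ a b → poch⁺ a b ≈ (1# + q ^ a) * poch⁺ (a ℕ.+ suc b) b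
  poch⁺-suc a b = trans (∏-suc (factors⁺ a b)) (*-cong (+-congˡ (q^-≡ (ℕ.+-identityʳ a)))
    (∏-cong (λ n → +-congˡ (q^-≡ (shift-exponent a b n))) (factors-suc {λ n → 1# + q ^ (a ℕ.+ n ℕ.* suc b)} (factors⁺ a b))))

  ∏-near : ∀ {f m} → Factors f → (∀ n → Ord m (f n - 1#)) → Ord m (∏ f - 1#)
  ∏-near {f} {m} s h = ord-cong (prove (∏ f ∷ Π< f m ∷ []) ((v0 ⊖ v1) ⊕ (v1 ⊖ I)) (v0 ⊖ I) ≡.refl) (ord-+ (∏-⟶ s m) (part m))
    where
    part : ∀ n → Ord m (Π< f n - 1#)
    part zero = ord-cong (sym (-‿inverseʳ 1#)) ord-0
    part (suc n) = ord-cong (prove (Π< f n ∷ f n ∷ []) ((v0 ⊖ I) ⊗ v1 ⊕ (v1 ⊖ I)) (v0 ⊗ v1 ⊖ I) ≡.refl) (ord-+ (ord-*ʳ (f n) (part n)) (h n))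

  near⁻ : ∀ {m} a b → m ≤ a → Ord m (poch⁻ a b - 1#)
  near⁻ a b m≤a = ∏-near (factors⁻ a b) λ n → ord-cong (prove (q ^ (a ℕ.+ n ℕ.* suc b) ∷ []) (⊝ v0) (I ⊖ v0 ⊖ I) ≡.refl)
    (ord-neg (ord-≥ (ℕ.≤-trans m≤a (ℕ.m≤m+n a _))))

  near⁺ : ∀ {m} a b → m ≤ a → Ord m (poch⁺ a b - 1#)
  near⁺ a b m≤a = ∏-near (factors⁺ a b) λ n → ord-cong (prove (q ^ (a ℕ.+ n ℕ.* suc b) ∷ []) v0 (I ⊕ v0 ⊖ I) ≡.refl)
    (ord-≥ (ℕ.≤-trans m≤a (ℕ.m≤m+n a _)))

  unital⁻ : ∀ a b → Unital (poch⁻ (suc a) b)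
  unital⁻ a b = near⁻ (suc a) b (s≤s z≤n)

  unital⁺ : ∀ a b → Unital (poch⁺ (suc a) b)
  unital⁺ a b = near⁺ (suc a) b (s≤s z≤n)

  ⟶-near : ∀ {f} → (∀ n → Ord n (f n - 1#)) → f ⟶ 1#
  ⟶-near {f} h n = ord-cong (prove (f n ∷ []) (⊝ (v0 ⊖ I)) (I ⊖ v0) ≡.refl) (ord-neg (h n))

  k≤ : ∀ a b k → k ≤ a ℕ.+ k ℕ.* suc b
  k≤ = n≤a+n*b

  ⟶⁻ : ∀ a b c → (λ k → poch⁻ (a ℕ.+ k ℕ.* suc b) c) ⟶ 1#
  ⟶⁻ a b c = ⟶-near λ k → near⁻ _ c (k≤ a b k)

  ⟶⁺ : ∀ a b c → (λ k → poch⁺ (a ℕ.+ k ℕ.* suc b) c) ⟶ 1#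
  ⟶⁺ a b c = ⟶-near λ k → near⁺ _ c (k≤ a b k)

  ⟶-one-* : ∀ {f g} → f ⟶ 1# → g ⟶ 1# → (λ n → f n * g n) ⟶ 1#
  ⟶-one-* p r = ⟶-≈ (*-identityˡ 1#) (⟶-* p r)

  poch⁻-iterate : ∀ m a b → poch⁻ a b ≈ Π< (λ i → 1# - q ^ (a ℕ.+ i ℕ.* suc b)) m * poch⁻ (a ℕ.+ m ℕ.* suc b) b
  poch⁻-iterate zero a b = trans (sym (*-identityˡ _)) (*-congˡ (reflexive (≡.cong (λ i → poch⁻ i b) (≡.sym (ℕ.+-identityʳ a)))))
  poch⁻-iterate (suc m) a b = trans (poch⁻-iterate m a b) (trans (*-congˡ (trans (poch⁻-suc (a ℕ.+ m ℕ.* suc b) b)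
    (*-congˡ (reflexive (≡.cong (λ i → poch⁻ i b) (≡.trans (ℕ.+-assoc a _ _) (≡.cong (a ℕ.+_) (ℕ.+-comm (m ℕ.* suc b) (suc b))))))))) (sym (*-assoc _ _ _)))

  Π<-1 : ∀ (f : ℕ → ℕ → Carrier) m → (∀ i → f i ⟶ 1#) → (λ k → Π< (λ i → f i k) m) ⟶ 1#
  Π<-1 f zero h = ⟶-const
  Π<-1 f (suc m) h = ⟶-one-* (Π<-1 f m h) (h m)

  dissect : ∀ m a b → poch⁻ a b ≈ Π< (λ i → poch⁻ (a ℕ.+ i ℕ.* suc b) (b ℕ.+ m ℕ.* suc b)) (suc m)
  dissect m a b = trans (reflexive (≡.cong (λ i → poch⁻ i b) (≡.sym (ℕ.+-identityʳ a)))) (trans (first-order-unique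
    (λ k → Π< (λ i → 1# - q ^ (a ℕ.+ k ℕ.* M ℕ.+ i ℕ.* suc b)) (suc m))
    (λ k → poch⁻ (a ℕ.+ k ℕ.* M) b) (λ k → Π< (y k) (suc m))
    (λ k → trans (poch⁻-iterate (suc m) (a ℕ.+ k ℕ.* M) b) (*-congˡ (reflexive (≡.cong (λ i → poch⁻ i b) (step k)))))
    (λ k → trans (Π<-cong {f = y k} {g = λ i → (1# - q ^ (a ℕ.+ k ℕ.* M ℕ.+ i ℕ.* suc b)) * y (suc k) i}
        (λ i → trans (poch⁻-suc (a ℕ.+ k ℕ.* M ℕ.+ i ℕ.* suc b) B) (*-congˡ (reflexive (≡.cong (λ j → poch⁻ j B) (step′ k i))))) (suc m))
      (sym (Π<-* (λ i → 1# - q ^ (a ℕ.+ k ℕ.* M ℕ.+ i ℕ.* suc b)) (y (suc k)) (suc m))))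
    (⟶⁻ a B b)
    (Π<-1 (λ i k → y k i) (suc m) λ i → ⟶-near λ k → near⁻ (a ℕ.+ k ℕ.* M ℕ.+ i ℕ.* suc b) B (ℕ.≤-trans (k≤ a B k) (ℕ.m≤m+n _ _))) 0)
    (Π<-cong {f = y 0} (λ i → reflexive (≡.cong (λ j → poch⁻ (j ℕ.+ i ℕ.* suc b) B) (ℕ.+-identityʳ a))) (suc m)))
    where
    B = b ℕ.+ m ℕ.* suc b
    M = suc B
    y : ℕ → ℕ → Carrier
    y k i = poch⁻ (a ℕ.+ k ℕ.* M ℕ.+ i ℕ.* suc b) B
    step : ∀ k → a ℕ.+ k ℕ.* M ℕ.+ suc m ℕ.* suc b ≡ a ℕ.+ suc k ℕ.* M
    step k = lemma a k b m
      where
      lemma : ∀ a k b m → a ℕ.+ k ℕ.* suc (b ℕ.+ m ℕ.* suc b) ℕ.+ suc m ℕ.* suc b ≡ a ℕ.+ suc k ℕ.* suc (b ℕ.+ m ℕ.* suc b)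
      lemma = solve-∀
    step′ : ∀ k i → a ℕ.+ k ℕ.* M ℕ.+ i ℕ.* suc b ℕ.+ suc (b ℕ.+ m ℕ.* suc b) ≡ a ℕ.+ suc k ℕ.* M ℕ.+ i ℕ.* suc b
    step′ k i = lemma a k b m i
      where
      lemma : ∀ a k b m i → a ℕ.+ k ℕ.* suc (b ℕ.+ m ℕ.* suc b) ℕ.+ i ℕ.* suc b ℕ.+ suc (b ℕ.+ m ℕ.* suc b) ≡ a ℕ.+ suc k ℕ.* suc (b ℕ.+ m ℕ.* suc b) ℕ.+ i ℕ.* suc b
      lemma = solve-∀

  poch-square : ∀ a b → poch⁺ a b * poch⁻ a b ≈ poch⁻ (a ℕ.+ a) (b ℕ.+ suc b)
  poch-square a b = trans (∏-* (factors⁺ a b) (factors⁻ a b)) (∏-cong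
    (λ n → trans (prove (q ^ (a ℕ.+ n ℕ.* suc b) ∷ []) ((I ⊕ v0) ⊗ (I ⊖ v0)) (I ⊖ v0 ⊗ v0) ≡.refl)
      (+-congˡ (-‿cong (trans (sym (q^-+ (a ℕ.+ n ℕ.* suc b) _)) (q^-≡ (lemma a n b)))))) (factors-* (factors⁺ a b) (factors⁻ a b)))
    where
    lemma : ∀ a n b → a ℕ.+ n ℕ.* suc b ℕ.+ (a ℕ.+ n ℕ.* suc b) ≡ a ℕ.+ a ℕ.+ n ℕ.* suc (b ℕ.+ suc b)
    lemma = solve-∀

  -- The coefficients (q^a; q^(b+1))_n / (q^(b+1); q^(b+1))_n.
  binom : ℕ → ℕ → ℕ → Carrier
  binom a b zero = 1#
  binom a b (suc n) = binom a b n * (1# - q ^ (a ℕ.+ n ℕ.* suc b)) * geo (q ^ (suc n ℕ.* suc b))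

  binom-suc : ∀ a b n → (1# - q ^ (suc n ℕ.* suc b)) * binom a b (suc n) ≈ (1# - q ^ (a ℕ.+ n ℕ.* suc b)) * binom a b n
  binom-suc a b n = trans
    (prove (q ^ (suc n ℕ.* suc b) ∷ binom a b n ∷ q ^ (a ℕ.+ n ℕ.* suc b) ∷ geo (q ^ (suc n ℕ.* suc b)) ∷ [])
      ((I ⊖ v0) ⊗ (v1 ⊗ (I ⊖ v2) ⊗ v3)) ((I ⊖ v0) ⊗ v3 ⊗ ((I ⊖ v2) ⊗ v1)) ≡.refl)
    (trans (*-congʳ (geo-inverse (ord-≥ {n = suc n ℕ.* suc b} (s≤s z≤n)))) (*-identityˡ _))

  z^-summable : ∀ (f : ℕ → Carrier) z → Summable (λ n → f n * q ^ (n ℕ.* suc z))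
  z^-summable f z n = ord-*ˡ (f n) (ord-≥ (ℕ.m≤m*n n (suc z)))

  q-binomial : ∀ a b z → ∑ (λ n → binom a b n * q ^ (n ℕ.* suc z)) * poch⁻ (suc z) b ≈ poch⁻ (a ℕ.+ suc z) b
  q-binomial a b z = begin
    f (suc z) * poch⁻ (suc z) b ≡⟨ ≡.cong₂ (λ i j → f i * poch⁻ j b) (≡.sym (ℕ.+-identityʳ (suc z))) (≡.sym (ℕ.+-identityʳ (suc z))) ⟩
    f (suc z ℕ.+ 0) * poch⁻ (suc z ℕ.+ 0) b ≈⟨ first-order-unique (λ k → 1# - q ^ (a ℕ.+ e k))
      (λ k → f (e k) * poch⁻ (e k) b) (λ k → poch⁻ (a ℕ.+ e k) b) recˡ recʳ
      (⟶-one-* (⟶-near λ k → near (e k) (k≤ (suc z) b k)) (⟶⁻ (suc z) b b))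
      (⟶-near λ k → near⁻ _ b (ℕ.≤-trans (k≤ (suc z) b k) (ℕ.m≤n+m _ a))) 0 ⟩
    poch⁻ (a ℕ.+ (suc z ℕ.+ 0)) b ≡⟨ ≡.cong (λ i → poch⁻ (a ℕ.+ i) b) (ℕ.+-identityʳ (suc z)) ⟩
    poch⁻ (a ℕ.+ suc z) b ∎
    where
    e : ℕ → ℕ
    e k = suc z ℕ.+ k ℕ.* suc b
    t : ℕ → ℕ → Carrier
    t m n = binom a b n * q ^ (n ℕ.* m)
    f : ℕ → Carrier
    f m = ∑ (t m)
    s : ∀ m → Summable (t (suc m))
    s m = z^-summable (binom a b) m
    near : ∀ {k} m → k ≤ m → Ord k (f m - 1#)
    near {zero} m _ = ord-all
    near {suc k} (suc m) k≤m = ord-cong (begin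
      ∑ (λ n → t (suc m) (suc n)) ≈⟨ prove (∑ (λ n → t (suc m) (suc n)) ∷ []) v0 (I ⊗ I ⊕ v0 ⊖ I) ≡.refl ⟩
      1# * 1# + ∑ (λ n → t (suc m) (suc n)) - 1# ≈⟨ +-congʳ (∑-suc (s m)) ⟨
      f (suc m) - 1# ∎) (ord-∑ (λ n → ord-mono (ℕ.n≤1+n n) (s m (suc n))) λ n → ord-*ˡ _ (ord-≥ (ℕ.≤-trans k≤m (ℕ.m≤m+n (suc m) _))))
    functional : ∀ m → (1# - q ^ suc m) * f (suc m) ≈ (1# - q ^ (a ℕ.+ suc m)) * f (suc m ℕ.+ suc b)
    functional m = separate (trans (trans (+-cong (∑-*ˡ _ (s m)) (trans (-‿≈ _) (∑-*ˡ _ (s (m ℕ.+ suc b)))))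
      (∑-+ (λ n → ord-*ˡ _ (s m n)) (λ n → ord-*ˡ _ (s (m ℕ.+ suc b) n))))
      (∑-telescope (λ n → - ((1# - q ^ (n ℕ.* suc b)) * t (suc m) n)) (λ n → ord-neg (ord-*ˡ _ (s m n)))
        termwise (trans (-‿cong (trans (*-congʳ (-‿inverseʳ 1#)) (zeroˡ _))) neg-0)))
      where
      separate : ∀ {x y} → x + - y ≈ 0# → x ≈ y
      separate {x} {y} h = trans (prove (x ∷ y ∷ []) v0 (v0 ⊕ ⊝ v1 ⊕ v1) ≡.refl) (trans (+-congʳ h) (+-identityˡ _))
      -‿≈ : ∀ {c} x → - (c * x) ≈ - c * x
      -‿≈ {c} x = prove (c ∷ x ∷ []) (⊝ (v0 ⊗ v1)) ((⊝ v0) ⊗ v1) ≡.refl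
      neg-0 : - 0# ≈ 0#
      neg-0 = prove [] (⊝ ø) ø ≡.refl
      termwise : ∀ n → (1# - q ^ suc m) * t (suc m) n + - (1# - q ^ (a ℕ.+ suc m)) * t (suc m ℕ.+ suc b) n
        ≈ - ((1# - q ^ (suc n ℕ.* suc b)) * t (suc m) (suc n)) - - ((1# - q ^ (n ℕ.* suc b)) * t (suc m) n)
      termwise n = begin
        (1# - x) * (c * z′) + - (1# - q ^ (a ℕ.+ suc m)) * (c * q ^ (n ℕ.* (suc m ℕ.+ suc b)))
          ≈⟨ +-congˡ (*-cong (-‿cong (+-congˡ (-‿cong (q^-+ a (suc m))))) (*-congˡ (trans (q^-≡ (ℕ.*-distribˡ-+ n (suc m) (suc b))) (q^-+ (n ℕ.* suc m) (n ℕ.* suc b))))) ⟩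
        (1# - x) * (c * z′) + - (1# - q ^ a * x) * (c * (z′ * y))
          ≈⟨ prove (x ∷ c ∷ z′ ∷ q ^ a ∷ y ∷ []) ((I ⊖ v0) ⊗ (v1 ⊗ v2) ⊕ (⊝ (I ⊖ v3 ⊗ v0)) ⊗ (v1 ⊗ (v2 ⊗ v4))) (⊝ ((I ⊖ v3 ⊗ v4) ⊗ v1 ⊗ (v0 ⊗ v2)) ⊖ ⊝ ((I ⊖ v4) ⊗ (v1 ⊗ v2))) ≡.refl ⟩
        - ((1# - q ^ a * y) * c * (x * z′)) - - ((1# - y) * (c * z′))
          ≈⟨ +-congʳ (-‿cong (*-cong (trans (*-congʳ (+-congˡ (-‿cong (sym (q^-+ a (n ℕ.* suc b)))))) (sym (binom-suc a b n))) (sym (q^-+ (suc m) (n ℕ.* suc m))))) ⟩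
        - ((1# - q ^ (suc n ℕ.* suc b)) * binom a b (suc n) * q ^ (suc n ℕ.* suc m)) - - ((1# - y) * (c * z′))
          ≈⟨ +-congʳ (-‿cong (*-assoc _ _ _)) ⟩
        _ ∎
        where
        x = q ^ suc m
        c = binom a b n
        z′ = q ^ (n ℕ.* suc m)
        y = q ^ (n ℕ.* suc b)
    e-suc : ∀ k → e (suc k) ≡ e k ℕ.+ suc b
    e-suc k = ≡.trans (≡.cong (suc z ℕ.+_) (ℕ.+-comm (suc b) (k ℕ.* suc b))) (≡.sym (ℕ.+-assoc (suc z) (k ℕ.* suc b) (suc b)))
    recˡ : ∀ k → f (e k) * poch⁻ (e k) b ≈ (1# - q ^ (a ℕ.+ e k)) * (f (e (suc k)) * poch⁻ (e (suc k)) b)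
    recˡ k = begin
      f (e k) * poch⁻ (e k) b ≈⟨ *-congˡ (poch⁻-suc (e k) b) ⟩
      f (e k) * ((1# - q ^ e k) * poch⁻ (e k ℕ.+ suc b) b) ≈⟨ prove (f (e k) ∷ 1# - q ^ e k ∷ poch⁻ (e k ℕ.+ suc b) b ∷ []) (v0 ⊗ (v1 ⊗ v2)) (v1 ⊗ v0 ⊗ v2) ≡.refl ⟩
      (1# - q ^ e k) * f (e k) * poch⁻ (e k ℕ.+ suc b) b ≈⟨ trans (*-congʳ (functional (z ℕ.+ k ℕ.* suc b))) (*-assoc _ _ _) ⟩
      (1# - q ^ (a ℕ.+ e k)) * (f (e k ℕ.+ suc b) * poch⁻ (e k ℕ.+ suc b) b) ≡⟨ ≡.cong (λ i → (1# - q ^ (a ℕ.+ e k)) * (f i * poch⁻ i b)) (≡.sym (e-suc k)) ⟩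
      (1# - q ^ (a ℕ.+ e k)) * (f (e (suc k)) * poch⁻ (e (suc k)) b) ∎
    recʳ : ∀ k → poch⁻ (a ℕ.+ e k) b ≈ (1# - q ^ (a ℕ.+ e k)) * poch⁻ (a ℕ.+ e (suc k)) b
    recʳ k = trans (poch⁻-suc (a ℕ.+ e k) b) (*-congˡ (reflexive (≡.cong (λ i → poch⁻ i b) (≡.trans (ℕ.+-assoc a (e k) (suc b)) (≡.cong (a ℕ.+_) (≡.sym (e-suc k)))))))

-- Cases 5a and 6a

module Heine where
  open import Data.Vec.Base using ([]; _∷_)
  open Solver
  open Products public

  e f : ℕ → Carrier
  e k = q ^ (5 ℕ.+ k ℕ.* 6)
  f k = q ^ (k ℕ.* 6)

  e-+ : ∀ k n → e (k ℕ.+ n) ≈ e k * f n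
  e-+ k n = trans (q^-≡ (≡.trans (≡.cong (5 ℕ.+_) (ℕ.*-distribʳ-+ 6 k n)) (≡.sym (ℕ.+-assoc 5 (k ℕ.* 6) _)))) (q^-+ (5 ℕ.+ k ℕ.* 6) (n ℕ.* 6))

  f-+ : ∀ k n → f (k ℕ.+ n) ≈ f k * f n
  f-+ k n = trans (q^-≡ (ℕ.*-distribʳ-+ 6 k n)) (q^-+ (k ℕ.* 6) (n ℕ.* 6))

  e-suc : ∀ k → e (suc k) ≈ q ^ 6 * e k
  e-suc k = q^-+ 6 (5 ℕ.+ k ℕ.* 6)

  e-f : ∀ k → e k ≈ q ^ 5 * f k
  e-f k = q^-+ 5 (k ℕ.* 6)

  L : ℕ → ℕ → Carrier
  L k zero = 1#
  L k (suc n) = L k n * (1# + e (k ℕ.+ n))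

  L-sucˡ : ∀ k n → L k (suc n) ≈ (1# + e k) * L (suc k) n
  L-sucˡ k zero = trans (*-comm _ _) (*-congʳ (+-congˡ (reflexive (≡.cong e (ℕ.+-identityʳ k)))))
  L-sucˡ k (suc n) = trans (*-cong (L-sucˡ k n) (+-congˡ (reflexive (≡.cong e (ℕ.+-suc k n))))) (*-assoc _ _ _)

  T : ℕ → Carrier
  T j = poch⁺ (j ℕ.* 6) 5

  T-suc : ∀ j → T j ≈ (1# + f j) * T (suc j)
  T-suc j = trans (poch⁺-suc (j ℕ.* 6) 5) (*-congˡ (reflexive (≡.cong (λ i → poch⁺ i 5) (ℕ.+-comm (j ℕ.* 6) 6))))

  near-* : ∀ {m x y} → Ord m (x - 1#) → Ord m (y - 1#) → Ord m (x * y - 1#)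
  near-* {x = x} {y} o p = ord-cong (prove (x ∷ y ∷ []) ((v0 ⊖ I) ⊗ v1 ⊕ (v1 ⊖ I)) (v0 ⊗ v1 ⊖ I) ≡.refl) (ord-+ (ord-*ʳ y o) p)

  near-1+ : ∀ {m x} → Ord m x → Ord m (1# + x - 1#)
  near-1+ {x = x} o = ord-cong (prove (x ∷ []) v0 (I ⊕ v0 ⊖ I) ≡.refl) o

  L-near : ∀ k n → Ord k (L k n - 1#)
  L-near k zero = ord-cong (sym (-‿inverseʳ 1#)) ord-0
  L-near k (suc n) = near-* (L-near k n) (near-1+ (ord-≥ (ℕ.≤-trans (ℕ.m≤m+n k n) (k≤ 5 5 (k ℕ.+ n)))))

  T-near : ∀ {k} j → k ≤ j → Ord k (T j - 1#)
  T-near j k≤j = near⁺ (j ℕ.* 6) 5 (ℕ.≤-trans k≤j (ℕ.m≤m*n j 6))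

  A : ℕ → Carrier
  A = binom 5 5

  module _ (z : ℕ) where
    x y : Carrier
    x = q ^ z
    y = q ^ suc (suc z)

    yⁿ : ℕ → Carrier
    yⁿ n = q ^ (n ℕ.* suc (suc z))

    yⁿ-suc : ∀ n → yⁿ (suc n) ≈ y * yⁿ n
    yⁿ-suc n = q^-+ (suc (suc z)) (n ℕ.* suc (suc z))

    t u : ℕ → ℕ → Carrier
    t k n = A n * (L k n * T (suc (k ℕ.+ n))) * yⁿ n
    u k n = A n * (L k n * T (suc (suc (k ℕ.+ n)))) * yⁿ n

    p p̃ : ℕ → Carrier
    p k = ∑ (t k)
    p̃ k = ∑ (u k)

    a : Carrier
    a = ∑ (λ n → A n * yⁿ n)

    t-summable : ∀ k → Summable (t k)
    t-summable k = z^-summable _ (suc z)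
    u-summable : ∀ k → Summable (u k)
    u-summable k = z^-summable _ (suc z)

    p-rec : ∀ k → p k ≈ (1# - q) * p̃ k + q * (1# + e k) * p (suc k)
    p-rec k = sym (trans (+-cong (∑-*ˡ _ (u-summable k)) (∑-*ˡ _ (t-summable (suc k))))
      (trans (∑-+ (λ n → ord-*ˡ _ (u-summable k n)) (λ n → ord-*ˡ _ (t-summable (suc k) n)))
        (∑-cong termwise λ n → ord-+ (ord-*ˡ _ (u-summable k n)) (ord-*ˡ _ (t-summable (suc k) n)))))
      where
      termwise : ∀ n → (1# - q) * u k n + q * (1# + e k) * t (suc k) n ≈ t k n
      termwise n = begin
        (1# - q) * u k n + q * (1# + e k) * (A n * (L (suc k) n * T₂) * Y)
          ≈⟨ prove (q ∷ A n ∷ L k n ∷ T₂ ∷ Y ∷ e k ∷ L (suc k) n ∷ [])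
              ((I ⊖ v0) ⊗ (v1 ⊗ (v2 ⊗ v3) ⊗ v4) ⊕ v0 ⊗ (I ⊕ v5) ⊗ (v1 ⊗ (v6 ⊗ v3) ⊗ v4))
              (v1 ⊗ (((I ⊖ v0) ⊗ v2 ⊕ v0 ⊗ ((I ⊕ v5) ⊗ v6)) ⊗ v3) ⊗ v4) ≡.refl ⟩
        A n * (((1# - q) * L k n + q * ((1# + e k) * L (suc k) n)) * T₂) * Y ≈⟨ *-congʳ (*-congˡ (*-congʳ (+-congˡ (*-congˡ (sym (L-sucˡ k n)))))) ⟩
        A n * (((1# - q) * L k n + q * (L k n * (1# + e (k ℕ.+ n)))) * T₂) * Y ≈⟨ *-congʳ (*-congˡ (*-congʳ (+-congˡ (*-congˡ (*-congˡ (+-congˡ (e-f (k ℕ.+ n)))))))) ⟩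
        A n * (((1# - q) * L k n + q * (L k n * (1# + q ^ 5 * f (k ℕ.+ n)))) * T₂) * Y
          ≈⟨ prove (q ∷ A n ∷ L k n ∷ T₂ ∷ Y ∷ f (k ℕ.+ n) ∷ [])
              (v1 ⊗ (((I ⊖ v0) ⊗ v2 ⊕ v0 ⊗ (v2 ⊗ (I ⊕ v0 ⊛ 5 ⊗ v5))) ⊗ v3) ⊗ v4) (v1 ⊗ (v2 ⊗ ((I ⊕ v0 ⊛ 6 ⊗ v5) ⊗ v3)) ⊗ v4) ≡.refl ⟩
        A n * (L k n * ((1# + q ^ 6 * f (k ℕ.+ n)) * T₂)) * Y ≈⟨ *-congʳ (*-congˡ (*-congˡ (trans (*-congʳ (+-congˡ (sym (q^-+ 6 ((k ℕ.+ n) ℕ.* 6))))) (sym (T-suc (suc (k ℕ.+ n))))))) ⟩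
        t k n ∎
        where
        T₂ = T (suc (suc (k ℕ.+ n)))
        Y = yⁿ n

    -- The telescoping sequence of the second recurrence.
    v : ℕ → ℕ → Carrier
    v k zero = 0#
    v k (suc n) = - (e k * (A n * (1# - e n) * (L (suc k) n * T (suc (suc (suc (k ℕ.+ n)))))) * y) * yⁿ n

    v-summable : ∀ k → Summable (v k)
    v-summable k zero = ord-0
    v-summable k (suc n) = ord-cong (prove (w ∷ y ∷ yⁿ n ∷ []) ((⊝ v0) ⊗ (v1 ⊗ v2)) ((⊝ (v0 ⊗ v1)) ⊗ v2) ≡.refl)
      (ord-*ˡ (- w) (ord-cong (yⁿ-suc n) (ord-≥ (ℕ.m≤m*n (suc n) (suc (suc z))))))
      where w = e k * (A n * (1# - e n) * (L (suc k) n * T (suc (suc (suc (k ℕ.+ n))))))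

    p̃-rec : ∀ k → p̃ k ≈ (1# - x) * p (suc k) + x * (1# + q ^ 2 * e k) * p̃ (suc k)
    p̃-rec k = begin
      p̃ k ≈⟨ prove (p̃ k ∷ (1# - x) * p (suc k) ∷ c * p̃ (suc k) ∷ []) v0 ((v0 ⊖ v1) ⊖ v2 ⊕ (v1 ⊕ v2)) ≡.refl ⟩
      p̃ k - (1# - x) * p (suc k) - c * p̃ (suc k) + rhs ≈⟨ +-congʳ (trans (+-cong (trans (+-congˡ (-‿cong (∑-*ˡ _ (t-summable (suc k))))) (∑-- (u-summable k) s₁)) (-‿cong (∑-*ˡ _ (u-summable (suc k)))))
          (∑-- (λ n → ord-- (u-summable k n) (s₁ n)) s₂)) ⟩
      ∑ (λ n → u k n - (1# - x) * t (suc k) n - c * u (suc k) n) + rhs ≈⟨ +-congʳ (∑-telescope (v k) (v-summable k) termwise refl) ⟩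
      0# + rhs ≈⟨ +-identityˡ rhs ⟩
      rhs ∎
      where
      c = x * (1# + q ^ 2 * e k)
      rhs = (1# - x) * p (suc k) + c * p̃ (suc k)
      s₁ : Summable (λ n → (1# - x) * t (suc k) n)
      s₁ n = ord-*ˡ _ (t-summable (suc k) n)
      s₂ : Summable (λ n → c * u (suc k) n)
      s₂ n = ord-*ˡ _ (u-summable (suc k) n)
      T-step : ∀ n → T (suc (suc (k ℕ.+ n))) ≈ (1# + q ^ 7 * (e k * f n)) * T (suc (suc (suc (k ℕ.+ n))))
      T-step n = trans (T-suc (suc (suc (k ℕ.+ n)))) (*-congʳ (+-congˡ (trans (q^-≡ (≡.cong (12 ℕ.+_) (≡.refl {x = (k ℕ.+ n) ℕ.* 6})))
        (trans (q^-+ 7 (5 ℕ.+ (k ℕ.+ n) ℕ.* 6)) (*-congˡ (e-+ k n))))))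
      termwise : ∀ n → u k n - (1# - x) * t (suc k) n - c * u (suc k) n ≈ v k (suc n) - v k n
      termwise zero = begin
        1# * (1# * T (suc (suc (k ℕ.+ 0)))) * 1# - (1# - x) * (1# * (1# * T (suc (suc (k ℕ.+ 0)))) * 1#) - c * (1# * (1# * T₃) * 1#)
          ≈⟨ +-congʳ (+-cong (*-congʳ (*-congˡ (*-congˡ (T-step 0)))) (-‿cong (*-congˡ (*-congʳ (*-congˡ (*-congˡ (T-step 0))))))) ⟩
        1# * (1# * ((1# + q ^ 7 * (e k * 1#)) * T₃)) * 1# - (1# - x) * (1# * (1# * ((1# + q ^ 7 * (e k * 1#)) * T₃)) * 1#) - c * (1# * (1# * T₃) * 1#)
          ≈⟨ prove (q ∷ x ∷ e k ∷ T₃ ∷ []) (I ⊗ (I ⊗ ((I ⊕ v0 ⊛ 7 ⊗ (v2 ⊗ I)) ⊗ v3)) ⊗ I ⊖ (I ⊖ v1) ⊗ (I ⊗ (I ⊗ ((I ⊕ v0 ⊛ 7 ⊗ (v2 ⊗ I)) ⊗ v3)) ⊗ I) ⊖ (v1 ⊗ (I ⊕ v0 ⊛ 2 ⊗ v2)) ⊗ (I ⊗ (I ⊗ v3) ⊗ I))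
              ((⊝ (v2 ⊗ (I ⊗ (I ⊖ v0 ⊛ 5) ⊗ (I ⊗ v3)) ⊗ (v0 ⊗ (v0 ⊗ v1)))) ⊗ I ⊖ ø) ≡.refl ⟩
        v k 1 - 0# ∎
        where T₃ = T (suc (suc (suc (k ℕ.+ 0))))
      termwise (suc n) = begin
        u k m - (1# - x) * t (suc k) m - c * u (suc k) m
          ≈⟨ +-cong (+-cong (*-congʳ (*-congˡ (*-cong (L-sucˡ k n) (T-step m)))) (-‿cong (*-congˡ (*-congʳ (*-congˡ (*-cong L′ (T-step m)))))))
                (-‿cong (*-congˡ (*-congʳ (*-congˡ (*-congʳ L′))))) ⟩
        A m * ((1# + e k) * L₁ * ((1# + q ^ 7 * (e k * f m)) * T₃)) * Y - (1# - x) * (A m * (L₁ * (1# + e k * f m) * ((1# + q ^ 7 * (e k * f m)) * T₃)) * Y)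
          - c * (A m * (L₁ * (1# + e k * f m) * T₃) * Y)
          ≈⟨ prove (q ∷ x ∷ e k ∷ f m ∷ A m ∷ L₁ ∷ T₃ ∷ Y ∷ [])
              (v4 ⊗ ((I ⊕ v2) ⊗ v5 ⊗ ((I ⊕ v0 ⊛ 7 ⊗ (v2 ⊗ v3)) ⊗ v6)) ⊗ v7 ⊖ (I ⊖ v1) ⊗ (v4 ⊗ (v5 ⊗ (I ⊕ v2 ⊗ v3) ⊗ ((I ⊕ v0 ⊛ 7 ⊗ (v2 ⊗ v3)) ⊗ v6)) ⊗ v7)
                ⊖ (v1 ⊗ (I ⊕ v0 ⊛ 2 ⊗ v2)) ⊗ (v4 ⊗ (v5 ⊗ (I ⊕ v2 ⊗ v3) ⊗ v6) ⊗ v7))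
              ((⊝ (v2 ⊗ (v4 ⊗ (I ⊖ v0 ⊛ 5 ⊗ v3) ⊗ (v5 ⊗ (I ⊕ v2 ⊗ v3) ⊗ v6)) ⊗ (v0 ⊗ (v0 ⊗ v1)))) ⊗ v7 ⊖ (⊝ (v2 ⊗ ((I ⊖ v3) ⊗ v4 ⊗ (v5 ⊗ ((I ⊕ v0 ⊛ 7 ⊗ (v2 ⊗ v3)) ⊗ v6))) ⊗ v7))) ≡.refl ⟩
        - (e k * (A m * (1# - q ^ 5 * f m) * (L₁ * (1# + e k * f m) * T₃)) * y) * Y - - (e k * ((1# - f m) * A m * (L₁ * ((1# + q ^ 7 * (e k * f m)) * T₃))) * Y)
          ≈⟨ +-cong (*-congʳ (-‿cong (*-congʳ (*-congˡ (*-cong (*-congˡ (+-congˡ (-‿cong (sym (e-f m))))) (*-congʳ (sym L′)))))))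
                (-‿cong (-‿cong (*-cong (*-congˡ (*-cong (trans (binom-suc 5 5 n) (*-comm _ _)) (*-congˡ (trans (sym (T-step m)) (reflexive (≡.cong (λ i → T (suc (suc i))) (ℕ.+-suc k n)))))))
                  (yⁿ-suc n)))) ⟩
        v k (suc m) - - (e k * (A n * (1# - e n) * (L₁ * T (suc (suc (suc (k ℕ.+ n)))))) * (y * yⁿ n))
          ≈⟨ +-congˡ (-‿cong (prove (e k * (A n * (1# - e n) * (L₁ * T (suc (suc (suc (k ℕ.+ n)))))) ∷ y ∷ yⁿ n ∷ []) (⊝ (v0 ⊗ (v1 ⊗ v2))) ((⊝ (v0 ⊗ v1)) ⊗ v2) ≡.refl)) ⟩
        v k (suc m) - v k m ∎
        where
        m = suc n
        L₁ = L (suc k) n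
        T₃ = T (suc (suc (suc (k ℕ.+ m))))
        Y = yⁿ m
        L′ : L (suc k) m ≈ L₁ * (1# + e k * f m)
        L′ = *-congˡ (+-congˡ (trans (reflexive (≡.cong e (≡.sym (ℕ.+-suc k n)))) (e-+ k m)))

    near-a : ∀ k (g : ℕ → Carrier) → (∀ n → Ord k (g n - 1#)) → Ord k (∑ (λ n → A n * g n * yⁿ n) - a)
    near-a k g h = ord-cong (sym (∑-- {λ n → A n * g n * yⁿ n} {λ n → A n * yⁿ n} (z^-summable (λ n → A n * g n) (suc z)) (z^-summable A (suc z))))
      (ord-∑ (λ n → ord-- (z^-summable (λ n → A n * g n) (suc z) n) (z^-summable A (suc z) n))
        λ n → ord-cong (prove (A n ∷ g n ∷ yⁿ n ∷ []) (v0 ⊗ v2 ⊗ (v1 ⊖ I)) (v0 ⊗ v1 ⊗ v2 ⊖ v0 ⊗ v2) ≡.refl) (ord-*ˡ _ (h n)))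

    p-near : ∀ k → Ord k (p k - a)
    p-near k = near-a k _ λ n → near-* (L-near k n) (T-near (suc (k ℕ.+ n)) (ℕ.≤-trans (ℕ.m≤m+n k n) (ℕ.n≤1+n _)))

    p̃-near : ∀ k → Ord k (p̃ k - a)
    p̃-near k = near-a k _ λ n → near-* (L-near k n) (T-near (suc (suc (k ℕ.+ n))) (ℕ.≤-trans (ℕ.m≤m+n k n) (ℕ.≤-trans (ℕ.n≤1+n _) (ℕ.n≤1+n _))))

    module _ (P Q : ℕ → Carrier) (l : Carrier) (P-rec : ∀ k → P k ≈ Q k + q * (1# + e k) * P (suc k))
      (Q-rec : ∀ k → Q k ≈ (1# - x) * (1# - q) * P (suc k) + x * (1# + q ^ 2 * e k) * Q (suc k))
      (P-lim : ∀ k → Ord k (P k - l)) (Q-lim : ∀ k → Ord k (Q k - (1# - q) * l)) where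
      private
        δ ε : ℕ → Carrier
        δ k = P k * a - l * p k
        ε k = Q k * a - (1# - q) * l * p̃ k
        both : ∀ k → δ k ≈ 0# × ε k ≈ 0#
        both = pair-zero (λ _ → 1#) (λ k → q * (1# + e k)) (λ _ → (1# - x) * (1# - q)) (λ k → x * (1# + q ^ 2 * e k)) δ ε
          (λ k → trans (+-cong (*-congʳ (P-rec k)) (-‿cong (*-congˡ (p-rec k))))
            (prove (Q k ∷ q * (1# + e k) ∷ P (suc k) ∷ a ∷ l ∷ q ∷ p̃ k ∷ p (suc k) ∷ [])
              ((v0 ⊕ v1 ⊗ v2) ⊗ v3 ⊖ v4 ⊗ ((I ⊖ v5) ⊗ v6 ⊕ v1 ⊗ v7)) (I ⊗ (v0 ⊗ v3 ⊖ (I ⊖ v5) ⊗ v4 ⊗ v6) ⊕ v1 ⊗ (v2 ⊗ v3 ⊖ v4 ⊗ v7)) ≡.refl))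
          (λ k → trans (+-cong (*-congʳ (Q-rec k)) (-‿cong (*-congˡ (p̃-rec k))))
            (prove (x ∷ q ∷ P (suc k) ∷ x * (1# + q ^ 2 * e k) ∷ Q (suc k) ∷ a ∷ l ∷ p (suc k) ∷ p̃ (suc k) ∷ [])
              (((I ⊖ v0) ⊗ (I ⊖ v1) ⊗ v2 ⊕ v3 ⊗ v4) ⊗ v5 ⊖ (I ⊖ v1) ⊗ v6 ⊗ ((I ⊖ v0) ⊗ v7 ⊕ v3 ⊗ v8))
              ((I ⊖ v0) ⊗ (I ⊖ v1) ⊗ (v2 ⊗ v5 ⊖ v6 ⊗ v7) ⊕ v3 ⊗ (v4 ⊗ v5 ⊖ (I ⊖ v1) ⊗ v6 ⊗ v8)) ≡.refl))
          (λ k → ord-cong (prove (P k ∷ l ∷ a ∷ p k ∷ []) ((v0 ⊖ v1) ⊗ v2 ⊖ v1 ⊗ (v3 ⊖ v2)) (v0 ⊗ v2 ⊖ v1 ⊗ v3) ≡.refl)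
            (ord-- (ord-*ʳ a (P-lim k)) (ord-*ˡ l (p-near k))))
          (λ k → ord-cong (prove (Q k ∷ (1# - q) * l ∷ a ∷ p̃ k ∷ []) ((v0 ⊖ v1) ⊗ v2 ⊖ v1 ⊗ (v3 ⊖ v2)) (v0 ⊗ v2 ⊖ v1 ⊗ v3) ≡.refl)
            (ord-- (ord-*ʳ a (Q-lim k)) (ord-*ˡ _ (p̃-near k))))

      P-value : P 0 * a ≈ l * p 0
      P-value = from-zero (proj₁ (both 0))

      Q-value : Q 0 * a ≈ (1# - q) * l * p̃ 0
      Q-value = from-zero (proj₂ (both 0))

  B : ℕ → Carrier
  B = binom 10 11

  A-B : ∀ n → A n * (L 0 n * T (suc n)) ≈ T 1 * B n
  A-B zero = prove (T 1 ∷ []) (I ⊗ (I ⊗ v0)) (v0 ⊗ I) ≡.refl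
  A-B (suc n) = cancel (1# - f² (suc n)) (unital-1- (ord-≥ {n = suc n ℕ.* 12} (s≤s z≤n))) (begin
    (1# - f² m) * (A m * (L 0 n * (1# + e n) * T (suc m))) ≈⟨ *-congʳ (+-congˡ (-‿cong f²-f)) ⟩
    (1# - f m * f m) * (A m * (L 0 n * (1# + e n) * T (suc m)))
      ≈⟨ prove (f m ∷ A m ∷ L 0 n ∷ e n ∷ T (suc m) ∷ []) ((I ⊖ v0 ⊗ v0) ⊗ (v1 ⊗ (v2 ⊗ (I ⊕ v3) ⊗ v4))) ((I ⊖ v0) ⊗ v1 ⊗ (v2 ⊗ ((I ⊕ v0) ⊗ v4)) ⊗ (I ⊕ v3)) ≡.refl ⟩
    (1# - f m) * A m * (L 0 n * ((1# + f m) * T (suc m))) * (1# + e n) ≈⟨ *-congʳ (*-cong (binom-suc 5 5 n) (*-congˡ (sym (T-suc m)))) ⟩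
    (1# - e n) * A n * (L 0 n * T m) * (1# + e n)
      ≈⟨ prove (e n ∷ A n ∷ L 0 n * T m ∷ []) ((I ⊖ v0) ⊗ v1 ⊗ v2 ⊗ (I ⊕ v0)) ((I ⊖ v0 ⊗ v0) ⊗ (v1 ⊗ v2)) ≡.refl ⟩
    (1# - e n * e n) * (A n * (L 0 n * T m)) ≈⟨ *-cong (+-congˡ (-‿cong e²)) (A-B n) ⟩
    (1# - q ^ (10 ℕ.+ n ℕ.* 12)) * (T 1 * B n) ≈⟨ prove (q ^ (10 ℕ.+ n ℕ.* 12) ∷ T 1 ∷ B n ∷ []) ((I ⊖ v0) ⊗ (v1 ⊗ v2)) (v1 ⊗ ((I ⊖ v0) ⊗ v2)) ≡.refl ⟩
    T 1 * ((1# - q ^ (10 ℕ.+ n ℕ.* 12)) * B n) ≈⟨ *-congˡ (binom-suc 10 11 n) ⟨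
    T 1 * ((1# - f² m) * B m) ≈⟨ prove (f² m ∷ T 1 ∷ B m ∷ []) (v1 ⊗ ((I ⊖ v0) ⊗ v2)) ((I ⊖ v0) ⊗ (v1 ⊗ v2)) ≡.refl ⟩
    (1# - f² m) * (T 1 * B m) ∎)
    where
    m = suc n
    f² : ℕ → Carrier
    f² m = q ^ (m ℕ.* 12)
    f²-f : f² m ≈ f m * f m
    f²-f = trans (q^-≡ (ℕ.*-distribˡ-+ m 6 6)) (q^-+ (m ℕ.* 6) (m ℕ.* 6))
    e² : e n * e n ≈ q ^ (10 ℕ.+ n ℕ.* 12)
    e² = trans (sym (q^-+ (5 ℕ.+ n ℕ.* 6) _)) (q^-≡ (lemma n))
      where
      open import Data.Nat.Tactic.RingSolver using (solve-∀)
      lemma : ∀ n → 5 ℕ.+ n ℕ.* 6 ℕ.+ (5 ℕ.+ n ℕ.* 6) ≡ 10 ℕ.+ n ℕ.* 12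
      lemma = solve-∀

module Values where
  open import Data.Fin.Base using (suc)
  open import Data.Vec.Base using ([]; _∷_)
  open Solver
  open Links
  open Identification public
  open Heine public using (poch⁻; poch⁺; poch⁻-suc; poch⁺-suc; near⁻; near⁺; ⟶-near; near-*; near-1+; unital⁻; unital⁺; q^-+; q^-≡; dissect; poch-square; q-binomial; z^-summable; T; L; A-B; e; f; e-f; binom; binom-suc; k≤)
  module H = Heine
  open S using () renaming (_*_ to _✶_)

  Λ-- : ∀ x y → Λ x - Λ y ≈ Λ (x S.- y)
  Λ-- x y = begin
    Λ x - Λ y ≈⟨ +-congʳ (Λ-cong (SP.prove (x ∷ y ∷ []) v0 (v0 ⊖ v1 ⊕ v1) ≡.refl)) ⟩
    Λ (x S.- y S.+ y) - Λ y ≈⟨ +-congʳ (Λ-+ _ _) ⟩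
    Λ (x S.- y) + Λ y - Λ y ≈⟨ prove (Λ (x S.- y) ∷ Λ y ∷ []) (v0 ⊕ v1 ⊖ v1) v0 ≡.refl ⟩
    Λ (x S.- y) ∎

  Λ-near : ∀ {n x u} → Ordˢ n (u S.- S.1#) → Ord n (Λ (x ✶ u) - Λ x)
  Λ-near {x = x} {u} o = ord-cong (sym (Λ-- _ _)) (ordˢ-Λ (ordˢ-cong (SP.prove (x ∷ u ∷ []) (v0 ⊗ (v1 ⊖ I)) (v0 ⊗ v1 ⊖ v0) ≡.refl) (ordˢ-* x o)))

  nearˢ-* : ∀ {n x y} → Ordˢ n (x S.- S.1#) → Ordˢ n (y S.- S.1#) → Ordˢ n (x ✶ y S.- S.1#)
  nearˢ-* {x = x} {y} o p = ordˢ-cong (SP.prove (x ∷ y ∷ []) (v0 ⊗ (v1 ⊖ I) ⊕ (v0 ⊖ I)) (v0 ⊗ v1 ⊖ I) ≡.refl) (ordˢ-+ (ordˢ-* x p) o)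

  B-near : ∀ {n} x c {v w} → Ord n v → Ord n w → Ord n (Λ (x ✶ B c v w) - Λ (x ✶ den 1 c))
  B-near x c {v} {w} ov ow = ord-cong (+-congʳ (Λ-cong (SP.prove (x ∷ den 1 c ∷ num 2 (- v) ∷ den 3 w ∷ []) ((v0 ⊗ v1) ⊗ (v2 ⊗ v3)) (v0 ⊗ (v1 ⊗ v2 ⊗ v3)) ≡.refl)))
    (Λ-near (nearˢ-* (num-ord (ord-neg ov)) (den-ord ow)))

  B-near₁ : ∀ {n} c {v w} → Ord n v → Ord n w → Ord n (Λ (B c v w) - Λ (den 1 c))
  B-near₁ c ov ow = ord-cong (+-cong (Λ-cong (S.*-identityˡ _)) (-‿cong (Λ-cong (S.*-identityˡ _)))) (B-near S.1# c ov ow)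

  Λ-B-cong : ∀ {c v v′ w w′} → v ≈ v′ → w ≈ w′ → Λ (B c v w) ≈ Λ (B c v′ w′)
  Λ-B-cong p r = Λ-cong (S.*-cong (S.*-congˡ (num-cong (-‿cong p))) (den-cong r))

  Λ-R-cong : ∀ {w w′} → w ≈ w′ → Λ (R w) ≈ Λ (R w′)
  Λ-R-cong p = Λ-cong (S.*-congˡ (S.*-cong (S.*-congˡ (num-cong (-‿cong (*-congʳ p)))) (den-cong p)))

  Λ-den : ∀ a → Λ (den 1 (q ^ a)) ≈ poch⁺ (suc a) 0
  Λ-den a = trans (Λ-cong (den-cong (q^-≡ (≡.sym (ℕ.+-identityʳ a))))) (trans (first-order-unique (λ k → 1# + q ^ suc (a ℕ.+ k))
    (λ k → Λ (den 1 (q ^ (a ℕ.+ k)))) (λ k → poch⁺ (suc a ℕ.+ k) 0)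
    (λ k → trans (E-rec (q ^ (a ℕ.+ k))) (*-cong (+-congˡ (*-comm _ q)) (Λ-cong (den-cong (trans (*-comm _ q) (q^-≡ (≡.sym (ℕ.+-suc a k))))))))
    (λ k → trans (poch⁺-suc (suc a ℕ.+ k) 0) (*-congˡ (reflexive (≡.cong (λ i → poch⁺ i 0) (≡.trans (ℕ.+-assoc (suc a) k 1) (≡.cong (suc a ℕ.+_) (ℕ.+-comm k 1)))))))
    (⟶-near λ k → ord-cong (+-cong (Λ-cong (S.*-identityˡ _)) (-‿cong Λ-1)) (Λ-near {x = S.1#} (den-ord (ord-≥ (ℕ.m≤n+m k a)))))
    (⟶-near λ k → near⁺ (suc a ℕ.+ k) 0 (ℕ.m≤n+m k (suc a))) 0) (reflexive (≡.cong (λ i → poch⁺ i 0) (ℕ.+-identityʳ (suc a)))))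

  private
    ≤5 : ∀ c k → k ≤ c ℕ.+ k ℕ.* 6
    ≤5 c k = k≤ c 5 k

  value₆ : Λ (R q) * poch⁻ 1 11 * poch⁻ 4 11 * poch⁻ 5 11 * poch⁻ 6 11 * poch⁻ 7 11 * poch⁻ 9 11 * poch⁻ 10 11 ≈ 1#
  value₆ = cancel (c₁₀ * c₁₆ * c₃ * c₁₂ * c₅ * c₆ * c₈ * c₁₁ * c₁₂ * c₁₄)
    (unital-* (unital-* (unital-* (unital-* (unital-* (unital-* (unital-* (unital-* (unital-* (unital⁻ 9 11) (unital⁻ 15 11)) (unital⁻ 2 11)) (unital⁻ 11 11)) (unital⁻ 4 11)) (unital⁻ 5 11)) (unital⁻ 7 11)) (unital⁻ 10 11)) (unital⁻ 11 11)) (unital⁻ 13 11))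
    (begin
    M * (F₆ * c₁ * c₄ * c₅ * c₆ * c₇ * c₉ * c₁₀) ≈⟨ *-congˡ (*-congʳ (*-congʳ (*-congʳ (*-congʳ (*-congʳ (*-congʳ (*-congˡ (poch⁻-suc 1 11)))))))) ⟩
    M * (F₆ * ((1# - q ^ 1) * c₁₃) * c₄ * c₅ * c₆ * c₇ * c₉ * c₁₀)
      ≈⟨ prove (q ∷ F₆ ∷ c₃ ∷ c₄ ∷ c₅ ∷ c₆ ∷ c₇ ∷ c₈ ∷ c₉ ∷ c₁₀ ∷ c₁₁ ∷ c₁₂ ∷ c₁₃ ∷ c₁₄ ∷ c₁₆ ∷ [])
        ((v9 ⊗ v14 ⊗ v2 ⊗ v11 ⊗ v4 ⊗ v5 ⊗ v7 ⊗ v10 ⊗ v11 ⊗ v13) ⊗ (v1 ⊗ ((I ⊖ v0 ⊛ 1) ⊗ v12) ⊗ v3 ⊗ v4 ⊗ v5 ⊗ v6 ⊗ v8 ⊗ v9))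
        ((I ⊖ v0) ⊗ v1 ⊗ (I ⊗ v9 ⊗ v14) ⊗ (I ⊗ v2 ⊗ v3 ⊗ v4 ⊗ v5 ⊗ v6 ⊗ v7 ⊗ v8 ⊗ v9 ⊗ v10 ⊗ v11 ⊗ v12 ⊗ v13) ⊗ (I ⊗ v5 ⊗ v11) ⊗ v4) ≡.refl ⟩
    (1# - q) * F₆ * (1# * c₁₀ * c₁₆) * (1# * c₃ * c₄ * c₅ * c₆ * c₇ * c₈ * c₉ * c₁₀ * c₁₁ * c₁₂ * c₁₃ * c₁₄) * (1# * c₆ * c₁₂) * c₅
      ≈⟨ *-congʳ (*-cong (*-cong (*-congˡ (sym (trans (q-binomial 5 5 4) (dissect 1 10 5)))) (sym (dissect 11 3 0))) (sym (dissect 1 6 5))) ⟩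
    (1# - q) * F₆ * (a * poch⁻ 5 5) * poch⁻ 3 0 * poch⁻ 6 5 * c₅
      ≈⟨ prove (1# - q ∷ F₆ ∷ a ∷ poch⁻ 5 5 ∷ poch⁻ 3 0 ∷ poch⁻ 6 5 ∷ c₅ ∷ []) (v0 ⊗ v1 ⊗ (v2 ⊗ v3) ⊗ v4 ⊗ v5 ⊗ v6) (v0 ⊗ (v1 ⊗ v2) ⊗ (v3 ⊗ v4 ⊗ v5 ⊗ v6)) ≡.refl ⟩
    (1# - q) * (F₆ * a) * (poch⁻ 5 5 * poch⁻ 3 0 * poch⁻ 6 5 * c₅)
      ≈⟨ *-congʳ (*-congˡ (trans F₆-a (*-cong l-value p₀))) ⟩
    (1# - q) * ((1# + q + q ^ 2) * poch⁺ 3 0 * (T 1 * F₅)) * (poch⁻ 5 5 * poch⁻ 3 0 * poch⁻ 6 5 * c₅)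
      ≈⟨ prove (q ∷ poch⁺ 3 0 ∷ T 1 ∷ F₅ ∷ poch⁻ 5 5 ∷ poch⁻ 3 0 ∷ poch⁻ 6 5 ∷ c₅ ∷ [])
          ((I ⊖ v0) ⊗ ((I ⊕ v0 ⊕ v0 ⊛ 2) ⊗ v1 ⊗ (v2 ⊗ v3)) ⊗ (v4 ⊗ v5 ⊗ v6 ⊗ v7))
          ((v1 ⊗ v5) ⊗ (v2 ⊗ v6) ⊗ ((I ⊖ v0 ⊛ 3) ⊗ (v3 ⊗ v7)) ⊗ v4) ≡.refl ⟩
    poch⁺ 3 0 * poch⁻ 3 0 * (T 1 * poch⁻ 6 5) * ((1# - q ^ 3) * (F₅ * c₅)) * poch⁻ 5 5
      ≈⟨ *-cong (*-cong (*-cong (trans (poch-square 3 0) (dissect 5 6 1)) (poch-square 6 5)) (trans (*-congˡ (q-binomial 10 11 4)) (sym (poch⁻-suc 3 11)))) (dissect 1 5 5) ⟩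
    1# * c₆ * c₈ * c₁₀ * c₁₂ * c₁₄ * c₁₆ * c₁₂ * c₃ * (1# * c₅ * c₁₁)
      ≈⟨ prove (c₃ ∷ c₅ ∷ c₆ ∷ c₈ ∷ c₁₀ ∷ c₁₁ ∷ c₁₂ ∷ c₁₄ ∷ c₁₆ ∷ []) (I ⊗ v2 ⊗ v3 ⊗ v4 ⊗ v6 ⊗ v7 ⊗ v8 ⊗ v6 ⊗ v0 ⊗ (I ⊗ v1 ⊗ v5)) (v4 ⊗ v8 ⊗ v0 ⊗ v6 ⊗ v1 ⊗ v2 ⊗ v3 ⊗ v5 ⊗ v6 ⊗ v7 ⊗ I) ≡.refl ⟩
    M * 1# ∎)
    where
    F₆ = Λ (R q)
    c₁ = poch⁻ 1 11 ; c₃ = poch⁻ 3 11 ; c₄ = poch⁻ 4 11 ; c₅ = poch⁻ 5 11 ; c₆ = poch⁻ 6 11 ; c₇ = poch⁻ 7 11 ; c₈ = poch⁻ 8 11 ; c₉ = poch⁻ 9 11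
    c₁₀ = poch⁻ 10 11 ; c₁₁ = poch⁻ 11 11 ; c₁₂ = poch⁻ 12 11 ; c₁₃ = poch⁻ 13 11 ; c₁₄ = poch⁻ 14 11 ; c₁₆ = poch⁻ 16 11
    M = c₁₀ * c₁₆ * c₃ * c₁₂ * c₅ * c₆ * c₈ * c₁₁ * c₁₂ * c₁₄
    a = H.a 3
    F₅ = ∑ (λ n → H.B n * q ^ (n ℕ.* 5))
    l = Λ ((S.1# S.+ s) ✶ den 1 q)
    P Q : ℕ → Carrier
    P k = Λ (R (q ^ (1 ℕ.+ k ℕ.* 6)))
    Q k = (1# - q ^ 3) * Λ (B (q ^ 2) (q ^ (7 ℕ.+ k ℕ.* 6)) (q ^ (7 ℕ.+ k ℕ.* 6)))
    p₀ : H.p 3 0 ≈ T 1 * F₅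
    p₀ = trans (∑-cong (λ n → trans (*-congʳ (A-B n)) (*-assoc _ _ _)) (H.t-summable 3 0)) (sym (∑-*ˡ (T 1) (z^-summable H.B 4)))
    D₂ = Λ (den 1 (q ^ 2))
    l-D₂ : l ≈ (1# + q + q ^ 2) * D₂
    l-D₂ = begin
      l ≈⟨ trans (Λ-cong (S.trans (S.distribʳ _ _ _) (S.+-congʳ (S.*-identityˡ _)))) (Λ-+ _ _) ⟩
      Λ (den 1 q) + Λ (s ✶ den 1 q) ≈⟨ +-cong (E-rec q) (trans (Λ-s _) (*-congˡ (Λ-cong (σ-den 0 q)))) ⟩
      (1# + q * q) * Λ (den 1 (q * q)) + q * Λ (den 1 (q ^ 2)) ≈⟨ +-congʳ (*-congˡ (Λ-cong (den-cong (*-congˡ (sym (*-identityʳ q)))))) ⟩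
      (1# + q * q) * D₂ + q * D₂ ≈⟨ prove (q ∷ D₂ ∷ []) ((I ⊕ v0 ⊗ v0) ⊗ v1 ⊕ v0 ⊗ v1) ((I ⊕ v0 ⊕ v0 ⊛ 2) ⊗ v1) ≡.refl ⟩
      (1# + q + q ^ 2) * D₂ ∎
    l-value : l ≈ (1# + q + q ^ 2) * poch⁺ 3 0
    l-value = trans l-D₂ (*-congˡ (Λ-den 2))
    P-rec′ : ∀ k → P k ≈ Q k + q * (1# + e k) * P (suc k)
    P-rec′ k = trans (R-rec w) (+-cong (*-congˡ (Λ-B-cong w⁶ w⁶)) (*-cong (*-congˡ (+-congˡ (prove (q ∷ q ^ (k ℕ.* 6) ∷ []) ((v0 ⊗ v1) ⊗ v0 ⊛ 4) (v0 ⊗ (v0 ⊗ (v0 ⊗ (v0 ⊗ (v0 ⊗ v1))))) ≡.refl))) (Λ-R-cong w⁶)))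
      where
      w = q ^ (1 ℕ.+ k ℕ.* 6)
      w⁶ : w * q ^ 6 ≈ q ^ (7 ℕ.+ k ℕ.* 6)
      w⁶ = trans (*-comm _ _) (sym (q^-+ 6 (1 ℕ.+ k ℕ.* 6)))
    Q-rec′ : ∀ k → Q k ≈ (1# - q ^ 3) * (1# - q) * P (suc k) + q ^ 3 * (1# + q ^ 2 * e k) * Q (suc k)
    Q-rec′ k = begin
      (1# - q ^ 3) * Λ (B (q ^ 2) w w) ≈⟨ *-congˡ (trans (V-rec w) (+-congˡ (*-congˡ (Λ-B-cong w⁶ w⁶)))) ⟩
      (1# - q ^ 3) * ((1# - q) * P (suc k) + q ^ 3 * (1# + w) * Λ (B (q ^ 2) w′ w′)) ≈⟨ *-congˡ (+-congˡ (*-congʳ (*-congˡ (+-congˡ (q^-+ 2 (5 ℕ.+ k ℕ.* 6)))))) ⟩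
      (1# - q ^ 3) * ((1# - q) * P (suc k) + q ^ 3 * (1# + q ^ 2 * e k) * Λ (B (q ^ 2) w′ w′))
        ≈⟨ prove (q ∷ P (suc k) ∷ e k ∷ Λ (B (q ^ 2) w′ w′) ∷ []) ((I ⊖ v0 ⊛ 3) ⊗ ((I ⊖ v0) ⊗ v1 ⊕ v0 ⊛ 3 ⊗ (I ⊕ v0 ⊛ 2 ⊗ v2) ⊗ v3)) ((I ⊖ v0 ⊛ 3) ⊗ (I ⊖ v0) ⊗ v1 ⊕ v0 ⊛ 3 ⊗ (I ⊕ v0 ⊛ 2 ⊗ v2) ⊗ ((I ⊖ v0 ⊛ 3) ⊗ v3)) ≡.refl ⟩
      (1# - q ^ 3) * (1# - q) * P (suc k) + q ^ 3 * (1# + q ^ 2 * e k) * Q (suc k) ∎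
      where
      w = q ^ (7 ℕ.+ k ℕ.* 6)
      w′ = q ^ (7 ℕ.+ suc k ℕ.* 6)
      w⁶ : w * q ^ 6 ≈ w′
      w⁶ = trans (*-comm _ _) (sym (q^-+ 6 (7 ℕ.+ k ℕ.* 6)))
    F₆-a : F₆ * a ≈ l * H.p 3 0
    F₆-a = trans (*-congʳ (Λ-R-cong (sym (*-identityʳ q)))) (H.P-value 3 P Q l P-rec′ Q-rec′
      (λ k → B-near (S.1# S.+ s) q (ord-*ʳ _ (ord-≥ (≤5 1 k))) (ord-≥ (≤5 1 k)))
      (λ k → ord-cong (+-congˡ (-‿cong (begin
          (1# - q ^ 3) * D₂ ≈⟨ prove (q ∷ D₂ ∷ []) ((I ⊖ v0 ⊛ 3) ⊗ v1) ((I ⊖ v0) ⊗ ((I ⊕ v0 ⊕ v0 ⊛ 2) ⊗ v1)) ≡.refl ⟩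
          (1# - q) * ((1# + q + q ^ 2) * D₂) ≈⟨ *-congˡ l-D₂ ⟨
          (1# - q) * l ∎)))
        (ord-cong (prove (q ∷ Λ (B (q ^ 2) (q ^ (7 ℕ.+ k ℕ.* 6)) (q ^ (7 ℕ.+ k ℕ.* 6))) ∷ D₂ ∷ []) ((I ⊖ v0 ⊛ 3) ⊗ (v1 ⊖ v2)) ((I ⊖ v0 ⊛ 3) ⊗ v1 ⊖ (I ⊖ v0 ⊛ 3) ⊗ v2) ≡.refl)
          (ord-*ˡ _ (B-near₁ (q ^ 2) (ord-≥ (≤5 7 k)) (ord-≥ (≤5 7 k)))))))

  -- With X = q⁶ⁿ, both sides of the evaluation of p̃ differ by u (n + 1) - u n, where u n = - T 1 * B n * q³ⁿ * (1 - X).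
  p̃-value : q * (1# - q ^ 2) * H.p̃ 1 0 ≈ (1# - q ^ 7) * (T 1 * ∑ (λ n → H.B n * q ^ (n ℕ.* 9))) - (1# - q) * (T 1 * ∑ (λ n → H.B n * q ^ (n ℕ.* 3)))
  p̃-value = from-zero (begin
    q * (1# - q ^ 2) * H.p̃ 1 0 - ((1# - q ^ 7) * (T 1 * ∑ b₉) - (1# - q) * (T 1 * ∑ b₃))
      ≈⟨ +-cong (∑-*ˡ _ (H.u-summable 1 0)) (-‿cong (+-cong (times b₉ (1# - q ^ 7) s₉) (-‿cong (times b₃ (1# - q) s₃)))) ⟩
    ∑ (λ n → q * (1# - q ^ 2) * H.u 1 0 n) - (∑ (λ n → (1# - q ^ 7) * (T 1 * b₉ n)) - ∑ (λ n → (1# - q) * (T 1 * b₃ n)))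
      ≈⟨ trans (+-congˡ (-‿cong (∑-- t₉ t₃))) (∑-- (λ n → ord-*ˡ _ (H.u-summable 1 0 n)) (λ n → ord-- (t₉ n) (t₃ n))) ⟩
    ∑ (λ n → q * (1# - q ^ 2) * H.u 1 0 n - ((1# - q ^ 7) * (T 1 * b₉ n) - (1# - q) * (T 1 * b₃ n)))
      ≈⟨ ∑-telescope v v-summable termwise (prove (T 1 * H.B 0 * q ^ 0 ∷ []) (⊝ (v0 ⊗ (I ⊖ I))) ø ≡.refl) ⟩
    0# ∎)
    where
    b₉ b₃ v t : ℕ → Carrier
    b₉ n = H.B n * q ^ (n ℕ.* 9)
    b₃ n = H.B n * q ^ (n ℕ.* 3)
    s₉ = z^-summable H.B 8
    s₃ = z^-summable H.B 2
    t₉ : Summable (λ n → (1# - q ^ 7) * (T 1 * b₉ n))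
    t₉ n = ord-*ˡ _ (ord-*ˡ _ (s₉ n))
    t₃ : Summable (λ n → (1# - q) * (T 1 * b₃ n))
    t₃ n = ord-*ˡ _ (ord-*ˡ _ (s₃ n))
    times : ∀ b c → Summable b → c * (T 1 * ∑ b) ≈ ∑ (λ n → c * (T 1 * b n))
    times b c s = trans (*-congˡ (∑-*ˡ (T 1) s)) (∑-*ˡ c (λ n → ord-*ˡ _ (s n)))
    v n = - (T 1 * H.B n * q ^ (n ℕ.* 3) * (1# - f n))
    v-summable : Summable v
    v-summable n = ord-neg (ord-*ʳ _ (z^-summable (λ n → T 1 * H.B n) 2 n))
    t n = H.A n * (L 0 n * T (suc (suc n)))
    t-B : ∀ n → T 1 * H.B n ≈ (1# + q ^ 6 * f n) * t n
    t-B n = trans (sym (A-B n)) (trans (*-congˡ (*-congˡ (trans (H.T-suc (suc n)) (*-congʳ (+-congˡ (q^-+ 6 (n ℕ.* 6)))))))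
      (prove (H.A n ∷ L 0 n ∷ T (suc (suc n)) ∷ q ^ 6 * f n ∷ []) (v0 ⊗ (v1 ⊗ ((I ⊕ v3) ⊗ v2))) ((I ⊕ v3) ⊗ (v0 ⊗ (v1 ⊗ v2))) ≡.refl))
    f² : ∀ n → q ^ (n ℕ.* 12) ≈ f n * f n
    f² n = trans (q^-≡ (ℕ.*-distribˡ-+ n 6 6)) (q^-+ (n ℕ.* 6) (n ℕ.* 6))
    next : ∀ n → T 1 * H.B (suc n) * (1# - q ^ 6 * f n) ≈ t n * (1# - q ^ 10 * (f n * f n))
    next n = cancel (1# + q ^ 6 * f n) (near-1+ (ord-cong (q^-+ 6 (n ℕ.* 6)) (ord-≥ {n = 6 ℕ.+ n ℕ.* 6} (s≤s z≤n)))) (begin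
      (1# + q ^ 6 * f n) * (T 1 * H.B (suc n) * (1# - q ^ 6 * f n))
        ≈⟨ prove (q ^ 6 ∷ f n ∷ T 1 ∷ H.B (suc n) ∷ []) ((I ⊕ v0 ⊗ v1) ⊗ (v2 ⊗ v3 ⊗ (I ⊖ v0 ⊗ v1))) (v2 ⊗ ((I ⊖ (v0 ⊗ v0) ⊗ (v1 ⊗ v1)) ⊗ v3)) ≡.refl ⟩
      T 1 * ((1# - q ^ 6 * q ^ 6 * (f n * f n)) * H.B (suc n)) ≈⟨ *-congˡ (*-congʳ (+-congˡ (-‿cong (trans (*-cong (sym (q^-+ 6 6)) (sym (f² n))) (sym (q^-+ 12 (n ℕ.* 12))))))) ⟩
      T 1 * ((1# - q ^ (suc n ℕ.* 12)) * H.B (suc n)) ≈⟨ *-congˡ (trans (binom-suc 10 11 n) (*-congʳ (+-congˡ (-‿cong (trans (q^-+ 10 (n ℕ.* 12)) (*-congˡ (f² n))))))) ⟩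
      T 1 * ((1# - q ^ 10 * (f n * f n)) * H.B n) ≈⟨ prove (T 1 ∷ 1# - q ^ 10 * (f n * f n) ∷ H.B n ∷ []) (v0 ⊗ (v1 ⊗ v2)) (v1 ⊗ (v0 ⊗ v2)) ≡.refl ⟩
      (1# - q ^ 10 * (f n * f n)) * (T 1 * H.B n) ≈⟨ *-congˡ (t-B n) ⟩
      (1# - q ^ 10 * (f n * f n)) * ((1# + q ^ 6 * f n) * t n)
        ≈⟨ prove (1# - q ^ 10 * (f n * f n) ∷ 1# + q ^ 6 * f n ∷ t n ∷ []) (v0 ⊗ (v1 ⊗ v2)) (v1 ⊗ (v2 ⊗ v0)) ≡.refl ⟩
      (1# + q ^ 6 * f n) * (t n * (1# - q ^ 10 * (f n * f n))) ∎)
    termwise : ∀ n → q * (1# - q ^ 2) * H.u 1 0 n - ((1# - q ^ 7) * (T 1 * b₉ n) - (1# - q) * (T 1 * b₃ n)) ≈ v (suc n) - v n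
    termwise n = begin
      q * (1# - q ^ 2) * (t n * y) - ((1# - q ^ 7) * (T 1 * (H.B n * q ^ (n ℕ.* 9))) - (1# - q) * (T 1 * (H.B n * y)))
        ≈⟨ +-congˡ (-‿cong (+-cong (*-congˡ (trans (*-congˡ (*-congˡ (trans (q^-≡ (ℕ.*-distribˡ-+ n 3 6)) (q^-+ (n ℕ.* 3) (n ℕ.* 6))))) (trans (sym (*-assoc _ _ _)) (*-congʳ (t-B n)))))
            (-‿cong (*-congˡ (trans (sym (*-assoc _ _ _)) (*-congʳ (t-B n))))))) ⟩
      q * (1# - q ^ 2) * (t n * y) - ((1# - q ^ 7) * ((1# + q ^ 6 * f n) * t n * (y * f n)) - (1# - q) * ((1# + q ^ 6 * f n) * t n * y))
        ≈⟨ prove (q ∷ f n ∷ t n ∷ y ∷ []) (v0 ⊗ (I ⊖ v0 ⊛ 2) ⊗ (v2 ⊗ v3) ⊖ ((I ⊖ v0 ⊛ 7) ⊗ ((I ⊕ v0 ⊛ 6 ⊗ v1) ⊗ v2 ⊗ (v3 ⊗ v1)) ⊖ (I ⊖ v0) ⊗ ((I ⊕ v0 ⊛ 6 ⊗ v1) ⊗ v2 ⊗ v3)))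
            (⊝ ((v2 ⊗ (I ⊖ v0 ⊛ 10 ⊗ (v1 ⊗ v1))) ⊗ (v0 ⊛ 3 ⊗ v3)) ⊖ ⊝ ((I ⊕ v0 ⊛ 6 ⊗ v1) ⊗ v2 ⊗ v3 ⊗ (I ⊖ v1))) ≡.refl ⟩
      - (t n * (1# - q ^ 10 * (f n * f n)) * (q ^ 3 * y)) - - ((1# + q ^ 6 * f n) * t n * y * (1# - f n))
        ≈⟨ +-cong (-‿cong (*-cong (sym (next n)) (sym (q^-+ 3 (n ℕ.* 3))))) (-‿cong (-‿cong (*-congʳ (*-congʳ (sym (t-B n)))))) ⟩
      - (T 1 * H.B (suc n) * (1# - q ^ 6 * f n) * q ^ (suc n ℕ.* 3)) - v n
        ≈⟨ +-congʳ (-‿cong (trans (prove (T 1 * H.B (suc n) ∷ q ^ 6 * f n ∷ q ^ (suc n ℕ.* 3) ∷ []) (v0 ⊗ (I ⊖ v1) ⊗ v2) (v0 ⊗ v2 ⊗ (I ⊖ v1)) ≡.refl)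
            (*-congˡ (+-congˡ (-‿cong (sym (q^-+ 6 (n ℕ.* 6)))))))) ⟩
      v (suc n) - v n ∎
      where y = q ^ (n ℕ.* 3)

  value₅ : (Λ (B q (q ^ 2 * q) (q ^ 2)) + q * (1# + q) * Λ (B q (q ^ 5) (q ^ 5))) * poch⁻ 1 11 * poch⁻ 2 11 * poch⁻ 5 11 * poch⁻ 6 11 * poch⁻ 8 11 * poch⁻ 9 11 * poch⁻ 11 11 ≈ 1#
  value₅ = cancel (c₈ * c₁₄ * c₃ * c₄ * c₆ * c₇ * c₉ * c₁₀ * c₁₂ * c₁₂)
    (unital-* (unital-* (unital-* (unital-* (unital-* (unital-* (unital-* (unital-* (unital-* (unital⁻ 7 11) (unital⁻ 13 11)) (unital⁻ 2 11)) (unital⁻ 3 11)) (unital⁻ 5 11)) (unital⁻ 6 11)) (unital⁻ 8 11)) (unital⁻ 9 11)) (unital⁻ 11 11)) (unital⁻ 11 11))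
    (begin
    M * (F₅ * c₁ * c₂ * c₅ * c₆ * c₈ * c₉ * c₁₁) ≈⟨ *-congˡ (*-congʳ (*-congʳ (*-congʳ (*-congʳ (*-congʳ (*-congʳ (*-congˡ (poch⁻-suc 1 11)))))))) ⟩
    M * (F₅ * ((1# - q ^ 1) * c₁₃) * c₂ * c₅ * c₆ * c₈ * c₉ * c₁₁)
      ≈⟨ prove (q ∷ F₅ ∷ c₂ ∷ c₃ ∷ c₄ ∷ c₅ ∷ c₆ ∷ c₇ ∷ c₈ ∷ c₉ ∷ c₁₀ ∷ c₁₁ ∷ c₁₂ ∷ c₁₃ ∷ c₁₄ ∷ [])
        ((v8 ⊗ v14 ⊗ v3 ⊗ v4 ⊗ v6 ⊗ v7 ⊗ v9 ⊗ v10 ⊗ v12 ⊗ v12) ⊗ (v1 ⊗ ((I ⊖ v0 ⊛ 1) ⊗ v13) ⊗ v2 ⊗ v5 ⊗ v6 ⊗ v8 ⊗ v9 ⊗ v11))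
        ((I ⊖ v0) ⊗ v1 ⊗ (I ⊗ v8 ⊗ v14) ⊗ (I ⊗ v2 ⊗ v3 ⊗ v4 ⊗ v5 ⊗ v6 ⊗ v7 ⊗ v8 ⊗ v9 ⊗ v10 ⊗ v11 ⊗ v12 ⊗ v13) ⊗ (I ⊗ v6 ⊗ v12) ⊗ v9) ≡.refl ⟩
    (1# - q) * F₅ * (1# * c₈ * c₁₄) * (1# * c₂ * c₃ * c₄ * c₅ * c₆ * c₇ * c₈ * c₉ * c₁₀ * c₁₁ * c₁₂ * c₁₃) * (1# * c₆ * c₁₂) * c₉
      ≈⟨ *-congʳ (*-cong (*-cong (*-congˡ (sym (trans (q-binomial 5 5 2) (dissect 1 8 5)))) (sym (dissect 11 2 0))) (sym (dissect 1 6 5))) ⟩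
    (1# - q) * F₅ * (a * poch⁻ 3 5) * poch⁻ 2 0 * poch⁻ 6 5 * c₉
      ≈⟨ prove (1# - q ∷ F₅ ∷ a ∷ poch⁻ 3 5 ∷ poch⁻ 2 0 ∷ poch⁻ 6 5 ∷ c₉ ∷ []) (v0 ⊗ v1 ⊗ (v2 ⊗ v3) ⊗ v4 ⊗ v5 ⊗ v6) ((v1 ⊗ v2 ⊗ v0) ⊗ (v3 ⊗ v4 ⊗ v5 ⊗ v6)) ≡.refl ⟩
    F₅ * a * (1# - q) * (poch⁻ 3 5 * poch⁻ 2 0 * poch⁻ 6 5 * c₉) ≈⟨ *-congʳ F₅-a ⟩
    poch⁺ 2 0 * ((1# - q ^ 7) * (T 1 * ∑ b₉)) * (poch⁻ 3 5 * poch⁻ 2 0 * poch⁻ 6 5 * c₉)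
      ≈⟨ prove (q ∷ poch⁺ 2 0 ∷ T 1 ∷ ∑ b₉ ∷ poch⁻ 3 5 ∷ poch⁻ 2 0 ∷ poch⁻ 6 5 ∷ c₉ ∷ [])
          (v1 ⊗ ((I ⊖ v0 ⊛ 7) ⊗ (v2 ⊗ v3)) ⊗ (v4 ⊗ v5 ⊗ v6 ⊗ v7)) ((v1 ⊗ v5) ⊗ (v2 ⊗ v6) ⊗ ((I ⊖ v0 ⊛ 7) ⊗ (v3 ⊗ v7)) ⊗ v4) ≡.refl ⟩
    poch⁺ 2 0 * poch⁻ 2 0 * (T 1 * poch⁻ 6 5) * ((1# - q ^ 7) * (∑ b₉ * c₉)) * poch⁻ 3 5
      ≈⟨ *-cong (*-cong (*-cong (trans (poch-square 2 0) (dissect 5 4 1)) (poch-square 6 5)) (trans (*-congˡ (q-binomial 10 11 8)) (sym (poch⁻-suc 7 11)))) (dissect 1 3 5) ⟩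
    1# * c₄ * c₆ * c₈ * c₁₀ * c₁₂ * c₁₄ * c₁₂ * c₇ * (1# * c₃ * c₉)
      ≈⟨ prove (c₃ ∷ c₄ ∷ c₆ ∷ c₇ ∷ c₈ ∷ c₉ ∷ c₁₀ ∷ c₁₂ ∷ c₁₄ ∷ []) (I ⊗ v1 ⊗ v2 ⊗ v4 ⊗ v6 ⊗ v7 ⊗ v8 ⊗ v7 ⊗ v3 ⊗ (I ⊗ v0 ⊗ v5)) (v4 ⊗ v8 ⊗ v0 ⊗ v1 ⊗ v2 ⊗ v3 ⊗ v5 ⊗ v6 ⊗ v7 ⊗ v7 ⊗ I) ≡.refl ⟩
    M * 1# ∎)
    where
    c₁ = poch⁻ 1 11 ; c₂ = poch⁻ 2 11 ; c₃ = poch⁻ 3 11 ; c₄ = poch⁻ 4 11 ; c₅ = poch⁻ 5 11 ; c₆ = poch⁻ 6 11 ; c₇ = poch⁻ 7 11 ; c₈ = poch⁻ 8 11 ; c₉ = poch⁻ 9 11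
    c₁₀ = poch⁻ 10 11 ; c₁₁ = poch⁻ 11 11 ; c₁₂ = poch⁻ 12 11 ; c₁₃ = poch⁻ 13 11 ; c₁₄ = poch⁻ 14 11
    M = c₈ * c₁₄ * c₃ * c₄ * c₆ * c₇ * c₉ * c₁₀ * c₁₂ * c₁₂
    Q₀ = Λ (B q (q ^ 5) (q ^ 5))
    F₅ = Λ (B q (q ^ 2 * q) (q ^ 2)) + q * (1# + q) * Q₀
    b₉ b₃ : ℕ → Carrier
    b₉ n = H.B n * q ^ (n ℕ.* 9)
    b₃ n = H.B n * q ^ (n ℕ.* 3)
    a = H.a 1
    l = Λ (den 1 q)
    P Q : ℕ → Carrier
    P k = Λ (B q (q ^ (3 ℕ.+ k ℕ.* 6)) (q ^ (2 ℕ.+ k ℕ.* 6)))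
    Q k = (1# - q ^ 1) * Λ (B q (q ^ (5 ℕ.+ k ℕ.* 6)) (q ^ (5 ℕ.+ k ℕ.* 6)))
    q¹ : q ^ 1 ≈ q
    q¹ = *-identityʳ q
    l-value : l ≈ poch⁺ 2 0
    l-value = trans (Λ-cong (den-cong (sym q¹))) (Λ-den 1)
    p₀ : H.p 1 0 ≈ T 1 * ∑ b₃
    p₀ = trans (∑-cong (λ n → trans (*-congʳ (A-B n)) (*-assoc _ _ _)) (H.t-summable 1 0)) (sym (∑-*ˡ (T 1) (z^-summable H.B 2)))
    up : ∀ m n → q ^ m * q ^ n ≈ q ^ (n ℕ.+ m)
    up m n = trans (*-comm _ _) (sym (q^-+ n m))
    P-rec′ : ∀ k → P k ≈ Q k + q * (1# + e k) * P (suc k)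
    P-rec′ k = trans (Λ-B-cong (*-comm q w) H.refl) (trans (P₁-rec w) (+-cong (*-cong (+-congˡ (-‿cong (sym q¹))) (Λ-B-cong (up (2 ℕ.+ k ℕ.* 6) 3) (up (2 ℕ.+ k ℕ.* 6) 3)))
      (*-cong (*-congˡ (+-congˡ (up (2 ℕ.+ k ℕ.* 6) 3))) (Λ-B-cong (trans (*-comm _ q) (*-congˡ (up (2 ℕ.+ k ℕ.* 6) 6))) (up (2 ℕ.+ k ℕ.* 6) 6)))))
      where w = q ^ (2 ℕ.+ k ℕ.* 6)
    Q-rec′ : ∀ k → Q k ≈ (1# - q ^ 1) * (1# - q) * P (suc k) + q ^ 1 * (1# + q ^ 2 * e k) * Q (suc k)
    Q-rec′ k = begin
      (1# - q ^ 1) * Λ (B q w w) ≈⟨ *-congˡ (trans (Q₁-rec w) (+-cong (*-congˡ (Λ-B-cong (trans (*-comm _ q) (*-congˡ (up (5 ℕ.+ k ℕ.* 6) 3))) (up (5 ℕ.+ k ℕ.* 6) 3)))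
        (*-cong (*-congˡ (+-congˡ (*-comm w (q ^ 2)))) (Λ-B-cong (up (5 ℕ.+ k ℕ.* 6) 6) (up (5 ℕ.+ k ℕ.* 6) 6))))) ⟩
      (1# - q ^ 1) * ((1# - q) * P (suc k) + q * (1# + q ^ 2 * w) * Λ (B q w′ w′))
        ≈⟨ prove (q ∷ P (suc k) ∷ w ∷ Λ (B q w′ w′) ∷ []) ((I ⊖ v0 ⊛ 1) ⊗ ((I ⊖ v0) ⊗ v1 ⊕ v0 ⊗ (I ⊕ v0 ⊛ 2 ⊗ v2) ⊗ v3)) ((I ⊖ v0 ⊛ 1) ⊗ (I ⊖ v0) ⊗ v1 ⊕ v0 ⊛ 1 ⊗ (I ⊕ v0 ⊛ 2 ⊗ v2) ⊗ ((I ⊖ v0 ⊛ 1) ⊗ v3)) ≡.refl ⟩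
      (1# - q ^ 1) * (1# - q) * P (suc k) + q ^ 1 * (1# + q ^ 2 * e k) * Q (suc k) ∎
      where
      w = q ^ (5 ℕ.+ k ℕ.* 6)
      w′ = q ^ (5 ℕ.+ suc k ℕ.* 6)
    P-lim : ∀ k → Ord k (P k - l)
    P-lim k = B-near₁ q (ord-≥ (≤5 3 k)) (ord-≥ (≤5 2 k))
    Q-lim : ∀ k → Ord k (Q k - (1# - q) * l)
    Q-lim k = ord-cong (prove (q ∷ Λ (B q (q ^ (5 ℕ.+ k ℕ.* 6)) (q ^ (5 ℕ.+ k ℕ.* 6))) ∷ l ∷ []) ((I ⊖ v0) ⊗ (v1 ⊖ v2)) ((I ⊖ v0 ⊛ 1) ⊗ v1 ⊖ (I ⊖ v0) ⊗ v2) ≡.refl)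
      (ord-*ˡ _ (B-near₁ q (ord-≥ (≤5 5 k)) (ord-≥ (≤5 5 k))))
    Q₀-a : Q₀ * a ≈ l * H.p̃ 1 0
    Q₀-a = cancel (1# - q) (unital-1- ord-q) (begin
      (1# - q) * (Q₀ * a) ≈⟨ prove (q ∷ Q₀ ∷ a ∷ []) ((I ⊖ v0) ⊗ (v1 ⊗ v2)) ((I ⊖ v0 ⊛ 1) ⊗ v1 ⊗ v2) ≡.refl ⟩
      Q 0 * a ≈⟨ H.Q-value 1 P Q l P-rec′ Q-rec′ P-lim Q-lim ⟩
      (1# - q) * l * H.p̃ 1 0 ≈⟨ *-assoc _ _ _ ⟩
      (1# - q) * (l * H.p̃ 1 0) ∎)
    F₅-a : F₅ * a * (1# - q) ≈ poch⁺ 2 0 * ((1# - q ^ 7) * (T 1 * ∑ b₉))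
    F₅-a = begin
      F₅ * a * (1# - q) ≈⟨ *-congʳ (trans (distribʳ a _ _) (+-cong (trans (*-congʳ (Λ-B-cong (*-comm _ q) H.refl)) (H.P-value 1 P Q l P-rec′ Q-rec′ P-lim Q-lim)) (trans (*-assoc _ _ _) (*-congˡ Q₀-a)))) ⟩
      (l * H.p 1 0 + q * (1# + q) * (l * H.p̃ 1 0)) * (1# - q)
        ≈⟨ prove (l ∷ H.p 1 0 ∷ q ∷ H.p̃ 1 0 ∷ []) ((v0 ⊗ v1 ⊕ v2 ⊗ (I ⊕ v2) ⊗ (v0 ⊗ v3)) ⊗ (I ⊖ v2)) (v0 ⊗ ((I ⊖ v2) ⊗ v1 ⊕ v2 ⊗ (I ⊖ v2 ⊛ 2) ⊗ v3)) ≡.refl ⟩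
      l * ((1# - q) * H.p 1 0 + q * (1# - q ^ 2) * H.p̃ 1 0) ≈⟨ *-cong l-value (+-cong (*-congˡ p₀) p̃-value) ⟩
      poch⁺ 2 0 * ((1# - q) * (T 1 * ∑ b₃) + ((1# - q ^ 7) * (T 1 * ∑ b₉) - (1# - q) * (T 1 * ∑ b₃)))
        ≈⟨ *-congˡ (prove ((1# - q) * (T 1 * ∑ b₃) ∷ (1# - q ^ 7) * (T 1 * ∑ b₉) ∷ []) (v0 ⊕ (v1 ⊖ v0)) v1 ≡.refl) ⟩
      poch⁺ 2 0 * ((1# - q ^ 7) * (T 1 * ∑ b₉)) ∎

module Constant where
  open import Data.Vec.Base using ([]; _∷_)
  open Solver
  open Values public

  D-near : ∀ {n v w} → Ord n v → Ord n w → Ord n (Λ (D v w) - 1#)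
  D-near ov ow = ord-cong (+-cong (Λ-cong (S.*-identityˡ _)) (-‿cong Λ-1)) (Λ-near {x = S.1#} (nearˢ-* (num-ord ov) (den-ord ow)))

  Λ-D-cong : ∀ {v v′ w w′} → v ≈ v′ → w ≈ w′ → Λ (D v w) ≈ Λ (D v′ w′)
  Λ-D-cong p r = Λ-cong (S.*-cong (num-cong p) (den-cong r))

  private
    C : ℕ → Carrier
    C zero = 1#
    C (suc n) = C n * geo (q ^ (suc n ℕ.* 6))

    C-suc : ∀ n → (1# - f (suc n)) * C (suc n) ≈ C n
    C-suc n = trans (prove (f (suc n) ∷ C n ∷ geo (f (suc n)) ∷ []) ((I ⊖ v0) ⊗ (v1 ⊗ v2)) ((I ⊖ v0) ⊗ v2 ⊗ v1) ≡.refl)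
      (trans (*-congʳ (geo-inverse (ord-≥ {n = suc n ℕ.* 6} (s≤s z≤n)))) (*-identityˡ _))

    Cq : ℕ → ℕ → Carrier
    Cq m n = C n * q ^ (n ℕ.* m)

    Cq-summable : ∀ m → Summable (Cq (suc m))
    Cq-summable m = z^-summable C m

    a-value : ∑ (Cq 7) * poch⁻ 7 5 ≈ 1#
    a-value = first-order-unique (λ _ → 1#) (λ k → ∑ (Cq (7 ℕ.+ k ℕ.* 6)) * poch⁻ (7 ℕ.+ k ℕ.* 6) 5) (λ _ → 1#)
      (λ k → trans (step {k}) (sym (*-identityˡ _))) (λ k → sym (*-identityˡ 1#)) (⟶-near λ k → near-* (near k (6 ℕ.+ k ℕ.* 6) (ℕ.≤-trans (k≤ 7 5 k) ℕ.≤-refl)) (near⁻ (7 ℕ.+ k ℕ.* 6) 5 (k≤ 7 5 k))) ⟶-const 0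
      where
      near : ∀ k m → k ≤ suc m → Ord k (∑ (Cq (suc m)) - 1#)
      near k m k≤m = ord-cong (begin
        ∑ (λ n → Cq (suc m) (suc n)) ≈⟨ prove (∑ (λ n → Cq (suc m) (suc n)) ∷ []) v0 (I ⊗ I ⊕ v0 ⊖ I) ≡.refl ⟩
        1# * 1# + ∑ (λ n → Cq (suc m) (suc n)) - 1# ≈⟨ +-congʳ (∑-suc (Cq-summable m)) ⟨
        ∑ (Cq (suc m)) - 1# ∎) (ord-∑ (λ n → ord-mono (ℕ.n≤1+n n) (Cq-summable m (suc n))) λ n → ord-*ˡ _ (ord-≥ (ℕ.≤-trans k≤m (ℕ.m≤m+n (suc m) _))))
      functional : ∀ m → (1# - q ^ suc m) * ∑ (Cq (suc m)) ≈ ∑ (Cq (6 ℕ.+ suc m))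
      functional m = from-zero (begin
        (1# - q ^ suc m) * ∑ (Cq (suc m)) - ∑ (Cq (6 ℕ.+ suc m)) ≈⟨ +-congʳ (∑-*ˡ _ (Cq-summable m)) ⟩
        ∑ (λ n → (1# - q ^ suc m) * Cq (suc m) n) - ∑ (Cq (6 ℕ.+ suc m)) ≈⟨ ∑-- (λ n → ord-*ˡ _ (Cq-summable m n)) (Cq-summable (5 ℕ.+ suc m)) ⟩
        ∑ (λ n → (1# - q ^ suc m) * Cq (suc m) n - Cq (6 ℕ.+ suc m) n)
          ≈⟨ ∑-telescope (λ n → - ((1# - f n) * Cq (suc m) n)) (λ n → ord-neg (ord-*ˡ _ (Cq-summable m n))) termwise (prove [] (⊝ ((I ⊖ I) ⊗ (I ⊗ I))) ø ≡.refl) ⟩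
        0# ∎)
        where
        termwise : ∀ n → (1# - q ^ suc m) * Cq (suc m) n - Cq (6 ℕ.+ suc m) n ≈ - ((1# - f (suc n)) * Cq (suc m) (suc n)) - - ((1# - f n) * Cq (suc m) n)
        termwise n = begin
          (1# - q ^ suc m) * (C n * y) - C n * q ^ (n ℕ.* (6 ℕ.+ suc m)) ≈⟨ +-congˡ (-‿cong (*-congˡ (trans (q^-≡ (ℕ.*-distribˡ-+ n 6 (suc m))) (q^-+ (n ℕ.* 6) (n ℕ.* suc m))))) ⟩
          (1# - q ^ suc m) * (C n * y) - C n * (f n * y) ≈⟨ prove (q ^ suc m ∷ C n ∷ y ∷ f n ∷ []) ((I ⊖ v0) ⊗ (v1 ⊗ v2) ⊖ v1 ⊗ (v3 ⊗ v2)) (⊝ (v1 ⊗ (v0 ⊗ v2)) ⊖ ⊝ ((I ⊖ v3) ⊗ (v1 ⊗ v2))) ≡.refl ⟩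
          - (C n * (q ^ suc m * y)) - - ((1# - f n) * (C n * y)) ≈⟨ +-congʳ (-‿cong (*-cong (sym (C-suc n)) (sym (q^-+ (suc m) (n ℕ.* suc m))))) ⟩
          - ((1# - f (suc n)) * C (suc n) * q ^ (suc n ℕ.* suc m)) - - ((1# - f n) * (C n * y)) ≈⟨ +-congʳ (-‿cong (*-assoc _ _ _)) ⟩
          _ ∎
          where y = q ^ (n ℕ.* suc m)
      step : ∀ {k} → ∑ (Cq (7 ℕ.+ k ℕ.* 6)) * poch⁻ (7 ℕ.+ k ℕ.* 6) 5 ≈ ∑ (Cq (7 ℕ.+ suc k ℕ.* 6)) * poch⁻ (7 ℕ.+ suc k ℕ.* 6) 5
      step {k} = begin
        ∑ (Cq m) * poch⁻ m 5 ≈⟨ *-congˡ (poch⁻-suc m 5) ⟩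
        ∑ (Cq m) * ((1# - q ^ m) * poch⁻ (m ℕ.+ 6) 5) ≈⟨ prove (∑ (Cq m) ∷ 1# - q ^ m ∷ poch⁻ (m ℕ.+ 6) 5 ∷ []) (v0 ⊗ (v1 ⊗ v2)) (v1 ⊗ v0 ⊗ v2) ≡.refl ⟩
        (1# - q ^ m) * ∑ (Cq m) * poch⁻ (m ℕ.+ 6) 5 ≈⟨ *-cong (functional (6 ℕ.+ k ℕ.* 6)) (reflexive (≡.cong (λ i → poch⁻ i 5) (ℕ.+-comm m 6))) ⟩
        _ ∎
        where m = 7 ℕ.+ k ℕ.* 6

    Z : ℕ → ℕ → Carrier
    Z k zero = 1#
    Z k (suc n) = Z k n * (1# - f (k ℕ.+ n))

    Z-sucˡ : ∀ k n → Z k (suc n) ≈ (1# - f k) * Z (suc k) n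
    Z-sucˡ k zero = trans (*-comm _ _) (*-congʳ (+-congˡ (-‿cong (reflexive (≡.cong f (ℕ.+-identityʳ k))))))
    Z-sucˡ k (suc n) = trans (*-cong (Z-sucˡ k n) (+-congˡ (-‿cong (reflexive (≡.cong f (ℕ.+-suc k n)))))) (*-assoc _ _ _)

    U : ℕ → Carrier
    U j = poch⁻ (5 ℕ.+ j ℕ.* 6) 5

    U-suc : ∀ k n → U (k ℕ.+ n) ≈ (1# - q ^ 5 * (f k * f n)) * U (suc (k ℕ.+ n))
    U-suc k n = trans (poch⁻-suc (5 ℕ.+ (k ℕ.+ n) ℕ.* 6) 5) (*-cong (+-congˡ (-‿cong (trans (e-f (k ℕ.+ n)) (*-congˡ (H.f-+ k n))))) (reflexive (≡.cong (λ i → poch⁻ i 5) (ℕ.+-comm (5 ℕ.+ (k ℕ.+ n) ℕ.* 6) 6))))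

    t : ℕ → ℕ → Carrier
    t k n = C n * (Z k n * U (k ℕ.+ n)) * q ^ (n ℕ.* 7)

    t-summable : ∀ k → Summable (t k)
    t-summable k = z^-summable (λ n → C n * (Z k n * U (k ℕ.+ n))) 6

    φ : ℕ → Carrier
    φ k = ∑ (t k)

    w : ℕ → ℕ → Carrier
    w k zero = 0#
    w k (suc n) = f k * (1# - q ^ 5) * (C n * (Z (suc k) n * U (suc (suc (k ℕ.+ n))))) * (q ^ (suc n ℕ.* 7))

    w-summable : ∀ k → Summable (w k)
    w-summable k zero = ord-0
    w-summable k (suc n) = ord-*ˡ _ (ord-≥ (ℕ.m≤m*n (suc n) 7))

    φ-rec : ∀ k → φ k ≈ (1# - (q ^ 5 + q ^ 7) * f k) * φ (suc k) + q ^ 12 * f k * (1# - q ^ 6 * f k) * φ (suc (suc k))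
    φ-rec k = begin
      φ k ≈⟨ prove (φ k ∷ c * φ (suc k) ∷ d * φ (suc (suc k)) ∷ []) v0 ((v0 ⊖ v1) ⊖ v2 ⊕ (v1 ⊕ v2)) ≡.refl ⟩
      φ k - c * φ (suc k) - d * φ (suc (suc k)) + rhs ≈⟨ +-congʳ (trans (+-cong (trans (+-congˡ (-‿cong (∑-*ˡ _ (t-summable (suc k))))) (∑-- (t-summable k) s₁)) (-‿cong (∑-*ˡ _ (t-summable (suc (suc k))))))
          (∑-- (λ n → ord-- (t-summable k n) (s₁ n)) s₂)) ⟩
      ∑ (λ n → t k n - c * t (suc k) n - d * t (suc (suc k)) n) + rhs ≈⟨ +-congʳ (∑-telescope (w k) (w-summable k) termwise H.refl) ⟩
      0# + rhs ≈⟨ +-identityˡ rhs ⟩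
      rhs ∎
      where
      c = 1# - (q ^ 5 + q ^ 7) * f k
      d = q ^ 12 * f k * (1# - q ^ 6 * f k)
      rhs = c * φ (suc k) + d * φ (suc (suc k))
      s₁ : Summable (λ n → c * t (suc k) n)
      s₁ n = ord-*ˡ _ (t-summable (suc k) n)
      s₂ : Summable (λ n → d * t (suc (suc k)) n)
      s₂ n = ord-*ˡ _ (t-summable (suc (suc k)) n)
      f⁶ : f (suc k) ≈ q ^ 6 * f k
      f⁶ = q^-+ 6 (k ℕ.* 6)
      U₁ : ∀ n → U (suc k ℕ.+ n) ≈ (1# - q ^ 11 * (f k * f n)) * U (suc (suc (k ℕ.+ n)))
      U₁ n = trans (U-suc (suc k) n) (*-congʳ (+-congˡ (-‿cong (trans (*-congˡ (*-congʳ f⁶)) (prove (q ∷ f k ∷ f n ∷ []) (v0 ⊛ 5 ⊗ ((v0 ⊛ 6 ⊗ v1) ⊗ v2)) (v0 ⊛ 11 ⊗ (v1 ⊗ v2)) ≡.refl)))))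
      U₀ : ∀ n → U (k ℕ.+ n) ≈ (1# - q ^ 5 * (f k * f n)) * ((1# - q ^ 11 * (f k * f n)) * U (suc (suc (k ℕ.+ n))))
      U₀ n = trans (U-suc k n) (*-congˡ (U₁ n))
      termwise : ∀ n → t k n - c * t (suc k) n - d * t (suc (suc k)) n ≈ w k (suc n) - w k n
      termwise zero = begin
        1# * (1# * U (k ℕ.+ 0)) * 1# - c * (1# * (1# * U (suc k ℕ.+ 0)) * 1#) - d * (1# * (1# * U₂) * 1#)
          ≈⟨ +-congʳ (+-cong (*-congʳ (*-congˡ (*-congˡ (U₀ 0)))) (-‿cong (*-congˡ (*-congʳ (*-congˡ (*-congˡ (U₁ 0))))))) ⟩
        1# * (1# * ((1# - q ^ 5 * (f k * 1#)) * ((1# - q ^ 11 * (f k * 1#)) * U₂))) * 1# - c * (1# * (1# * ((1# - q ^ 11 * (f k * 1#)) * U₂)) * 1#) - d * (1# * (1# * U₂) * 1#)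
          ≈⟨ prove (q ∷ f k ∷ U₂ ∷ [])
            (I ⊗ (I ⊗ ((I ⊖ v0 ⊛ 5 ⊗ (v1 ⊗ I)) ⊗ ((I ⊖ v0 ⊛ 11 ⊗ (v1 ⊗ I)) ⊗ v2))) ⊗ I ⊖ (I ⊖ (v0 ⊛ 5 ⊕ v0 ⊛ 7) ⊗ v1) ⊗ (I ⊗ (I ⊗ ((I ⊖ v0 ⊛ 11 ⊗ (v1 ⊗ I)) ⊗ v2)) ⊗ I)
              ⊖ (v0 ⊛ 12 ⊗ v1 ⊗ (I ⊖ v0 ⊛ 6 ⊗ v1)) ⊗ (I ⊗ (I ⊗ v2) ⊗ I))
            (v1 ⊗ (I ⊖ v0 ⊛ 5) ⊗ (I ⊗ (I ⊗ v2)) ⊗ v0 ⊛ 7 ⊖ ø) ≡.refl ⟩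
        w k 1 - 0# ∎
        where U₂ = U (suc (suc (k ℕ.+ 0)))
      termwise (suc n) = begin
        t k m - c * t (suc k) m - d * t (suc (suc k)) m
          ≈⟨ +-cong (+-cong (*-congʳ (*-congˡ (*-cong (Z-sucˡ k n) (U₀ m)))) (-‿cong (*-congˡ (*-congʳ (*-congˡ (*-cong Z₁ (U₁ m))))))) (-‿cong (trans (*-assoc _ _ _) (*-congˡ third))) ⟩
        C m * ((1# - f k) * Z′ * ((1# - q ^ 5 * (f k * f m)) * ((1# - q ^ 11 * (f k * f m)) * U₂))) * Y
          - c * (C m * (Z′ * (1# - f k * f m) * ((1# - q ^ 11 * (f k * f m)) * U₂)) * Y)
          - q ^ 12 * f k * (C m * (Z′ * (1# - f k * f m) * (1# - q ^ 6 * (f k * f m)) * U₂) * Y)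
          ≈⟨ prove (q ∷ f k ∷ f m ∷ C m ∷ Z′ ∷ U₂ ∷ Y ∷ [])
            (v3 ⊗ ((I ⊖ v1) ⊗ v4 ⊗ ((I ⊖ v0 ⊛ 5 ⊗ (v1 ⊗ v2)) ⊗ ((I ⊖ v0 ⊛ 11 ⊗ (v1 ⊗ v2)) ⊗ v5))) ⊗ v6
              ⊖ (I ⊖ (v0 ⊛ 5 ⊕ v0 ⊛ 7) ⊗ v1) ⊗ (v3 ⊗ (v4 ⊗ (I ⊖ v1 ⊗ v2) ⊗ ((I ⊖ v0 ⊛ 11 ⊗ (v1 ⊗ v2)) ⊗ v5)) ⊗ v6)
              ⊖ v0 ⊛ 12 ⊗ v1 ⊗ (v3 ⊗ (v4 ⊗ (I ⊖ v1 ⊗ v2) ⊗ (I ⊖ v0 ⊛ 6 ⊗ (v1 ⊗ v2)) ⊗ v5) ⊗ v6))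
            (v1 ⊗ (I ⊖ v0 ⊛ 5) ⊗ (v3 ⊗ (v4 ⊗ (I ⊖ v1 ⊗ v2) ⊗ v5)) ⊗ (v0 ⊛ 7 ⊗ v6) ⊖ v1 ⊗ (I ⊖ v0 ⊛ 5) ⊗ ((I ⊖ v2) ⊗ v3 ⊗ (v4 ⊗ ((I ⊖ v0 ⊛ 11 ⊗ (v1 ⊗ v2)) ⊗ v5))) ⊗ v6) ≡.refl ⟩
        f k * (1# - q ^ 5) * (C m * (Z′ * (1# - f k * f m) * U₂)) * (q ^ 7 * Y) - f k * (1# - q ^ 5) * ((1# - f m) * C m * (Z′ * ((1# - q ^ 11 * (f k * f m)) * U₂))) * Y
          ≈⟨ +-cong (*-cong (*-congˡ (*-congˡ (*-congʳ (sym Z₁)))) (sym (q^-+ 7 (m ℕ.* 7)))) (-‿cong (*-congʳ (*-congˡ (*-cong (C-suc n) (*-congˡ (trans (sym (U₁ m)) (reflexive (≡.cong (λ i → U (suc i)) (ℕ.+-suc k n))))))))) ⟩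
        w k (suc m) - w k m ∎
        where
        m = suc n
        Z′ = Z (suc k) n
        U₂ = U (suc (suc (k ℕ.+ m)))
        Y = q ^ (m ℕ.* 7)
        Z₁ : Z (suc k) m ≈ Z′ * (1# - f k * f m)
        Z₁ = *-congˡ (+-congˡ (-‿cong (trans (reflexive (≡.cong f (≡.sym (ℕ.+-suc k n)))) (H.f-+ k m))))
        third : (1# - q ^ 6 * f k) * t (suc (suc k)) m ≈ C m * (Z′ * (1# - f k * f m) * (1# - q ^ 6 * (f k * f m)) * U₂) * Y
        third = begin
          (1# - q ^ 6 * f k) * (C m * (Z (suc (suc k)) m * U₂) * Y) ≈⟨ prove (1# - q ^ 6 * f k ∷ C m ∷ Z (suc (suc k)) m ∷ U₂ ∷ Y ∷ []) (v0 ⊗ (v1 ⊗ (v2 ⊗ v3) ⊗ v4)) (v1 ⊗ ((v0 ⊗ v2) ⊗ v3) ⊗ v4) ≡.refl ⟩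
          C m * ((1# - q ^ 6 * f k) * Z (suc (suc k)) m * U₂) * Y ≈⟨ *-congʳ (*-congˡ (*-congʳ (begin
            (1# - q ^ 6 * f k) * Z (suc (suc k)) m ≈⟨ *-congʳ (+-congˡ (-‿cong f⁶)) ⟨
            (1# - f (suc k)) * Z (suc (suc k)) m ≈⟨ Z-sucˡ (suc k) m ⟨
            Z (suc k) m * (1# - f (suc k ℕ.+ m)) ≈⟨ *-cong Z₁ (+-congˡ (-‿cong (trans (q^-+ 6 ((k ℕ.+ m) ℕ.* 6)) (*-congˡ (H.f-+ k m))))) ⟩
            Z′ * (1# - f k * f m) * (1# - q ^ 6 * (f k * f m)) ∎))) ⟩
          C m * (Z′ * (1# - f k * f m) * (1# - q ^ 6 * (f k * f m)) * U₂) * Y ∎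

    Z-near : ∀ k n → Ord k (Z k n - 1#)
    Z-near k zero = ord-cong (sym (-‿inverseʳ 1#)) ord-0
    Z-near k (suc n) = near-* (Z-near k n) (ord-cong (prove (f (k ℕ.+ n) ∷ []) (⊝ v0) (I ⊖ v0 ⊖ I) ≡.refl)
      (ord-neg (ord-≥ (ℕ.≤-trans (ℕ.m≤m+n k n) (ℕ.m≤m*n (k ℕ.+ n) 6)))))

    φ-lim : φ ⟶ ∑ (Cq 7)
    φ-lim k = ord-cong (sym (∑-- (Cq-summable 6) (t-summable k))) (ord-∑ (λ n → ord-- (Cq-summable 6 n) (t-summable k n))
      λ n → ord-cong (prove (C n ∷ Z k n * U (k ℕ.+ n) ∷ q ^ (n ℕ.* 7) ∷ []) ((⊝ (v0 ⊗ v2)) ⊗ (v1 ⊖ I)) (v0 ⊗ v2 ⊖ v0 ⊗ v1 ⊗ v2) ≡.refl)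
        (ord-*ˡ _ (near-* (Z-near k n) (near⁻ (5 ℕ.+ (k ℕ.+ n) ℕ.* 6) 5 (ℕ.≤-trans (ℕ.m≤m+n k n) (k≤ 5 5 (k ℕ.+ n)))))))

    φ₀ : φ 0 ≈ poch⁻ 5 5
    φ₀ = trans (∑-suc (t-summable 0)) (trans (+-cong (prove (U 0 ∷ []) (I ⊗ (I ⊗ v0) ⊗ I) v0 ≡.refl) vanish) (+-identityʳ _))
      where
      Z₀ : ∀ n → Z 0 (suc n) ≈ 0#
      Z₀ n = trans (Z-sucˡ 0 n) (trans (*-congʳ (-‿inverseʳ 1#)) (zeroˡ _))
      vanish : ∑ (λ n → t 0 (suc n)) ≈ 0#
      vanish = ∑-telescope (λ _ → 0#) (λ _ → ord-0) (λ n → trans (*-congʳ (*-congˡ (*-congʳ (Z₀ n)))) (prove (C (suc n) ∷ U (suc n) ∷ q ^ (suc n ℕ.* 7) ∷ []) (v0 ⊗ (ø ⊗ v1) ⊗ v2) (ø ⊖ ø) ≡.refl)) H.refl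

    ψ : ℕ → Carrier
    ψ k = Λ (D (q ^ (2 ℕ.+ k ℕ.* 6)) (q ^ (3 ℕ.+ k ℕ.* 6)))

    ψ-rec : ∀ k → ψ k ≈ (1# - (q ^ 5 + q ^ 7) * f k) * ψ (suc k) + q ^ 12 * f k * (1# - q ^ 6 * f k) * ψ (suc (suc k))
    ψ-rec k = begin
      ψ k ≈⟨ W⁻ k ⟩
      χ k - q ^ 5 * f k * ψ (suc k) ≈⟨ +-congʳ (W⁺ k) ⟩
      (1# - q) * ψ (suc k) + q * (1# - q ^ 6 * f k) * χ (suc k) - q ^ 5 * f k * ψ (suc k)
        ≈⟨ +-congʳ (+-congˡ (*-congˡ (trans (prove (χ (suc k) ∷ q ^ 5 * f (suc k) * ψ (suc (suc k)) ∷ []) v0 (v0 ⊖ v1 ⊕ v1) ≡.refl) (+-cong (sym (W⁻ (suc k))) (*-congʳ (*-congˡ (q^-+ 6 (k ℕ.* 6)))))))) ⟩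
      (1# - q) * ψ (suc k) + q * (1# - q ^ 6 * f k) * (ψ (suc k) + q ^ 5 * (q ^ 6 * f k) * ψ (suc (suc k))) - q ^ 5 * f k * ψ (suc k)
        ≈⟨ prove (q ∷ f k ∷ ψ (suc k) ∷ ψ (suc (suc k)) ∷ [])
          ((I ⊖ v0) ⊗ v2 ⊕ v0 ⊗ (I ⊖ v0 ⊛ 6 ⊗ v1) ⊗ (v2 ⊕ v0 ⊛ 5 ⊗ (v0 ⊛ 6 ⊗ v1) ⊗ v3) ⊖ v0 ⊛ 5 ⊗ v1 ⊗ v2)
          ((I ⊖ (v0 ⊛ 5 ⊕ v0 ⊛ 7) ⊗ v1) ⊗ v2 ⊕ v0 ⊛ 12 ⊗ v1 ⊗ (I ⊖ v0 ⊛ 6 ⊗ v1) ⊗ v3) ≡.refl ⟩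
      _ ∎
      where
      χ : ℕ → Carrier
      χ k = Λ (D (q ^ (4 ℕ.+ k ℕ.* 6)) (q ^ (3 ℕ.+ k ℕ.* 6)))
      up : ∀ m n → q ^ m * q ^ n ≈ q ^ (n ℕ.+ m)
      up m n = trans (*-comm _ _) (sym (q^-+ n m))
      up₂ : ∀ k n → f k * q ^ 6 * q ^ n ≈ q ^ (n ℕ.+ suc k ℕ.* 6)
      up₂ k n = trans (*-congʳ (up (k ℕ.* 6) 6)) (up (suc k ℕ.* 6) n)
      W⁻ : ∀ k → ψ k ≈ χ k - q ^ 5 * f k * ψ (suc k)
      W⁻ k = trans (Λ-D-cong (sym (up (k ℕ.* 6) 2)) (sym (up (k ℕ.* 6) 3))) (trans (W⁻-rec (f k))
        (trans (+-cong (*-congˡ (Λ-D-cong (up (k ℕ.* 6) 4) (up (k ℕ.* 6) 3))) (*-congˡ (Λ-D-cong (up₂ k 2) (up₂ k 3))))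
          (prove (χ k ∷ f k ∷ q ^ 5 ∷ ψ (suc k) ∷ []) (I ⊗ v0 ⊕ ⊝ (v1 ⊗ v2) ⊗ v3) (v0 ⊖ v2 ⊗ v1 ⊗ v3) ≡.refl)))
      W⁺ : ∀ k → χ k ≈ (1# - q) * ψ (suc k) + q * (1# - q ^ 6 * f k) * χ (suc k)
      W⁺ k = trans (Λ-D-cong (sym (up (k ℕ.* 6) 4)) (sym (up (k ℕ.* 6) 3))) (trans (W⁺-rec (f k))
        (+-cong (*-congˡ (Λ-D-cong (up₂ k 2) (up₂ k 3))) (*-cong (*-congˡ (+-congˡ (-‿cong (*-comm _ _)))) (Λ-D-cong (up₂ k 4) (up₂ k 3)))))

  G∞ : Carrier
  G∞ = Λ (D (q ^ 2) (q ^ 3))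

  G∞-value : G∞ ≈ poch⁻ 5 5 * poch⁻ 7 5
  G∞-value = begin
    ψ 0 ≈⟨ *-identityʳ _ ⟨
    ψ 0 * 1# ≈⟨ *-congˡ a-value ⟨
    ψ 0 * (∑ (Cq 7) * poch⁻ 7 5) ≈⟨ *-assoc _ _ _ ⟨
    ψ 0 * ∑ (Cq 7) * poch⁻ 7 5 ≈⟨ *-congʳ (trans (*-comm _ _) (recurrence-unique (λ k → 1# - (q ^ 5 + q ^ 7) * f k) (λ k → q ^ 12 * f k * (1# - q ^ 6 * f k))
      (λ k → ∑ (Cq 7) * ψ k) φ
      (λ k → trans (*-congˡ (ψ-rec k)) (prove (∑ (Cq 7) ∷ 1# - (q ^ 5 + q ^ 7) * f k ∷ ψ (suc k) ∷ q ^ 12 * f k * (1# - q ^ 6 * f k) ∷ ψ (suc (suc k)) ∷ []) (v0 ⊗ (v1 ⊗ v2 ⊕ v3 ⊗ v4)) (v1 ⊗ (v0 ⊗ v2) ⊕ v3 ⊗ (v0 ⊗ v4)) ≡.refl))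
      φ-rec (⟶-≈ (*-identityʳ _) (⟶-* ⟶-const (⟶-near λ k → D-near (ord-≥ (k≤ 2 5 k)) (ord-≥ (k≤ 3 5 k))))) φ-lim 0)) ⟩
    φ 0 * poch⁻ 7 5 ≈⟨ *-congʳ φ₀ ⟩
    poch⁻ 5 5 * poch⁻ 7 5 ∎

-- The quintuple product

module Bilateral where
  open import Data.Integer.Base using (∣_∣; 0ℤ; 1ℤ)
  open import Data.Vec.Base using ([]; _∷_)
  open Solver

  next : ℤ → ℤ
  next (+ n) = + suc n
  next -[1+ zero ] = 0ℤ
  next -[1+ suc n ] = -[1+ n ]

  minus : ℕ → ℤ
  minus zero = 0ℤ
  minus (suc n) = -[1+ n ]

  next-+ : ∀ z → next z ≡ z ℤ.+ 1ℤ
  next-+ (+ n) = ≡.cong +_ (ℕ.+-comm 1 n)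
  next-+ -[1+ zero ] = ≡.refl
  next-+ -[1+ suc n ] = ≡.refl

  ∣minus∣ : ∀ n → ∣ minus n ∣ ≡ n
  ∣minus∣ zero = ≡.refl
  ∣minus∣ (suc n) = ≡.refl

  module Sums where
    open AK

    -- The sum of f over the integers in [-M, M).
    W : (ℤ → Carrier) → ℕ → Carrier
    W f zero = 0#
    W f (suc M) = W f M + (f (+ M) + f -[1+ M ])

    BS : (ℤ → Carrier) → Carrier → Set
    BS f x = ∀ N → Σ ℕ λ c → ∀ M → c ≤ M → Ord N (x - W f M)

    Tail : (ℤ → Carrier) → Set
    Tail f = ∀ N → Σ ℕ λ c → ∀ z → c ≤ ∣ z ∣ → Ord N (f z)

    W-cong : ∀ {f g} → (∀ z → f z ≈ g z) → ∀ M → W f M ≈ W g M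
    W-cong e zero = refl
    W-cong e (suc M) = +-cong (W-cong e M) (+-cong (e _) (e _))

    W-+ : ∀ f g M → W (λ z → f z + g z) M ≈ W f M + W g M
    W-+ f g zero = sym (+-identityˡ _)
    W-+ f g (suc M) = trans (+-congʳ (W-+ f g M)) (prove (W f M ∷ W g M ∷ f (+ M) ∷ g (+ M) ∷ f -[1+ M ] ∷ g -[1+ M ] ∷ [])
      ((v0 ⊕ v1) ⊕ ((v2 ⊕ v3) ⊕ (v4 ⊕ v5))) ((v0 ⊕ (v2 ⊕ v4)) ⊕ (v1 ⊕ (v3 ⊕ v5))) ≡.refl)

    W-*ˡ : ∀ c f M → W (λ z → c * f z) M ≈ c * W f M
    W-*ˡ c f zero = sym (zeroʳ c)
    W-*ˡ c f (suc M) = trans (+-congʳ (W-*ˡ c f M)) (prove (c ∷ W f M ∷ f (+ M) ∷ f -[1+ M ] ∷ []) (v0 ⊗ v1 ⊕ (v0 ⊗ v2 ⊕ v0 ⊗ v3)) (v0 ⊗ (v1 ⊕ (v2 ⊕ v3))) ≡.refl)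

    W-next : ∀ f M → W (λ z → f (next z)) M ≈ W f M + f (+ M) - f (minus M)
    W-next f zero = prove (f 0ℤ ∷ []) ø (ø ⊕ v0 ⊖ v0) ≡.refl
    W-next f (suc M) = trans (+-cong (W-next f M) (+-congˡ (reflexive (≡.cong f (next-minus M)))))
      (prove (W f M ∷ f (+ M) ∷ f (minus M) ∷ f (+ suc M) ∷ f -[1+ M ] ∷ []) ((v0 ⊕ v1 ⊖ v2) ⊕ (v3 ⊕ v2)) ((v0 ⊕ (v1 ⊕ v4)) ⊕ v3 ⊖ v4) ≡.refl)
      where
      next-minus : ∀ M → next -[1+ M ] ≡ minus M
      next-minus zero = ≡.refl
      next-minus (suc M) = ≡.refl

    W-grow : ∀ {n f M} → (∀ z → M ≤ ∣ z ∣ → Ord n (f z)) → ∀ M′ → M ≤ M′ → Ord n (W f M′ - W f M)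
    W-grow {f = f} {zero} o zero _ = ord-cong (sym (-‿inverseʳ 0#)) ord-0
    W-grow {n} {f} {M} o (suc M′) le with ℕ.m≤n⇒m<n∨m≡n le
    ... | inj₂ ≡.refl = ord-cong (sym (-‿inverseʳ _)) ord-0
    ... | inj₁ (s≤s M≤) = ord-cong (prove (W f M′ ∷ W f M ∷ f (+ M′) ∷ f -[1+ M′ ] ∷ []) ((v0 ⊖ v1) ⊕ (v2 ⊕ v3)) ((v0 ⊕ (v2 ⊕ v3)) ⊖ v1) ≡.refl)
      (ord-+ (W-grow o M′ M≤) (ord-+ (o (+ M′) M≤) (o -[1+ M′ ] (ℕ.≤-trans M≤ (ℕ.n≤1+n M′)))))

    bs-unique : ∀ {f x y} → BS f x → BS f y → x ≈ y
    bs-unique {f} {x} {y} p r = separated λ N → let (c , pN) = p N ; (d , rN) = r N in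
      ord-cong (prove (x ∷ y ∷ W f (c ℕ.+ d) ∷ []) ((v0 ⊖ v2) ⊖ (v1 ⊖ v2)) (v0 ⊖ v1) ≡.refl)
        (ord-- (pN _ (ℕ.m≤m+n c d)) (rN _ (ℕ.m≤n+m d c)))

    bs-cong : ∀ {f g x} → (∀ z → f z ≈ g z) → BS f x → BS g x
    bs-cong e p N = proj₁ (p N) , λ M le → ord-cong (+-congˡ (-‿cong (W-cong e M))) (proj₂ (p N) M le)

    bs-≈ : ∀ {f x y} → x ≈ y → BS f x → BS f y
    bs-≈ e p N = proj₁ (p N) , λ M le → ord-cong (+-congʳ e) (proj₂ (p N) M le)

    bs-*ˡ : ∀ k {f x} → BS f x → BS (λ z → k * f z) (k * x)
    bs-*ˡ k {f} {x} p N = proj₁ (p N) , λ M le → ord-cong (trans (prove (k ∷ x ∷ W f M ∷ []) (v0 ⊗ (v1 ⊖ v2)) (v0 ⊗ v1 ⊖ v0 ⊗ v2) ≡.refl) (+-congˡ (-‿cong (sym (W-*ˡ k f M))))) (ord-*ˡ k (proj₂ (p N) M le))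

    bs-+ : ∀ {f g x y} → BS f x → BS g y → BS (λ z → f z + g z) (x + y)
    bs-+ {f} {g} {x} {y} p r N = proj₁ (p N) ℕ.+ proj₁ (r N) , λ M le → ord-cong
      (trans (prove (x ∷ y ∷ W f M ∷ W g M ∷ []) ((v0 ⊖ v2) ⊕ (v1 ⊖ v3)) ((v0 ⊕ v1) ⊖ (v2 ⊕ v3)) ≡.refl) (+-congˡ (-‿cong (sym (W-+ f g M)))))
      (ord-+ (proj₂ (p N) M (ℕ.m+n≤o⇒m≤o _ le)) (proj₂ (r N) M (ℕ.m+n≤o⇒n≤o (proj₁ (p N)) le)))

    bs-∑ : ∀ {f} g → Summable g → (∀ n → f (+ n) + f -[1+ n ] ≈ g n) → BS f (∑ g)
    bs-∑ {f} g s e N = N , λ M le → ord-cong (+-congˡ (-‿cong (sym (part M)))) (ord-mono le (∑-⟶ s M))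
      where
      part : ∀ M → W f M ≈ Σ< g M
      part zero = refl
      part (suc M) = +-cong (part M) (e M)

    private
      both-ends : ∀ {f} (t : Tail f) N M → proj₁ (t N) ≤ M → Ord N (f (+ M) - f (minus M))
      both-ends t N M le = ord-- (proj₂ (t N) (+ M) le) (proj₂ (t N) (minus M) (ℕ.≤-trans le (ℕ.≤-reflexive (≡.sym (∣minus∣ M)))))

    bs-next : ∀ {f x} → Tail f → BS f x → BS (λ z → f (next z)) x
    bs-next {f} {x} t p N = proj₁ (p N) ℕ.+ proj₁ (t N) , λ M le → ord-cong
      (trans (prove (x ∷ W f M ∷ f (+ M) ∷ f (minus M) ∷ []) ((v0 ⊖ v1) ⊖ (v2 ⊖ v3)) (v0 ⊖ (v1 ⊕ v2 ⊖ v3)) ≡.refl) (+-congˡ (-‿cong (sym (W-next f M)))))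
      (ord-- (proj₂ (p N) M (ℕ.m+n≤o⇒m≤o _ le)) (both-ends {f} t N M (ℕ.m+n≤o⇒n≤o (proj₁ (p N)) le)))

    bs-next⁻ : ∀ {f x} → Tail f → BS (λ z → f (next z)) x → BS f x
    bs-next⁻ {f} {x} t p N = proj₁ (p N) ℕ.+ proj₁ (t N) , λ M le → ord-cong
      (trans (+-congʳ (+-congˡ (-‿cong (W-next f M)))) (prove (x ∷ W f M ∷ f (+ M) ∷ f (minus M) ∷ []) (v0 ⊖ (v1 ⊕ v2 ⊖ v3) ⊕ (v2 ⊖ v3)) (v0 ⊖ v1) ≡.refl))
      (ord-+ (proj₂ (p N) M (ℕ.m+n≤o⇒m≤o _ le)) (both-ends {f} t N M (ℕ.m+n≤o⇒n≤o (proj₁ (p N)) le)))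

    tail-shift : ∀ {f} → Tail f → ∀ d → Tail (λ z → f (z ℤ.+ d))
    tail-shift t d N = proj₁ (t N) ℕ.+ ∣ d ∣ , λ z le → proj₂ (t N) (z ℤ.+ d) (ℕ.+-cancelʳ-≤ ∣ d ∣ _ _ (ℕ.≤-trans le (far z)))
      where
      far : ∀ z → ∣ z ∣ ≤ ∣ z ℤ.+ d ∣ ℕ.+ ∣ d ∣
      far z = ℕ.≤-trans (ℕ.≤-reflexive (≡.cong ∣_∣ (back z d))) (ℕ.≤-trans (ℤ.∣i+j∣≤∣i∣+∣j∣ (z ℤ.+ d) (ℤ.- d)) (ℕ.≤-reflexive (≡.cong (∣ z ℤ.+ d ∣ ℕ.+_) (ℤ.∣-i∣≡∣i∣ d))))
        where
        back : ∀ z d → z ≡ z ℤ.+ d ℤ.+ ℤ.- d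
        back = ℤR.solve-∀

    bs-shift : ∀ {f x} → Tail f → BS f x → ∀ d → BS (λ z → f (z ℤ.+ d)) x
    bs-shift {f} {x} t b = shift
      where
      up : ∀ n → BS (λ z → f (z ℤ.+ + n)) x
      up zero = bs-cong (λ z → reflexive (≡.cong f (≡.sym (ℤ.+-identityʳ z)))) b
      up (suc n) = bs-cong same (bs-next {λ z → f (z ℤ.+ + n)} (tail-shift {f} t (+ n)) (up n))
        where
        same : ∀ z → f (next z ℤ.+ + n) ≈ f (z ℤ.+ + suc n)
        same z = reflexive (≡.cong f (≡.trans (≡.cong (ℤ._+ + n) (next-+ z)) (ℤ.+-assoc z 1ℤ (+ n))))
      down : ∀ n → BS (λ z → f (z ℤ.+ minus n)) x
      down zero = up zero
      down (suc n) = bs-next⁻ {λ z → f (z ℤ.+ -[1+ n ])} (tail-shift {f} t -[1+ n ]) (bs-cong same (down n))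
        where
        step : ∀ n → 1ℤ ℤ.+ -[1+ n ] ≡ minus n
        step zero = ≡.refl
        step (suc n) = ≡.refl
        same : ∀ z → f (z ℤ.+ minus n) ≈ f (next z ℤ.+ -[1+ n ])
        same z = reflexive (≡.cong f (≡.sym (≡.trans (≡.cong (ℤ._+ -[1+ n ]) (next-+ z)) (≡.trans (ℤ.+-assoc z 1ℤ -[1+ n ]) (≡.cong (λ w → z ℤ.+ w) (step n))))))
      shift : ∀ d → BS (λ z → f (z ℤ.+ d)) x
      shift (+ n) = up n
      shift -[1+ n ] = down (suc n)

    bs-triple : ∀ {f x} → BS f x → BS (λ l → f (+ 3 ℤ.* l) + f (+ 3 ℤ.* l ℤ.+ 1ℤ) + f (+ 3 ℤ.* l ℤ.+ + 2)) x
    bs-triple {f} {x} p N = proj₁ (p N) , λ M le → ord-cong (+-congˡ (-‿cong (sym (triple M)))) (proj₂ (p N) (3 ℕ.* M) (ℕ.≤-trans le (ℕ.m≤m+n M _)))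
      where
      g : ℤ → Carrier
      g l = f (+ 3 ℤ.* l) + f (+ 3 ℤ.* l ℤ.+ 1ℤ) + f (+ 3 ℤ.* l ℤ.+ + 2)
      three : ∀ M → W f (3 ℕ.+ M) ≈ W f M + ((f (+ M) + f (+ suc M) + f (+ suc (suc M))) + (f -[1+ suc (suc M) ] + f -[1+ suc M ] + f -[1+ M ]))
      three M = prove (W f M ∷ f (+ M) ∷ f -[1+ M ] ∷ f (+ suc M) ∷ f -[1+ suc M ] ∷ f (+ suc (suc M)) ∷ f -[1+ suc (suc M) ] ∷ [])
        (v0 ⊕ (v1 ⊕ v2) ⊕ (v3 ⊕ v4) ⊕ (v5 ⊕ v6)) (v0 ⊕ ((v1 ⊕ v3 ⊕ v5) ⊕ (v6 ⊕ v4 ⊕ v2))) ≡.refl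
      triple : ∀ M → W g M ≈ W f (3 ℕ.* M)
      triple zero = refl
      triple (suc M) = begin
        W g M + (g (+ M) + g -[1+ M ]) ≈⟨ +-cong (triple M) (+-cong (+-cong (+-cong (at (pos₀ M)) (at (pos 1 M))) (at (pos 2 M))) (+-cong (+-cong (at (neg₀ M)) (at (neg 1 M))) (at (neg 2 M)))) ⟩
        W f (3 ℕ.* M) + ((f (+ (3 ℕ.* M)) + f (+ suc (3 ℕ.* M)) + f (+ suc (suc (3 ℕ.* M)))) + (f -[1+ suc (suc (3 ℕ.* M)) ] + f -[1+ suc (3 ℕ.* M) ] + f -[1+ 3 ℕ.* M ])) ≈⟨ three (3 ℕ.* M) ⟨
        W f (3 ℕ.+ 3 ℕ.* M) ≡⟨ ≡.cong (W f) (≡.sym (ℕ.*-suc 3 M)) ⟩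
        W f (3 ℕ.* suc M) ∎
        where
        at : ∀ {y z} → y ≡ z → f y ≈ f z
        at e = reflexive (≡.cong f e)
        pos : ∀ r M → + 3 ℤ.* + M ℤ.+ + r ≡ + (r ℕ.+ 3 ℕ.* M)
        pos r M = ≡.trans (≡.cong (ℤ._+ + r) (≡.sym (ℤ.pos-* 3 M))) (≡.cong +_ (ℕ.+-comm (3 ℕ.* M) r))
        neg : ∀ r M → + 3 ℤ.* -[1+ M ] ℤ.+ + r ≡ ℤ.- + (3 ℕ.+ 3 ℕ.* M) ℤ.+ + r
        neg r M = ≡.cong (λ w → ℤ.- w ℤ.+ + r) (≡.trans (≡.sym (ℤ.pos-* 3 (suc M))) (≡.cong +_ (ℕ.*-suc 3 M)))
        pos₀ : ∀ M → + 3 ℤ.* + M ≡ + (3 ℕ.* M)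
        pos₀ M = ≡.sym (ℤ.pos-* 3 M)
        neg₀ : ∀ M → + 3 ℤ.* -[1+ M ] ≡ -[1+ suc (suc (3 ℕ.* M)) ]
        neg₀ M = ≡.cong ℤ.-_ (≡.trans (≡.sym (ℤ.pos-* 3 (suc M))) (≡.cong +_ (ℕ.*-suc 3 M)))

    -- Interchange of the two summations in A * B, where A is resummed for each m.
    bs-fubini : ∀ {b A B C} (g : ℤ → ℤ → Carrier) → (∀ m → BS (g m) A) → Tail b → BS b B →
      (∀ l → BS (λ m → g m l * b m) (C l)) → BS C (A * B)
    bs-fubini {b} {A} {B} {C} g gA t bB inner N = proj₁ (outer M) , λ K le → ord-cong
      (prove (A ∷ B ∷ W b M ∷ W (λ m → b m * A) M ∷ W (λ l → window l) K ∷ W C K ∷ []) (v0 ⊗ (v1 ⊖ v2) ⊕ (v0 ⊗ v2 ⊖ v3) ⊕ (v3 ⊖ v4) ⊕ (v4 ⊖ v5)) (v0 ⊗ v1 ⊖ v5) ≡.refl)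
      (ord-+ (ord-+ (ord-+ (ord-*ˡ A (proj₂ (bB N) M (ℕ.m≤n+m (proj₁ (bB N)) (proj₁ (t N))))) (ord-cong (sym (total M)) ord-0)) (proj₂ (outer M) K le)) (diff K))
      where
      M = proj₁ (t N) ℕ.+ proj₁ (bB N)
      window : ℤ → Carrier
      window l = W (λ m → g m l * b m) M
      total : ∀ M → A * W b M - W (λ m → b m * A) M ≈ 0#
      total M = trans (+-congʳ (trans (sym (W-*ˡ A b M)) (W-cong (λ m → *-comm A (b m)) M))) (-‿inverseʳ _)
      outer : ∀ M → Σ ℕ λ c → ∀ K → c ≤ K → Ord N (W (λ m → b m * A) M - W (λ l → W (λ m → g m l * b m) M) K)
      outer zero = 0 , λ K _ → ord-cong (sym (trans (+-congˡ (-‿cong (zeros K))) (-‿inverseʳ 0#))) ord-0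
        where
        zeros : ∀ K → W (λ l → 0#) K ≈ 0#
        zeros zero = refl
        zeros (suc K) = trans (+-cong (zeros K) (+-identityˡ 0#)) (+-identityˡ 0#)
      outer (suc M) = c ℕ.+ (c₊ ℕ.+ c₋) , λ K le → ord-cong
        (trans (prove (W (λ m → b m * A) M ∷ W (λ l → W (λ m → g m l * b m) M) K ∷ A ∷ b (+ M) ∷ b -[1+ M ] ∷ W (g (+ M)) K ∷ W (g -[1+ M ]) K ∷ [])
          ((v0 ⊖ v1) ⊕ (v3 ⊗ (v2 ⊖ v5) ⊕ v4 ⊗ (v2 ⊖ v6))) ((v0 ⊕ (v3 ⊗ v2 ⊕ v4 ⊗ v2)) ⊖ (v1 ⊕ (v3 ⊗ v5 ⊕ v4 ⊗ v6))) ≡.refl)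
          (+-congˡ (-‿cong (sym (trans (W-+ _ _ K) (+-congˡ (trans (W-+ _ _ K) (+-cong (pull (+ M) K) (pull -[1+ M ] K)))))))))
        (ord-+ (p K (ℕ.m+n≤o⇒m≤o _ le)) (ord-+ (ord-*ˡ _ (p₊ K (ℕ.m+n≤o⇒m≤o _ (ℕ.m+n≤o⇒n≤o c le)))) (ord-*ˡ _ (p₋ K (ℕ.m+n≤o⇒n≤o c₊ (ℕ.m+n≤o⇒n≤o c le))))))
        where
        c = proj₁ (outer M)
        p = proj₂ (outer M)
        c₊ = proj₁ (gA (+ M) N)
        p₊ = proj₂ (gA (+ M) N)
        c₋ = proj₁ (gA -[1+ M ] N)
        p₋ = proj₂ (gA -[1+ M ] N)
        pull : ∀ m K → W (λ l → g m l * b m) K ≈ b m * W (g m) K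
        pull m K = trans (W-cong (λ l → *-comm _ _) K) (W-*ˡ (b m) (g m) K)
      close : ∀ l → Ord N (window l - C l)
      close l = ord-cong (prove (window l ∷ C l ∷ W (λ m → g m l * b m) M′ ∷ []) (⊝ ((v1 ⊖ v2) ⊕ (v2 ⊖ v0))) (v0 ⊖ v1) ≡.refl)
        (ord-neg (ord-+ (proj₂ (inner l N) M′ (ℕ.m≤n+m _ M)) (W-grow {M = M} (λ z le → ord-*ˡ _ (proj₂ (t N) z (ℕ.≤-trans (ℕ.m≤m+n _ _) le))) M′ (ℕ.m≤m+n M _))))
        where
        M′ = M ℕ.+ proj₁ (inner l N)
      diff : ∀ K → Ord N (W window K - W C K)
      diff zero = ord-cong (sym (-‿inverseʳ 0#)) ord-0
      diff (suc K) = ord-cong (prove (W window K ∷ W C K ∷ window (+ K) ∷ C (+ K) ∷ window -[1+ K ] ∷ C -[1+ K ] ∷ [])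
        ((v0 ⊖ v1) ⊕ ((v2 ⊖ v3) ⊕ (v4 ⊖ v5))) ((v0 ⊕ (v2 ⊕ v4)) ⊖ (v1 ⊕ (v3 ⊕ v5))) ≡.refl) (ord-+ (diff K) (ord-+ (close (+ K)) (close -[1+ K ])))

module Quintuple where
  open import Data.Integer.Base using (∣_∣; 0ℤ; 1ℤ)
  open import Data.Vec.Base using ([]; _∷_)
  open Solver
  open PS using (CompleteRing)
  open Bilateral

  module TwoVariable (x y p : CompleteRing.Carrier K)
    (xy : CompleteRing._≈_ K (CompleteRing._*_ K x y) p)
    (ord-x : CompleteRing.Ord K 1 x) (ord-y : CompleteRing.Ord K 1 y) where
    open AK

    ord-p : Ord 1 p
    ord-p = ord-cong xy (ord-*ˡ x ord-y)
    open JT.Triple p (x * p + y) ord-p (ord-+ (ord-*ˡ x ord-p) ord-y)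

    θ⁺ θ⁻ : ℕ → Carrier
    θ⁺ zero = 1#
    θ⁺ (suc n) = θ⁺ n * (x * p ^ n)
    θ⁻ zero = 1#
    θ⁻ (suc n) = θ⁻ n * (y * p ^ n)

    θ : ℕ → Carrier
    θ n = θ⁺ (suc n) + θ⁻ n

    ord-θ⁺ : ∀ n → Ord n (θ⁺ n)
    ord-θ⁺ zero = ord-all
    ord-θ⁺ (suc n) = ord-mono (ℕ.≤-reflexive (ℕ.+-comm 1 n)) (ord-* (ord-θ⁺ n) (ord-*ʳ (p ^ n) ord-x))

    ord-θ⁻ : ∀ n → Ord n (θ⁻ n)
    ord-θ⁻ zero = ord-all
    ord-θ⁻ (suc n) = ord-mono (ℕ.≤-reflexive (ℕ.+-comm 1 n)) (ord-* (ord-θ⁻ n) (ord-*ʳ (p ^ n) ord-y))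

    θ-summable : Summable θ
    θ-summable n = ord-+ (ord-mono (ℕ.n≤1+n n) (ord-θ⁺ (suc n))) (ord-θ⁻ n)

    θ-e : ∀ n → (1# + x) * e n ≈ θ n × (1# + x) * e (suc n) ≈ θ (suc n)
    θ-e zero = prove (x ∷ []) ((I ⊕ v0) ⊗ I) (I ⊗ (v0 ⊗ I) ⊕ I) ≡.refl , (begin
        (1# + x) * (x * p + y - p) ≈⟨ prove (x ∷ y ∷ p ∷ []) ((I ⊕ v0) ⊗ (v0 ⊗ v2 ⊕ v1 ⊖ v2)) (v0 ⊗ v0 ⊗ v2 ⊕ v1 ⊖ v2 ⊕ v0 ⊗ v1) ≡.refl ⟩
        x * x * p + y - p + x * y ≈⟨ +-congˡ xy ⟩
        x * x * p + y - p + p ≈⟨ prove (x ∷ y ∷ p ∷ []) (v0 ⊗ v0 ⊗ v2 ⊕ v1 ⊖ v2 ⊕ v2) (I ⊗ (v0 ⊗ I) ⊗ (v0 ⊗ (v2 ⊗ I)) ⊕ I ⊗ (v1 ⊗ I)) ≡.refl ⟩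
        θ 1 ∎)
    θ-e (suc n) = proj₂ (θ-e n) , (begin
      (1# + x) * ((x * p + y) * p ^ suc n * e (suc n) - p ^ (3 ℕ.+ (n ℕ.+ n)) * e n)
        ≈⟨ *-congˡ (+-congˡ (-‿cong (*-congʳ (*-congˡ (*-congˡ (*-congˡ (^-homo-* p n n))))))) ⟩
      (1# + x) * ((x * p + y) * (p * P) * e (suc n) - p * (p * (p * (P * P))) * e n)
        ≈⟨ prove (x ∷ y ∷ p ∷ P ∷ e n ∷ e (suc n) ∷ [])
            ((I ⊕ v0) ⊗ ((v0 ⊗ v2 ⊕ v1) ⊗ (v2 ⊗ v3) ⊗ v5 ⊖ v2 ⊗ (v2 ⊗ (v2 ⊗ (v3 ⊗ v3))) ⊗ v4))
            ((v0 ⊗ v2 ⊕ v1) ⊗ (v2 ⊗ v3) ⊗ ((I ⊕ v0) ⊗ v5) ⊖ v2 ⊗ (v2 ⊗ (v2 ⊗ (v3 ⊗ v3))) ⊗ ((I ⊕ v0) ⊗ v4)) ≡.refl ⟩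
      (x * p + y) * (p * P) * ((1# + x) * e (suc n)) - p * (p * (p * (P * P))) * ((1# + x) * e n)
        ≈⟨ +-cong (*-congˡ (proj₂ (θ-e n))) (-‿cong (*-congˡ (proj₁ (θ-e n)))) ⟩
      (x * p + y) * (p * P) * θ (suc n) - p * (p * (p * (P * P))) * θ n
        ≈⟨ prove (x ∷ y ∷ p ∷ P ∷ U ∷ V ∷ [])
            ((v0 ⊗ v2 ⊕ v1) ⊗ (v2 ⊗ v3) ⊗ (v4 ⊗ (v0 ⊗ v3) ⊗ (v0 ⊗ (v2 ⊗ v3)) ⊕ v5 ⊗ (v1 ⊗ v3)) ⊖ v2 ⊗ (v2 ⊗ (v2 ⊗ (v3 ⊗ v3))) ⊗ (v4 ⊗ (v0 ⊗ v3) ⊕ v5))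
            (v4 ⊗ (v0 ⊗ v3) ⊗ (v0 ⊗ (v2 ⊗ v3)) ⊗ (v0 ⊗ (v2 ⊗ (v2 ⊗ v3))) ⊕ v5 ⊗ (v1 ⊗ v3) ⊗ (v1 ⊗ (v2 ⊗ v3))
              ⊕ (v0 ⊗ v1 ⊖ v2) ⊗ (v2 ⊗ v2 ⊗ v3 ⊗ v3) ⊗ (v4 ⊗ (v0 ⊗ v3) ⊕ v5)) ≡.refl ⟩
      θ (suc (suc n)) + (x * y - p) * (p * p * P * P) * (U * (x * P) + V)
        ≈⟨ +-congˡ (trans (*-congʳ (trans (*-congʳ (trans (+-congʳ xy) (-‿inverseʳ p))) (zeroˡ _))) (zeroˡ _)) ⟩
      θ (suc (suc n)) + 0# ≈⟨ +-identityʳ _ ⟩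
      θ (suc (suc n)) ∎)
      where
      P = p ^ n
      U = θ⁺ n
      V = θ⁻ n

    Factor : Carrier → ℕ → Carrier
    Factor z j = 1# + z * p ^ j

    Factor-factors : ∀ {z} → Ord 1 z → Factors (Factor z)
    Factor-factors {z} o j = ord-cong (prove (z * p ^ j ∷ []) v0 (I ⊕ v0 ⊖ I) ≡.refl) (ord-*ˡ z (ord-p^ j))

    θ-product : ∏ (Factor x) * ∏ (Factor y) * pp∞ ≈ ∑ θ
    θ-product = begin
      ∏ (Factor x) * ∏ (Factor y) * pp∞ ≈⟨ *-congʳ (*-congʳ (∏-suc (Factor-factors ord-x))) ⟩
      Factor x 0 * ∏ (λ j → Factor x (suc j)) * ∏ (Factor y) * pp∞
        ≈⟨ prove (x ∷ ∏ (λ j → Factor x (suc j)) ∷ ∏ (Factor y) ∷ pp∞ ∷ []) ((I ⊕ v0 ⊗ I) ⊗ v1 ⊗ v2 ⊗ v3) ((I ⊕ v0) ⊗ (v1 ⊗ v2 ⊗ v3)) ≡.refl ⟩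
      (1# + x) * (∏ (λ j → Factor x (suc j)) * ∏ (Factor y) * pp∞)
        ≈⟨ *-congˡ (*-congʳ (trans (∏-* shifted (Factor-factors ord-y)) (∏-cong same (factors-* shifted (Factor-factors ord-y))))) ⟩
      (1# + x) * (∏ factor * pp∞) ≈⟨ *-congˡ triple-product ⟩
      (1# + x) * ∑ e ≈⟨ ∑-*ˡ (1# + x) e-summable ⟩
      ∑ (λ n → (1# + x) * e n) ≈⟨ ∑-cong (λ n → proj₁ (θ-e n)) (λ n → ord-*ˡ (1# + x) (e-summable n)) ⟩
      ∑ θ ∎
      where
      shifted : Factors (λ j → Factor x (suc j))
      shifted = factors-suc {Factor x} (Factor-factors ord-x)
      same : ∀ j → Factor x (suc j) * Factor y j ≈ factor j
      same j = begin
        Factor x (suc j) * Factor y j ≈⟨ prove (x ∷ y ∷ p ∷ p ^ j ∷ []) ((I ⊕ v0 ⊗ (v2 ⊗ v3)) ⊗ (I ⊕ v1 ⊗ v3)) (I ⊕ (v0 ⊗ v2 ⊕ v1) ⊗ v3 ⊕ (v0 ⊗ v1) ⊗ (v2 ⊗ (v3 ⊗ v3))) ≡.refl ⟩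
        1# + (x * p + y) * p ^ j + x * y * (p * (p ^ j * p ^ j)) ≈⟨ +-congˡ (trans (*-congʳ xy) (*-congˡ (*-congˡ (sym (^-homo-* p j j))))) ⟩
        factor j ∎

  quadratic : ℕ → ℤ → ℤ → ℤ
  quadratic P D z = + P ℤ.* z ℤ.* z ℤ.+ D ℤ.* z

  steps : ℕ → ℕ → ℕ → ℕ
  steps i j zero = 0
  steps i j (suc n) = steps i j n ℕ.+ (i ℕ.+ (i ℕ.+ j) ℕ.* n)

  module _ (P : ℕ) (D : ℤ) (i j : ℕ) (iD : + i ≡ + P ℤ.+ D) (jD : + j ≡ + P ℤ.- D) where

    quadratic-steps : ∀ n → quadratic P D (+ n) ≡ + steps i j n
    quadratic-steps zero = base (+ P) D
      where
      base : ∀ P D → P ℤ.* 0ℤ ℤ.* 0ℤ ℤ.+ D ℤ.* 0ℤ ≡ 0ℤ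
      base = ℤR.solve-∀
    quadratic-steps (suc n) = ≡.trans (split (+ P) D (+ n)) (≡.cong₂ ℤ._+_ (quadratic-steps n)
      (≡.sym (≡.trans (≡.cong (λ z → + i ℤ.+ z) (≡.trans (ℤ.pos-* (i ℕ.+ j) n) (≡.cong (ℤ._* + n) (≡.cong₂ ℤ._+_ iD jD)))) (≡.cong (λ w → w ℤ.+ (+ P ℤ.+ D ℤ.+ (+ P ℤ.- D)) ℤ.* + n) iD))))
      where
      split : ∀ P D n → P ℤ.* (1ℤ ℤ.+ n) ℤ.* (1ℤ ℤ.+ n) ℤ.+ D ℤ.* (1ℤ ℤ.+ n) ≡ P ℤ.* n ℤ.* n ℤ.+ D ℤ.* n ℤ.+ (P ℤ.+ D ℤ.+ (P ℤ.+ D ℤ.+ (P ℤ.- D)) ℤ.* n)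
      split = ℤR.solve-∀

  quadratic-neg : ∀ P D z → quadratic P (ℤ.- D) z ≡ quadratic P D (ℤ.- z)
  quadratic-neg P D z = lemma (+ P) D z
    where
    lemma : ∀ P D z → P ℤ.* z ℤ.* z ℤ.+ ℤ.- D ℤ.* z ≡ P ℤ.* (ℤ.- z) ℤ.* (ℤ.- z) ℤ.+ D ℤ.* (ℤ.- z)
    lemma = ℤR.solve-∀

  module Gauss (ε : CompleteRing.Carrier K) (ε² : CompleteRing._≈_ K (CompleteRing._*_ K ε ε) (CompleteRing.1# K))
    {P : ℕ} {i j : ℕ} {D : ℤ} (iD : + suc i ≡ + P ℤ.+ D) (jD : + suc j ≡ + P ℤ.- D) where
    open Products
    open Sums

    x y p : Carrier
    x = ε * q ^ suc i
    y = ε * q ^ suc j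
    p = q ^ (suc i ℕ.+ suc j)

    xy : x * y ≈ p
    xy = begin
      ε * q ^ suc i * (ε * q ^ suc j) ≈⟨ prove (ε ∷ q ^ suc i ∷ q ^ suc j ∷ []) (v0 ⊗ v1 ⊗ (v0 ⊗ v2)) (v0 ⊗ v0 ⊗ (v1 ⊗ v2)) ≡.refl ⟩
      ε * ε * (q ^ suc i * q ^ suc j) ≈⟨ *-cong ε² (sym (q^-+ (suc i) (suc j))) ⟩
      1# * p ≈⟨ *-identityˡ p ⟩
      p ∎

    open TwoVariable x y p xy (ord-*ˡ ε (ord-≥ {n = suc i} (s≤s z≤n))) (ord-*ˡ ε (ord-≥ {n = suc j} (s≤s z≤n)))

    f : ℤ → Carrier
    f z = ε ^ ∣ z ∣ * q ^ ∣ quadratic P D z ∣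

    jD′ : + suc j ≡ + P ℤ.+ ℤ.- D
    jD′ = jD

    iD′ : + suc i ≡ + P ℤ.- (ℤ.- D)
    iD′ = ≡.trans iD (≡.cong (λ d → + P ℤ.+ d) (≡.sym (ℤ.neg-involutive D)))

    value⁺ : ∀ n → θ⁺ n ≈ ε ^ n * q ^ steps (suc i) (suc j) n
    value⁺ zero = sym (*-identityˡ 1#)
    value⁺ (suc n) = begin
      θ⁺ n * (x * p ^ n) ≈⟨ *-cong (value⁺ n) (*-congˡ (^-assocʳ q (suc i ℕ.+ suc j) n)) ⟩
      ε ^ n * q ^ s * (ε * q ^ suc i * q ^ r) ≈⟨ prove (ε ∷ ε ^ n ∷ q ^ s ∷ q ^ suc i ∷ q ^ r ∷ []) (v1 ⊗ v2 ⊗ (v0 ⊗ v3 ⊗ v4)) (v0 ⊗ v1 ⊗ (v2 ⊗ (v3 ⊗ v4))) ≡.refl ⟩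
      ε * ε ^ n * (q ^ s * (q ^ suc i * q ^ r)) ≈⟨ *-congˡ (trans (q^-+ s (suc i ℕ.+ r)) (*-congˡ (q^-+ (suc i) r))) ⟨
      ε ^ suc n * q ^ steps (suc i) (suc j) (suc n) ∎
      where
      s = steps (suc i) (suc j) n
      r = (suc i ℕ.+ suc j) ℕ.* n

    value⁻ : ∀ n → θ⁻ n ≈ ε ^ n * q ^ steps (suc j) (suc i) n
    value⁻ zero = sym (*-identityˡ 1#)
    value⁻ (suc n) = begin
      θ⁻ n * (y * p ^ n) ≈⟨ *-cong (value⁻ n) (*-congˡ (trans (^-assocʳ q (suc i ℕ.+ suc j) n) (q^-≡ (≡.cong (ℕ._* n) (ℕ.+-comm (suc i) (suc j)))))) ⟩
      ε ^ n * q ^ s * (ε * q ^ suc j * q ^ r) ≈⟨ prove (ε ∷ ε ^ n ∷ q ^ s ∷ q ^ suc j ∷ q ^ r ∷ []) (v1 ⊗ v2 ⊗ (v0 ⊗ v3 ⊗ v4)) (v0 ⊗ v1 ⊗ (v2 ⊗ (v3 ⊗ v4))) ≡.refl ⟩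
      ε * ε ^ n * (q ^ s * (q ^ suc j * q ^ r)) ≈⟨ *-congˡ (trans (q^-+ s (suc j ℕ.+ r)) (*-congˡ (q^-+ (suc j) r))) ⟨
      ε ^ suc n * q ^ steps (suc j) (suc i) (suc n) ∎
      where
      s = steps (suc j) (suc i) n
      r = (suc j ℕ.+ suc i) ℕ.* n

    f⁺ : ∀ n → f (+ n) ≈ θ⁺ n
    f⁺ n = trans (*-congˡ (q^-≡ (≡.cong ∣_∣ (quadratic-steps P D (suc i) (suc j) iD jD n)))) (sym (value⁺ n))

    quadratic-minus : ∀ n → quadratic P D (ℤ.- + n) ≡ + steps (suc j) (suc i) n
    quadratic-minus n = ≡.trans (≡.sym (quadratic-neg P D (+ n))) (quadratic-steps P (ℤ.- D) (suc j) (suc i) jD′ iD′ n)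

    f⁻ : ∀ n → f (ℤ.- + n) ≈ θ⁻ n
    f⁻ n = trans (*-cong (reflexive (≡.cong (ε ^_) (ℤ.∣-i∣≡∣i∣ (+ n)))) (q^-≡ (≡.cong ∣_∣ (quadratic-minus n)))) (sym (value⁻ n))

    natural : ∀ z → + ∣ quadratic P D z ∣ ≡ quadratic P D z
    natural (+ n) = ≡.trans (≡.cong (λ w → + ∣ w ∣) (quadratic-steps P D (suc i) (suc j) iD jD n)) (≡.sym (quadratic-steps P D (suc i) (suc j) iD jD n))
    natural -[1+ n ] = ≡.trans (≡.cong (λ w → + ∣ w ∣) (quadratic-minus (suc n))) (≡.sym (quadratic-minus (suc n)))

    f-tail : Tail f
    f-tail N = N , λ where
      (+ n) le → ord-mono le (ord-cong (sym (f⁺ n)) (ord-θ⁺ n))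
      -[1+ n ] le → ord-mono le (ord-cong (sym (f⁻ (suc n))) (ord-θ⁻ (suc n)))

    value : Carrier
    value = ∏ (λ n → 1# + ε * q ^ (suc i ℕ.+ n ℕ.* (suc i ℕ.+ suc j))) * ∏ (λ n → 1# + ε * q ^ (suc j ℕ.+ n ℕ.* (suc i ℕ.+ suc j))) * poch⁻ (suc i ℕ.+ suc j) (i ℕ.+ suc j)

    f-sum : BS f value
    f-sum = bs-next⁻ {f} f-tail (bs-≈ (sym total) (bs-∑ {λ z → f (next z)} θ θ-summable λ n → +-cong (f⁺ (suc n)) (trans (reflexive (≡.cong f (next-neg n))) (f⁻ n))))
      where
      next-neg : ∀ n → next -[1+ n ] ≡ ℤ.- + n
      next-neg zero = ≡.refl
      next-neg (suc n) = ≡.refl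
      p^ : ∀ n → p ^ n ≈ q ^ (n ℕ.* (suc i ℕ.+ suc j))
      p^ n = trans (^-assocʳ q (suc i ℕ.+ suc j) n) (q^-≡ (ℕ.*-comm (suc i ℕ.+ suc j) n))
      same : ∀ k n → 1# + ε * q ^ (k ℕ.+ n ℕ.* (suc i ℕ.+ suc j)) ≈ Factor (ε * q ^ k) n
      same k n = +-congˡ (trans (*-congˡ (trans (q^-+ k _) (*-congˡ (sym (p^ n))))) (sym (*-assoc _ _ _)))
      ords : ∀ k → Factors (λ n → 1# + ε * q ^ (suc k ℕ.+ n ℕ.* (suc i ℕ.+ suc j)))
      ords k n = ord-cong (+-congʳ (sym (same (suc k) n))) (Factor-factors (ord-*ˡ ε (ord-≥ {n = suc k} (s≤s z≤n))) n)
      total : value ≈ ∑ θ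
      total = trans (*-cong (*-cong (∏-cong (same (suc i)) (ords i)) (∏-cong (same (suc j)) (ords j)))
        (∏-cong (λ n → +-congˡ (-‿cong (sym (p^ (suc n))))) (factors⁻ (suc i ℕ.+ suc j) (i ℕ.+ suc j)))) θ-product

  module Watson (a c : ℕ) (sum : + suc c ≡ + 6 ℤ.- + suc a) where
    open Products
    open Sums
    private
      α : ℤ
      α = + suc a
      first : ∀ α → α ≡ + 6 ℤ.+ (α ℤ.- + 6)
      first = ℤR.solve-∀
      second : ∀ α → + 6 ℤ.+ (+ 6 ℤ.- α) ≡ + 6 ℤ.- (α ℤ.- + 6)
      second = ℤR.solve-∀
      third : ∀ α → (+ 6 ℤ.- α) ℤ.+ (+ 6 ℤ.- α) ≡ + 12 ℤ.- (α ℤ.+ α)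
      third = ℤR.solve-∀

    negative² : - 1# * - 1# ≈ 1#
    negative² = prove [] ((⊝ I) ⊗ (⊝ I)) I ≡.refl

    module A = Gauss 1# (*-identityˡ 1#) {6} {a} {6 ℕ.+ c} {α ℤ.- + 6} (first α)
      (≡.trans (≡.cong (λ z → + 6 ℤ.+ z) sum) (second α))
    module B = Gauss (- 1#) negative² {12} {11 ℕ.+ (suc a ℕ.+ suc a)} {c ℕ.+ suc c} {α ℤ.+ α} ≡.refl
      (≡.trans (≡.cong₂ ℤ._+_ sum sum) (third α))
    module E₀ = Gauss (- 1#) negative² {36} {47} {23} {+ 12} ≡.refl ≡.refl
    module E₁ = Gauss (- 1#) negative² {36} {23} {47} { -[1+ 11 ]} ≡.refl ≡.refl

    χ : ℤ → Carrier
    χ z = (- 1#) ^ ∣ z ∣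

    χ-next : ∀ z → χ (next z) ≈ - χ z
    χ-next (+ n) = prove (χ (+ n) ∷ []) ((⊝ I) ⊗ v0) (⊝ v0) ≡.refl
    χ-next -[1+ zero ] = prove [] I (⊝ ((⊝ I) ⊗ I)) ≡.refl
    χ-next -[1+ suc n ] = prove (χ -[1+ n ] ∷ []) v0 (⊝ ((⊝ I) ⊗ v0)) ≡.refl

    χ-+ : ∀ z d → χ (z ℤ.+ d) ≈ χ z * χ d
    χ-+ z (+ zero) = trans (reflexive (≡.cong χ (ℤ.+-identityʳ z))) (sym (*-identityʳ _))
    χ-+ z (+ suc n) = begin
      χ (z ℤ.+ + suc n) ≡⟨ ≡.cong χ (≡.sym (≡.trans (≡.cong (ℤ._+ + n) (next-+ z)) (ℤ.+-assoc z 1ℤ (+ n)))) ⟩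
      χ (next z ℤ.+ + n) ≈⟨ χ-+ (next z) (+ n) ⟩
      χ (next z) * χ (+ n) ≈⟨ *-congʳ (χ-next z) ⟩
      - χ z * χ (+ n) ≈⟨ prove (χ z ∷ χ (+ n) ∷ []) ((⊝ v0) ⊗ v1) (v0 ⊗ ((⊝ I) ⊗ v1)) ≡.refl ⟩
      χ z * χ (+ suc n) ∎
    χ-+ z -[1+ n ] = begin
      χ (z ℤ.+ -[1+ n ]) ≈⟨ prove (χ (z ℤ.+ -[1+ n ]) ∷ []) v0 (⊝ (⊝ v0)) ≡.refl ⟩
      - (- χ (z ℤ.+ -[1+ n ])) ≈⟨ -‿cong (χ-next (z ℤ.+ -[1+ n ])) ⟨
      - χ (next (z ℤ.+ -[1+ n ])) ≈⟨ -‿cong (rest n) ⟩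
      - (χ z * χ (minus n)) ≈⟨ -‿cong (*-congˡ (reflexive (≡.cong ((- 1#) ^_) (∣minus∣ n)))) ⟩
      - (χ z * (- 1#) ^ n) ≈⟨ prove (χ z ∷ (- 1#) ^ n ∷ []) (⊝ (v0 ⊗ v1)) (v0 ⊗ ((⊝ I) ⊗ v1)) ≡.refl ⟩
      χ z * χ -[1+ n ] ∎
      where
      next-step : ∀ n → -[1+ n ] ℤ.+ 1ℤ ≡ minus n
      next-step zero = ≡.refl
      next-step (suc n) = ≡.refl
      rest : ∀ n → χ (next (z ℤ.+ -[1+ n ])) ≈ χ z * χ (minus n)
      rest n = trans (reflexive (≡.cong χ (≡.trans (next-+ (z ℤ.+ -[1+ n ])) (≡.trans (ℤ.+-assoc z -[1+ n ] 1ℤ) (≡.cong (λ w → z ℤ.+ w) (next-step n)))))) (by n)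
        where
        by : ∀ n → χ (z ℤ.+ minus n) ≈ χ z * χ (minus n)
        by zero = χ-+ z (+ zero)
        by (suc n) = χ-+ z -[1+ n ]

    1^ : ∀ n → 1# ^ n ≈ 1#
    1^ zero = refl
    1^ (suc n) = trans (*-identityˡ _) (1^ n)

    EA EB : ℤ → ℤ
    EA = quadratic 6 (α ℤ.- + 6)
    EB = quadratic 12 (α ℤ.+ α)

    A-value : ∀ z → A.f z ≈ q ^ ∣ EA z ∣
    A-value z = trans (*-congʳ (1^ ∣ z ∣)) (*-identityˡ _)

    term : ℤ → ℤ → Carrier
    term u v = A.f u * B.f v

    term-value : ∀ u v → term u v ≈ χ v * q ^ (∣ EA u ∣ ℕ.+ ∣ EB v ∣)
    term-value u v = trans (*-congʳ (A-value u)) (trans (prove (q ^ ∣ EA u ∣ ∷ χ v ∷ q ^ ∣ EB v ∣ ∷ []) (v0 ⊗ (v1 ⊗ v2)) (v1 ⊗ (v0 ⊗ v2)) ≡.refl) (*-congˡ (sym (q^-+ ∣ EA u ∣ ∣ EB v ∣))))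

    natural : ∀ u v → + (∣ EA u ∣ ℕ.+ ∣ EB v ∣) ≡ EA u ℤ.+ EB v
    natural u v = ≡.cong₂ ℤ._+_ (A.natural u) (B.natural v)

    inner : ∀ (D : ℤ) {P} (f : ℤ → Carrier) (total : Carrier) → Tail f → BS f total →
      (∀ z → f z ≡ χ z * q ^ ∣ quadratic P D z ∣) → (∀ z → + ∣ quadratic P D z ∣ ≡ quadratic P D z) → ∀ r →
      (∀ l m → EA (+ 3 ℤ.* l ℤ.+ r ℤ.- + 2 ℤ.* m) ℤ.+ EB m ≡ EA (l ℤ.+ r) ℤ.+ EB l ℤ.+ quadratic P D (m ℤ.+ ℤ.- l)) →
      ∀ l → BS (λ m → term (+ 3 ℤ.* l ℤ.+ r ℤ.- + 2 ℤ.* m) m) (term (l ℤ.+ r) l * total)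
    inner D {P} f total t b same nat r exponents l = bs-cong terms (bs-*ˡ (term (l ℤ.+ r) l) (bs-shift {f} t b (ℤ.- l)))
      where
      terms : ∀ m → term (l ℤ.+ r) l * f (m ℤ.+ ℤ.- l) ≈ term (+ 3 ℤ.* l ℤ.+ r ℤ.- + 2 ℤ.* m) m
      terms m = begin
        term (l ℤ.+ r) l * f (m ℤ.+ ℤ.- l) ≈⟨ *-cong (term-value (l ℤ.+ r) l) (reflexive (same (m ℤ.+ ℤ.- l))) ⟩
        χ l * q ^ n * (χ (m ℤ.+ ℤ.- l) * q ^ n′) ≈⟨ prove (χ l ∷ q ^ n ∷ χ (m ℤ.+ ℤ.- l) ∷ q ^ n′ ∷ []) (v0 ⊗ v1 ⊗ (v2 ⊗ v3)) (v2 ⊗ v0 ⊗ (v1 ⊗ v3)) ≡.refl ⟩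
        χ (m ℤ.+ ℤ.- l) * χ l * (q ^ n * q ^ n′) ≈⟨ *-cong (χ-+ (m ℤ.+ ℤ.- l) l) (q^-+ n n′) ⟨
        χ (m ℤ.+ ℤ.- l ℤ.+ l) * q ^ (n ℕ.+ n′) ≈⟨ *-cong (reflexive (≡.cong χ (back m l))) (q^-≡ (ℤ.+-injective total-exponent)) ⟩
        χ m * q ^ (∣ EA u ∣ ℕ.+ ∣ EB m ∣) ≈⟨ term-value u m ⟨
        term u m ∎
        where
        n = ∣ EA (l ℤ.+ r) ∣ ℕ.+ ∣ EB l ∣
        n′ = ∣ quadratic P D (m ℤ.+ ℤ.- l) ∣
        u = + 3 ℤ.* l ℤ.+ r ℤ.- + 2 ℤ.* m
        back : ∀ m l → m ℤ.+ ℤ.- l ℤ.+ l ≡ m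
        back = ℤR.solve-∀
        total-exponent : + (n ℕ.+ n′) ≡ + (∣ EA u ∣ ℕ.+ ∣ EB m ∣)
        total-exponent = ≡.trans (≡.cong₂ ℤ._+_ (natural (l ℤ.+ r) l) (nat (m ℤ.+ ℤ.- l))) (≡.sym (≡.trans (natural u m) (exponents l m)))

    -- The terms of residue 2 cancel in pairs m ↔ 2 l + 1 - m.
    vanishing : ∀ l → BS (λ m → term (+ 3 ℤ.* l ℤ.+ + 2 ℤ.- + 2 ℤ.* m) m) 0#
    vanishing l = bs-cong (λ m → reflexive (≡.cong h (back m l))) (bs-shift {λ m → h (m ℤ.+ d)} (tail-shift {h} h-tail d) paired (ℤ.- d))
      where
      d = l ℤ.+ 1ℤ
      h : ℤ → Carrier
      h m = term (+ 3 ℤ.* l ℤ.+ + 2 ℤ.- + 2 ℤ.* m) m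
      h-tail : Tail h
      h-tail N = proj₁ (B.f-tail N) , λ z le → ord-*ˡ (A.f (+ 3 ℤ.* l ℤ.+ + 2 ℤ.- + 2 ℤ.* z)) (proj₂ (B.f-tail N) z le)
      back : ∀ m l → m ℤ.+ ℤ.- (l ℤ.+ 1ℤ) ℤ.+ (l ℤ.+ 1ℤ) ≡ m
      back = ℤR.solve-∀
      antisymmetric : ∀ m → h (ℤ.- (1ℤ ℤ.+ m) ℤ.+ d) ≈ - h (m ℤ.+ d)
      antisymmetric m = begin
        h v ≈⟨ term-value u v ⟩
        χ v * q ^ n ≈⟨ *-cong sign (q^-≡ (ℤ.+-injective (≡.trans (natural u v) (≡.trans (exponents α l m) (≡.sym (natural u′ v′)))))) ⟩
        - χ v′ * q ^ n′ ≈⟨ prove (χ v′ ∷ q ^ n′ ∷ []) ((⊝ v0) ⊗ v1) (⊝ (v0 ⊗ v1)) ≡.refl ⟩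
        - (χ v′ * q ^ n′) ≈⟨ -‿cong (term-value u′ v′) ⟨
        - h v′ ∎
        where
        v = ℤ.- (1ℤ ℤ.+ m) ℤ.+ d
        v′ = m ℤ.+ d
        u = + 3 ℤ.* l ℤ.+ + 2 ℤ.- + 2 ℤ.* v
        u′ = + 3 ℤ.* l ℤ.+ + 2 ℤ.- + 2 ℤ.* v′
        n = ∣ EA u ∣ ℕ.+ ∣ EB v ∣
        n′ = ∣ EA u′ ∣ ℕ.+ ∣ EB v′ ∣
        exponents : ∀ α l m → quadratic 6 (α ℤ.- + 6) (+ 3 ℤ.* l ℤ.+ + 2 ℤ.- + 2 ℤ.* (ℤ.- (1ℤ ℤ.+ m) ℤ.+ (l ℤ.+ 1ℤ))) ℤ.+ quadratic 12 (α ℤ.+ α) (ℤ.- (1ℤ ℤ.+ m) ℤ.+ (l ℤ.+ 1ℤ)) ≡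
          quadratic 6 (α ℤ.- + 6) (+ 3 ℤ.* l ℤ.+ + 2 ℤ.- + 2 ℤ.* (m ℤ.+ (l ℤ.+ 1ℤ))) ℤ.+ quadratic 12 (α ℤ.+ α) (m ℤ.+ (l ℤ.+ 1ℤ))
        exponents = unfolded
          where
          unfolded : ∀ α l m → (+ 6 ℤ.* (+ 3 ℤ.* l ℤ.+ + 2 ℤ.- + 2 ℤ.* (ℤ.- (1ℤ ℤ.+ m) ℤ.+ (l ℤ.+ 1ℤ))) ℤ.* (+ 3 ℤ.* l ℤ.+ + 2 ℤ.- + 2 ℤ.* (ℤ.- (1ℤ ℤ.+ m) ℤ.+ (l ℤ.+ 1ℤ))) ℤ.+ (α ℤ.- + 6) ℤ.* (+ 3 ℤ.* l ℤ.+ + 2 ℤ.- + 2 ℤ.* (ℤ.- (1ℤ ℤ.+ m) ℤ.+ (l ℤ.+ 1ℤ)))) ℤ.+ (+ 12 ℤ.* (ℤ.- (1ℤ ℤ.+ m) ℤ.+ (l ℤ.+ 1ℤ)) ℤ.* (ℤ.- (1ℤ ℤ.+ m) ℤ.+ (l ℤ.+ 1ℤ)) ℤ.+ (α ℤ.+ α) ℤ.* (ℤ.- (1ℤ ℤ.+ m) ℤ.+ (l ℤ.+ 1ℤ))) ≡ (+ 6 ℤ.* (+ 3 ℤ.* l ℤ.+ + 2 ℤ.- + 2 ℤ.* (m ℤ.+ (l ℤ.+ 1ℤ))) ℤ.* (+ 3 ℤ.* l ℤ.+ + 2 ℤ.- + 2 ℤ.* (m ℤ.+ (l ℤ.+ 1ℤ)))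 ℤ.+ (α ℤ.- + 6) ℤ.* (+ 3 ℤ.* l ℤ.+ + 2 ℤ.- + 2 ℤ.* (m ℤ.+ (l ℤ.+ 1ℤ)))) ℤ.+ (+ 12 ℤ.* (m ℤ.+ (l ℤ.+ 1ℤ)) ℤ.* (m ℤ.+ (l ℤ.+ 1ℤ)) ℤ.+ (α ℤ.+ α) ℤ.* (m ℤ.+ (l ℤ.+ 1ℤ)))
          unfolded = ℤR.solve-∀
        sign : χ v ≈ - χ v′
        sign = begin
          χ v ≈⟨ χ-+ (ℤ.- (1ℤ ℤ.+ m)) d ⟩
          χ (ℤ.- (1ℤ ℤ.+ m)) * χ d ≡⟨ ≡.cong (λ e → (- 1#) ^ e * χ d) (≡.trans (ℤ.∣-i∣≡∣i∣ (1ℤ ℤ.+ m)) (≡.cong ∣_∣ (≡.trans (ℤ.+-comm 1ℤ m) (≡.sym (next-+ m))))) ⟩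
          χ (next m) * χ d ≈⟨ *-congʳ (χ-next m) ⟩
          - χ m * χ d ≈⟨ prove (χ m ∷ χ d ∷ []) ((⊝ v0) ⊗ v1) (⊝ (v0 ⊗ v1)) ≡.refl ⟩
          - (χ m * χ d) ≈⟨ -‿cong (χ-+ m d) ⟨
          - χ v′ ∎
      paired : BS (λ m → h (m ℤ.+ d)) 0#
      paired = bs-≈ zeros (bs-∑ {λ m → h (m ℤ.+ d)} (λ _ → 0#) (λ _ → ord-0) λ n → trans (+-congˡ (antisymmetric (+ n))) (-‿inverseʳ _))
        where
        zeros : ∑ (λ _ → 0#) ≈ 0#
        zeros = ord-sep λ n → ord-∑ (λ _ → ord-0) (λ _ → ord-0)

    quintuple : BS (λ l → E₀.value * (term l l + term (l ℤ.+ 1ℤ) l)) (A.value * B.value)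
    quintuple = bs-fubini {b = B.f} g gA B.f-tail B.f-sum collect
      where
      g : ℤ → ℤ → Carrier
      g m l = A.f (+ 3 ℤ.* l ℤ.+ 0ℤ ℤ.- + 2 ℤ.* m) + A.f (+ 3 ℤ.* l ℤ.+ 1ℤ ℤ.- + 2 ℤ.* m) + A.f (+ 3 ℤ.* l ℤ.+ + 2 ℤ.- + 2 ℤ.* m)
      gA : ∀ m → BS (g m) A.value
      gA m = bs-cong (λ l → +-congʳ (+-congʳ (reflexive (≡.cong (λ w → A.f (w ℤ.- + 2 ℤ.* m)) (≡.sym (ℤ.+-identityʳ (+ 3 ℤ.* l)))))))
        (bs-triple {λ z → A.f (z ℤ.+ ℤ.- (+ 2 ℤ.* m))} (bs-shift {A.f} A.f-tail A.f-sum (ℤ.- (+ 2 ℤ.* m))))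
      swap : E₁.value ≈ E₀.value
      swap = *-congʳ (*-comm _ _)
      collect : ∀ l → BS (λ m → g m l * B.f m) (E₀.value * (term l l + term (l ℤ.+ 1ℤ) l))
      collect l = bs-≈ (trans (+-cong (+-cong (*-congʳ (reflexive (≡.cong (λ w → term w l) (ℤ.+-identityʳ l)))) (*-congˡ swap)) refl)
          (prove (term l l ∷ term (l ℤ.+ 1ℤ) l ∷ E₀.value ∷ []) (v0 ⊗ v2 ⊕ v1 ⊗ v2 ⊕ ø) (v2 ⊗ (v0 ⊕ v1)) ≡.refl))
        (bs-cong (λ m → prove (A.f (+ 3 ℤ.* l ℤ.+ 0ℤ ℤ.- + 2 ℤ.* m) ∷ A.f (+ 3 ℤ.* l ℤ.+ 1ℤ ℤ.- + 2 ℤ.* m) ∷ A.f (+ 3 ℤ.* l ℤ.+ + 2 ℤ.- + 2 ℤ.* m) ∷ B.f m ∷ []) (v0 ⊗ v3 ⊕ v1 ⊗ v3 ⊕ v2 ⊗ v3) ((v0 ⊕ v1 ⊕ v2) ⊗ v3) ≡.refl)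
          (bs-+ (bs-+ (inner (+ 12) {36} E₀.f E₀.value E₀.f-tail E₀.f-sum (λ _ → ≡.refl) E₀.natural 0ℤ (exponents₀ α) l)
            (inner -[1+ 11 ] {36} E₁.f E₁.value E₁.f-tail E₁.f-sum (λ _ → ≡.refl) E₁.natural 1ℤ (exponents₁ α) l)) (vanishing l)))
        where
        exponents₀ : ∀ α l m → quadratic 6 (α ℤ.- + 6) (+ 3 ℤ.* l ℤ.+ 0ℤ ℤ.- + 2 ℤ.* m) ℤ.+ quadratic 12 (α ℤ.+ α) m ≡
          quadratic 6 (α ℤ.- + 6) (l ℤ.+ 0ℤ) ℤ.+ quadratic 12 (α ℤ.+ α) l ℤ.+ quadratic 36 (+ 12) (m ℤ.+ ℤ.- l)
        exponents₀ = unfolded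
          where
          unfolded : ∀ α l m → (+ 6 ℤ.* (+ 3 ℤ.* l ℤ.+ 0ℤ ℤ.- + 2 ℤ.* (m)) ℤ.* (+ 3 ℤ.* l ℤ.+ 0ℤ ℤ.- + 2 ℤ.* (m)) ℤ.+ (α ℤ.- + 6) ℤ.* (+ 3 ℤ.* l ℤ.+ 0ℤ ℤ.- + 2 ℤ.* (m))) ℤ.+ (+ 12 ℤ.* (m) ℤ.* (m) ℤ.+ (α ℤ.+ α) ℤ.* (m)) ≡ (+ 6 ℤ.* (l ℤ.+ 0ℤ) ℤ.* (l ℤ.+ 0ℤ) ℤ.+ (α ℤ.- + 6) ℤ.* (l ℤ.+ 0ℤ)) ℤ.+ (+ 12 ℤ.* (l) ℤ.* (l) ℤ.+ (α ℤ.+ α) ℤ.* (l)) ℤ.+ (+ 36 ℤ.* (m ℤ.+ ℤ.- l) ℤ.* (m ℤ.+ ℤ.- l) ℤ.+ (+ 12) ℤ.* (m ℤ.+ ℤ.- l))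
          unfolded = ℤR.solve-∀
        exponents₁ : ∀ α l m → quadratic 6 (α ℤ.- + 6) (+ 3 ℤ.* l ℤ.+ 1ℤ ℤ.- + 2 ℤ.* m) ℤ.+ quadratic 12 (α ℤ.+ α) m ≡
          quadratic 6 (α ℤ.- + 6) (l ℤ.+ 1ℤ) ℤ.+ quadratic 12 (α ℤ.+ α) l ℤ.+ quadratic 36 -[1+ 11 ] (m ℤ.+ ℤ.- l)
        exponents₁ = unfolded
          where
          unfolded : ∀ α l m → (+ 6 ℤ.* (+ 3 ℤ.* l ℤ.+ 1ℤ ℤ.- + 2 ℤ.* (m)) ℤ.* (+ 3 ℤ.* l ℤ.+ 1ℤ ℤ.- + 2 ℤ.* (m)) ℤ.+ (α ℤ.- + 6) ℤ.* (+ 3 ℤ.* l ℤ.+ 1ℤ ℤ.- + 2 ℤ.* (m))) ℤ.+ (+ 12 ℤ.* (m) ℤ.* (m) ℤ.+ (α ℤ.+ α) ℤ.* (m)) ≡ (+ 6 ℤ.* (l ℤ.+ 1ℤ) ℤ.* (l ℤ.+ 1ℤ) ℤ.+ (α ℤ.- + 6) ℤ.* (l ℤ.+ 1ℤ)) ℤ.+ (+ 12 ℤ.* (l) ℤ.* (l) ℤ.+ (α ℤ.+ α) ℤ.* (l)) ℤ.+ (+ 36 ℤ.* (m ℤ.+ ℤ.- l) ℤ.* (m ℤ.+ ℤ.- l) ℤ.+ (-[1+ 11 ]) ℤ.* (m ℤ.+ ℤ.- l))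
          unfolded = ℤR.solve-∀

open Lam using (triangle; m≤triangle)
-- Cases 7, 7a, 8 and 8a

module Chain₇ where
  open import Data.Vec.Base using ([]; _∷_)
  open Solver
  open Bilateral
  open Quintuple
  open Constant public hiding (e; f; e-f; T; L)
  open H using (factors⁻)
  open Root3 using (module L; embed; embed-*; embed-^; embed-1-q^; embed-∏; ∑-pair; ⟶-pair; three) renaming (complete to K√3)

  Λ-G-cong : ∀ {w w′} → w ≈ w′ → Λ (G w) ≈ Λ (G w′)
  Λ-G-cong p = Λ-cong (S.*-cong (S.*-cong (S.*-cong (S.*-cong (S.*-cong (num-cong (-‿cong p)) (num-cong (-‿cong (*-congʳ p)))) S.refl) (den-cong p)) (den-cong (*-congʳ p))) S.refl)

  g : ℕ → Carrier
  g m = Λ (G (q ^ (m ℕ.+ m)))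

  g-next : ∀ m → g (suc m) ≈ Λ (G (q ^ (m ℕ.+ m) * q ^ 2))
  g-next m = Λ-G-cong (trans (q^-≡ (≡.cong suc (ℕ.+-suc m m))) (prove (q ∷ q ^ (m ℕ.+ m) ∷ []) (v0 ⊗ (v0 ⊗ v1)) (v1 ⊗ v0 ⊛ 2) ≡.refl))

  g-rec : ∀ m → g m ≈ (1# + q) * (1# + q ^ suc (m ℕ.+ m)) * g (suc m) + - (q * (1# - q ^ (suc m ℕ.+ suc m) + q ^ (suc m ℕ.+ suc m) * q ^ (suc m ℕ.+ suc m))) * g (suc (suc m))
  g-rec m = trans (G-rec w) (+-cong (*-cong (*-congˡ (+-congˡ (*-comm w q))) (sym (g-next m)))
    (*-cong (-‿cong (*-congˡ (trans (prove (w ∷ q ∷ []) (I ⊖ v0 ⊗ v1 ⊛ 2 ⊕ v0 ⊛ 2 ⊗ v1 ⊛ 4) (I ⊖ v1 ⊗ (v1 ⊗ v0) ⊕ v1 ⊗ (v1 ⊗ v0) ⊗ (v1 ⊗ (v1 ⊗ v0))) ≡.refl)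
        (+-cong (+-congˡ (-‿cong up)) (*-cong up up)))))
      (trans (Λ-G-cong (prove (w ∷ q ∷ []) (v0 ⊗ v1 ⊛ 4) (v1 ⊗ (v1 ⊗ v0) ⊗ v1 ⊛ 2) ≡.refl)) (trans (Λ-G-cong (*-congʳ up)) (sym (g-next (suc m)))))))
    where
    w = q ^ (m ℕ.+ m)
    up : q * (q * w) ≈ q ^ (suc m ℕ.+ suc m)
    up = q^-≡ (≡.cong suc (≡.sym (ℕ.+-suc m m)))

  g-limit : g ⟶ G∞
  g-limit m = ord-cong (prove (Λ (G w) ∷ G∞ ∷ []) (⊝ (v0 ⊖ v1)) (v1 ⊖ v0) ≡.refl) (ord-neg (ord-cong (+-congʳ (Λ-cong
      (SP.prove (num 1 (- w) ∷ num 2 (- (w * q ^ 2)) ∷ num 2 (q ^ 2) ∷ den 2 w ∷ den 2 (w * q) ∷ den 3 (q ^ 3) ∷ [])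
        ((v2 ⊗ v5) ⊗ (v0 ⊗ v1 ⊗ v3 ⊗ v4)) (v0 ⊗ v1 ⊗ v2 ⊗ v3 ⊗ v4 ⊗ v5) ≡.refl)))
    (Λ-near {x = D (q ^ 2) (q ^ 3)} (nearˢ-* (nearˢ-* (nearˢ-* (num-ord (ord-neg o)) (num-ord (ord-neg (ord-*ʳ _ o)))) (den-ord o)) (den-ord (ord-*ʳ _ o))))))
    where
    w = q ^ (m ℕ.+ m)
    o : Ord m w
    o = ord-≥ (ℕ.m≤m+n m m)

  A : ℕ → Carrier
  A m = g m - (1# + q ^ (m ℕ.+ m)) * (q * g (suc m))

  E : ℕ → L.Carrier
  E m = A m , q ^ suc m * g (suc m)

  root : L.Carrier
  root = 0# , q

  open JacobiTriple.Triple K√3 L.q root L.ord-q (ord-0 , ord-q) using (e; factor; e-summable; pp∞; factor-factors; triple-product)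

  E-step : ∀ m → E m L.≈ factor m L.* E (suc m)
  E-step m = L.trans (first , second) (L.*-congʳ (L.+-cong (L.+-congˡ (L.*-congˡ (embed-^ m))) (embed-^ (2 ℕ.+ (m ℕ.+ m)))))
    where
    W = q ^ (m ℕ.+ m)
    Y = q ^ (suc m ℕ.+ suc m)
    Y-value : Y ≈ q * (q * W)
    Y-value = q^-≡ (≡.cong suc (ℕ.+-suc m m))
    W-value : W ≈ q ^ m * q ^ m
    W-value = q^-+ m m
    e₁ = v3 ⊗ v3
    e₂ = v2 ⊗ (v2 ⊗ e₁)
    first : A m ≈ (1# + (0# * q ^ m + three * (q * 0#)) + q ^ (2 ℕ.+ (m ℕ.+ m))) * A (suc m) + three * ((0# + (0# * 0# + q * q ^ m) + 0#) * (q ^ suc (suc m) * g (suc (suc m))))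
    first = trans (+-cong (g-rec m) (-‿cong (*-congʳ (+-congˡ W-value)))) (trans (+-congʳ (+-cong
        (*-congʳ (*-congˡ (+-congˡ (*-congˡ W-value)))) (*-congʳ (-‿cong (*-congˡ (+-cong (+-congˡ (-‿cong Y′)) (*-cong Y′ Y′)))))))
      (trans (prove (g (suc m) ∷ g (suc (suc m)) ∷ q ∷ q ^ m ∷ three ∷ [])
        ((I ⊕ v2) ⊗ (I ⊕ v2 ⊗ e₁) ⊗ v0 ⊕ (⊝ (v2 ⊗ (I ⊖ e₂ ⊕ e₂ ⊗ e₂))) ⊗ v1 ⊖ (I ⊕ e₁) ⊗ (v2 ⊗ v0))
        ((I ⊕ (ø ⊗ v3 ⊕ v4 ⊗ (v2 ⊗ ø)) ⊕ v2 ⊗ (v2 ⊗ e₁)) ⊗ (v0 ⊖ (I ⊕ e₂) ⊗ (v2 ⊗ v1)) ⊕ (I ⊕ I ⊕ I) ⊗ ((ø ⊕ (ø ⊗ ø ⊕ v2 ⊗ v3) ⊕ ø) ⊗ (v2 ⊗ (v2 ⊗ v3) ⊗ v1))) ≡.refl)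
      (+-congʳ (*-cong (+-congˡ (*-congˡ (*-congˡ (sym W-value)))) (+-congˡ (-‿cong (*-congʳ (+-congˡ (sym Y′)))))))))
      where
      Y′ : Y ≈ q * (q * (q ^ m * q ^ m))
      Y′ = trans Y-value (*-congˡ (*-congˡ W-value))
    second : q ^ suc m * g (suc m) ≈ (1# + (0# * q ^ m + three * (q * 0#)) + q ^ (2 ℕ.+ (m ℕ.+ m))) * (q ^ suc (suc m) * g (suc (suc m))) + (0# + (0# * 0# + q * q ^ m) + 0#) * A (suc m)
    second = trans (prove (g (suc m) ∷ g (suc (suc m)) ∷ q ∷ q ^ m ∷ three ∷ W ∷ [])
        (v2 ⊗ v3 ⊗ v0)
        ((I ⊕ (ø ⊗ v3 ⊕ v4 ⊗ (v2 ⊗ ø)) ⊕ v2 ⊗ (v2 ⊗ v5)) ⊗ (v2 ⊗ (v2 ⊗ v3) ⊗ v1) ⊕ (ø ⊕ (ø ⊗ ø ⊕ v2 ⊗ v3) ⊕ ø) ⊗ (v0 ⊖ (I ⊕ v2 ⊗ (v2 ⊗ v5)) ⊗ (v2 ⊗ v1))) ≡.refl)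
      (+-congˡ (*-congˡ (+-congˡ (-‿cong (*-congʳ (+-congˡ (sym Y-value)))))))

  κ : Carrier
  κ = (1# - q) * G∞

  E-limit : E L.⟶ embed κ
  E-limit = ⟶-pair (⟶-≈ (prove (q ∷ G∞ ∷ []) (v1 ⊕ (⊝ I) ⊗ (I ⊗ (v0 ⊗ v1))) ((I ⊖ v0) ⊗ v1) ≡.refl)
      (⟶-cong (λ m → prove (g m ∷ (1# + q ^ (m ℕ.+ m)) * (q * g (suc m)) ∷ []) (v0 ⊕ (⊝ I) ⊗ v1) (v0 ⊖ v1) ≡.refl)
        (⟶-+ g-limit (⟶-* (⟶-const {x = - 1#}) (⟶-* (⟶-near λ m → ord-cong (prove (q ^ (m ℕ.+ m) ∷ []) v0 (I ⊕ v0 ⊖ I) ≡.refl) (ord-≥ (ℕ.m≤m+n m m)))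
          (⟶-* (⟶-const {x = q}) (⟶-suc g-limit)))))))
    (λ m → ord-cong (prove (q ^ suc m * g (suc m) ∷ []) (⊝ v0) (ø ⊖ v0) ≡.refl) (ord-neg (ord-*ʳ (g (suc m)) (ord-≥ (ℕ.n≤1+n m)))))

  E-value : E 0 L.≈ L.∏ factor L.* embed κ
  E-value = L.⟶-unique {f = λ _ → E 0} L.⟶-const (L.⟶-cong (λ n → L.sym (unroll n)) (L.⟶-* (L.∏-⟶ factor-factors) E-limit))
    where
    unroll : ∀ n → E 0 L.≈ L.Π< factor n L.* E n
    unroll zero = L.sym (L.*-identityˡ _)
    unroll (suc n) = L.trans (unroll n) (L.trans (L.*-congˡ (E-step n)) (L.sym (L.*-assoc _ _ _)))

  -- The coefficients of q^(n (n + 1) / 2) in the theta series e: α + β √3 with cₙ₊₂ = √3 cₙ₊₁ - cₙ.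
  α β : ℕ → Carrier
  α zero = 1#
  α (suc zero) = - 1#
  α (suc (suc n)) = three * β (suc n) - α n
  β zero = 0#
  β (suc zero) = 1#
  β (suc (suc n)) = α (suc n) - β n

  _at_ : (ℕ → Carrier) → ℕ → Carrier
  γ at n = γ n * q ^ triangle n

  at-summable : ∀ γ → Summable (γ at_)
  at-summable γ n = ord-*ˡ (γ n) (ord-≥ (m≤triangle n))

  e-value : ∀ n → e n L.≈ (α at n , β at n) × e (suc n) L.≈ (α at suc n , β at suc n)
  e-value zero = (sym (*-identityˡ 1#) , sym (zeroˡ 1#)) , (prove (q ∷ []) (ø ⊖ v0) (⊝ I ⊗ (v0 ⊗ I)) ≡.refl , prove (q ∷ []) (v0 ⊖ ø) (I ⊗ (v0 ⊗ I)) ≡.refl)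
  e-value (suc n) = proj₂ (e-value n) , L.trans
    (L.+-cong (L.*-cong (L.*-congˡ (L.sym (embed-^ (suc n)))) (proj₂ (e-value n))) (L.-‿cong (L.*-cong (L.sym (embed-^ (3 ℕ.+ (n ℕ.+ n)))) (proj₁ (e-value n)))))
    (first , second)
    where
    x = q ^ n
    t = q ^ triangle n
    T₁ : q ^ triangle (suc n) ≈ q * (x * t)
    T₁ = trans (q^-+ (suc n) (triangle n)) (*-assoc _ _ _)
    T₂ : q ^ triangle (suc (suc n)) ≈ q * (q * (x * (q * (x * t))))
    T₂ = trans (q^-+ (suc (suc n)) (triangle (suc n))) (trans (*-congˡ T₁) (prove (q ∷ x ∷ t ∷ []) (v0 ⊗ (v0 ⊗ v1) ⊗ (v0 ⊗ (v1 ⊗ v2))) (v0 ⊗ (v0 ⊗ (v1 ⊗ (v0 ⊗ (v1 ⊗ v2))))) ≡.refl))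
    P₃ : q ^ (3 ℕ.+ (n ℕ.+ n)) ≈ q * (q * (q * (x * x)))
    P₃ = *-congˡ (*-congˡ (*-congˡ (q^-+ n n)))
    a₀ = α n
    b₀ = β n
    a₁ = α (suc n)
    b₁ = β (suc n)
    eᵗ : Expr 8
    eᵗ = v0 ⊗ (v0 ⊗ (v1 ⊗ (v0 ⊗ (v1 ⊗ v2))))
    e₃ : Expr 8
    e₃ = v0 ⊗ (v0 ⊗ (v0 ⊗ (v1 ⊗ v1)))
    ex : Expr 8
    ex = v0 ⊗ v1
    et : Expr 8
    et = v0 ⊗ (v1 ⊗ v2)
    ρ = q ∷ x ∷ t ∷ a₀ ∷ b₀ ∷ a₁ ∷ b₁ ∷ three ∷ []
    first : (0# * q ^ suc n + three * (q * 0#)) * (α at suc n) + three * ((0# * 0# + q * q ^ suc n) * (β at suc n)) - (q ^ (3 ℕ.+ (n ℕ.+ n)) * (α at n) + three * (0# * (β at n))) ≈ α at suc (suc n)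
    first = trans (+-cong (+-cong (*-congˡ (*-congˡ T₁)) (*-congˡ (*-congˡ (*-congˡ T₁)))) (-‿cong (+-congʳ (*-congʳ P₃)))) (trans (prove ρ
        ((ø ⊗ ex ⊕ v7 ⊗ (v0 ⊗ ø)) ⊗ (v5 ⊗ et) ⊕ v7 ⊗ ((ø ⊗ ø ⊕ v0 ⊗ ex) ⊗ (v6 ⊗ et)) ⊖ (e₃ ⊗ (v3 ⊗ v2) ⊕ v7 ⊗ (ø ⊗ (v4 ⊗ v2))))
        ((v7 ⊗ v6 ⊖ v3) ⊗ eᵗ) ≡.refl) (*-congˡ (sym T₂)))
    second : (0# * q ^ suc n + three * (q * 0#)) * (β at suc n) + (0# * 0# + q * q ^ suc n) * (α at suc n) - (q ^ (3 ℕ.+ (n ℕ.+ n)) * (β at n) + 0# * (α at n)) ≈ β at suc (suc n)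
    second = trans (+-cong (+-cong (*-congˡ (*-congˡ T₁)) (*-congˡ (*-congˡ T₁))) (-‿cong (+-congʳ (*-congʳ P₃)))) (trans (prove ρ
        ((ø ⊗ ex ⊕ v7 ⊗ (v0 ⊗ ø)) ⊗ (v6 ⊗ et) ⊕ (ø ⊗ ø ⊕ v0 ⊗ ex) ⊗ (v5 ⊗ et) ⊖ (e₃ ⊗ (v4 ⊗ v2) ⊕ ø ⊗ (v3 ⊗ v2)))
        ((v5 ⊖ v4) ⊗ eᵗ) ≡.refl) (*-congˡ (sym T₂)))

  pp-value : pp∞ L.≈ embed (poch⁻ 1 0)
  pp-value = L.sym (L.trans (embed-∏ (factors⁻ 1 0) factors) (L.∏-cong same factors))
    where
    same : ∀ n → embed (1# - q ^ (1 ℕ.+ n ℕ.* 1)) L.≈ L.1# L.- L.q L.^ suc n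
    same n = L.trans (embed-1-q^ (suc (n ℕ.* 1))) (L.reflexive (≡.cong (λ k → L.1# L.- L.q L.^ suc k) (ℕ.*-identityʳ n)))
    factors : ∀ n → L.Ord n (embed (1# - q ^ (1 ℕ.+ n ℕ.* 1)) L.- L.1#)
    factors n = factors⁻ 1 0 n , ord-cong (prove [] ø (ø ⊖ ø) ≡.refl) ord-0

  theta : A 0 * poch⁻ 1 0 ≈ κ * ∑ (α at_) × q * g 1 * poch⁻ 1 0 ≈ κ * ∑ (β at_)
  theta = trans (prove (A 0 ∷ q * 1# * g 1 ∷ P ∷ three ∷ []) (v0 ⊗ v2) (v0 ⊗ v2 ⊕ v3 ⊗ (v1 ⊗ ø)) ≡.refl) (trans (proj₁ both) (prove (∑ (α at_) ∷ κ ∷ ∑ (β at_) ∷ three ∷ []) (v0 ⊗ v1 ⊕ v3 ⊗ (v2 ⊗ ø)) (v1 ⊗ v0) ≡.refl)) ,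
    trans (prove (A 0 ∷ q ∷ g 1 ∷ P ∷ []) (v1 ⊗ v2 ⊗ v3) (v0 ⊗ ø ⊕ v1 ⊗ I ⊗ v2 ⊗ v3) ≡.refl) (trans (proj₂ both) (prove (∑ (α at_) ∷ κ ∷ ∑ (β at_) ∷ []) (v0 ⊗ ø ⊕ v2 ⊗ v1) (v1 ⊗ v2) ≡.refl))
    where
    P = poch⁻ 1 0
    swap : ∀ x y z → x L.* y L.* z L.≈ x L.* z L.* y
    swap x y z = L.trans (L.*-assoc x y z) (L.trans (L.*-congˡ (L.*-comm y z)) (L.sym (L.*-assoc x z y)))
    both : E 0 L.* embed P L.≈ (∑ (α at_) , ∑ (β at_)) L.* embed κ
    both = L.trans (L.*-cong E-value (L.sym pp-value)) (L.trans (swap _ _ _) (L.*-congʳ (L.trans triple-product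
      (L.trans (L.∑-cong (λ n → proj₁ (e-value n)) e-summable) (∑-pair (at-summable α) (at-summable β))))))

module Thetas where
  open import Data.Integer.Base using (∣_∣; 0ℤ; 1ℤ)
  open import Data.Vec.Base using ([]; _∷_)
  open Solver
  open Lam using (triangle)
  open Bilateral
  open Quintuple

  six : ℕ → ℕ
  six zero = 0
  six (suc M) = 6 ℕ.+ six M

  six-* : ∀ M → six M ≡ 6 ℕ.* M
  six-* zero = ≡.refl
  six-* (suc M) = ≡.trans (≡.cong (6 ℕ.+_) (six-* M)) (≡.sym (ℕ.*-suc 6 M))

  M≤six : ∀ M → M ≤ six M
  M≤six zero = z≤n
  M≤six (suc M) = s≤s (ℕ.≤-trans (M≤six M) (ℕ.m≤n+m _ 5))

  triangle-6 : ∀ n → triangle (6 ℕ.+ n) ≡ 21 ℕ.+ 6 ℕ.* n ℕ.+ triangle n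
  triangle-6 n = lemma n (triangle n)
    where
    lemma : ∀ n t → 6 ℕ.+ n ℕ.+ (5 ℕ.+ n ℕ.+ (4 ℕ.+ n ℕ.+ (3 ℕ.+ n ℕ.+ (2 ℕ.+ n ℕ.+ (1 ℕ.+ n ℕ.+ t))))) ≡ 21 ℕ.+ 6 ℕ.* n ℕ.+ t
    lemma = ℕR.solve-∀

  triangle-six : ∀ i M → triangle (i ℕ.+ six M) ≡ triangle i ℕ.+ (6 ℕ.* i ℕ.+ 3) ℕ.* M ℕ.+ 18 ℕ.* (M ℕ.* M)
  triangle-six i zero = ≡.trans (≡.cong triangle (ℕ.+-identityʳ i)) (base (triangle i) (6 ℕ.* i ℕ.+ 3))
    where
    base : ∀ t a → t ≡ t ℕ.+ a ℕ.* 0 ℕ.+ 0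
    base = ℕR.solve-∀
  triangle-six i (suc M) = ≡.trans (≡.cong triangle (move i (six M))) (≡.trans (triangle-6 (i ℕ.+ six M))
    (≡.trans (≡.cong₂ (λ s t → 21 ℕ.+ 6 ℕ.* (i ℕ.+ s) ℕ.+ t) (six-* M) (triangle-six i M)) (step (triangle i) i M)))
    where
    move : ∀ i s → i ℕ.+ (6 ℕ.+ s) ≡ 6 ℕ.+ (i ℕ.+ s)
    move = ℕR.solve-∀
    step : ∀ t i M → 21 ℕ.+ 6 ℕ.* (i ℕ.+ 6 ℕ.* M) ℕ.+ (t ℕ.+ (6 ℕ.* i ℕ.+ 3) ℕ.* M ℕ.+ 18 ℕ.* (M ℕ.* M)) ≡ t ℕ.+ (6 ℕ.* i ℕ.+ 3) ℕ.* (1 ℕ.+ M) ℕ.+ 18 ℕ.* ((1 ℕ.+ M) ℕ.* (1 ℕ.+ M))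
    step = ℕR.solve-∀

  triangle-ℤ : ∀ i M → + triangle (i ℕ.+ six M) ≡ + triangle i ℤ.+ + (6 ℕ.* i ℕ.+ 3) ℤ.* + M ℤ.+ + 18 ℤ.* (+ M ℤ.* + M)
  triangle-ℤ i M = ≡.trans (≡.cong +_ (triangle-six i M))
    (≡.cong₂ ℤ._+_ (≡.cong (λ z → + triangle i ℤ.+ z) (ℤ.pos-* (6 ℕ.* i ℕ.+ 3) M)) (≡.trans (ℤ.pos-* 18 (M ℕ.* M)) (≡.cong (λ z → + 18 ℤ.* z) (ℤ.pos-* M M))))

  module Series where
    open Chain₇ public
    open Sums

    Antiperiodic : (ℕ → Carrier) → Set
    Antiperiodic γ = ∀ n → γ (6 ℕ.+ n) ≈ - γ n

    private
      αᵉ βᵉ : ℕ → Expr 4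
      αᵉ zero = v0
      αᵉ (suc zero) = v1
      αᵉ (suc (suc n)) = (I ⊕ I ⊕ I) ⊗ βᵉ (suc n) ⊖ αᵉ n
      βᵉ zero = v2
      βᵉ (suc zero) = v3
      βᵉ (suc (suc n)) = αᵉ (suc n) ⊖ βᵉ n

    α-antiperiodic : Antiperiodic α
    α-antiperiodic n = prove (α n ∷ α (suc n) ∷ β n ∷ β (suc n) ∷ []) (αᵉ 6) (⊝ v0) ≡.refl

    β-antiperiodic : Antiperiodic β
    β-antiperiodic n = prove (α n ∷ α (suc n) ∷ β n ∷ β (suc n) ∷ []) (βᵉ 6) (⊝ v2) ≡.refl

    private
      αᵉ₀ βᵉ₀ : ∀ {k} → ℕ → Expr k
      αᵉ₀ zero = I
      αᵉ₀ (suc zero) = ⊝ I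
      αᵉ₀ (suc (suc n)) = (I ⊕ I ⊕ I) ⊗ βᵉ₀ (suc n) ⊖ αᵉ₀ n
      βᵉ₀ zero = ø
      βᵉ₀ (suc zero) = I
      βᵉ₀ (suc (suc n)) = αᵉ₀ (suc n) ⊖ βᵉ₀ n
      γᵉ γᵉ₀ : ∀ {k} → ℕ → Expr k
      γᵉ n = αᵉ₀ n ⊕ (βᵉ₀ n ⊕ βᵉ₀ n)
      γᵉ₀ n = αᵉ₀ n ⊕ βᵉ₀ n

    _⊞_ : (ℕ → Carrier) → (ℕ → Carrier) → ℕ → Carrier
    (γ ⊞ δ) n = γ n + δ n

    ⊞-antiperiodic : ∀ {γ δ} → Antiperiodic γ → Antiperiodic δ → Antiperiodic (γ ⊞ δ)
    ⊞-antiperiodic {γ} {δ} p r n = trans (+-cong (p n) (r n)) (prove (γ n ∷ δ n ∷ []) (⊝ v0 ⊕ ⊝ v1) (⊝ (v0 ⊕ v1)) ≡.refl)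

    ∑-⊞ : ∀ γ δ → ∑ (γ at_) + ∑ (δ at_) ≈ ∑ ((γ ⊞ δ) at_)
    ∑-⊞ γ δ = trans (∑-+ (at-summable γ) (at-summable δ)) (∑-cong (λ n → sym (distribʳ _ _ _)) (λ n → ord-+ (at-summable γ n) (at-summable δ n)))

    γ-six : ∀ {γ} → Antiperiodic γ → ∀ i M → γ (i ℕ.+ six M) ≈ (- 1#) ^ M * γ i
    γ-six {γ} p i zero = trans (reflexive (≡.cong γ (ℕ.+-identityʳ i))) (sym (*-identityˡ _))
    γ-six {γ} p i (suc M) = trans (reflexive (≡.cong γ (move i (six M)))) (trans (p (i ℕ.+ six M)) (trans (-‿cong (γ-six p i M))
      (prove ((- 1#) ^ M ∷ γ i ∷ []) (⊝ (v0 ⊗ v1)) (⊝ I ⊗ v0 ⊗ v1) ≡.refl)))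
      where
      move : ∀ i s → i ℕ.+ (6 ℕ.+ s) ≡ 6 ℕ.+ (i ℕ.+ s)
      move = ℕR.solve-∀

    at-zero : ∀ {γ} → Antiperiodic γ → ∀ i M → γ i ≈ 0# → γ at (i ℕ.+ six M) ≈ 0#
    at-zero p i M z = trans (*-congʳ (trans (γ-six p i M) (trans (*-congˡ z) (zeroʳ _)))) (zeroˡ _)

    at-6 : ∀ {γ} → Antiperiodic γ → ∀ n → γ at (6 ℕ.+ n) ≈ - (q ^ (21 ℕ.+ 6 ℕ.* n)) * (γ at n)
    at-6 {γ} p n = trans (*-cong (p n) (trans (q^-≡ (triangle-6 n)) (q^-+ (21 ℕ.+ 6 ℕ.* n) (triangle n))))
      (prove (γ n ∷ q ^ (21 ℕ.+ 6 ℕ.* n) ∷ q ^ triangle n ∷ []) (⊝ v0 ⊗ (v1 ⊗ v2)) (⊝ v1 ⊗ (v0 ⊗ v2)) ≡.refl)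

    module Match (a c : ℕ) (sum : + suc c ≡ + 6 ℤ.- + suc a) where
      module Q = Watson a c sum
      open Q public using (term; χ)

      match : ∀ k {γ} → Antiperiodic γ → ∀ i u v M → χ v ≈ (- 1#) ^ M * γ i →
        + k ℤ.+ (Q.EA u ℤ.+ Q.EB v) ≡ + triangle i ℤ.+ + (6 ℕ.* i ℕ.+ 3) ℤ.* + M ℤ.+ + 18 ℤ.* (+ M ℤ.* + M) → q ^ k * term u v ≈ γ at (i ℕ.+ six M)
      match k {γ} p i u v M sign exponent = begin
        q ^ k * term u v ≈⟨ *-congˡ (Q.term-value u v) ⟩
        q ^ k * (χ v * q ^ n) ≈⟨ prove (q ^ k ∷ χ v ∷ q ^ n ∷ []) (v0 ⊗ (v1 ⊗ v2)) (v1 ⊗ (v0 ⊗ v2)) ≡.refl ⟩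
        χ v * (q ^ k * q ^ n) ≈⟨ *-cong (trans sign (sym (γ-six p i M))) (sym (q^-+ k n)) ⟩
        γ (i ℕ.+ six M) * q ^ (k ℕ.+ n) ≈⟨ *-congˡ (q^-≡ (ℤ.+-injective (≡.trans (≡.cong (λ z → + k ℤ.+ z) (Q.natural u v)) (≡.trans exponent (≡.sym (triangle-ℤ i M)))))) ⟩
        γ at (i ℕ.+ six M) ∎
        where
        n = ∣ Q.EA u ∣ ℕ.+ ∣ Q.EB v ∣

    private
      same-sign : ∀ {x y} → y ≈ 1# → x ≈ x * y
      same-sign e = sym (trans (*-congˡ e) (*-identityʳ _))
      opposite : ∀ {x y} → y ≈ - 1# → - 1# * x ≈ x * y
      opposite e = trans (*-comm _ _) (*-congˡ (sym e))

    -- The coefficients of the two quintuple products are the linear combinations α + 2 β and β.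
    module One where
      open Match 0 4 ≡.refl public
      γ : ℕ → Carrier
      γ = α ⊞ (β ⊞ β)
      γ-anti : Antiperiodic γ
      γ-anti = ⊞-antiperiodic {α} {β ⊞ β} α-antiperiodic (⊞-antiperiodic {β} {β} β-antiperiodic β-antiperiodic)

      window : ∀ M → W (λ l → term l l + term (l ℤ.+ 1ℤ) l) M ≈ Σ< (γ at_) (six M) + term (ℤ.- + M) (ℤ.- + M) - term (+ M) (+ M)
      window zero = prove (term 0ℤ 0ℤ ∷ []) ø (ø ⊕ v0 ⊖ v0) ≡.refl
      window (suc M) = trans (+-cong (window M) (+-cong (+-congˡ t₁) (+-congˡ t₄)))
        (trans (prove (Σ< w m ∷ c₋ ∷ c₊ ∷ w (1 ℕ.+ m) ∷ d₋ ∷ w (4 ℕ.+ m) ∷ d₊ ∷ []) ((v0 ⊕ v1 ⊖ v2) ⊕ ((v2 ⊕ v3) ⊕ (v4 ⊕ v5))) (v0 ⊕ v1 ⊕ v3 ⊕ ø ⊕ ø ⊕ v5 ⊕ v6 ⊕ v4 ⊖ v6) ≡.refl)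
          (+-congʳ (+-congʳ (+-cong (+-congʳ (+-cong (+-cong (+-congʳ (+-congˡ t₀)) (sym (at-zero {γ} γ-anti 2 M (z₂)))) (sym (at-zero {γ} γ-anti 3 M z₃)))) t₅))))
        where
        w = γ at_
        m = six M
        c₋ = term (ℤ.- + M) (ℤ.- + M)
        c₊ = term (+ M) (+ M)
        d₋ = term -[1+ M ] -[1+ M ]
        d₊ = term (+ suc M) (+ suc M)
        z₂ : γ 2 ≈ 0#
        z₂ = prove [] (γᵉ 2) ø ≡.refl
        z₃ : γ 3 ≈ 0#
        z₃ = prove [] (γᵉ 3) ø ≡.refl
        x₀ : ∀ m → + 0 ℤ.+ ((+ 6 ℤ.* (ℤ.- m) ℤ.* (ℤ.- m) ℤ.+ (-[1+ 4 ]) ℤ.* (ℤ.- m)) ℤ.+ (+ 12 ℤ.* (ℤ.- m) ℤ.* (ℤ.- m) ℤ.+ (+ 2) ℤ.* (ℤ.- m))) ≡ + 0 ℤ.+ + 3 ℤ.* (m) ℤ.+ + 18 ℤ.* ((m) ℤ.* (m))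
        x₀ = ℤR.solve-∀
        x₁ : ∀ m → + 0 ℤ.+ ((+ 6 ℤ.* (m ℤ.+ 1ℤ) ℤ.* (m ℤ.+ 1ℤ) ℤ.+ (-[1+ 4 ]) ℤ.* (m ℤ.+ 1ℤ)) ℤ.+ (+ 12 ℤ.* (m) ℤ.* (m) ℤ.+ (+ 2) ℤ.* (m))) ≡ + 1 ℤ.+ + 9 ℤ.* (m) ℤ.+ + 18 ℤ.* ((m) ℤ.* (m))
        x₁ = ℤR.solve-∀
        x₄ : ∀ m → + 0 ℤ.+ ((+ 6 ℤ.* (ℤ.- (1ℤ ℤ.+ m) ℤ.+ 1ℤ) ℤ.* (ℤ.- (1ℤ ℤ.+ m) ℤ.+ 1ℤ) ℤ.+ (-[1+ 4 ]) ℤ.* (ℤ.- (1ℤ ℤ.+ m) ℤ.+ 1ℤ)) ℤ.+ (+ 12 ℤ.* (ℤ.- (1ℤ ℤ.+ m)) ℤ.* (ℤ.- (1ℤ ℤ.+ m)) ℤ.+ (+ 2) ℤ.* (ℤ.- (1ℤ ℤ.+ m)))) ≡ + 10 ℤ.+ + 27 ℤ.* (m) ℤ.+ + 18 ℤ.* ((m) ℤ.* (m))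
        x₄ = ℤR.solve-∀
        x₅ : ∀ m → + 0 ℤ.+ ((+ 6 ℤ.* (1ℤ ℤ.+ m) ℤ.* (1ℤ ℤ.+ m) ℤ.+ (-[1+ 4 ]) ℤ.* (1ℤ ℤ.+ m)) ℤ.+ (+ 12 ℤ.* (1ℤ ℤ.+ m) ℤ.* (1ℤ ℤ.+ m) ℤ.+ (+ 2) ℤ.* (1ℤ ℤ.+ m))) ≡ + 15 ℤ.+ + 33 ℤ.* (m) ℤ.+ + 18 ℤ.* ((m) ℤ.* (m))
        x₅ = ℤR.solve-∀
        t₀ : c₋ ≈ w m
        t₀ = trans (sym (*-identityˡ c₋)) (match 0 {γ} γ-anti 0 (ℤ.- + M) (ℤ.- + M) M (trans (reflexive (≡.cong ((- 1#) ^_) (ℤ.∣-i∣≡∣i∣ (+ M)))) (same-sign (prove [] (I ⊕ (ø ⊕ ø)) I ≡.refl))) (x₀ (+ M)))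
        t₁ : term (+ M ℤ.+ 1ℤ) (+ M) ≈ w (1 ℕ.+ m)
        t₁ = trans (sym (*-identityˡ (term (+ M ℤ.+ 1ℤ) (+ M)))) (match 0 {γ} γ-anti 1 (+ M ℤ.+ 1ℤ) (+ M) M (same-sign (prove [] (⊝ I ⊕ (I ⊕ I)) I ≡.refl)) (x₁ (+ M)))
        t₄ : term (-[1+ M ] ℤ.+ 1ℤ) -[1+ M ] ≈ w (4 ℕ.+ m)
        t₄ = trans (sym (*-identityˡ (term (-[1+ M ] ℤ.+ 1ℤ) -[1+ M ]))) (match 0 {γ} γ-anti 4 (-[1+ M ] ℤ.+ 1ℤ) -[1+ M ] M (opposite (prove [] (γᵉ 4) (⊝ I) ≡.refl)) (x₄ (+ M)))
        t₅ : d₊ ≈ w (5 ℕ.+ m)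
        t₅ = trans (sym (*-identityˡ d₊)) (match 0 {γ} γ-anti 5 (+ suc M) (+ suc M) M (opposite (prove [] (γᵉ 5) (⊝ I) ≡.refl)) (x₅ (+ M)))

      expansion : BS (λ l → term l l + term (l ℤ.+ 1ℤ) l) (∑ (γ at_))
      expansion N = N , λ M N≤M → ord-mono N≤M (ord-cong (trans (prove (∑ w ∷ Σ< w (six M) ∷ term (ℤ.- + M) (ℤ.- + M) ∷ term (+ M) (+ M) ∷ []) ((v0 ⊖ v1) ⊖ (v2 ⊖ v3)) (v0 ⊖ (v1 ⊕ v2 ⊖ v3)) ≡.refl) (+-congˡ (-‿cong (sym (window M)))))
        (ord-- (ord-mono (M≤six M) (∑-⟶ (at-summable γ) (six M)))
          (ord-- (ord-*ˡ _ (proj₂ (Q.B.f-tail M) (ℤ.- + M) (ℕ.≤-reflexive (≡.sym (ℤ.∣-i∣≡∣i∣ (+ M)))))) (ord-*ˡ _ (proj₂ (Q.B.f-tail M) (+ M) ℕ.≤-refl)))))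
        where
        w = γ at_

    module Five where
      open Match 4 0 ≡.refl public

      f : ℤ → Carrier
      f l = q ^ 1 * (term l l + term (l ℤ.+ 1ℤ) l)

      window : ∀ M → W f M ≈ Σ< (β at_) (six M)
      window zero = H.refl
      window (suc M) = trans (+-cong (window M) (+-cong (trans (distribˡ _ _ _) (+-cong t₁ t₃)) (trans (distribˡ _ _ _) (+-cong t₄ t₂))))
        (trans (prove (Σ< w m ∷ w (1 ℕ.+ m) ∷ w (2 ℕ.+ m) ∷ w (3 ℕ.+ m) ∷ w (4 ℕ.+ m) ∷ []) (v0 ⊕ ((v1 ⊕ v3) ⊕ (v4 ⊕ v2))) (v0 ⊕ ø ⊕ v1 ⊕ v2 ⊕ v3 ⊕ v4 ⊕ ø) ≡.refl)
          (+-cong (+-congʳ (+-congʳ (+-congʳ (+-congʳ (+-congˡ (sym (at-zero {β} β-antiperiodic 0 M H.refl))))))) (sym (at-zero {β} β-antiperiodic 5 M (prove [] (βᵉ₀ 5) ø ≡.refl)))))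
        where
        w = β at_
        m = six M
        x₁ : ∀ m → + 1 ℤ.+ ((+ 6 ℤ.* (m) ℤ.* (m) ℤ.+ (-[1+ 0 ]) ℤ.* (m)) ℤ.+ (+ 12 ℤ.* (m) ℤ.* (m) ℤ.+ (+ 10) ℤ.* (m))) ≡ + 1 ℤ.+ + 9 ℤ.* (m) ℤ.+ + 18 ℤ.* ((m) ℤ.* (m))
        x₁ = ℤR.solve-∀
        x₂ : ∀ m → + 1 ℤ.+ ((+ 6 ℤ.* (ℤ.- (1ℤ ℤ.+ m) ℤ.+ 1ℤ) ℤ.* (ℤ.- (1ℤ ℤ.+ m) ℤ.+ 1ℤ) ℤ.+ (-[1+ 0 ]) ℤ.* (ℤ.- (1ℤ ℤ.+ m) ℤ.+ 1ℤ)) ℤ.+ (+ 12 ℤ.* (ℤ.- (1ℤ ℤ.+ m)) ℤ.* (ℤ.- (1ℤ ℤ.+ m)) ℤ.+ (+ 10) ℤ.* (ℤ.- (1ℤ ℤ.+ m)))) ≡ + 3 ℤ.+ + 15 ℤ.* (m) ℤ.+ + 18 ℤ.* ((m) ℤ.* (m))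
        x₂ = ℤR.solve-∀
        x₃ : ∀ m → + 1 ℤ.+ ((+ 6 ℤ.* (m ℤ.+ 1ℤ) ℤ.* (m ℤ.+ 1ℤ) ℤ.+ (-[1+ 0 ]) ℤ.* (m ℤ.+ 1ℤ)) ℤ.+ (+ 12 ℤ.* (m) ℤ.* (m) ℤ.+ (+ 10) ℤ.* (m))) ≡ + 6 ℤ.+ + 21 ℤ.* (m) ℤ.+ + 18 ℤ.* ((m) ℤ.* (m))
        x₃ = ℤR.solve-∀
        x₄ : ∀ m → + 1 ℤ.+ ((+ 6 ℤ.* (ℤ.- (1ℤ ℤ.+ m)) ℤ.* (ℤ.- (1ℤ ℤ.+ m)) ℤ.+ (-[1+ 0 ]) ℤ.* (ℤ.- (1ℤ ℤ.+ m))) ℤ.+ (+ 12 ℤ.* (ℤ.- (1ℤ ℤ.+ m)) ℤ.* (ℤ.- (1ℤ ℤ.+ m)) ℤ.+ (+ 10) ℤ.* (ℤ.- (1ℤ ℤ.+ m)))) ≡ + 10 ℤ.+ + 27 ℤ.* (m) ℤ.+ + 18 ℤ.* ((m) ℤ.* (m))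
        x₄ = ℤR.solve-∀
        t₁ : q ^ 1 * term (+ M) (+ M) ≈ w (1 ℕ.+ m)
        t₁ = match 1 {β} β-antiperiodic 1 (+ M) (+ M) M (same-sign H.refl) (x₁ (+ M))
        t₂ : q ^ 1 * term (-[1+ M ] ℤ.+ 1ℤ) -[1+ M ] ≈ w (2 ℕ.+ m)
        t₂ = match 1 {β} β-antiperiodic 2 (-[1+ M ] ℤ.+ 1ℤ) -[1+ M ] M (opposite (prove [] (βᵉ₀ 2) (⊝ I) ≡.refl)) (x₂ (+ M))
        t₃ : q ^ 1 * term (+ M ℤ.+ 1ℤ) (+ M) ≈ w (3 ℕ.+ m)
        t₃ = match 1 {β} β-antiperiodic 3 (+ M ℤ.+ 1ℤ) (+ M) M (same-sign (prove [] (βᵉ₀ 3) I ≡.refl)) (x₃ (+ M))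
        t₄ : q ^ 1 * term -[1+ M ] -[1+ M ] ≈ w (4 ℕ.+ m)
        t₄ = match 1 {β} β-antiperiodic 4 -[1+ M ] -[1+ M ] M (opposite (prove [] (βᵉ₀ 4) (⊝ I) ≡.refl)) (x₄ (+ M))

      expansion : BS f (∑ (β at_))
      expansion N = N , λ M N≤M → ord-mono N≤M (ord-cong (+-congˡ (-‿cong (sym (window M)))) (ord-mono (M≤six M) (∑-⟶ (at-summable β) (six M))))

    module Euler where
      γ : ℕ → Carrier
      γ = α ⊞ β
      γ-anti : Antiperiodic γ
      γ-anti = ⊞-antiperiodic {α} {β} α-antiperiodic β-antiperiodic

      x y p : Carrier
      x = q ^ 3
      y = - (q ^ 6)
      p = - (q ^ 9)
      xy : x * y ≈ p
      xy = prove (q ∷ []) (v0 ⊛ 3 ⊗ (⊝ (v0 ⊛ 6))) (⊝ (v0 ⊛ 9)) ≡.refl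
      module J = TwoVariable x y p xy (ord-≥ {n = 3} (s≤s z≤n)) (ord-neg (ord-≥ {n = 6} (s≤s z≤n)))
      open J

      private
        w = γ at_
        p-square : ∀ n → p ^ n * p ^ n ≈ q ^ (18 ℕ.* n)
        p-square zero = *-identityˡ _
        p-square (suc n) = trans (prove (q ∷ p ^ n ∷ []) (⊝ (v0 ⊛ 9) ⊗ v1 ⊗ (⊝ (v0 ⊛ 9) ⊗ v1)) (v0 ⊛ 18 ⊗ (v1 ⊗ v1)) ≡.refl)
          (trans (*-congˡ (p-square n)) (trans (sym (q^-+ 18 (18 ℕ.* n))) (q^-≡ (≡.sym (ℕ.*-suc 18 n)))))

      θ⁻-value : ∀ n → θ⁻ n ≈ w (3 ℕ.* n) × θ⁻ (suc n) ≈ w (3 ℕ.* suc n)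
      θ⁻-value zero = prove [] I ((I ⊕ ø) ⊗ I) ≡.refl , prove (q ∷ []) (I ⊗ (⊝ (v0 ⊛ 6) ⊗ I)) (γᵉ₀ 3 ⊗ v0 ⊛ 6) ≡.refl
      θ⁻-value (suc n) = proj₂ (θ⁻-value n) , (begin
        θ⁻ n * (y * p ^ n) * (y * (p * p ^ n)) ≈⟨ prove (θ⁻ n ∷ q ∷ p ^ n ∷ []) (v0 ⊗ (⊝ (v1 ⊛ 6) ⊗ v2) ⊗ (⊝ (v1 ⊛ 6) ⊗ (⊝ (v1 ⊛ 9) ⊗ v2))) (⊝ (v1 ⊛ 21 ⊗ (v2 ⊗ v2)) ⊗ v0) ≡.refl ⟩
        - (q ^ 21 * (p ^ n * p ^ n)) * θ⁻ n ≈⟨ *-cong (-‿cong (trans (*-congˡ (p-square n)) (trans (sym (q^-+ 21 (18 ℕ.* n))) (q^-≡ (exponent n))))) (proj₁ (θ⁻-value n)) ⟩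
        - (q ^ (21 ℕ.+ 6 ℕ.* (3 ℕ.* n))) * w (3 ℕ.* n) ≈⟨ at-6 {γ} γ-anti (3 ℕ.* n) ⟨
        w (6 ℕ.+ 3 ℕ.* n) ≡⟨ ≡.cong w (index n) ⟩
        w (3 ℕ.* suc (suc n)) ∎)
        where
        exponent : ∀ n → 21 ℕ.+ 18 ℕ.* n ≡ 21 ℕ.+ 6 ℕ.* (3 ℕ.* n)
        exponent = ℕR.solve-∀
        index : ∀ n → 6 ℕ.+ 3 ℕ.* n ≡ 3 ℕ.* (2 ℕ.+ n)
        index = ℕR.solve-∀

      θ⁺-value : ∀ n → θ⁺ (suc n) ≈ w (2 ℕ.+ 3 ℕ.* n) × θ⁺ (suc (suc n)) ≈ w (2 ℕ.+ 3 ℕ.* suc n)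
      θ⁺-value zero = prove (q ∷ []) (I ⊗ (v0 ⊛ 3 ⊗ I)) (γᵉ₀ 2 ⊗ v0 ⊛ 3) ≡.refl , prove (q ∷ []) (I ⊗ (v0 ⊛ 3 ⊗ I) ⊗ (v0 ⊛ 3 ⊗ (⊝ (v0 ⊛ 9) ⊗ I))) (γᵉ₀ 5 ⊗ v0 ⊛ 15) ≡.refl
      θ⁺-value (suc n) = proj₂ (θ⁺-value n) , (begin
        θ⁺ (suc n) * (x * (p * p ^ n)) * (x * (p * (p * p ^ n))) ≈⟨ prove (θ⁺ (suc n) ∷ q ∷ p ^ n ∷ []) (v0 ⊗ (v1 ⊛ 3 ⊗ (⊝ (v1 ⊛ 9) ⊗ v2)) ⊗ (v1 ⊛ 3 ⊗ (⊝ (v1 ⊛ 9) ⊗ (⊝ (v1 ⊛ 9) ⊗ v2)))) (⊝ (v1 ⊛ 33 ⊗ (v2 ⊗ v2)) ⊗ v0) ≡.refl ⟩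
        - (q ^ 33 * (p ^ n * p ^ n)) * θ⁺ (suc n) ≈⟨ *-cong (-‿cong (trans (*-congˡ (p-square n)) (trans (sym (q^-+ 33 (18 ℕ.* n))) (q^-≡ (exponent n))))) (proj₁ (θ⁺-value n)) ⟩
        - (q ^ (21 ℕ.+ 6 ℕ.* (2 ℕ.+ 3 ℕ.* n))) * w (2 ℕ.+ 3 ℕ.* n) ≈⟨ at-6 {γ} γ-anti (2 ℕ.+ 3 ℕ.* n) ⟨
        w (6 ℕ.+ (2 ℕ.+ 3 ℕ.* n)) ≡⟨ ≡.cong w (index n) ⟩
        w (2 ℕ.+ 3 ℕ.* suc (suc n)) ∎)
        where
        exponent : ∀ n → 33 ℕ.+ 18 ℕ.* n ≡ 21 ℕ.+ 6 ℕ.* (2 ℕ.+ 3 ℕ.* n)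
        exponent = ℕR.solve-∀
        index : ∀ n → 6 ℕ.+ (2 ℕ.+ 3 ℕ.* n) ≡ 2 ℕ.+ 3 ℕ.* (2 ℕ.+ n)
        index = ℕR.solve-∀

      gap : ∀ n → w (1 ℕ.+ 3 ℕ.* n) ≈ 0# × w (1 ℕ.+ 3 ℕ.* suc n) ≈ 0#
      gap zero = prove (q ∷ []) (γᵉ₀ 1 ⊗ v0 ⊛ 1) ø ≡.refl , prove (q ∷ []) (γᵉ₀ 4 ⊗ v0 ⊛ 10) ø ≡.refl
      gap (suc n) = proj₂ (gap n) , trans (reflexive (≡.cong w (index n))) (trans (at-6 {γ} γ-anti (1 ℕ.+ 3 ℕ.* n)) (trans (*-congˡ (proj₁ (gap n))) (zeroʳ _)))
        where
        index : ∀ n → 1 ℕ.+ 3 ℕ.* (2 ℕ.+ n) ≡ 6 ℕ.+ (1 ℕ.+ 3 ℕ.* n)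
        index = ℕR.solve-∀

      window : ∀ n → Σ< θ n ≈ Σ< w (3 ℕ.* n)
      window zero = H.refl
      window (suc n) = trans (+-cong (window n) (+-cong (proj₁ (θ⁺-value n)) (proj₁ (θ⁻-value n))))
        (trans (prove (Σ< w (3 ℕ.* n) ∷ w (2 ℕ.+ 3 ℕ.* n) ∷ w (3 ℕ.* n) ∷ []) (v0 ⊕ (v1 ⊕ v2)) (v0 ⊕ v2 ⊕ ø ⊕ v1) ≡.refl)
        (trans (+-congʳ (+-congˡ (sym (proj₁ (gap n))))) (reflexive (≡.cong (Σ< w) (≡.sym (ℕ.*-suc 3 n))))))

      sum : ∑ θ ≈ ∑ w
      sum = ⟶-unique (∑-⟶ θ-summable) (λ n → ord-mono (ℕ.m≤m+n n _) (ord-cong (+-congˡ (-‿cong (sym (window n)))) (∑-⟶ (at-summable γ) (3 ℕ.* n))))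

module Evaluations where
  open import Data.Integer.Base using (1ℤ)
  open import Data.Vec.Base using ([]; _∷_)
  open Solver
  open Thetas using (module Series)
  open Bilateral
  open Series public
  open Sums
  open S using () renaming (_*_ to _✶_)

  signed⁻ : ∀ a b → ∏ (λ n → 1# + - 1# * q ^ (a ℕ.+ n ℕ.* suc b)) ≈ poch⁻ a b
  signed⁻ a b = sym (∏-cong (λ n → prove (q ^ (a ℕ.+ n ℕ.* suc b) ∷ []) (I ⊖ v0) (I ⊕ ⊝ I ⊗ v0) ≡.refl) (H.factors⁻ a b))

  signed⁺ : ∀ a b → ∏ (λ n → 1# + 1# * q ^ (a ℕ.+ n ℕ.* suc b)) ≈ poch⁺ a b
  signed⁺ a b = sym (∏-cong (λ n → +-congˡ (sym (*-identityˡ _))) (H.factors⁺ a b))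

  p r : ℕ → Carrier
  p i = poch⁻ i 11
  r i = poch⁻ i 23

  private
    E₂₄ : ∏ (λ n → 1# + - 1# * q ^ (48 ℕ.+ n ℕ.* 72)) * ∏ (λ n → 1# + - 1# * q ^ (24 ℕ.+ n ℕ.* 72)) * poch⁻ 72 71 ≈ r 24
    E₂₄ = trans (*-congʳ (*-cong (signed⁻ 48 71) (signed⁻ 24 71))) (trans (prove (poch⁻ 48 71 ∷ poch⁻ 24 71 ∷ poch⁻ 72 71 ∷ []) (v0 ⊗ v1 ⊗ v2) (I ⊗ v1 ⊗ v0 ⊗ v2) ≡.refl) (sym (dissect 2 24 23)))

  one-product : ∑ (One.γ at_) ≈ poch⁺ 1 11 * poch⁺ 11 11 * p 12 * (r 14 * r 10)
  one-product = cancel (r 24) (unital⁻ 23 23) (begin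
    r 24 * ∑ (One.γ at_) ≈⟨ *-congʳ E₂₄ ⟨
    One.Q.E₀.value * ∑ (One.γ at_) ≈⟨ bs-unique (bs-*ˡ One.Q.E₀.value One.expansion) One.Q.quintuple ⟩
    One.Q.A.value * One.Q.B.value ≈⟨ *-cong (*-congʳ (*-cong (signed⁺ 1 11) (signed⁺ 11 11))) (*-congʳ (*-cong (signed⁻ 14 23) (signed⁻ 10 23))) ⟩
    poch⁺ 1 11 * poch⁺ 11 11 * p 12 * (r 14 * r 10 * r 24) ≈⟨ prove (poch⁺ 1 11 * poch⁺ 11 11 * p 12 ∷ r 14 * r 10 ∷ r 24 ∷ []) (v0 ⊗ (v1 ⊗ v2)) (v2 ⊗ (v0 ⊗ v1)) ≡.refl ⟩
    r 24 * (poch⁺ 1 11 * poch⁺ 11 11 * p 12 * (r 14 * r 10)) ∎)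

  five-product : ∑ (β at_) ≈ q * (poch⁺ 5 11 * poch⁺ 7 11 * p 12 * (r 22 * r 2))
  five-product = cancel (r 24) (unital⁻ 23 23) (begin
    r 24 * ∑ (β at_) ≈⟨ *-congʳ E₂₄ ⟨
    Five.Q.E₀.value * ∑ (β at_) ≈⟨ bs-unique (bs-cong (λ l → swap Five.Q.E₀.value (Five.term l l + Five.term (l ℤ.+ 1ℤ) l)) (bs-*ˡ Five.Q.E₀.value Five.expansion)) (bs-*ˡ (q ^ 1) Five.Q.quintuple) ⟩
    q ^ 1 * (Five.Q.A.value * Five.Q.B.value) ≈⟨ *-congˡ (*-cong (*-congʳ (*-cong (signed⁺ 5 11) (signed⁺ 7 11))) (*-congʳ (*-cong (signed⁻ 22 23) (signed⁻ 2 23)))) ⟩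
    q ^ 1 * (poch⁺ 5 11 * poch⁺ 7 11 * p 12 * (r 22 * r 2 * r 24)) ≈⟨ prove (poch⁺ 5 11 * poch⁺ 7 11 * p 12 ∷ r 22 * r 2 ∷ r 24 ∷ q ∷ []) (v3 ⊛ 1 ⊗ (v0 ⊗ (v1 ⊗ v2))) (v2 ⊗ (v3 ⊗ (v0 ⊗ v1))) ≡.refl ⟩
    r 24 * (q * (poch⁺ 5 11 * poch⁺ 7 11 * p 12 * (r 22 * r 2))) ∎)
    where
    swap : ∀ e t → e * (q ^ 1 * t) ≈ q ^ 1 * (e * t)
    swap e t = prove (e ∷ q ^ 1 ∷ t ∷ []) (v0 ⊗ (v1 ⊗ v2)) (v1 ⊗ (v0 ⊗ v2)) ≡.refl

  ∏-pairs : ∀ {f} → Factors f → ∏ f ≈ ∏ (λ k → f (k ℕ.+ k) * f (suc (k ℕ.+ k)))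
  ∏-pairs {f} s = ⟶-unique {f = Π< pair} (λ n → ord-mono (ℕ.m≤m+n n n) (ord-cong (+-congˡ (-‿cong (sym (halves n)))) (H.∏-⟶ s (n ℕ.+ n)))) (H.∏-⟶ pairs)
    where
    pair : ℕ → Carrier
    pair k = f (k ℕ.+ k) * f (suc (k ℕ.+ k))
    halves : ∀ n → Π< pair n ≈ Π< f (n ℕ.+ n)
    halves zero = H.refl
    halves (suc n) = trans (*-congʳ (halves n)) (trans (sym (*-assoc _ _ _)) (reflexive (≡.cong (λ k → Π< f (suc k)) (≡.sym (ℕ.+-suc n n)))))
    pairs : Factors pair
    pairs n = near-* (ord-mono (ℕ.m≤m+n n n) (s (n ℕ.+ n))) (ord-mono (ℕ.≤-trans (ℕ.m≤m+n n n) (ℕ.n≤1+n _)) (s (suc (n ℕ.+ n))))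

  alternating : ∀ {f} a b c → Factors f → (∀ k → f (k ℕ.+ k) ≈ 1# + q ^ (a ℕ.+ k ℕ.* suc c)) → (∀ k → f (suc (k ℕ.+ k)) ≈ 1# - q ^ (b ℕ.+ k ℕ.* suc c)) → ∏ f ≈ poch⁺ a c * poch⁻ b c
  alternating a b c s even odd = trans (∏-pairs s) (trans (sym (H.∏-cong (λ k → *-cong (sym (even k)) (sym (odd k))) (H.factors-* (H.factors⁺ a c) (H.factors⁻ b c)))) (sym (H.∏-* (H.factors⁺ a c) (H.factors⁻ b c))))

  alternating′ : ∀ {f} a b c → Factors f → (∀ k → f (k ℕ.+ k) ≈ 1# - q ^ (a ℕ.+ k ℕ.* suc c)) → (∀ k → f (suc (k ℕ.+ k)) ≈ 1# + q ^ (b ℕ.+ k ℕ.* suc c)) → ∏ f ≈ poch⁻ a c * poch⁺ b c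
  alternating′ a b c s even odd = trans (∏-pairs s) (trans (sym (H.∏-cong (λ k → *-cong (sym (even k)) (sym (odd k))) (H.factors-* (H.factors⁻ a c) (H.factors⁺ b c)))) (sym (H.∏-* (H.factors⁻ a c) (H.factors⁺ b c))))

  euler-product : ∑ (Euler.γ at_) ≈ poch⁺ 3 5 * poch⁻ 6 5
  euler-product = begin
    ∑ (Euler.γ at_) ≈⟨ Euler.sum ⟨
    ∑ J.θ ≈⟨ J.θ-product ⟨
    ∏ (J.Factor Euler.x) * ∏ (J.Factor Euler.y) * ∏ (λ i → 1# - P ^ suc i)
      ≈⟨ *-cong (*-cong (alternating 3 12 17 (J.Factor-factors (ord-≥ {n = 3} (s≤s z≤n)))
            (λ k → +-congˡ (trans (*-congˡ (even k)) (sym (q^-+ 3 (k ℕ.* 18)))))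
            (λ k → trans (+-congˡ (*-congˡ (*-congˡ (even k)))) (trans (prove (q ∷ q ^ (k ℕ.* 18) ∷ []) (I ⊕ v0 ⊛ 3 ⊗ (⊝ (v0 ⊛ 9) ⊗ v1)) (I ⊖ v0 ⊛ 12 ⊗ v1) ≡.refl) (+-congˡ (-‿cong (sym (q^-+ 12 (k ℕ.* 18))))))))
          (alternating′ 6 15 17 (J.Factor-factors (ord-neg (ord-≥ {n = 6} (s≤s z≤n))))
            (λ k → trans (+-congˡ (*-congˡ (even k))) (trans (prove (q ∷ q ^ (k ℕ.* 18) ∷ []) (I ⊕ ⊝ (v0 ⊛ 6) ⊗ v1) (I ⊖ v0 ⊛ 6 ⊗ v1) ≡.refl) (+-congˡ (-‿cong (sym (q^-+ 6 (k ℕ.* 18)))))))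
            (λ k → trans (+-congˡ (*-congˡ (*-congˡ (even k)))) (trans (prove (q ∷ q ^ (k ℕ.* 18) ∷ []) (I ⊕ ⊝ (v0 ⊛ 6) ⊗ (⊝ (v0 ⊛ 9) ⊗ v1)) (I ⊕ v0 ⊛ 15 ⊗ v1) ≡.refl) (+-congˡ (sym (q^-+ 15 (k ℕ.* 18))))))))
        (alternating 9 18 17 (λ n → ord-cong (prove (P ^ suc n ∷ []) (⊝ v0) (I ⊖ v0 ⊖ I) ≡.refl) (ord-neg (ord-mono (ℕ.n≤1+n n) (ord-P^ (suc n)))))
            (λ k → trans (+-congˡ (-‿cong (*-congˡ (even k)))) (trans (prove (q ∷ q ^ (k ℕ.* 18) ∷ []) (I ⊖ ⊝ (v0 ⊛ 9) ⊗ v1) (I ⊕ v0 ⊛ 9 ⊗ v1) ≡.refl) (+-congˡ (sym (q^-+ 9 (k ℕ.* 18))))))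
            (λ k → trans (+-congˡ (-‿cong (*-congˡ (*-congˡ (even k))))) (trans (prove (q ∷ q ^ (k ℕ.* 18) ∷ []) (I ⊖ ⊝ (v0 ⊛ 9) ⊗ (⊝ (v0 ⊛ 9) ⊗ v1)) (I ⊖ v0 ⊛ 18 ⊗ v1) ≡.refl) (+-congˡ (-‿cong (sym (q^-+ 18 (k ℕ.* 18)))))))) ⟩
    a 3 * b 12 * (b 6 * a 15) * (a 9 * b 18) ≈⟨ prove (a 3 ∷ a 9 ∷ a 15 ∷ b 6 ∷ b 12 ∷ b 18 ∷ []) (v0 ⊗ v4 ⊗ (v3 ⊗ v2) ⊗ (v1 ⊗ v5)) ((v0 ⊗ v1 ⊗ v2) ⊗ (I ⊗ v3 ⊗ v4 ⊗ v5)) ≡.refl ⟩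
    a 3 * a 9 * a 15 * (1# * b 6 * b 12 * b 18) ≈⟨ *-cong thirds (dissect 2 6 5) ⟨
    poch⁺ 3 5 * poch⁻ 6 5 ∎
    where
    module J = Euler.J
    P = Euler.p
    a b : ℕ → Carrier
    a i = poch⁺ i 17
    b i = poch⁻ i 17
    ord-P^ : ∀ n → Ord n (P ^ n)
    ord-P^ n = ≡.subst (λ k → Ord k (P ^ n)) (ℕ.*-identityʳ n) (ord-^ {1} (ord-neg (ord-≥ {n = 9} (s≤s z≤n))) n)
    even : ∀ k → P ^ (k ℕ.+ k) ≈ q ^ (k ℕ.* 18)
    even zero = H.refl
    even (suc k) = trans (reflexive (≡.cong (λ j → P * P ^ j) (ℕ.+-suc k k))) (trans (*-congˡ (*-congˡ (even k)))
      (trans (prove (q ∷ q ^ (k ℕ.* 18) ∷ []) (⊝ (v0 ⊛ 9) ⊗ (⊝ (v0 ⊛ 9) ⊗ v1)) (v0 ⊛ 18 ⊗ v1) ≡.refl) (sym (q^-+ 18 (k ℕ.* 18)))))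
    thirds : poch⁺ 3 5 ≈ a 3 * a 9 * a 15
    thirds = cancel (b 3 * b 9 * b 15) (H.unital-* (H.unital-* (unital⁻ 2 17) (unital⁻ 8 17)) (unital⁻ 14 17)) (begin
      b 3 * b 9 * b 15 * poch⁺ 3 5 ≈⟨ prove (b 3 ∷ b 9 ∷ b 15 ∷ poch⁺ 3 5 ∷ []) (v0 ⊗ v1 ⊗ v2 ⊗ v3) (v3 ⊗ (I ⊗ v0 ⊗ v1 ⊗ v2)) ≡.refl ⟩
      poch⁺ 3 5 * (1# * b 3 * b 9 * b 15) ≈⟨ *-congˡ (dissect 2 3 5) ⟨
      poch⁺ 3 5 * poch⁻ 3 5 ≈⟨ poch-square 3 5 ⟩
      poch⁻ 6 11 ≈⟨ dissect 2 6 11 ⟩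
      1# * poch⁻ 6 35 * poch⁻ 18 35 * poch⁻ 30 35 ≈⟨ *-cong (*-cong (*-congˡ (poch-square 3 17)) (poch-square 9 17)) (poch-square 15 17) ⟨
      1# * (a 3 * b 3) * (a 9 * b 9) * (a 15 * b 15) ≈⟨ prove (b 3 ∷ b 9 ∷ b 15 ∷ a 3 ∷ a 9 ∷ a 15 ∷ []) (I ⊗ (v3 ⊗ v0) ⊗ (v4 ⊗ v1) ⊗ (v5 ⊗ v2)) (v0 ⊗ v1 ⊗ v2 ⊗ (v3 ⊗ v4 ⊗ v5)) ≡.refl ⟩
      b 3 * b 9 * b 15 * (a 3 * a 9 * a 15) ∎)

  D₀ : Carrier
  D₀ = Λ (num 1 (- q) ✶ den 2 q)

  AΦ-value : ∀ a → Λ (AΦ (q ^ a)) ≈ poch⁺ (a ℕ.+ 3) 5 * D₀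
  AΦ-value a = trans (cong-AΦ (q^-≡ (≡.sym (ℕ.+-identityʳ a)))) (trans
    (H.first-order-unique (λ k → 1# + q ^ (a ℕ.+ 3 ℕ.+ k ℕ.* 6)) (λ k → Λ (AΦ (q ^ (a ℕ.+ k ℕ.* 6)))) (λ k → poch⁺ (a ℕ.+ 3 ℕ.+ k ℕ.* 6) 5 * D₀)
      (λ k → trans (A-rec (q ^ (a ℕ.+ k ℕ.* 6))) (*-cong (+-congˡ (trans (sym (q^-+ (a ℕ.+ k ℕ.* 6) 3)) (q^-≡ (exponent₃ a k)))) (cong-AΦ (trans (sym (q^-+ (a ℕ.+ k ℕ.* 6) 6)) (q^-≡ (exponent₆ a k))))))
      (λ k → trans (*-congʳ (poch⁺-suc (a ℕ.+ 3 ℕ.+ k ℕ.* 6) 5)) (trans (*-assoc _ _ _) (*-congˡ (*-congʳ (reflexive (≡.cong (λ i → poch⁺ i 5) (exponent₆ (a ℕ.+ 3) k)))))))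
      (λ k → ord-cong (prove (D₀ ∷ Λ (AΦ (q ^ (a ℕ.+ k ℕ.* 6))) ∷ []) (⊝ (v1 ⊖ v0)) (v0 ⊖ v1) ≡.refl) (ord-neg (near k)))
      (⟶-≈ (*-identityˡ D₀) (⟶-* (H.⟶⁺ (a ℕ.+ 3) 5 5) (H.⟶-const {x = D₀}))) 0)
    (*-congʳ (reflexive (≡.cong (λ i → poch⁺ i 5) (ℕ.+-identityʳ (a ℕ.+ 3))))))
    where
    cong-AΦ : ∀ {w w′} → w ≈ w′ → Λ (AΦ w) ≈ Λ (AΦ w′)
    cong-AΦ e = Λ-cong (S.*-cong (S.*-congʳ (S.*-congˡ (num-cong (-‿cong e)))) (den-cong e))
    exponent₃ : ∀ a k → a ℕ.+ k ℕ.* 6 ℕ.+ 3 ≡ a ℕ.+ 3 ℕ.+ k ℕ.* 6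
    exponent₃ = ℕR.solve-∀
    exponent₆ : ∀ a k → a ℕ.+ k ℕ.* 6 ℕ.+ 6 ≡ a ℕ.+ (6 ℕ.+ k ℕ.* 6)
    exponent₆ = ℕR.solve-∀
    near : ∀ k → Ord k (Λ (AΦ (q ^ (a ℕ.+ k ℕ.* 6))) - D₀)
    near k = ord-cong (+-congʳ (Λ-cong (SP.prove (num 1 (- q) ∷ num 2 (- w) ∷ den 2 q ∷ den 3 w ∷ []) ((v0 ⊗ v2) ⊗ (v1 ⊗ v3)) (v0 ⊗ v1 ⊗ v2 ⊗ v3) ≡.refl)))
      (Λ-near {x = num 1 (- q) ✶ den 2 q} (nearˢ-* (num-ord (ord-neg o)) (den-ord o)))
      where
      w = q ^ (a ℕ.+ k ℕ.* 6)
      o : Ord k w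
      o = ord-≥ (k≤ a 5 k)

  private
    P = poch⁻ 1 0
    κ-value : κ ≈ p 1 * p 7 * (p 5 * p 11)
    κ-value = trans (*-congˡ G∞-value) (trans (prove (q ∷ poch⁻ 5 5 ∷ poch⁻ 7 5 ∷ []) ((I ⊖ v0) ⊗ (v1 ⊗ v2)) ((I ⊖ v0 ⊛ 1) ⊗ v2 ⊗ v1) ≡.refl)
      (trans (*-congʳ (sym (poch⁻-suc 1 5))) (trans (*-cong (dissect 1 1 5) (dissect 1 5 5)) (*-cong (*-congʳ (*-identityˡ _)) (*-congʳ (*-identityˡ _))))))
    S₀-value : g 0 * P ≈ κ * ∑ (One.γ at_)
    S₀-value = begin
      g 0 * P ≈⟨ prove (g 0 ∷ q ∷ g 1 ∷ P ∷ []) (v0 ⊗ v3) ((v0 ⊖ (I ⊕ I) ⊗ (v1 ⊗ v2)) ⊗ v3 ⊕ (v1 ⊗ v2 ⊗ v3 ⊕ v1 ⊗ v2 ⊗ v3)) ≡.refl ⟩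
      A 0 * P + (q * g 1 * P + q * g 1 * P) ≈⟨ +-cong (proj₁ theta) (+-cong (proj₂ theta) (proj₂ theta)) ⟩
      κ * ∑ (α at_) + (κ * ∑ (β at_) + κ * ∑ (β at_)) ≈⟨ prove (κ ∷ ∑ (α at_) ∷ ∑ (β at_) ∷ []) (v0 ⊗ v1 ⊕ (v0 ⊗ v2 ⊕ v0 ⊗ v2)) (v0 ⊗ (v1 ⊕ (v2 ⊕ v2))) ≡.refl ⟩
      κ * (∑ (α at_) + (∑ (β at_) + ∑ (β at_))) ≈⟨ *-congˡ (trans (+-congˡ (∑-⊞ β β)) (∑-⊞ α (β ⊞ β))) ⟩
      κ * ∑ (One.γ at_) ∎
    p₂ : p 2 ≈ r 2 * r 14
    p₂ = trans (dissect 1 2 11) (*-congʳ (*-identityˡ _))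
    p₁₀ : p 10 ≈ r 10 * r 22
    p₁₀ = trans (dissect 1 10 11) (*-congʳ (*-identityˡ _))
    P-value₁ : P ≈ 1# * p 1 * p 2 * p 3 * p 4 * p 5 * p 6 * p 7 * p 8 * p 9 * p 10 * p 11 * p 12
    P-value₁ = dissect 11 1 0
    unital : ∀ i j k l m → Unital (p (suc i) * p (suc j) * p (suc k) * p (suc l) * p (suc m))
    unital i j k l m = H.unital-* (H.unital-* (H.unital-* (H.unital-* (unital⁻ i 11) (unital⁻ j 11)) (unital⁻ k 11)) (unital⁻ l 11)) (unital⁻ m 11)

  value₇ : g 0 * p 1 * p 3 * p 4 * p 6 * p 8 * p 9 * p 11 ≈ 1#
  value₇ = cancel (p 2 * p 5 * p 7 * p 10 * p 12) (unital 1 4 6 9 11) (begin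
    p 2 * p 5 * p 7 * p 10 * p 12 * (g 0 * p 1 * p 3 * p 4 * p 6 * p 8 * p 9 * p 11)
      ≈⟨ prove (g 0 ∷ p 1 ∷ p 2 ∷ p 3 ∷ p 4 ∷ p 5 ∷ p 6 ∷ p 7 ∷ p 8 ∷ p 9 ∷ p 10 ∷ p 11 ∷ p 12 ∷ [])
          (v2 ⊗ v5 ⊗ v7 ⊗ v10 ⊗ v12 ⊗ (v0 ⊗ v1 ⊗ v3 ⊗ v4 ⊗ v6 ⊗ v8 ⊗ v9 ⊗ v11)) (v0 ⊗ (I ⊗ v1 ⊗ v2 ⊗ v3 ⊗ v4 ⊗ v5 ⊗ v6 ⊗ v7 ⊗ v8 ⊗ v9 ⊗ v10 ⊗ v11 ⊗ v12)) ≡.refl ⟩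
    g 0 * (1# * p 1 * p 2 * p 3 * p 4 * p 5 * p 6 * p 7 * p 8 * p 9 * p 10 * p 11 * p 12) ≈⟨ *-congˡ P-value₁ ⟨
    g 0 * P ≈⟨ S₀-value ⟩
    κ * ∑ (One.γ at_) ≈⟨ *-cong κ-value one-product ⟩
    p 1 * p 7 * (p 5 * p 11) * (poch⁺ 1 11 * poch⁺ 11 11 * p 12 * (r 14 * r 10))
      ≈⟨ prove (p 1 ∷ p 7 ∷ p 5 ∷ p 11 ∷ poch⁺ 1 11 ∷ poch⁺ 11 11 ∷ p 12 ∷ r 14 ∷ r 10 ∷ [])
          (v0 ⊗ v1 ⊗ (v2 ⊗ v3) ⊗ (v4 ⊗ v5 ⊗ v6 ⊗ (v7 ⊗ v8))) (v1 ⊗ v2 ⊗ v6 ⊗ ((v4 ⊗ v0) ⊗ v7) ⊗ (v8 ⊗ (v5 ⊗ v3))) ≡.refl ⟩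
    p 7 * p 5 * p 12 * ((poch⁺ 1 11 * p 1) * r 14) * (r 10 * (poch⁺ 11 11 * p 11)) ≈⟨ *-cong (*-congˡ (*-congʳ (poch-square 1 11))) (*-congˡ (poch-square 11 11)) ⟩
    p 7 * p 5 * p 12 * (r 2 * r 14) * (r 10 * r 22) ≈⟨ *-cong (*-congˡ p₂) p₁₀ ⟨
    p 7 * p 5 * p 12 * p 2 * p 10 ≈⟨ prove (p 7 ∷ p 5 ∷ p 12 ∷ p 2 ∷ p 10 ∷ []) (v0 ⊗ v1 ⊗ v2 ⊗ v3 ⊗ v4) (v3 ⊗ v1 ⊗ v0 ⊗ v4 ⊗ v2 ⊗ I) ≡.refl ⟩
    p 2 * p 5 * p 7 * p 10 * p 12 * 1# ∎)

  module _ (cancel-q : ∀ {x y} → q * x ≈ q * y → x ≈ y) where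
    value₇ₐ : g 1 * p 3 * p 4 * p 5 * p 6 * p 7 * p 8 * p 9 ≈ 1#
    value₇ₐ = cancel (p 1 * p 2 * p 10 * p 11 * p 12) (unital 0 1 9 10 11) (cancel-q (begin
      q * (p 1 * p 2 * p 10 * p 11 * p 12 * (g 1 * p 3 * p 4 * p 5 * p 6 * p 7 * p 8 * p 9))
        ≈⟨ prove (q * g 1 ∷ p 1 ∷ p 2 ∷ p 3 ∷ p 4 ∷ p 5 ∷ p 6 ∷ p 7 ∷ p 8 ∷ p 9 ∷ p 10 ∷ p 11 ∷ p 12 ∷ q ∷ g 1 ∷ [])
            (v13 ⊗ (v1 ⊗ v2 ⊗ v10 ⊗ v11 ⊗ v12 ⊗ (v14 ⊗ v3 ⊗ v4 ⊗ v5 ⊗ v6 ⊗ v7 ⊗ v8 ⊗ v9))) ((v13 ⊗ v14) ⊗ (I ⊗ v1 ⊗ v2 ⊗ v3 ⊗ v4 ⊗ v5 ⊗ v6 ⊗ v7 ⊗ v8 ⊗ v9 ⊗ v10 ⊗ v11 ⊗ v12)) ≡.refl ⟩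
      q * g 1 * (1# * p 1 * p 2 * p 3 * p 4 * p 5 * p 6 * p 7 * p 8 * p 9 * p 10 * p 11 * p 12) ≈⟨ *-congˡ P-value₁ ⟨
      q * g 1 * P ≈⟨ proj₂ theta ⟩
      κ * ∑ (β at_) ≈⟨ *-cong κ-value five-product ⟩
      p 1 * p 7 * (p 5 * p 11) * (q * (poch⁺ 5 11 * poch⁺ 7 11 * p 12 * (r 22 * r 2)))
        ≈⟨ prove (p 1 ∷ p 7 ∷ p 5 ∷ p 11 ∷ poch⁺ 5 11 ∷ poch⁺ 7 11 ∷ p 12 ∷ r 22 ∷ r 2 ∷ q ∷ [])
            (v0 ⊗ v1 ⊗ (v2 ⊗ v3) ⊗ (v9 ⊗ (v4 ⊗ v5 ⊗ v6 ⊗ (v7 ⊗ v8)))) (v9 ⊗ (v0 ⊗ v3 ⊗ v6 ⊗ (v8 ⊗ (v5 ⊗ v1)) ⊗ ((v4 ⊗ v2) ⊗ v7))) ≡.refl ⟩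
      q * (p 1 * p 11 * p 12 * (r 2 * (poch⁺ 7 11 * p 7)) * ((poch⁺ 5 11 * p 5) * r 22)) ≈⟨ *-congˡ (*-cong (*-congˡ (*-congˡ (poch-square 7 11))) (*-congʳ (poch-square 5 11))) ⟩
      q * (p 1 * p 11 * p 12 * (r 2 * r 14) * (r 10 * r 22)) ≈⟨ *-congˡ (*-cong (*-congˡ p₂) p₁₀) ⟨
      q * (p 1 * p 11 * p 12 * p 2 * p 10) ≈⟨ prove (p 1 ∷ p 11 ∷ p 12 ∷ p 2 ∷ p 10 ∷ q ∷ []) (v5 ⊗ (v0 ⊗ v1 ⊗ v2 ⊗ v3 ⊗ v4)) (v5 ⊗ (v0 ⊗ v3 ⊗ v4 ⊗ v1 ⊗ v2 ⊗ I)) ≡.refl ⟩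
      q * (p 1 * p 2 * p 10 * p 11 * p 12 * 1#) ∎))

  module _ (difference : g 0 ≈ Λ (AΦ 1#) + q * g 1) where
    D₀-value : D₀ * p 2 * p 3 * p 4 * p 8 * p 9 * p 10 ≈ 1#
    D₀-value = cancel (poch⁺ 3 5 * p 12 * (p 1 * p 5 * p 6 * p 7 * p 11)) (H.unital-* (H.unital-* (unital⁺ 2 5) (unital⁻ 11 11)) (unital 0 4 5 6 10)) (begin
      u * p 12 * (p 1 * p 5 * p 6 * p 7 * p 11) * (D₀ * p 2 * p 3 * p 4 * p 8 * p 9 * p 10)
        ≈⟨ prove (u ∷ p 1 ∷ p 2 ∷ p 3 ∷ p 4 ∷ p 5 ∷ p 6 ∷ p 7 ∷ p 8 ∷ p 9 ∷ p 10 ∷ p 11 ∷ p 12 ∷ D₀ ∷ [])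
            (v0 ⊗ v12 ⊗ (v1 ⊗ v5 ⊗ v6 ⊗ v7 ⊗ v11) ⊗ (v13 ⊗ v2 ⊗ v3 ⊗ v4 ⊗ v8 ⊗ v9 ⊗ v10)) ((v0 ⊗ v13) ⊗ (I ⊗ v1 ⊗ v2 ⊗ v3 ⊗ v4 ⊗ v5 ⊗ v6 ⊗ v7 ⊗ v8 ⊗ v9 ⊗ v10 ⊗ v11 ⊗ v12)) ≡.refl ⟩
      u * D₀ * (1# * p 1 * p 2 * p 3 * p 4 * p 5 * p 6 * p 7 * p 8 * p 9 * p 10 * p 11 * p 12) ≈⟨ *-cong (AΦ-value 0) P-value₁ ⟨
      X * P ≈⟨ prove (X ∷ q * g 1 ∷ P ∷ []) (v0 ⊗ v2) ((v0 ⊕ v1) ⊗ v2 ⊖ v1 ⊗ v2) ≡.refl ⟩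
      (X + q * g 1) * P - q * g 1 * P ≈⟨ +-congʳ (*-congʳ difference) ⟨
      g 0 * P - q * g 1 * P ≈⟨ prove (g 0 ∷ q ∷ g 1 ∷ P ∷ []) (v0 ⊗ v3 ⊖ v1 ⊗ v2 ⊗ v3) ((v0 ⊖ (I ⊕ I) ⊗ (v1 ⊗ v2)) ⊗ v3 ⊕ v1 ⊗ v2 ⊗ v3) ≡.refl ⟩
      A 0 * P + q * g 1 * P ≈⟨ +-cong (proj₁ theta) (proj₂ theta) ⟩
      κ * ∑ (α at_) + κ * ∑ (β at_) ≈⟨ distribˡ _ _ _ ⟨
      κ * (∑ (α at_) + ∑ (β at_)) ≈⟨ *-cong κ-value (trans (∑-⊞ α β) euler-product) ⟩
      p 1 * p 7 * (p 5 * p 11) * (u * poch⁻ 6 5) ≈⟨ *-congˡ (*-congˡ (trans (dissect 1 6 5) (*-congʳ (*-identityˡ _)))) ⟩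
      p 1 * p 7 * (p 5 * p 11) * (u * (p 6 * p 12)) ≈⟨ prove (u ∷ p 1 ∷ p 5 ∷ p 6 ∷ p 7 ∷ p 11 ∷ p 12 ∷ []) (v1 ⊗ v4 ⊗ (v2 ⊗ v5) ⊗ (v0 ⊗ (v3 ⊗ v6))) (v0 ⊗ v6 ⊗ (v1 ⊗ v2 ⊗ v3 ⊗ v4 ⊗ v5) ⊗ I) ≡.refl ⟩
      u * p 12 * (p 1 * p 5 * p 6 * p 7 * p 11) * 1# ∎)
      where
      u = poch⁺ 3 5
      X = Λ (AΦ 1#)

    value₈ : Λ (AΦ (q ^ 2)) * p 2 * p 3 * p 4 * p 5 * p 8 * p 9 * p 11 ≈ 1#
    value₈ = begin
      Λ (AΦ (q ^ 2)) * p 2 * p 3 * p 4 * p 5 * p 8 * p 9 * p 11 ≈⟨ prove (Λ (AΦ (q ^ 2)) ∷ p 2 ∷ p 3 ∷ p 4 ∷ p 5 ∷ p 8 ∷ p 9 ∷ p 11 ∷ [])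
          (v0 ⊗ v1 ⊗ v2 ⊗ v3 ⊗ v4 ⊗ v5 ⊗ v6 ⊗ v7) (v0 ⊗ (I ⊗ v4 ⊗ v7) ⊗ (v1 ⊗ v2 ⊗ v3 ⊗ v5 ⊗ v6)) ≡.refl ⟩
      Λ (AΦ (q ^ 2)) * (1# * p 5 * p 11) * (p 2 * p 3 * p 4 * p 8 * p 9) ≈⟨ *-congʳ (*-cong (sym (AΦ-value 2)) (dissect 1 5 5)) ⟨
      poch⁺ 5 5 * D₀ * poch⁻ 5 5 * (p 2 * p 3 * p 4 * p 8 * p 9) ≈⟨ prove (poch⁺ 5 5 ∷ D₀ ∷ poch⁻ 5 5 ∷ p 2 ∷ p 3 ∷ p 4 ∷ p 8 ∷ p 9 ∷ [])
          (v0 ⊗ v1 ⊗ v2 ⊗ (v3 ⊗ v4 ⊗ v5 ⊗ v6 ⊗ v7)) (v1 ⊗ v3 ⊗ v4 ⊗ v5 ⊗ v6 ⊗ v7 ⊗ (v0 ⊗ v2)) ≡.refl ⟩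
      D₀ * p 2 * p 3 * p 4 * p 8 * p 9 * (poch⁺ 5 5 * poch⁻ 5 5) ≈⟨ *-congˡ (poch-square 5 5) ⟩
      D₀ * p 2 * p 3 * p 4 * p 8 * p 9 * p 10 ≈⟨ D₀-value ⟩
      1# ∎

    value₈ₐ : (1# + q) * Λ (AΦ (q ^ 4)) * p 1 * p 3 * p 4 * p 7 * p 8 * p 9 * p 10 ≈ 1#
    value₈ₐ = begin
      (1# + q) * Λ (AΦ (q ^ 4)) * p 1 * p 3 * p 4 * p 7 * p 8 * p 9 * p 10 ≈⟨ prove (q ∷ Λ (AΦ (q ^ 4)) ∷ p 1 ∷ p 3 ∷ p 4 ∷ p 7 ∷ p 8 ∷ p 9 ∷ p 10 ∷ [])
          ((I ⊕ v0) ⊗ v1 ⊗ v2 ⊗ v3 ⊗ v4 ⊗ v5 ⊗ v6 ⊗ v7 ⊗ v8) ((I ⊕ v0 ⊛ 1) ⊗ v1 ⊗ (I ⊗ v2 ⊗ v5) ⊗ (v3 ⊗ v4 ⊗ v6 ⊗ v7 ⊗ v8)) ≡.refl ⟩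
      (1# + q ^ 1) * Λ (AΦ (q ^ 4)) * (1# * p 1 * p 7) * (p 3 * p 4 * p 8 * p 9 * p 10) ≈⟨ *-congʳ (*-cong (*-congˡ (sym (AΦ-value 4))) (dissect 1 1 5)) ⟨
      (1# + q ^ 1) * (poch⁺ 7 5 * D₀) * poch⁻ 1 5 * (p 3 * p 4 * p 8 * p 9 * p 10) ≈⟨ *-congʳ (*-congʳ (trans (sym (*-assoc _ _ _)) (*-congʳ (sym (poch⁺-suc 1 5))))) ⟩
      poch⁺ 1 5 * D₀ * poch⁻ 1 5 * (p 3 * p 4 * p 8 * p 9 * p 10) ≈⟨ prove (poch⁺ 1 5 ∷ D₀ ∷ poch⁻ 1 5 ∷ p 3 ∷ p 4 ∷ p 8 ∷ p 9 ∷ p 10 ∷ [])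
          (v0 ⊗ v1 ⊗ v2 ⊗ (v3 ⊗ v4 ⊗ v5 ⊗ v6 ⊗ v7)) (v1 ⊗ (v0 ⊗ v2) ⊗ v3 ⊗ v4 ⊗ v5 ⊗ v6 ⊗ v7) ≡.refl ⟩
      D₀ * (poch⁺ 1 5 * poch⁻ 1 5) * p 3 * p 4 * p 8 * p 9 * p 10 ≈⟨ *-congʳ (*-congʳ (*-congʳ (*-congʳ (*-congʳ (*-congˡ (poch-square 1 5)))))) ⟩
      D₀ * p 2 * p 3 * p 4 * p 8 * p 9 * p 10 ≈⟨ D₀-value ⟩
      1# ∎

-- From patterns to recurrences

module Walk where
  open import Data.Bool.Base using (Bool; true; false; T; _∧_; _∨_; if_then_else_)
  open import Data.Bool.Properties using (T-∧; T-∨)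
  open import Data.Fin.Base using (Fin; zero; suc)
  open import Data.Bool.ListAction using (any; all)
  open import Data.List.Base using (List; []; _∷_; _++_)
  open import Data.List.Relation.Unary.All as All using (All; []; _∷_)
  open import Data.List.Relation.Unary.All.Properties using (all⁺)
  open import Data.List.Relation.Unary.Any using (Any; here; there)
  open import Data.List.Relation.Unary.Any.Properties using (any⁻)
  open import Data.Nat.Base using (_≡ᵇ_)
  open import Data.Unit.Base using (tt)
  open import Data.Vec.Base using () renaming ([] to []ᵥ; _∷_ to _∷ᵥ_)
  open ≡ using (refl)
  open import Relation.Nullary using (¬_)
  open Solver
  open Lam using (triangle)
  open Cases
  open Links using (module Identification)
  open Count
  open Patterns using (table)

  module Walks where
    open AK hiding (refl)
    open Identification using (Solves)
    open Systems using (sumR)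
    open Generating generating

    dead : List Pattern → Bool
    dead [] = false
    dead ([] ∷ π) = true
    dead ((_ ∷ _) ∷ π) = dead π

    dead-zero : ∀ {P N} π → T (dead π) → gf P N π ≈ 0#
    dead-zero {P} {N} π d = gf-dead {P} {N} {π} (member π d)
      where
      open import Data.List.Membership.Propositional using (_∈_)
      member : ∀ π → T (dead π) → [] ∈ π
      member ([] ∷ π) _ = here refl
      member ((_ ∷ _) ∷ π) d = there (member π d)

    prefixᵇ : Pattern → Pattern → Bool
    prefixᵇ [] p = true
    prefixᵇ (d ∷ ds) [] = false
    prefixᵇ (d ∷ ds) (e ∷ es) = (d ≡ᵇ e) ∧ prefixᵇ ds es

    pre-prefix : ∀ {N} t p xs → T (prefixᵇ t p) → Pre N p xs → Pre N t xs
    pre-prefix [] p xs _ _ = tt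
    pre-prefix (d ∷ ds) (e ∷ es) (x ∷ xs) c (eq , pr) with Equivalence.to (T-∧ {d ≡ᵇ e}) c
    ... | (h , r) with refl ← ℕ.≡ᵇ⇒≡ d e h = eq , pre-prefix ds es xs r pr

    inner : List Pattern → Pattern → Bool
    inner fam [] = false
    inner fam (d ∷ ds) = any (λ t → prefixᵇ t ds) fam ∨ inner fam ds

    implied : List Pattern → List Pattern → Pattern → Bool
    implied fam π p = any (λ t → prefixᵇ t p) π ∨ inner fam p

    equivalent : List Pattern → List Pattern → List Pattern → Bool
    equivalent fam π ρ = all (implied fam ρ) π ∧ all (implied fam π) ρ

    family : List Pattern → Table
    family fam _ = fam

    none : ∀ {N} {f : Pattern → Bool} {π xs} → (∀ t → T (f t) → Pre N t xs) → All (λ p → ¬ Pre N p xs) π → ¬ Any (λ t → T (f t)) π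
    none h (a ∷ as) (here i) = a (h _ i)
    none h (a ∷ as) (there i) = none h as i

    inner-sound : ∀ fam {N} p xs → T (inner fam p) → OK (family fam) xs → ¬ Pre N p xs
    inner-sound fam (d ∷ ds) (x ∷ xs) i (o , os) (_ , pr) with Equivalence.to (T-∨ {any (λ t → prefixᵇ t ds) fam}) i
    ... | inj₁ j = none (λ t c → pre-prefix t ds xs c pr) o (any⁻ _ fam j)
    ... | inj₂ j = inner-sound fam ds xs j os pr

    equivalent-sound : ∀ {fam N} π ρ → T (equivalent fam π ρ) → gf (family fam) N π ≈ gf (family fam) N ρ
    equivalent-sound {fam} {N} π ρ e = gf-same {π = π} {ρ} λ xs → mk⇔ (convert π ρ (proj₂ both) xs) (convert ρ π (proj₁ both) xs)
      where
      both = Equivalence.to (T-∧ {all (implied fam ρ) π}) e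
      convert : ∀ π ρ → T (all (implied fam π) ρ) → ∀ xs → Language (family fam) (suc N) π xs → Language (family fam) (suc N) ρ xs
      convert π ρ c xs (language a o s) = language a o (All.map step (all⁺ _ ρ c))
        where
        step : ∀ {p} → T (implied fam π p) → ¬ Pre (suc N) p xs
        step {p} i pr with Equivalence.to (T-∨ {any (λ t → prefixᵇ t p) π}) i
        ... | inj₁ j = none (λ t c → pre-prefix t p xs c pr) s (any⁻ _ π j)
        ... | inj₂ j = inner-sound fam p xs j o pr

    -- item a c d π stands for q^(c + a (N + 1)) times the generating function of π at N + d.
    record Item : Set where
      constructor item
      field
        a c d : ℕ
        π : List Pattern

    module Expansion (P : Table) (N : ℕ) (fam : ℕ → List Pattern) (P≡ : ∀ d → P (suc (N ℕ.+ d)) ≡ fam d) (stop : ℕ → List Pattern → Bool) where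

      expand arrive : (fuel d a c : ℕ) → List Pattern → List Item
      expand zero d a c π = item a c d π ∷ []
      expand (suc k) d a c π = if dead π then [] else arrive k (suc d) a c (up π) ++ expand k d (suc a) (c ℕ.+ d) (take π ++ fam d)
      arrive k d a c π = if stop d π then item a c d π ∷ [] else expand k d a c π

    value : Table → ℕ → Item → Carrier
    value P N (item a c d π) = q ^ (c ℕ.+ a ℕ.* suc N) * gf P (N ℕ.+ d) π

    total : Table → ℕ → List Item → Carrier
    total P N [] = 0#
    total P N (i ∷ is) = value P N i + total P N is

    total-++ : ∀ P N is js → total P N (is ++ js) ≈ total P N is + total P N js
    total-++ P N [] js = sym (+-identityˡ _)
    total-++ P N (i ∷ is) js = trans (+-congˡ (total-++ P N is js)) (sym (+-assoc _ _ _))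

    module Sound (P : Table) (N : ℕ) (fam : ℕ → List Pattern) (P≡ : ∀ d → P (suc (N ℕ.+ d)) ≡ fam d) (stop : ℕ → List Pattern → Bool) where
      open Expansion P N fam P≡ stop

      expand-sound : ∀ k d a c π → total P N (expand k d a c π) ≈ value P N (item a c d π)
      arrive-sound : ∀ k d a c π → total P N (arrive k d a c π) ≈ value P N (item a c d π)
      expand-sound zero d a c π = +-identityʳ _
      expand-sound (suc k) d a c π with dead π in eq
      ... | true = sym (trans (*-congˡ {q ^ (c ℕ.+ a ℕ.* suc N)} (dead-zero {P} {N ℕ.+ d} π (≡.subst T (≡.sym eq) tt))) (zeroʳ _))
      ... | false = begin
        total P N (arrive k (suc d) a c (up π) ++ expand k d (suc a) (c ℕ.+ d) (take π ++ fam d))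
          ≈⟨ total-++ P N (arrive k (suc d) a c (up π)) _ ⟩
        total P N (arrive k (suc d) a c (up π)) + total P N (expand k d (suc a) (c ℕ.+ d) (take π ++ fam d))
          ≈⟨ +-cong (arrive-sound k (suc d) a c (up π)) (expand-sound k d (suc a) (c ℕ.+ d) (take π ++ fam d)) ⟩
        q ^ e * gf P (N ℕ.+ suc d) (up π) + q ^ (c ℕ.+ d ℕ.+ suc a ℕ.* suc N) * gf P (N ℕ.+ d) (take π ++ fam d)
          ≡⟨ ≡.cong₂ _+_ (≡.cong (λ i → q ^ e * gf P i (up π)) (ℕ.+-suc N d)) (≡.cong₂ (λ i f → q ^ i * gf P (N ℕ.+ d) (take π ++ f)) (exponent c d a N) (≡.sym (P≡ d))) ⟩
        q ^ e * U + q ^ (e ℕ.+ suc (N ℕ.+ d)) * V ≈⟨ +-congˡ {q ^ e * U} (*-congʳ {V} (^-homo-* q e (suc (N ℕ.+ d)))) ⟩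
        q ^ e * U + q ^ e * q ^ suc (N ℕ.+ d) * V
          ≈⟨ prove (q ^ e ∷ᵥ U ∷ᵥ q ^ suc (N ℕ.+ d) ∷ᵥ V ∷ᵥ []ᵥ) (v0 ⊗ v1 ⊕ v0 ⊗ v2 ⊗ v3) (v0 ⊗ (v1 ⊕ v2 ⊗ v3)) refl ⟩
        q ^ e * (U + q ^ suc (N ℕ.+ d) * V) ≈⟨ *-congˡ {q ^ e} (gf-step P (N ℕ.+ d) π) ⟨
        value P N (item a c d π) ∎
        where
        e = c ℕ.+ a ℕ.* suc N
        U = gf P (suc (N ℕ.+ d)) (up π)
        V = gf P (N ℕ.+ d) (take π ++ P (suc (N ℕ.+ d)))
        exponent : ∀ c d a N → c ℕ.+ d ℕ.+ suc a ℕ.* suc N ≡ c ℕ.+ a ℕ.* suc N ℕ.+ suc (N ℕ.+ d)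
        exponent = ℕR.solve-∀
      arrive-sound k d a c π with stop d π
      ... | true = +-identityʳ _
      ... | false = expand-sound k d a c π

    module Automaton {k : ℕ} (fam : List Pattern) (states : Fin k → List Pattern) (indices : List (Fin k)) where

      F : Fin k → ℕ → Carrier
      F i n = gf (family fam) (suc n) (states i)

      known : ℕ → List Pattern → Bool
      known _ π = any (λ i → equivalent fam π (states i)) indices

      -- The constant family does not depend on the level, so one expansion serves every n.
      items : Fin k → List Item
      items i = Expansion.expand (family fam) 0 (λ _ → fam) (λ _ → refl) known 12 0 0 0 (states i)

      matches : List Item → List (Term k) → Bool
      matches [] [] = true
      matches (item a c d π ∷ is) (term a′ c′ d′ j ∷ ts) =
        (a ≡ᵇ a′) ∧ (c ℕ.+ 2 ℕ.* a ≡ᵇ c′ ℕ.+ triangle a′) ∧ (d ≡ᵇ suc (a′ ℕ.+ d′ ℕ.∸ 1)) ∧ equivalent fam π (states j) ∧ matches is ts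
      matches _ _ = false

      matches-sound : ∀ n is ts → T (matches is ts) → total (family fam) (suc n) is ≈ sumR F n ts
      matches-sound n [] [] _ = reflexive refl
      matches-sound n (item a c d π ∷ is) (term a′ c′ d′ j ∷ ts) m with Equivalence.to (T-∧ {a ≡ᵇ a′}) m
      ... | m₁ , r₁ with Equivalence.to (T-∧ {c ℕ.+ 2 ℕ.* a ≡ᵇ c′ ℕ.+ triangle a′}) r₁
      ... | m₂ , r₂ with Equivalence.to (T-∧ {d ≡ᵇ suc (a′ ℕ.+ d′ ℕ.∸ 1)}) r₂
      ... | m₃ , r₃ with Equivalence.to (T-∧ {equivalent fam π (states j)}) r₃
      ... | m₄ , r₄ with refl ← ℕ.≡ᵇ⇒≡ a a′ m₁ with refl ← ℕ.≡ᵇ⇒≡ d _ m₃ = +-cong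
        (*-cong {q ^ (c ℕ.+ a ℕ.* suc (suc n))} {q ^ (c′ ℕ.+ triangle a ℕ.+ n ℕ.* a)} (reflexive (≡.cong (q ^_) (≡.trans (exponent c a n) (≡.cong (ℕ._+ n ℕ.* a) (ℕ.≡ᵇ⇒≡ _ _ m₂)))))
          (trans (reflexive (≡.cong (λ i → gf (family fam) i π) (ℕ.+-suc (suc n) _))) (equivalent-sound π (states j) m₄)))
        (matches-sound n is ts r₄)
        where
        exponent : ∀ c a n → c ℕ.+ a ℕ.* suc (suc n) ≡ c ℕ.+ 2 ℕ.* a ℕ.+ n ℕ.* a
        exponent = ℕR.solve-∀

      solves : (sys : Fin k → List (Term k)) → (∀ i → T (matches (items i) (sys i))) → (∀ i → dead (states i) ≡ false) → Solves sys F
      solves sys m alive = (λ i n → trans (trans (sym (*-identityˡ (F i n))) (trans (reflexive (≡.cong (λ w → 1# * gf (family fam) w (states i)) (≡.sym (ℕ.+-identityʳ (suc n)))))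
          (sym (Sound.expand-sound (family fam) (suc n) (λ _ → fam) (λ _ → refl) known 12 0 0 0 (states i))))) (matches-sound n (items i) (sys i) (m i))) ,
        λ i n → ord-mono {n} {suc (suc n)} (ℕ.≤-trans (ℕ.n≤1+n n) (ℕ.n≤1+n (suc n))) (gf-near {family fam} {suc n} {states i} (nonempty (states i) (alive i)))
        where
        nonempty : ∀ π → dead π ≡ false → All (λ p → ¬ p ≡ []) π
        nonempty [] _ = []
        nonempty ((_ ∷ _) ∷ π) e = (λ ()) ∷ nonempty π e

      -- Summands qᵉ F j 0 and qᵉ F j 1.
      data Summand : Set where
        at₀ at₁ : ℕ → Fin k → Summand

      combination : List Summand → Carrier
      combination [] = 0#
      combination (at₀ e j ∷ ss) = q ^ e * F j 0 + combination ss
      combination (at₁ e j ∷ ss) = q ^ e * F j 1 + combination ss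

      Weighted : Set
      Weighted = List (ℕ × List Pattern)

      weigh : Weighted → Carrier
      weigh [] = 0#
      weigh ((e , π) ∷ ws) = q ^ e * gf (family fam) 2 π + weigh ws

      weigh-++ : ∀ vs ws → weigh (vs ++ ws) ≈ weigh vs + weigh ws
      weigh-++ [] ws = sym (+-identityˡ _)
      weigh-++ ((e , π) ∷ vs) ws = trans (+-congˡ (weigh-++ vs ws)) (sym (+-assoc _ _ _))

      similar : Weighted → Weighted → Bool
      similar [] [] = true
      similar ((e , π) ∷ vs) ((e′ , ρ) ∷ ws) = (e ≡ᵇ e′) ∧ equivalent fam π ρ ∧ similar vs ws
      similar _ _ = false

      similar-sound : ∀ vs ws → T (similar vs ws) → weigh vs ≈ weigh ws
      similar-sound [] [] _ = reflexive refl
      similar-sound ((e , π) ∷ vs) ((e′ , ρ) ∷ ws) s with Equivalence.to (T-∧ {e ≡ᵇ e′}) s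
      ... | s₁ , r₁ with Equivalence.to (T-∧ {equivalent fam π ρ}) r₁
      ... | s₂ , r₂ = +-cong (*-cong (reflexive (≡.cong (q ^_) (ℕ.≡ᵇ⇒≡ e e′ s₁))) (equivalent-sound π ρ s₂)) (similar-sound vs ws r₂)

      weights : ℕ → ℕ → List Item → Weighted
      weights N e [] = []
      weights N e (item a c d π ∷ is) = (e ℕ.+ (c ℕ.+ a ℕ.* suc N) , π) ∷ weights N e is

      level₃ : ℕ → List Item → Bool
      level₃ N [] = true
      level₃ N (item a c d π ∷ is) = (N ℕ.+ d ≡ᵇ 2) ∧ level₃ N is

      weights-sound : ∀ P N e is → (∀ π → gf P 2 π ≈ gf (family fam) 2 π) → T (level₃ N is) → q ^ e * total P N is ≈ weigh (weights N e is)
      weights-sound P N e [] h l = zeroʳ _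
      weights-sound P N e (item a c d π ∷ is) h l with Equivalence.to (T-∧ {N ℕ.+ d ≡ᵇ 2}) l
      ... | l₁ , l₂ = trans (distribˡ _ _ _) (+-cong (trans (sym (*-assoc _ _ _)) (*-cong (sym (^-homo-* q e (c ℕ.+ a ℕ.* suc N)))
        (trans (reflexive (≡.cong (λ i → gf P i π) (ℕ.≡ᵇ⇒≡ (N ℕ.+ d) 2 l₁))) (h π)))) (weights-sound P N e is h l₂))

      from₂ : Fin k → List Item
      from₂ j = Expansion.expand (family fam) 1 (λ _ → fam) (λ _ → refl) (λ d _ → d ≡ᵇ 1) 12 0 0 0 (states j)

      flatten : List Summand → Weighted
      flatten [] = []
      flatten (at₀ e j ∷ ss) = weights 1 e (from₂ j) ++ flatten ss
      flatten (at₁ e j ∷ ss) = (e , states j) ∷ flatten ss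

      flat : List Summand → Bool
      flat [] = true
      flat (at₀ e j ∷ ss) = level₃ 1 (from₂ j) ∧ flat ss
      flat (at₁ e j ∷ ss) = flat ss

      flatten-sound : ∀ ss → T (flat ss) → combination ss ≈ weigh (flatten ss)
      flatten-sound [] _ = reflexive refl
      flatten-sound (at₀ e j ∷ ss) l with Equivalence.to (T-∧ {level₃ 1 (from₂ j)}) l
      ... | l₁ , l₂ = trans (+-cong (trans (*-congˡ (trans (sym (*-identityˡ (F j 0)))
          (sym (Sound.expand-sound (family fam) 1 (λ _ → fam) (λ _ → refl) (λ d _ → d ≡ᵇ 1) 12 0 0 0 (states j)))))
          (weights-sound (family fam) 1 e (from₂ j) (λ π → reflexive refl) l₁)) (flatten-sound ss l₂)) (sym (weigh-++ (weights 1 e (from₂ j)) (flatten ss)))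
      flatten-sound (at₁ e j ∷ ss) l = +-congˡ (flatten-sound ss l)

      module Start (extra₁ extra₂ : List Pattern) where
        T′ : Table
        T′ = table fam extra₁ extra₂

        eventually : ∀ π → gf T′ 2 π ≈ gf (family fam) 2 π
        eventually π = gf-same {π = π} {π} λ xs → mk⇔ (λ { (language a o s) → language a (to xs a o) s }) (λ { (language a o s) → language a (back xs a o) s })
          where
          to : ∀ {N} xs → Above (3 ℕ.+ N) xs → OK T′ xs → OK (family fam) xs
          to [] a o = tt
          to (x ∷ xs) (s≤s (s≤s (s≤s _)) , a) (o , os) = o , to xs a os
          back : ∀ {N} xs → Above (3 ℕ.+ N) xs → OK (family fam) xs → OK T′ xs
          back [] a o = tt
          back (x ∷ xs) (s≤s (s≤s (s≤s _)) , a) (o , os) = o , back xs a os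

        initial : List Item
        initial = Expansion.expand T′ 0 (λ d → T′ (suc d)) (λ _ → refl) (λ d _ → d ≡ᵇ 2) 12 0 0 0 []

        start-value : ∀ ss → T (level₃ 0 initial ∧ flat ss ∧ similar (weights 0 0 initial) (flatten ss)) → gf T′ 0 [] ≈ combination ss
        start-value ss c with Equivalence.to (T-∧ {level₃ 0 initial}) c
        ... | c₁ , r with Equivalence.to (T-∧ {flat ss}) r
        ... | c₂ , c₃ = begin
          gf T′ 0 [] ≈⟨ *-identityˡ _ ⟨
          1# * gf T′ 0 [] ≈⟨ Sound.expand-sound T′ 0 (λ d → T′ (suc d)) (λ _ → refl) (λ d _ → d ≡ᵇ 2) 12 0 0 0 [] ⟨
          total T′ 0 initial ≈⟨ *-identityˡ _ ⟨
          1# * total T′ 0 initial ≈⟨ weights-sound T′ 0 0 initial eventually c₁ ⟩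
          weigh (weights 0 0 initial) ≈⟨ similar-sound (weights 0 0 initial) (flatten ss) c₃ ⟩
          weigh (flatten ss) ≈⟨ flatten-sound ss c₂ ⟨
          combination ss ∎

module Machines where
  open import Data.Fin.Base using (Fin)
  open import Data.Fin.Patterns using (0F; 1F; 2F; 3F)
  open import Data.List.Base using (List; []; _∷_; allFin)
  open import Data.Unit.Base using (tt)
  open ≡ using (refl)
  open Links
  open Count using (Pattern)
  open Patterns
  open Walk using (module Walks)

  module Solutions where
    open Walks
    open Identification using (Solves)

    module Machine₇ where
      states : Fin 3 → List Pattern
      states 0F = []
      states 1F = (0 ∷ 0 ∷ []) ∷ (1 ∷ 0 ∷ 0 ∷ []) ∷ []
      states 2F = (0 ∷ 0 ∷ 0 ∷ []) ∷ []
      open Automaton families₇ states (allFin 3) public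
      solution : Solves system₇ F
      solution = solves system₇ (λ { 0F → tt ; 1F → tt ; 2F → tt }) (λ { 0F → refl ; 1F → refl ; 2F → refl })
      module S₇ = Start ((0 ∷ []) ∷ []) ((0 ∷ 0 ∷ []) ∷ [])
      start₇ = S₇.start-value (at₀ 0 2F ∷ at₀ 1 1F ∷ []) tt
      module S₇ₐ = Start ([] ∷ []) ([] ∷ [])
      start₇ₐ = S₇ₐ.start-value (at₁ 0 0F ∷ []) tt

    module Machine₈ where
      states : Fin 4 → List Pattern
      states 0F = []
      states 1F = (0 ∷ 0 ∷ 2 ∷ 0 ∷ []) ∷ (0 ∷ 1 ∷ 0 ∷ []) ∷ (0 ∷ 1 ∷ 1 ∷ []) ∷ []
      states 2F = (0 ∷ 0 ∷ []) ∷ (0 ∷ 1 ∷ []) ∷ []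
      states 3F = (0 ∷ 0 ∷ []) ∷ []
      open Automaton families₈ states (allFin 4) public
      solution : Solves system₈ F
      solution = solves system₈ (λ { 0F → tt ; 1F → tt ; 2F → tt ; 3F → tt })
        (λ { 0F → refl ; 1F → refl ; 2F → refl ; 3F → refl })
      module S₈ = Start ([] ∷ []) []
      start₈ = S₈.start-value (at₀ 0 0F ∷ []) tt

    module Machine₈ₐ where
      states : Fin 4 → List Pattern
      states 0F = []
      states 1F = (0 ∷ 0 ∷ []) ∷ (0 ∷ 1 ∷ 1 ∷ []) ∷ []
      states 2F = (0 ∷ 0 ∷ []) ∷ (0 ∷ 1 ∷ []) ∷ []
      states 3F = (0 ∷ 0 ∷ 1 ∷ []) ∷ []
      open Automaton families₈ₐ states (allFin 4) public
      solution : Solves system₈ₐ F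
      solution = solves system₈ₐ (λ { 0F → tt ; 1F → tt ; 2F → tt ; 3F → tt })
        (λ { 0F → refl ; 1F → refl ; 2F → refl ; 3F → refl })
      module S₈ₐ = Start ((0 ∷ []) ∷ (1 ∷ 1 ∷ []) ∷ []) ((0 ∷ 1 ∷ []) ∷ [])
      start₈ₐ = S₈ₐ.start-value (at₀ 0 3F ∷ at₀ 1 2F ∷ []) tt

    module Machine₅ where
      states : Fin 4 → List Pattern
      states 0F = []
      states 1F = (0 ∷ 0 ∷ 0 ∷ []) ∷ (0 ∷ 0 ∷ 1 ∷ []) ∷ (0 ∷ 1 ∷ 0 ∷ []) ∷ (1 ∷ 0 ∷ 0 ∷ []) ∷ []
      states 2F = (0 ∷ 0 ∷ []) ∷ (0 ∷ 1 ∷ 0 ∷ []) ∷ (1 ∷ 0 ∷ 0 ∷ []) ∷ []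
      states 3F = (0 ∷ 0 ∷ []) ∷ []
      open Automaton families₅ states (allFin 4) public
      solution : Solves system₅ F
      solution = solves system₅ (λ { 0F → tt ; 1F → tt ; 2F → tt ; 3F → tt })
        (λ { 0F → refl ; 1F → refl ; 2F → refl ; 3F → refl })
      module S₅ₐ = Start ((1 ∷ 0 ∷ []) ∷ []) []
      start₅ₐ = S₅ₐ.start-value (at₀ 0 0F ∷ at₀ 1 2F ∷ at₁ 2 3F ∷ []) tt

    module Machine₆ where
      states : Fin 2 → List Pattern
      states 0F = []
      states 1F = (0 ∷ 0 ∷ []) ∷ (0 ∷ 1 ∷ 0 ∷ []) ∷ (1 ∷ 0 ∷ 0 ∷ []) ∷ []
      open Automaton families₆ states (allFin 2) public
      solution : Solves system₆ F
      solution = solves system₆ (λ { 0F → tt ; 1F → tt }) (λ { 0F → refl ; 1F → refl })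
      module S₆ₐ = Start [] ([] ∷ [])
      start₆ₐ = S₆ₐ.start-value (at₁ 0 0F ∷ at₁ 1 0F ∷ at₁ 2 1F ∷ []) tt

-- Partitions into parts with given residues

module Residues where
  open import Data.Bool.Base using (Bool; true; false; if_then_else_)
  open import Data.List.Base using (List; []; _∷_)
  open import Data.List.Relation.Unary.Any using (here)
  open import Data.List.Relation.Unary.All using ([])
  open import Data.Vec.Base using () renaming ([] to []ᵥ; _∷_ to _∷ᵥ_)
  open ≡ using (refl)
  open Solver
  open Count
  open Patterns using (admitting)

  module Eulerian (χ : ℕ → Bool) (χ-periodic : ∀ y → χ (12 ℕ.+ y) ≡ χ y) where
    open Products hiding (refl)
    open Generating generating

    f : ℕ → Carrier
    f N = gf (admitting χ) N []

    factor : ℕ → Carrier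
    factor y = if χ y then 1# - q ^ y else 1#

    f-step : ∀ N → factor (suc N) * f N ≈ f (suc N)
    f-step N with χ (suc N) in eq
    ... | true = begin
      (1# - q ^ suc N) * f N ≈⟨ prove (q ^ suc N ∷ᵥ f N ∷ᵥ []ᵥ) ((I ⊖ v0) ⊗ v1) (v1 ⊖ v0 ⊗ v1) refl ⟩
      f N - q ^ suc N * f N ≈⟨ +-congʳ (trans (gf-step (admitting χ) N []) (+-congˡ (*-congˡ (reflexive (≡.cong (λ b → gf (admitting χ) N (if b then [] else [] ∷ [])) eq))))) ⟩
      f (suc N) + q ^ suc N * f N - q ^ suc N * f N ≈⟨ prove (f (suc N) ∷ᵥ q ^ suc N * f N ∷ᵥ []ᵥ) (v0 ⊕ v1 ⊖ v1) v0 refl ⟩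
      f (suc N) ∎
    ... | false = begin
      1# * f N ≈⟨ *-identityˡ _ ⟩
      f N ≈⟨ gf-step (admitting χ) N [] ⟩
      f (suc N) + q ^ suc N * gf (admitting χ) N (admitting χ (suc N)) ≡⟨ ≡.cong (λ b → f (suc N) + q ^ suc N * gf (admitting χ) N (if b then [] else [] ∷ [])) eq ⟩
      f (suc N) + q ^ suc N * gf (admitting χ) N ([] ∷ []) ≈⟨ +-congˡ (trans (*-congˡ (gf-dead (here refl))) (zeroʳ _)) ⟩
      f (suc N) + 0# ≈⟨ +-identityʳ _ ⟩
      f (suc N) ∎

    χ-period : ∀ i k → χ (i ℕ.+ k ℕ.* 12) ≡ χ i
    χ-period i zero = ≡.cong χ (ℕ.+-identityʳ i)
    χ-period i (suc k) = ≡.trans (≡.cong χ (move i (k ℕ.* 12))) (≡.trans (χ-periodic (i ℕ.+ k ℕ.* 12)) (χ-period i k))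
      where
      move : ∀ i m → i ℕ.+ (12 ℕ.+ m) ≡ 12 ℕ.+ (i ℕ.+ m)
      move = ℕR.solve-∀

    residue : ℕ → ℕ → Carrier
    residue k i = if χ (suc i) then poch⁻ (suc i ℕ.+ k ℕ.* 12) 11 else 1#

    product : ℕ → Carrier
    product k = Π< (residue k) 12

    residue-suc : ∀ k i → residue k i ≈ factor (suc i ℕ.+ k ℕ.* 12) * residue (suc k) i
    residue-suc k i rewrite χ-period (suc i) k with χ (suc i)
    ... | true = trans (poch⁻-suc (suc i ℕ.+ k ℕ.* 12) 11) (*-congˡ (reflexive (≡.cong (λ j → poch⁻ j 11) (move i (k ℕ.* 12)))))
      where
      move : ∀ i m → suc i ℕ.+ m ℕ.+ 12 ≡ suc i ℕ.+ (12 ℕ.+ m)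
      move = ℕR.solve-∀
    ... | false = sym (*-identityˡ 1#)

    near-product : ∀ {m} (g : ℕ → Carrier) → (∀ i → Ord m (g i - 1#)) → ∀ n → Ord m (Π< g n - 1#)
    near-product g h zero = ord-cong (sym (-‿inverseʳ 1#)) ord-0
    near-product g h (suc n) = ord-cong (prove (Π< g n ∷ᵥ g n ∷ᵥ []ᵥ) ((v0 ⊖ I) ⊗ v1 ⊕ (v1 ⊖ I)) (v0 ⊗ v1 ⊖ I) refl) (ord-+ (ord-*ʳ (g n) (near-product g h n)) (h n))

    residue-near : ∀ k i → Ord k (residue k i - 1#)
    residue-near k i with χ (suc i)
    ... | true = near⁻ (suc i ℕ.+ k ℕ.* 12) 11 (k≤ (suc i) 11 k)
    ... | false = ord-cong (sym (-‿inverseʳ 1#)) ord-0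

    value : f 0 * product 0 ≈ 1#
    value = first-order-unique (λ _ → 1#) (λ k → f (k ℕ.* 12) * product k) (λ _ → 1#) step (λ k → sym (*-identityˡ 1#))
      (⟶-≈ (*-identityˡ 1#) (⟶-* (⟶-near λ k → ord-mono (ℕ.≤-trans (ℕ.m≤m*n k 12) (ℕ.n≤1+n _)) (gf-near {admitting χ} {k ℕ.* 12} []))
        (⟶-near λ k → near-product (residue k) (residue-near k) 12))) ⟶-const 0
      where
      climb : ∀ k n → Π< (λ i → factor (suc i ℕ.+ k ℕ.* 12)) n * f (k ℕ.* 12) ≈ f (n ℕ.+ k ℕ.* 12)
      climb k zero = *-identityˡ _
      climb k (suc n) = begin
        Π< φ n * φ n * f (k ℕ.* 12) ≈⟨ prove (Π< φ n ∷ᵥ φ n ∷ᵥ f (k ℕ.* 12) ∷ᵥ []ᵥ) (v0 ⊗ v1 ⊗ v2) (v1 ⊗ (v0 ⊗ v2)) refl ⟩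
        φ n * (Π< φ n * f (k ℕ.* 12)) ≈⟨ *-congˡ (climb k n) ⟩
        φ n * f (n ℕ.+ k ℕ.* 12) ≈⟨ f-step (n ℕ.+ k ℕ.* 12) ⟩
        f (suc n ℕ.+ k ℕ.* 12) ∎
        where
        φ : ℕ → Carrier
        φ i = factor (suc i ℕ.+ k ℕ.* 12)
      step : ∀ k → f (k ℕ.* 12) * product k ≈ 1# * (f (suc k ℕ.* 12) * product (suc k))
      step k = begin
        f (k ℕ.* 12) * product k ≈⟨ *-congˡ (trans (Π<-cong (residue-suc k) 12) (sym (Π<-* φ (residue (suc k)) 12))) ⟩
        f (k ℕ.* 12) * (Π< φ 12 * product (suc k)) ≈⟨ prove (f (k ℕ.* 12) ∷ᵥ Π< φ 12 ∷ᵥ product (suc k) ∷ᵥ []ᵥ) (v0 ⊗ (v1 ⊗ v2)) (I ⊗ ((v1 ⊗ v0) ⊗ v2)) refl ⟩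
        1# * (Π< φ 12 * f (k ℕ.* 12) * product (suc k)) ≈⟨ *-congˡ (*-congʳ (climb k 12)) ⟩
        1# * (f (12 ℕ.+ k ℕ.* 12) * product (suc k)) ∎
        where
        φ : ℕ → Carrier
        φ i = factor (suc i ℕ.+ k ℕ.* 12)

module Equalities where
  open import Data.Fin.Base using (Fin)
  open import Data.Fin.Patterns using (0F; 1F; 2F; 3F)
  open import Data.List.Base using (List; []; _∷_)
  open import Data.Vec.Base using () renaming ([] to []ᵥ; _∷_ to _∷ᵥ_)
  open ≡ using (refl)
  open Solver
  open Links using (module Identification)
  open Count
  open Machines using (module Solutions)
  open Residues
  open Patterns
  open Predicates using (congruent; congruent-periodic; residues₅ₐ; residues₆ₐ; residues₇; residues₇ₐ; residues₈; residues₈ₐ)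

  module Comparison where
    open Evaluations
    open Solutions
    open Generating generating using (gf)

    residue-gf : List ℕ → Carrier
    residue-gf residues = gf (admitting (congruent residues)) 0 []

    equal : ∀ residues {x} → x * Eulerian.product (congruent residues) (congruent-periodic residues) 0 ≈ 1# → x ≈ residue-gf residues
    equal residues {x} e = begin
      x ≈⟨ *-identityʳ x ⟨
      x * 1# ≈⟨ *-congˡ (Eulerian.value (congruent residues) (congruent-periodic residues)) ⟨
      x * (y * u) ≈⟨ prove (x ∷ᵥ y ∷ᵥ u ∷ᵥ []ᵥ) (v0 ⊗ (v1 ⊗ v2)) (v1 ⊗ (v0 ⊗ v2)) refl ⟩
      y * (x * u) ≈⟨ *-congˡ e ⟩
      y * 1# ≈⟨ *-identityʳ y ⟩
      y ∎
      where
      y = residue-gf residues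
      u = Eulerian.product (congruent residues) (congruent-periodic residues) 0

    arrange₅ₐ : ∀ {x y} → x ≈ y → y * p 1 * p 2 * p 5 * p 6 * p 8 * p 9 * p 11 ≈ 1# → x ≈ residue-gf residues₅ₐ
    arrange₅ₐ {x} e v = equal residues₅ₐ (trans (prove (x ∷ᵥ p 1 ∷ᵥ p 2 ∷ᵥ p 5 ∷ᵥ p 6 ∷ᵥ p 8 ∷ᵥ p 9 ∷ᵥ p 11 ∷ᵥ []ᵥ) (v0 ⊗ (I ⊗ v1 ⊗ v2 ⊗ I ⊗ I ⊗ v3 ⊗ v4 ⊗ I ⊗ v5 ⊗ v6 ⊗ I ⊗ v7 ⊗ I)) (v0 ⊗ v1 ⊗ v2 ⊗ v3 ⊗ v4 ⊗ v5 ⊗ v6 ⊗ v7) refl)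
      (trans (*-congʳ (*-congʳ (*-congʳ (*-congʳ (*-congʳ (*-congʳ (*-congʳ (e)))))))) v))

    arrange₆ₐ : ∀ {x y} → x ≈ y → y * p 1 * p 4 * p 5 * p 6 * p 7 * p 9 * p 10 ≈ 1# → x ≈ residue-gf residues₆ₐ
    arrange₆ₐ {x} e v = equal residues₆ₐ (trans (prove (x ∷ᵥ p 1 ∷ᵥ p 4 ∷ᵥ p 5 ∷ᵥ p 6 ∷ᵥ p 7 ∷ᵥ p 9 ∷ᵥ p 10 ∷ᵥ []ᵥ) (v0 ⊗ (I ⊗ v1 ⊗ I ⊗ I ⊗ v2 ⊗ v3 ⊗ v4 ⊗ v5 ⊗ I ⊗ v6 ⊗ v7 ⊗ I ⊗ I)) (v0 ⊗ v1 ⊗ v2 ⊗ v3 ⊗ v4 ⊗ v5 ⊗ v6 ⊗ v7) refl)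
      (trans (*-congʳ (*-congʳ (*-congʳ (*-congʳ (*-congʳ (*-congʳ (*-congʳ (e)))))))) v))

    arrange₇ : ∀ {x y} → x ≈ y → y * p 1 * p 3 * p 4 * p 6 * p 8 * p 9 * p 11 ≈ 1# → x ≈ residue-gf residues₇
    arrange₇ {x} e v = equal residues₇ (trans (prove (x ∷ᵥ p 1 ∷ᵥ p 3 ∷ᵥ p 4 ∷ᵥ p 6 ∷ᵥ p 8 ∷ᵥ p 9 ∷ᵥ p 11 ∷ᵥ []ᵥ) (v0 ⊗ (I ⊗ v1 ⊗ I ⊗ v2 ⊗ v3 ⊗ I ⊗ v4 ⊗ I ⊗ v5 ⊗ v6 ⊗ I ⊗ v7 ⊗ I)) (v0 ⊗ v1 ⊗ v2 ⊗ v3 ⊗ v4 ⊗ v5 ⊗ v6 ⊗ v7) refl)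
      (trans (*-congʳ (*-congʳ (*-congʳ (*-congʳ (*-congʳ (*-congʳ (*-congʳ (e)))))))) v))

    arrange₇ₐ : ∀ {x y} → x ≈ y → y * p 3 * p 4 * p 5 * p 6 * p 7 * p 8 * p 9 ≈ 1# → x ≈ residue-gf residues₇ₐ
    arrange₇ₐ {x} e v = equal residues₇ₐ (trans (prove (x ∷ᵥ p 3 ∷ᵥ p 4 ∷ᵥ p 5 ∷ᵥ p 6 ∷ᵥ p 7 ∷ᵥ p 8 ∷ᵥ p 9 ∷ᵥ []ᵥ) (v0 ⊗ (I ⊗ I ⊗ I ⊗ v1 ⊗ v2 ⊗ v3 ⊗ v4 ⊗ v5 ⊗ v6 ⊗ v7 ⊗ I ⊗ I ⊗ I)) (v0 ⊗ v1 ⊗ v2 ⊗ v3 ⊗ v4 ⊗ v5 ⊗ v6 ⊗ v7) refl)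
      (trans (*-congʳ (*-congʳ (*-congʳ (*-congʳ (*-congʳ (*-congʳ (*-congʳ (e)))))))) v))

    arrange₈ : ∀ {x y} → x ≈ y → y * p 2 * p 3 * p 4 * p 5 * p 8 * p 9 * p 11 ≈ 1# → x ≈ residue-gf residues₈
    arrange₈ {x} e v = equal residues₈ (trans (prove (x ∷ᵥ p 2 ∷ᵥ p 3 ∷ᵥ p 4 ∷ᵥ p 5 ∷ᵥ p 8 ∷ᵥ p 9 ∷ᵥ p 11 ∷ᵥ []ᵥ) (v0 ⊗ (I ⊗ I ⊗ v1 ⊗ v2 ⊗ v3 ⊗ v4 ⊗ I ⊗ I ⊗ v5 ⊗ v6 ⊗ I ⊗ v7 ⊗ I)) (v0 ⊗ v1 ⊗ v2 ⊗ v3 ⊗ v4 ⊗ v5 ⊗ v6 ⊗ v7) refl)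
      (trans (*-congʳ (*-congʳ (*-congʳ (*-congʳ (*-congʳ (*-congʳ (*-congʳ (e)))))))) v))

    arrange₈ₐ : ∀ {x y} → x ≈ y → y * p 1 * p 3 * p 4 * p 7 * p 8 * p 9 * p 10 ≈ 1# → x ≈ residue-gf residues₈ₐ
    arrange₈ₐ {x} e v = equal residues₈ₐ (trans (prove (x ∷ᵥ p 1 ∷ᵥ p 3 ∷ᵥ p 4 ∷ᵥ p 7 ∷ᵥ p 8 ∷ᵥ p 9 ∷ᵥ p 10 ∷ᵥ []ᵥ) (v0 ⊗ (I ⊗ v1 ⊗ I ⊗ v2 ⊗ v3 ⊗ I ⊗ I ⊗ v4 ⊗ v5 ⊗ v6 ⊗ v7 ⊗ I ⊗ I)) (v0 ⊗ v1 ⊗ v2 ⊗ v3 ⊗ v4 ⊗ v5 ⊗ v6 ⊗ v7) refl)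
      (trans (*-congʳ (*-congʳ (*-congʳ (*-congʳ (*-congʳ (*-congʳ (*-congʳ (e)))))))) v))

    module I = Identification

    case₅ₐ : gf (table families₅ ((1 ∷ 0 ∷ []) ∷ []) []) 0 [] ≈ residue-gf residues₅ₐ
    case₅ₐ = arrange₅ₐ (trans Machine₅.start₅ₐ (trans (prove (Machine₅.F 0F 0 ∷ᵥ Machine₅.F 2F 0 ∷ᵥ Machine₅.F 3F 1 ∷ᵥ q ∷ᵥ []ᵥ)
      (v3 ⊛ 0 ⊗ v0 ⊕ (v3 ⊛ 1 ⊗ v1 ⊕ (v3 ⊛ 2 ⊗ v2 ⊕ ø))) (v0 ⊕ v3 ⊗ v1 ⊕ v3 ⊛ 2 ⊗ v2) refl) (I.Case₅.solution Machine₅.F Machine₅.solution))) value₅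

    case₆ₐ : gf (table families₆ [] ([] ∷ [])) 0 [] ≈ residue-gf residues₆ₐ
    case₆ₐ = arrange₆ₐ (trans Machine₆.start₆ₐ (trans (prove (Machine₆.F 0F 1 ∷ᵥ Machine₆.F 1F 1 ∷ᵥ q ∷ᵥ []ᵥ)
      (v2 ⊛ 0 ⊗ v0 ⊕ (v2 ⊛ 1 ⊗ v0 ⊕ (v2 ⊛ 2 ⊗ v1 ⊕ ø))) ((I ⊕ v2) ⊗ v0 ⊕ v2 ⊛ 2 ⊗ v1) refl) (I.Case₆.solution Machine₆.F Machine₆.solution))) value₆

    case₇ : gf (table families₇ ((0 ∷ []) ∷ []) ((0 ∷ 0 ∷ []) ∷ [])) 0 [] ≈ residue-gf residues₇
    case₇ = arrange₇ (trans Machine₇.start₇ (trans (prove (Machine₇.F 2F 0 ∷ᵥ Machine₇.F 1F 0 ∷ᵥ q ∷ᵥ []ᵥ)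
      (v2 ⊛ 0 ⊗ v0 ⊕ (v2 ⊛ 1 ⊗ v1 ⊕ ø)) (v0 ⊕ v2 ⊗ v1) refl) (I.Case₇.first Machine₇.F Machine₇.solution))) value₇

    second : Machine₇.F 0F 1 ≈ g 1
    second = trans (I.Case₇.second Machine₇.F Machine₇.solution) (Λ-G-cong (*-identityˡ _))

    case₇ₐ : gf (table families₇ ([] ∷ []) ([] ∷ [])) 0 [] ≈ residue-gf residues₇ₐ
    case₇ₐ = arrange₇ₐ (trans Machine₇.start₇ₐ (trans (prove (Machine₇.F 0F 1 ∷ᵥ q ∷ᵥ []ᵥ) (v1 ⊛ 0 ⊗ v0 ⊕ ø) v0 refl) second)) (value₇ₐ cancel-q)

    difference : g 0 ≈ Λ (AΦ 1#) + q * g 1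
    difference = trans (sym (I.Case₇.first Machine₇.F Machine₇.solution)) (trans (I.Case₇.difference Machine₇.F Machine₇.solution) (+-congˡ (*-congˡ second)))

    case₈ : gf (table families₈ ([] ∷ []) []) 0 [] ≈ residue-gf residues₈
    case₈ = arrange₈ (trans Machine₈.start₈ (trans (prove (Machine₈.F 0F 0 ∷ᵥ q ∷ᵥ []ᵥ) (v1 ⊛ 0 ⊗ v0 ⊕ ø) v0 refl) (I.Case₈.solution Machine₈.F Machine₈.solution))) (value₈ difference)

    case₈ₐ : gf (table families₈ₐ ((0 ∷ []) ∷ (1 ∷ 1 ∷ []) ∷ []) ((0 ∷ 1 ∷ []) ∷ [])) 0 [] ≈ residue-gf residues₈ₐ
    case₈ₐ = arrange₈ₐ (trans Machine₈ₐ.start₈ₐ (trans (prove (Machine₈ₐ.F 3F 0 ∷ᵥ Machine₈ₐ.F 2F 0 ∷ᵥ q ∷ᵥ []ᵥ)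
      (v2 ⊛ 0 ⊗ v0 ⊕ (v2 ⊛ 1 ⊗ v1 ⊕ ø)) (v0 ⊕ v2 ⊗ v1) refl) (I.Case₈ₐ.solution Machine₈ₐ.F Machine₈ₐ.solution))) (value₈ₐ difference)

open import Defs
open import Data.List.Base using (List; []; _∷_)
open import Data.List.Relation.Unary.All using (All; []; _∷_)
open import Data.List.Relation.Unary.Any using (here; there)
open ≡ using (refl)
open import Relation.Unary using (Pred; _∩_)
open Count
open Patterns
open Predicates

open Equivalence using (to; from)

same-number : ∀ P residues (A : Pred (List ℕ) 0ℓ) → (∀ xs → Above 1 xs → OK P xs ⇔ A xs) → Generating.gf generating P 0 [] AK.≈ Generating.gf generating (admitting (congruent residues)) 0 [] →
  ∀ n → SameNumberOfPartitions n A (PartsCongruentMod12To residues)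
same-number P residues A e equal n = count P 0 [] n ,
  count-⇔ (total⇔partition P A e n) (count-correct P 0 [] n) ,
  ≡.subst (HasCount _) (≡.sym (counts-equal P (admitting (congruent residues)) [] equal n))
    (count-⇔ (total⇔partition (admitting (congruent residues)) _ (λ xs _ → residues⇔ residues xs) n) (count-correct (admitting (congruent residues)) 0 [] n))

⇔-trans : ∀ {A B C : Set} → A ⇔ B → B ⇔ C → A ⇔ C
⇔-trans e f = mk⇔ (λ a → to f (to e a)) (λ c → from e (from f c))

family-to : ∀ {t P xs} → (∀ r → After t r ≡ P r) → AvoidsFamily (After t) xs → AvoidsFamily P xs
family-to e = to (family⇔ e)
family-from : ∀ {t P xs} → (∀ r → After t r ≡ P r) → AvoidsFamily P xs → AvoidsFamily (After t) xs
family-from e = from (family⇔ e)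

theorem₇ : ∀ n → SameNumberOfPartitions n
  (Avoids (1 ∷ 1 ∷ []) ∩ Avoids (2 ∷ 2 ∷ 2 ∷ []) ∩ AvoidsFamily P₂ ∩ AvoidsFamily P₃ ∩ AvoidsFamily P₄ ∩ AvoidsFamily P₅ ∩ AvoidsFamily P₉)
  (PartsCongruentMod12To residues₇)
theorem₇ = same-number (table families₇ ((0 ∷ []) ∷ []) ((0 ∷ 0 ∷ []) ∷ [])) residues₇ _ (λ xs _ → ⇔-trans (restricted⇔ok families₇ ((0 ∷ []) ∷ []) ((0 ∷ 0 ∷ []) ∷ []) xs) (mk⇔
    (λ { (restricted (a₀ ∷ []) (b₀ ∷ []) (h₂ ∷ h₃ ∷ h₄ ∷ h₅ ∷ h₉ ∷ [])) →
      a₀ , b₀ , family-to after₂ h₂ , family-to after₃ h₃ , family-to after₄ h₄ , family-to after₅ h₅ , family-to after₉ h₉ })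
    (λ { (a₀ , b₀ , h₂ , h₃ , h₄ , h₅ , h₉) →
      restricted (a₀ ∷ []) (b₀ ∷ []) (family-from after₂ h₂ ∷ family-from after₃ h₃ ∷ family-from after₄ h₄ ∷ family-from after₅ h₅ ∷ family-from after₉ h₉ ∷ []) })))
  Equalities.Comparison.case₇

theorem₇ₐ : ∀ n → SameNumberOfPartitions n
  (All (3 ≤_) ∩ AvoidsFamily P₂ ∩ AvoidsFamily P₃ ∩ AvoidsFamily P₄ ∩ AvoidsFamily P₅ ∩ AvoidsFamily P₉)
  (PartsCongruentMod12To residues₇ₐ)
theorem₇ₐ = same-number (table families₇ ([] ∷ []) ([] ∷ [])) residues₇ₐ _ (λ xs ab → ⇔-trans (restricted⇔ok families₇ ([] ∷ []) ([] ∷ []) xs) (mk⇔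
    (λ { (restricted (a₀ ∷ []) (b₀ ∷ []) (h₂ ∷ h₃ ∷ h₄ ∷ h₅ ∷ h₉ ∷ [])) →
      to (three-up⇔ xs ab) (a₀ , b₀) , family-to after₂ h₂ , family-to after₃ h₃ , family-to after₄ h₄ , family-to after₅ h₅ , family-to after₉ h₉ })
    (λ { (three , h₂ , h₃ , h₄ , h₅ , h₉) → let (a₀ , b₀) = from (three-up⇔ xs ab) three in
      restricted (a₀ ∷ []) (b₀ ∷ []) (family-from after₂ h₂ ∷ family-from after₃ h₃ ∷ family-from after₄ h₄ ∷ family-from after₅ h₅ ∷ family-from after₉ h₉ ∷ []) })))
  Equalities.Comparison.case₇ₐ

theorem₈ : ∀ n → SameNumberOfPartitions n
  (Avoids (1 ∷ []) ∩ AvoidsFamily P₁ ∩ AvoidsFamily P₂ ∩ AvoidsFamily P₇ ∩ AvoidsFamily P₈ ∩ AvoidsFamily P₁₁)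
  (PartsCongruentMod12To residues₈)
theorem₈ = same-number (table families₈ ([] ∷ []) []) residues₈ _ (λ xs _ → ⇔-trans (restricted⇔ok families₈ ([] ∷ []) [] xs) (mk⇔
    (λ { (restricted (a₀ ∷ []) ([]) (h₁ ∷ h₂ ∷ h₇ ∷ h₈ ∷ h₁₁ ∷ [])) →
      a₀ , family-to after₁ h₁ , family-to after₂ h₂ , family-to after₇ h₇ , family-to after₈ h₈ , family-to after₁₁ h₁₁ })
    (λ { (a₀ , h₁ , h₂ , h₇ , h₈ , h₁₁) →
      restricted (a₀ ∷ []) ([]) (family-from after₁ h₁ ∷ family-from after₂ h₂ ∷ family-from after₇ h₇ ∷ family-from after₈ h₈ ∷ family-from after₁₁ h₁₁ ∷ []) })))
  Equalities.Comparison.case₈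

theorem₈ₐ : ∀ n → SameNumberOfPartitions n
  (Avoids (1 ∷ 1 ∷ []) ∩ Avoids (1 ∷ 2 ∷ 3 ∷ []) ∩ Avoids (2 ∷ 2 ∷ 3 ∷ []) ∩ AvoidsFamily P₁ ∩ AvoidsFamily P₃ ∩ AvoidsFamily P₆ ∩ AvoidsFamily P₈ ∩ AvoidsFamily P₁₀)
  (PartsCongruentMod12To residues₈ₐ)
theorem₈ₐ = same-number (table families₈ₐ ((0 ∷ []) ∷ (1 ∷ 1 ∷ []) ∷ []) ((0 ∷ 1 ∷ []) ∷ [])) residues₈ₐ _ (λ xs _ → ⇔-trans (restricted⇔ok families₈ₐ ((0 ∷ []) ∷ (1 ∷ 1 ∷ []) ∷ []) ((0 ∷ 1 ∷ []) ∷ []) xs) (mk⇔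
    (λ { (restricted (a₀ ∷ a₁ ∷ []) (b₀ ∷ []) (h₁ ∷ h₃ ∷ h₆ ∷ h₈ ∷ h₁₀ ∷ [])) →
      a₀ , a₁ , b₀ , family-to after₁ h₁ , family-to after₃ h₃ , family-to after₆ h₆ , family-to after₈ h₈ , family-to after₁₀ h₁₀ })
    (λ { (a₀ , a₁ , b₀ , h₁ , h₃ , h₆ , h₈ , h₁₀) →
      restricted (a₀ ∷ a₁ ∷ []) (b₀ ∷ []) (family-from after₁ h₁ ∷ family-from after₃ h₃ ∷ family-from after₆ h₆ ∷ family-from after₈ h₈ ∷ family-from after₁₀ h₁₀ ∷ []) })))
  Equalities.Comparison.case₈ₐ

theorem₅ₐ : ∀ n → SameNumberOfPartitions n (Condition 2 ∩ Avoids (1 ∷ 2 ∷ 2 ∷ [])) (PartsCongruentMod12To residues₅ₐ)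
theorem₅ₐ = same-number (table families₅ ((1 ∷ 0 ∷ []) ∷ []) []) residues₅ₐ _ (λ xs ab → ⇔-trans (restricted⇔ok families₅ ((1 ∷ 0 ∷ []) ∷ []) [] xs) (mk⇔
    (λ { (restricted (a ∷ []) [] fs) → to (condition xs ab) fs , a })
    (λ { (c , a) → restricted (a ∷ []) [] (from (condition xs ab) c) })))
  Equalities.Comparison.case₅ₐ
  where
  condition : ∀ xs → Above 1 xs → All (λ t → AvoidsFamily (After t) xs) families₅ ⇔ Condition 2 xs
  condition = condition⇔ 2 (p₁ ∷ p₂ ∷ []) (λ { (here refl) → inj₁ (refl , λ ()) ; (there (here refl)) → inj₂ (inj₁ (refl , λ ())) })
    (inj₁ (here refl)) (inj₁ (there (here refl))) (inj₂ refl)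

theorem₆ₐ : ∀ n → SameNumberOfPartitions n (Condition 1 ∩ Avoids (2 ∷ [])) (PartsCongruentMod12To residues₆ₐ)
theorem₆ₐ = same-number (table families₆ [] ([] ∷ [])) residues₆ₐ _ (λ xs ab → ⇔-trans (restricted⇔ok families₆ [] ([] ∷ []) xs) (mk⇔
    (λ { (restricted [] (b ∷ []) fs) → to (condition xs ab) fs , b })
    (λ { (c , b) → restricted [] (b ∷ []) (from (condition xs ab) c) })))
  Equalities.Comparison.case₆ₐ
  where
  condition : ∀ xs → Above 1 xs → All (λ t → AvoidsFamily (After t) xs) families₆ ⇔ Condition 1 xs
  condition = condition⇔ 1 (p₁ ∷ p₃ ∷ []) (λ { (here refl) → inj₁ (refl , λ ()) ; (there (here refl)) → inj₂ (inj₂ (refl , λ ())) })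
    (inj₁ (here refl)) (inj₂ refl) (inj₁ (there (here refl)))

corollary1p3 : (n : ℕ) →
    -- I5a
    SameNumberOfPartitions n
      (Condition 2 ∩ Avoids (1 ∷ 2 ∷ 2 ∷ []))
      (PartsCongruentMod12To (1 ∷ 2 ∷ 5 ∷ 6 ∷ 8 ∷ 9 ∷ 11 ∷ []))
  × -- I6a
    SameNumberOfPartitions n
      (Condition 1 ∩ Avoids (2 ∷ []))
      (PartsCongruentMod12To (1 ∷ 4 ∷ 5 ∷ 6 ∷ 7 ∷ 9 ∷ 10 ∷ []))
  × -- 7
    SameNumberOfPartitions n
      (Avoids (1 ∷ 1 ∷ []) ∩ Avoids (2 ∷ 2 ∷ 2 ∷ [])
        ∩ AvoidsFamily P₂ ∩ AvoidsFamily P₃ ∩ AvoidsFamily P₄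
        ∩ AvoidsFamily P₅ ∩ AvoidsFamily P₉)
      (PartsCongruentMod12To (1 ∷ 3 ∷ 4 ∷ 6 ∷ 8 ∷ 9 ∷ 11 ∷ []))
  × -- 7a
    SameNumberOfPartitions n
      (All (3 ≤_)
        ∩ AvoidsFamily P₂ ∩ AvoidsFamily P₃ ∩ AvoidsFamily P₄
        ∩ AvoidsFamily P₅ ∩ AvoidsFamily P₉)
      (PartsCongruentMod12To (3 ∷ 4 ∷ 5 ∷ 6 ∷ 7 ∷ 8 ∷ 9 ∷ []))
  × -- 8
    SameNumberOfPartitions n
      (Avoids (1 ∷ [])
        ∩ AvoidsFamily P₁ ∩ AvoidsFamily P₂ ∩ AvoidsFamily P₇
        ∩ AvoidsFamily P₈ ∩ AvoidsFamily P₁₁)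
      (PartsCongruentMod12To (2 ∷ 3 ∷ 4 ∷ 5 ∷ 8 ∷ 9 ∷ 11 ∷ []))
  × -- 8a
    SameNumberOfPartitions n
      (Avoids (1 ∷ 1 ∷ []) ∩ Avoids (1 ∷ 2 ∷ 3 ∷ []) ∩ Avoids (2 ∷ 2 ∷ 3 ∷ [])
        ∩ AvoidsFamily P₁ ∩ AvoidsFamily P₃ ∩ AvoidsFamily P₆
        ∩ AvoidsFamily P₈ ∩ AvoidsFamily P₁₀)
      (PartsCongruentMod12To (1 ∷ 3 ∷ 4 ∷ 7 ∷ 8 ∷ 9 ∷ 10 ∷ []))
corollary1p3 n = theorem₅ₐ n , theorem₆ₐ n , theorem₇ n , theorem₇ₐ n , theorem₈ n , theorem₈ₐ n
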